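{- For $n\ge 1$ let $\ell_n$ be the number of level three cheesy polyominoes (on the hexagonal tiling, counted up to translation) having exactly $n$ cells. Then there exist real constants $\kappa$ and $\lambda$, with decimal expansions $\kappa=0.108269\ldots$ and $\lambda=4.288630\ldots$ (i.e. $0.108269\le\kappa<0.108270$ and $4.288630\le\lambda<4.288631$), such that $$\ell_n\sim \kappa\,\lambda^n\qquad (n\to\infty),$$ i.e. $\lim_{n\to\infty} \ell_n/(\kappa\lambda^n)=1$.
   Context: Consider the regular hexagonal tiling of the Euclidean plane, oriented so that every hexagonal tile has two horizontal edges; tiles are called cells. A (hexagonal-celled) polyomino is a union of finitely many (at least one) cells whose interior is connected (for unions of hexagonal cells, this is equivalent to the union being connected). Two polyominoes are considered equal if and only if one is the image of the other under a translation. The cells of a polyomino $P$ are partitioned according to their horizontal projection (cells with the same projection onto the horizontal axis lie in the same block); each block is a column of $P$. Cells of the tiling with the same horizontal projection are stacked vertically, consecutive ones sharing a horizontal edge. A column need not be a connected set; its connected components are its maximal runs of vertically consecutive cells. If a column has two connected components, the gap (hole) between them is the set of cells of the tiling lying in that vertical stack strictly between the two components. Columns are ordered from left to right; the first column is the leftmost one, and two columns are adjacent if they are consecutive in this order. A polyomino $P$ is rightward-semi-directed if the first (leftmost) column of $P$ has no gap (i.e. is connected) and, in every pair of adjacent columns of $P$, every connected component of the right column has at least one edge in common with the left column. For an integer $m\ge 1$, a polyomino $P$ is a level $m$ cheesy polyomino if: (i) $P$ is rightward-semi-directed; (ii) every column of $P$ has at most two connected components; (iii) if a column of $P$ has two connected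 components, then the gap between the components consists of at most $m$ cells. -}

module Defs where

open import Data.Nat.Base as ℕ using (ℕ; zero; suc)
import Data.Nat.Properties as ℕ
open import Data.Integer.Base as ℤ using (ℤ; +_)
import Data.Integer.Properties as ℤ
open import Data.Rational.Base as ℚ using (ℚ; 0ℚ; 1ℚ; ½)
import Data.Rational.Properties as ℚ
open import Data.Rational.Solver using (module +-*-Solver)
open import Data.Fin.Base using (Fin)
open import Data.List.Base using (List; []; _∷_; length)
open import Data.List.Membership.Propositional using (_∈_; _∉_)
open import Data.List.Relation.Unary.Unique.Propositional using (Unique)
open import Data.Product.Base using (Σ-syntax; ∃-syntax; _×_; _,_; proj₁; proj₂)
open import Data.Sum.Base using (_⊎_; inj₁; inj₂)
open import Function.Base using (_on_)
open import Function.Bundles using (_⇔_; Equivalence; mk⇔; Inverse)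
open import Level using (0ℓ)
open import Relation.Binary.Bundles using (Setoid)
open import Relation.Binary.Construct.Closure.ReflexiveTransitive using (Star)
import Relation.Binary.Construct.On as On
open import Relation.Binary.PropositionalEquality
  using (_≡_; refl; sym; trans; cong; cong₂; subst; subst₂; setoid)
open import Relation.Binary.Structures using (IsEquivalence)
open import Relation.Nullary.Negation using (¬_)

-- Axial coordinates: the cell (x , y) has its centre at horizontal
-- position 3x/2 and height √3 (y + x/2), the edges having length 1.
-- Thus x determines the horizontal projection of the cell, and (x , y)
-- lies immediately below (x , y + 1).  The translations that preserve
-- the tiling are the translations of ℤ × ℤ.

Cell : Set
Cell = ℤ × ℤ

infixl 6 _⊹_

_⊹_ : Cell → Cell → Cell
(x , y) ⊹ (u , v) = (x ℤ.+ u , y ℤ.+ v)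

edgeVectors : List Cell
edgeVectors = (+ 0 , + 1)  ∷ (+ 0 , ℤ.-1ℤ)
            ∷ (+ 1 , + 0)  ∷ (+ 1 , ℤ.-1ℤ)
            ∷ (ℤ.-1ℤ , + 0) ∷ (ℤ.-1ℤ , + 1) ∷ []

ShareEdge : Cell → Cell → Set
ShareEdge c d = ∃[ δ ] δ ∈ edgeVectors × d ≡ c ⊹ δ

-- A finite union of hexagonal cells has connected interior exactly when
-- its cells are connected through shared edges.

Step : List Cell → Cell → Cell → Set
Step P c d = ShareEdge c d × d ∈ P

Connected : List Cell → Set
Connected P = ∀ {c d} → c ∈ P → d ∈ P → Star (Step P) c d

record Polyomino : Set where
  field
    cells     : List Cell
    unique    : Unique cells
    nonEmpty  : ∃[ c ] c ∈ cells
    connected : Connected cells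

  size : ℕ
  size = length cells

open Polyomino public

infix 4 _∈ₚ_ _∉ₚ_ _≋_

_∈ₚ_ _∉ₚ_ : Cell → Polyomino → Set
c ∈ₚ P = c ∈ cells P
c ∉ₚ P = c ∉ cells P

-- Equality up to translation.  Only membership is compared, so the order
-- in which the cells are listed is immaterial.
_≋_ : Polyomino → Polyomino → Set
P ≋ Q = ∃[ v ] (∀ c → c ∈ₚ P ⇔ c ⊹ v ∈ₚ Q)

⊹-identityʳ : ∀ c → c ⊹ (+ 0 , + 0) ≡ c
⊹-identityʳ (x , y) = cong₂ _,_ (ℤ.+-identityʳ x) (ℤ.+-identityʳ y)

⊹-assoc : ∀ c u v → (c ⊹ u) ⊹ v ≡ c ⊹ (u ⊹ v)
⊹-assoc (x , y) (u , v) (s , t) = cong₂ _,_ (ℤ.+-assoc x u s) (ℤ.+-assoc y v t)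

neg : Cell → Cell
neg (x , y) = (ℤ.- x , ℤ.- y)

⊹-inverseˡ : ∀ v → neg v ⊹ v ≡ (+ 0 , + 0)
⊹-inverseˡ (x , y) = cong₂ _,_ (ℤ.+-inverseˡ x) (ℤ.+-inverseˡ y)

⊹-cancel : ∀ c v → (c ⊹ neg v) ⊹ v ≡ c
⊹-cancel c v = trans (⊹-assoc c (neg v) v)
              (trans (cong (c ⊹_) (⊹-inverseˡ v)) (⊹-identityʳ c))

≋-isEquivalence : IsEquivalence _≋_
≋-isEquivalence = record
  { refl  = λ {P} → (+ 0 , + 0) , λ c →
      mk⇔ (subst (_∈ₚ P) (sym (⊹-identityʳ c))) (subst (_∈ₚ P) (⊹-identityʳ c))
  ; sym   = λ { {P} {Q} (v , e) → neg v , λ c →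
      mk⇔ (λ c∈Q → Equivalence.from (e (c ⊹ neg v)) (subst (_∈ₚ Q) (sym (⊹-cancel c v)) c∈Q))
          (λ c∈P → subst (_∈ₚ Q) (⊹-cancel c v) (Equivalence.to (e (c ⊹ neg v)) c∈P)) }
  ; trans = λ { {P} {Q} {R} (u , e) (v , f) → u ⊹ v , λ c →
      mk⇔ (λ c∈P → subst (_∈ₚ R) (⊹-assoc c u v)
                     (Equivalence.to (f (c ⊹ u)) (Equivalence.to (e c) c∈P)))
          (λ c∈R → Equivalence.from (e c)
                     (Equivalence.from (f (c ⊹ u)) (subst (_∈ₚ R) (sym (⊹-assoc c u v)) c∈R))) }
  }

IsColumn : Polyomino → ℤ → Set
IsColumn P x = ∃[ y ] (x , y) ∈ₚ P

FirstColumn : Polyomino → ℤ → Set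
FirstColumn P x = IsColumn P x × (∀ x′ → IsColumn P x′ → x ℤ.≤ x′)

AdjacentColumns : Polyomino → ℤ → ℤ → Set
AdjacentColumns P x x′ =
  IsColumn P x × IsColumn P x′ × x ℤ.< x′ ×
  (∀ z → x ℤ.< z → z ℤ.< x′ → ¬ IsColumn P z)

-- (b , t) stands for the vertical run of cells from height b to height t.
Run : Set
Run = ℤ × ℤ

-- The connected components of a column are its maximal runs.
record Component (P : Polyomino) (x : ℤ) (run : Run) : Set where
  private
    b = proj₁ run
    t = proj₂ run
  field
    inhabited    : b ℤ.≤ t
    filled       : ∀ y → b ℤ.≤ y → y ℤ.≤ t → (x , y) ∈ₚ P
    maximalBelow : (x , ℤ.pred b) ∉ₚ P
    maximalAbove : (x , ℤ.suc t) ∉ₚ P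

AtMostOneComponent : Polyomino → ℤ → Set
AtMostOneComponent P x =
  ∀ r s → Component P x r → Component P x s → r ≡ s

AtMostTwoComponents : Polyomino → ℤ → Set
AtMostTwoComponents P x =
  ∀ r s u → Component P x r → Component P x s → Component P x u →
  r ≡ s ⊎ r ≡ u ⊎ s ≡ u

TouchesColumn : Polyomino → ℤ → ℤ → Run → Set
TouchesColumn P x x′ (b , t) =
  ∃[ y ] ∃[ y′ ] (x , y) ∈ₚ P × b ℤ.≤ y′ × y′ ℤ.≤ t × ShareEdge (x , y) (x′ , y′)

-- The number of heights strictly between t and b, for t < b.
gapSize : (t b : ℤ) → ℤ
gapSize t b = ℤ.pred (b ℤ.- t)

record RightwardSemiDirected (P : Polyomino) : Set where
  field
    firstColumn : ∀ x → FirstColumn P x → AtMostOneComponent P x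
    touching    : ∀ x x′ → AdjacentColumns P x x′ →
                  ∀ r → Component P x′ r → TouchesColumn P x x′ r

record Cheesy (m : ℕ) (P : Polyomino) : Set where
  field
    semiDirected  : RightwardSemiDirected P
    twoComponents : ∀ x → IsColumn P x → AtMostTwoComponents P x
    smallGaps     : ∀ x b₁ t₁ b₂ t₂ →
                    Component P x (b₁ , t₁) → Component P x (b₂ , t₂) →
                    t₁ ℤ.< b₂ → gapSize t₁ b₂ ℤ.≤ + m

CheesyPolyomino : (m n : ℕ) → Set
CheesyPolyomino m n = Σ[ P ∈ Polyomino ] Cheesy m P × size P ≡ n

cheesySetoid : (m n : ℕ) → Setoid 0ℓ 0ℓ
cheesySetoid m n = record
  { Carrier       = CheesyPolyomino m n
  ; _≈_           = _≋_ on proj₁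
  ; isEquivalence = On.isEquivalence proj₁ ≋-isEquivalence
  }

HasCardinality : Setoid 0ℓ 0ℓ → ℕ → Set
HasCardinality S k = Inverse (setoid (Fin k)) S

-- Real numbers are Cauchy sequences of rationals; as ∃ is constructive, a
-- proof of IsCauchy contains a modulus of convergence.

Close : (u v ε : ℚ) → Set
Close u v ε = ℚ.∣ u ℚ.- v ∣ ℚ.< ε

IsCauchy : (ℕ → ℚ) → Set
IsCauchy s = ∀ ε → 0ℚ ℚ.< ε → ∃[ N ] (∀ i j → N ℕ.≤ i → N ℕ.≤ j → Close (s i) (s j) ε)

record ℝ : Set where
  constructor mkℝ
  field
    seq    : ℕ → ℚ
    cauchy : IsCauchy seq

open ℝ public

infix 4 _<_ _≤_

_<_ _≤_ : ℝ → ℝ → Set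
x < y = ∃[ ε ] 0ℚ ℚ.< ε × ∃[ N ] (∀ i → N ℕ.≤ i → seq x i ℚ.+ ε ℚ.≤ seq y i)
x ≤ y = ∀ ε → 0ℚ ℚ.< ε → ∃[ N ] (∀ i → N ℕ.≤ i → seq x i ℚ.≤ seq y i ℚ.+ ε)

private
  open +-*-Solver using (solve; _:=_; _:+_; _:*_; :-_; _:-_)

Close-refl : ∀ q ε → 0ℚ ℚ.< ε → Close q q ε
Close-refl q ε ε>0 = subst (ℚ._< ε) (sym (cong ℚ.∣_∣ (ℚ.+-inverseʳ q))) ε>0

half-pos : ∀ {ε} → 0ℚ ℚ.< ε → 0ℚ ℚ.< ½ ℚ.* ε
half-pos {ε} ε>0 = subst (ℚ._< ½ ℚ.* ε) (ℚ.*-zeroʳ ½) (ℚ.*-monoʳ-<-pos ½ ε>0)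

half+half : ∀ ε → ½ ℚ.* ε ℚ.+ ½ ℚ.* ε ≡ ε
half+half ε = trans (sym (ℚ.*-distribʳ-+ ε ½ ½)) (ℚ.*-identityˡ ε)

*-pos : ∀ {p q} → 0ℚ ℚ.< p → 0ℚ ℚ.< q → 0ℚ ℚ.< p ℚ.* q
*-pos {p} {q} p>0 q>0 =
  ℚ.positive⁻¹ _ {{ℚ.pos*pos⇒pos p {{ℚ.positive p>0}} q {{ℚ.positive q>0}}}}

*-mono-≤ : ∀ {p q r s} → 0ℚ ℚ.≤ p → 0ℚ ℚ.≤ s → p ℚ.≤ q → r ℚ.≤ s → p ℚ.* r ℚ.≤ q ℚ.* s
*-mono-≤ {p} {q} {r} {s} p≥0 s≥0 p≤q r≤s = ℚ.≤-trans
  (ℚ.*-monoˡ-≤-nonNeg p {{ℚ.nonNegative p≥0}} r≤s)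
  (ℚ.*-monoʳ-≤-nonNeg s {{ℚ.nonNegative s≥0}} p≤q)

p≤∣p∣ : ∀ p → p ℚ.≤ ℚ.∣ p ∣
p≤∣p∣ p with ℚ.≤-total 0ℚ p
... | inj₁ 0≤p = ℚ.≤-reflexive (sym (ℚ.0≤p⇒∣p∣≡p 0≤p))
... | inj₂ p≤0 = ℚ.≤-trans p≤0 (ℚ.0≤∣p∣ p)

∣∣-bound : ∀ {p r} → p ℚ.≤ r → ℚ.- p ℚ.≤ r → ℚ.∣ p ∣ ℚ.≤ r
∣∣-bound {p} {r} p≤r -p≤r with ℚ.∣p∣≡p∨∣p∣≡-p p
... | inj₁ e = subst (ℚ._≤ r) (sym e) p≤r
... | inj₂ e = subst (ℚ._≤ r) (sym e) -p≤r

∣u-v∣≡∣v-u∣ : ∀ u v → ℚ.∣ u ℚ.- v ∣ ≡ ℚ.∣ v ℚ.- u ∣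
∣u-v∣≡∣v-u∣ u v = trans (sym (ℚ.∣-p∣≡∣p∣ (u ℚ.- v)))
  (cong ℚ.∣_∣ (solve 2 (λ u v → :- (u :- v) := v :- u) refl u v))

∣u∣≤∣u-v∣+∣v∣ : ∀ u v → ℚ.∣ u ∣ ℚ.≤ ℚ.∣ u ℚ.- v ∣ ℚ.+ ℚ.∣ v ∣
∣u∣≤∣u-v∣+∣v∣ u v = subst (λ w → ℚ.∣ w ∣ ℚ.≤ ℚ.∣ u ℚ.- v ∣ ℚ.+ ℚ.∣ v ∣)
  (solve 2 (λ u v → (u :- v) :+ v := u) refl u v)
  (ℚ.∣p+q∣≤∣p∣+∣q∣ (u ℚ.- v) v)

∣u∣-∣v∣≤∣u-v∣ : ∀ u v → ℚ.∣ u ∣ ℚ.- ℚ.∣ v ∣ ℚ.≤ ℚ.∣ u ℚ.- v ∣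
∣u∣-∣v∣≤∣u-v∣ u v = subst (ℚ.∣ u ∣ ℚ.- ℚ.∣ v ∣ ℚ.≤_)
  (solve 2 (λ a b → (a :+ b) :- b := a) refl ℚ.∣ u ℚ.- v ∣ ℚ.∣ v ∣)
  (ℚ.+-monoˡ-≤ (ℚ.- ℚ.∣ v ∣) (∣u∣≤∣u-v∣+∣v∣ u v))

∣∣u∣-∣v∣∣≤∣u-v∣ : ∀ u v → ℚ.∣ ℚ.∣ u ∣ ℚ.- ℚ.∣ v ∣ ∣ ℚ.≤ ℚ.∣ u ℚ.- v ∣
∣∣u∣-∣v∣∣≤∣u-v∣ u v = ∣∣-bound (∣u∣-∣v∣≤∣u-v∣ u v)
  (subst₂ ℚ._≤_
    (solve 2 (λ a b → b :- a := :- (a :- b)) refl ℚ.∣ u ∣ ℚ.∣ v ∣)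
    (∣u-v∣≡∣v-u∣ v u)
    (∣u∣-∣v∣≤∣u-v∣ v u))

eventuallyBounded : ∀ x → ∃[ B ] 0ℚ ℚ.< B × ∃[ N ] (∀ i → N ℕ.≤ i → ℚ.∣ seq x i ∣ ℚ.≤ B)
eventuallyBounded x with cauchy x 1ℚ (ℚ.positive⁻¹ 1ℚ)
... | N , close = 1ℚ ℚ.+ ℚ.∣ seq x N ∣
                , ℚ.+-mono-<-≤ (ℚ.positive⁻¹ 1ℚ) (ℚ.0≤∣p∣ (seq x N))
                , N
                , λ i N≤i → ℚ.≤-trans (∣u∣≤∣u-v∣+∣v∣ (seq x i) (seq x N))
                    (ℚ.+-monoˡ-≤ ℚ.∣ seq x N ∣ (ℚ.<⇒≤ (close i N N≤i ℕ.≤-refl)))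

*-diff : ∀ a b c d → ℚ.∣ a ℚ.* b ℚ.- c ℚ.* d ∣
         ℚ.≤ ℚ.∣ a ∣ ℚ.* ℚ.∣ b ℚ.- d ∣ ℚ.+ ℚ.∣ a ℚ.- c ∣ ℚ.* ℚ.∣ d ∣
*-diff a b c d = subst₂ ℚ._≤_
  (cong ℚ.∣_∣ (solve 4 (λ a b c d → a :* (b :- d) :+ (a :- c) :* d := a :* b :- c :* d)
                 refl a b c d))
  (cong₂ ℚ._+_ (ℚ.∣p*q∣≡∣p∣*∣q∣ a (b ℚ.- d)) (ℚ.∣p*q∣≡∣p∣*∣q∣ (a ℚ.- c) d))
  (ℚ.∣p+q∣≤∣p∣+∣q∣ (a ℚ.* (b ℚ.- d)) ((a ℚ.- c) ℚ.* d))

quotient : ∀ C ε → 0ℚ ℚ.< C → 0ℚ ℚ.< ε → ∃[ δ ] 0ℚ ℚ.< δ × C ℚ.* δ ≡ ε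
quotient C ε C>0 ε>0 = C⁻¹ ℚ.* ε , *-pos C⁻¹>0 ε>0 ,
    trans (sym (ℚ.*-assoc C C⁻¹ ε))
    (trans (cong (ℚ._* ε) (ℚ.*-inverseʳ C)) (ℚ.*-identityˡ ε))
  where
  instance
    C-pos : ℚ.Positive C
    C-pos = ℚ.positive C>0
    C-nz : ℚ.NonZero C
    C-nz = ℚ.pos⇒nonZero C
  C⁻¹ = ℚ.1/ C
  C⁻¹>0 : 0ℚ ℚ.< C⁻¹
  C⁻¹>0 = ℚ.positive⁻¹ C⁻¹ {{ℚ.1/pos⇒pos C}}

fromℚ : ℚ → ℝ
fromℚ q = mkℝ (λ _ → q) (λ ε ε>0 → 0 , λ _ _ _ _ → Close-refl q ε ε>0)

fromℕ : ℕ → ℝ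
fromℕ n = fromℚ (+ n ℚ./ 1)

0ℝ 1ℝ : ℝ
0ℝ = fromℚ 0ℚ
1ℝ = fromℚ 1ℚ

infixl 6 _+_ _-_
infixl 7 _*_ _/_[_]
infixr 8 _^_

_+_ : ℝ → ℝ → ℝ
x + y = mkℝ (λ i → seq x i ℚ.+ seq y i) isCauchy
  where
  isCauchy : IsCauchy (λ i → seq x i ℚ.+ seq y i)
  isCauchy ε ε>0 with cauchy x _ (half-pos ε>0) | cauchy y _ (half-pos ε>0)
  ... | M , p | N , q = M ℕ.⊔ N , λ i j hi hj →
    ℚ.≤-<-trans
      (subst (ℚ._≤ ℚ.∣ seq x i ℚ.- seq x j ∣ ℚ.+ ℚ.∣ seq y i ℚ.- seq y j ∣)
        (cong ℚ.∣_∣ (solve 4 (λ a b c d → (a :- c) :+ (b :- d) := (a :+ b) :- (c :+ d))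
                       refl (seq x i) (seq y i) (seq x j) (seq y j)))
        (ℚ.∣p+q∣≤∣p∣+∣q∣ (seq x i ℚ.- seq x j) (seq y i ℚ.- seq y j)))
      (subst (ℚ.∣ seq x i ℚ.- seq x j ∣ ℚ.+ ℚ.∣ seq y i ℚ.- seq y j ∣ ℚ.<_) (half+half ε)
        (ℚ.+-mono-< (p i j (ℕ.m⊔n≤o⇒m≤o M N hi) (ℕ.m⊔n≤o⇒m≤o M N hj))
                    (q i j (ℕ.m⊔n≤o⇒n≤o M N hi) (ℕ.m⊔n≤o⇒n≤o M N hj))))

-_ : ℝ → ℝ
- x = mkℝ (λ i → ℚ.- seq x i) λ ε ε>0 →
  let N , p = cauchy x ε ε>0 in N , λ i j hi hj →
  subst (ℚ._< ε)
    (trans (∣u-v∣≡∣v-u∣ (seq x i) (seq x j))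
      (cong ℚ.∣_∣ (solve 2 (λ a b → b :- a := (:- a) :- (:- b)) refl (seq x i) (seq x j))))
    (p i j hi hj)

_-_ : ℝ → ℝ → ℝ
x - y = x + (- y)

∣_∣ : ℝ → ℝ
∣ x ∣ = mkℝ (λ i → ℚ.∣ seq x i ∣) λ ε ε>0 →
  let N , p = cauchy x ε ε>0 in N , λ i j hi hj →
  ℚ.≤-<-trans (∣∣u∣-∣v∣∣≤∣u-v∣ (seq x i) (seq x j)) (p i j hi hj)

half<ε : ∀ {ε} → 0ℚ ℚ.< ε → ½ ℚ.* ε ℚ.< ε
half<ε {ε} ε>0 = subst₂ ℚ._<_ (ℚ.+-identityʳ (½ ℚ.* ε)) (half+half ε)
                   (ℚ.+-monoʳ-< (½ ℚ.* ε) (half-pos ε>0))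

*-close : ∀ {A B δ η} a b c d → 0ℚ ℚ.< B → 0ℚ ℚ.< δ → (A ℚ.+ B) ℚ.* δ ≡ η →
          ℚ.∣ a ∣ ℚ.≤ A → ℚ.∣ d ∣ ℚ.≤ B → Close a c δ → Close b d δ →
          ℚ.∣ a ℚ.* b ℚ.- c ℚ.* d ∣ ℚ.≤ η
*-close {A} {B} {δ} {η} a b c d B>0 δ>0 eq a≤A d≤B ac bd =
  ℚ.≤-trans (*-diff a b c d)
  (ℚ.≤-trans
    (ℚ.+-mono-≤
      (*-mono-≤ {ℚ.∣ a ∣} {A} {ℚ.∣ b ℚ.- d ∣} {δ} (ℚ.0≤∣p∣ a) (ℚ.<⇒≤ δ>0) a≤A (ℚ.<⇒≤ bd))
      (*-mono-≤ {ℚ.∣ a ℚ.- c ∣} {δ} {ℚ.∣ d ∣} {B}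
        (ℚ.0≤∣p∣ (a ℚ.- c)) (ℚ.<⇒≤ B>0) (ℚ.<⇒≤ ac) d≤B))
    (ℚ.≤-reflexive
      (trans (solve 3 (λ A B δ → A :* δ :+ δ :* B := (A :+ B) :* δ) refl A B δ) eq)))

_*_ : ℝ → ℝ → ℝ
x * y = mkℝ (λ i → seq x i ℚ.* seq y i) λ ε ε>0 →
  let A , A>0 , K , ∣x∣≤A = eventuallyBounded x
      B , B>0 , L , ∣y∣≤B = eventuallyBounded y
      δ , δ>0 , eq        = quotient (A ℚ.+ B) (½ ℚ.* ε) (ℚ.+-mono-< A>0 B>0) (half-pos ε>0)
      M , p               = cauchy x δ δ>0
      N , q               = cauchy y δ δ>0
  in (K ℕ.⊔ L) ℕ.⊔ (M ℕ.⊔ N) , λ i j hi hj →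
  let KL≤i = ℕ.m⊔n≤o⇒m≤o (K ℕ.⊔ L) (M ℕ.⊔ N) hi
      KL≤j = ℕ.m⊔n≤o⇒m≤o (K ℕ.⊔ L) (M ℕ.⊔ N) hj
      MN≤i = ℕ.m⊔n≤o⇒n≤o (K ℕ.⊔ L) (M ℕ.⊔ N) hi
      MN≤j = ℕ.m⊔n≤o⇒n≤o (K ℕ.⊔ L) (M ℕ.⊔ N) hj
  in ℚ.≤-<-trans
       (*-close (seq x i) (seq y i) (seq x j) (seq y j) B>0 δ>0 eq
         (∣x∣≤A i (ℕ.m⊔n≤o⇒m≤o K L KL≤i))
         (∣y∣≤B j (ℕ.m⊔n≤o⇒n≤o K L KL≤j))
         (p i j (ℕ.m⊔n≤o⇒m≤o M N MN≤i) (ℕ.m⊔n≤o⇒m≤o M N MN≤j))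
         (q i j (ℕ.m⊔n≤o⇒n≤o M N MN≤i) (ℕ.m⊔n≤o⇒n≤o M N MN≤j)))
       (half<ε ε>0)

_^_ : ℝ → ℕ → ℝ
x ^ zero  = 1ℝ
x ^ suc n = x * x ^ n

⊔-pos : ∀ {δ} q → 0ℚ ℚ.< δ → ℚ.Positive (δ ℚ.⊔ q)
⊔-pos {δ} q δ>0 = ℚ.positive (ℚ.<-≤-trans δ>0 (ℚ.p≤p⊔q δ q))

recipAbove : ∀ δ → 0ℚ ℚ.< δ → ℚ → ℚ
recipAbove δ δ>0 q = ℚ.1/_ (δ ℚ.⊔ q) {{ℚ.pos⇒nonZero (δ ℚ.⊔ q) {{⊔-pos q δ>0}}}}

recip-inverse : ∀ δ (δ>0 : 0ℚ ℚ.< δ) q → δ ℚ.≤ q → q ℚ.* recipAbove δ δ>0 q ≡ 1ℚ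
recip-inverse δ δ>0 q δ≤q = subst (λ z → z ℚ.* recipAbove δ δ>0 q ≡ 1ℚ)
  (ℚ.p≤q⇒p⊔q≡q δ≤q)
  (ℚ.*-inverseʳ (δ ℚ.⊔ q) {{ℚ.pos⇒nonZero (δ ℚ.⊔ q) {{⊔-pos q δ>0}}}})

-- Since x is eventually ≥ δ, replacing its terms by their maximum with δ
-- changes only finitely many of them.
_⁻¹[_] : (x : ℝ) → 0ℝ < x → ℝ
x ⁻¹[ δ , δ>0 , K , δ≤x ] = mkℝ (λ i → recipAbove δ δ>0 (seq x i)) isCauchy
  where
  isCauchy : IsCauchy (λ i → recipAbove δ δ>0 (seq x i))
  isCauchy ε ε>0 with cauchy x (δ ℚ.* δ ℚ.* ε) (*-pos (*-pos δ>0 δ>0) ε>0)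
  ... | N , p = K ℕ.⊔ N , bound
    where
    bound : ∀ i j → K ℕ.⊔ N ℕ.≤ i → K ℕ.⊔ N ℕ.≤ j →
            Close (recipAbove δ δ>0 (seq x i)) (recipAbove δ δ>0 (seq x j)) ε
    bound i j hi hj = ℚ.*-cancelˡ-<-nonNeg (δ ℚ.* δ) {{ℚ.nonNegative (ℚ.<⇒≤ (*-pos δ>0 δ>0))}}
      (ℚ.≤-<-trans
        (ℚ.≤-trans
          (ℚ.*-monoʳ-≤-nonNeg ℚ.∣ u ℚ.- v ∣ {{ℚ.nonNegative (ℚ.0≤∣p∣ (u ℚ.- v))}}
            (*-mono-≤ (ℚ.<⇒≤ δ>0) (ℚ.≤-trans (ℚ.<⇒≤ δ>0) δ≤b) δ≤a δ≤b))
          (ℚ.≤-reflexive product))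
        (p j i (ℕ.m⊔n≤o⇒n≤o K N hj) (ℕ.m⊔n≤o⇒n≤o K N hi)))
      where
      a = seq x i
      b = seq x j
      u = recipAbove δ δ>0 a
      v = recipAbove δ δ>0 b
      δ≤ : ∀ k → K ℕ.≤ k → δ ℚ.≤ seq x k
      δ≤ k hk = subst (ℚ._≤ seq x k) (ℚ.+-identityˡ δ) (δ≤x k hk)
      δ≤a = δ≤ i (ℕ.m⊔n≤o⇒m≤o K N hi)
      δ≤b = δ≤ j (ℕ.m⊔n≤o⇒m≤o K N hj)
      0≤ab : 0ℚ ℚ.≤ a ℚ.* b
      0≤ab = ℚ.<⇒≤ (*-pos (ℚ.<-≤-trans δ>0 δ≤a) (ℚ.<-≤-trans δ>0 δ≤b))
      numerator : a ℚ.* b ℚ.* (u ℚ.- v) ≡ b ℚ.- a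
      numerator = trans
        (solve 4 (λ a b u v → a :* b :* (u :- v) := (a :* u) :* b :- (b :* v) :* a) refl a b u v)
        (cong₂ ℚ._-_
          (trans (cong (ℚ._* b) (recip-inverse δ δ>0 a δ≤a)) (ℚ.*-identityˡ b))
          (trans (cong (ℚ._* a) (recip-inverse δ δ>0 b δ≤b)) (ℚ.*-identityˡ a)))
      product : a ℚ.* b ℚ.* ℚ.∣ u ℚ.- v ∣ ≡ ℚ.∣ b ℚ.- a ∣
      product = trans (cong (ℚ._* ℚ.∣ u ℚ.- v ∣) (sym (ℚ.0≤p⇒∣p∣≡p 0≤ab)))
               (trans (sym (ℚ.∣p*q∣≡∣p∣*∣q∣ (a ℚ.* b) (u ℚ.- v))) (cong ℚ.∣_∣ numerator))

_/_[_] : ℝ → (y : ℝ) → 0ℝ < y → ℝ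
x / y [ y>0 ] = x * y ⁻¹[ y>0 ]

infix 4 _⟶_ _∼_

_⟶_ : (ℕ → ℝ) → ℝ → Set
a ⟶ L = ∀ ε → 0ℝ < ε → ∃[ N ] (∀ n → N ℕ.≤ n → ∣ a n - L ∣ < ε)

-- Asymptotic equivalence to a sequence of positive reals: positivity is
-- what makes the quotients f n / g n meaningful.
_∼_ : (f g : ℕ → ℝ) → Set
f ∼ g = Σ[ g>0 ∈ (∀ n → 0ℝ < g n) ] (λ n → f n / g n [ g>0 n ]) ⟶ 1ℝ

module Submission where

-- A cheesy polyomino is determined up to translation by its list of columns, and
-- the number of ways to place one column next to another is bilinear in finitely
-- many features of the two shapes.  Hence the generating series of the counts,
-- refined by features, solve a linear system over ℤ[x], and eliminating all but
-- one of them shows that Σ ℓₙ xⁿ is rational.  Let P be its reversed denominator,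
-- Λ the dominant root of P and Q = P / (x - Λ).  The shift operator Q(E) turns ℓ
-- into a geometric sequence with ratio Λ, which determines κ, and the deviation
-- ℓₙ - κ Λⁿ satisfies the recurrence with characteristic polynomial Q.  Once P has
-- been multiplied by a suitable cofactor, the coefficients of Q after the leading
-- one are so small that the deviation is o(Λⁿ).  As Λ is only available through
-- rational approximations, the identities hold up to multiples of the residue of
-- P at the approximation; the numerical estimates use balls with integer data.

open import Defs
open import Data.Nat.Base as ℕ using (ℕ; zero; suc; z≤n; s≤s)
import Data.Nat.Properties as ℕ
open import Data.Integer.Base as ℤ using (ℤ; +_; -[1+_]; 0ℤ; 1ℤ; -1ℤ)
import Data.Integer.Properties as ℤ
import Data.Integer.Tactic.RingSolver as ℤSolver
open import Data.Bool.Base using (Bool; true; false; if_then_else_; not; _∧_; _∨_)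
open import Data.Empty using (⊥; ⊥-elim)
open import Data.Unit.Base using (tt)
open import Data.List.Base as List using (List; []; _∷_; _++_; map; length; concatMap; lookup)
import Data.List.Properties as List
open import Data.List.Membership.Propositional using (_∈_)
open import Data.List.Relation.Unary.All as All using (All; []; _∷_)
import Data.List.Relation.Unary.All.Properties as All
open import Data.List.Relation.Unary.Any as Any using (Any; here; there)
import Data.List.Relation.Unary.Any.Properties as Any
open import Data.Product.Base using (Σ-syntax; ∃-syntax; _×_; _,_; proj₁; proj₂)
open import Data.Sum.Base using (_⊎_; inj₁; inj₂)
open import Function.Base using (_∘_; id; _$_)
open import Relation.Binary.PropositionalEquality
open import Relation.Binary.Definitions using (tri<; tri≈; tri>)
open import Relation.Nullary.Negation using (¬_; contradiction)
open import Relation.Nullary.Decidable using (Dec; yes; no; _×-dec_; _⊎-dec_)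
open import Data.Fin.Base as Fin using (Fin; zero; suc; toℕ)
open import Data.Fin.Patterns using (0F; 1F; 2F)
open import Relation.Unary using (Decidable)
open import Data.Rational.Base as ℚ using (ℚ; 0ℚ; 1ℚ; ½)
import Data.Rational.Properties as ℚ
import Data.Rational.Unnormalised.Base as ℚᵘ
import Data.Rational.Unnormalised.Properties as ℚᵘ
open import Data.Maybe.Base using (Maybe; just; nothing)
open import Tactic.RingSolver.Core.AlmostCommutativeRing using (AlmostCommutativeRing; fromCommutativeRing)
import Tactic.RingSolver as RingSolver
open import Level using (0ℓ)
open import Data.List.Membership.Propositional.Properties
  using (∈-++⁺ˡ; ∈-++⁺ʳ; ∈-++⁻; ∈-map⁺; ∈-map⁻; ∈-filter⁺; ∈-filter⁻; ∈-concatMap⁺; ∈-concatMap⁻; ∈-lookup; ∈-∃++)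
open import Data.List.Relation.Unary.Unique.Propositional using (Unique)
import Data.List.Relation.Unary.Unique.Propositional.Properties as Unique
open import Data.List.Relation.Unary.AllPairs using ([]; _∷_)
open import Relation.Binary.Construct.Closure.ReflexiveTransitive as Star using (Star; _◅_; _◅◅_)
open import Data.Fin.Properties using (toℕ-injective; toℕ-fromℕ<)
import Data.List.Membership.DecPropositional as DecMembership
import Data.Product.Properties as Product
open import Function.Bundles using (_⇔_; mk⇔; Equivalence)
open import Relation.Binary.Structures using (IsEquivalence)

-- Deciding linear formulas over ℤ

-- Column lengths are unbounded, so a transfer matrix indexed by shapes would be infinite. The bound
-- on the gaps is what leaves finitely many features: a run of i + 1 cells is adjacent to i + 2
-- cells of the previous column, so a gap of at most three cells can hide only components of length
-- 1 or 2, and apart from this the number of placements is affine in the lengths (or truncated below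
-- a small threshold). The elimination is certified rather than performed: one row of multipliers is
-- listed, and the resulting polynomial identity is checked by evaluation. Q alone gives no one-step
-- estimate: its second coefficient Λ - 14 already exceeds Λ in absolute value. Multiplying by a
-- truncated expansion of a power of x divided by Q trades a longer recurrence for small
-- coefficients, so that the other roots never have to be located. All estimates are uniform in the
-- approximation to Λ. For fixed n the terms carrying the residue can therefore be made arbitrarily
-- small by refining the approximation afterwards.

LinearForm : Set
LinearForm = List ℤ

dot : List ℤ → List ℤ → ℤ
dot (a ∷ as) (x ∷ xs) = a ℤ.* x ℤ.+ dot as xs
dot _        _        = 0ℤ

addForm : LinearForm → LinearForm → LinearForm
addForm []       bs       = bs
addForm as       []       = as
addForm (a ∷ as) (b ∷ bs) = a ℤ.+ b ∷ addForm as bs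

scaleForm : ℤ → LinearForm → LinearForm
scaleForm c = map (c ℤ.*_)

dot-add : ∀ as bs xs → dot (addForm as bs) xs ≡ dot as xs ℤ.+ dot bs xs
dot-add []       bs       xs       = sym (ℤ.+-identityˡ (dot bs xs))
dot-add (a ∷ as) []       xs       = sym (ℤ.+-identityʳ (dot (a ∷ as) xs))
dot-add (a ∷ as) (b ∷ bs) []       = refl
dot-add (a ∷ as) (b ∷ bs) (x ∷ xs) =
  trans (cong (λ z → (a ℤ.+ b) ℤ.* x ℤ.+ z) (dot-add as bs xs))
        (regroup a b x (dot as xs) (dot bs xs))
  where
  regroup : ∀ a b x p q → (a ℤ.+ b) ℤ.* x ℤ.+ (p ℤ.+ q) ≡ (a ℤ.* x ℤ.+ p) ℤ.+ (b ℤ.* x ℤ.+ q)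
  regroup = ℤSolver.solve-∀

dot-scale : ∀ c as xs → dot (scaleForm c as) xs ≡ c ℤ.* dot as xs
dot-scale c []       xs       = sym (ℤ.*-zeroʳ c)
dot-scale c (a ∷ as) []       = sym (ℤ.*-zeroʳ c)
dot-scale c (a ∷ as) (x ∷ xs) =
  trans (cong (λ z → c ℤ.* a ℤ.* x ℤ.+ z) (dot-scale c as xs)) (regroup c a x (dot as xs))
  where
  regroup : ∀ c a x p → c ℤ.* a ℤ.* x ℤ.+ c ℤ.* p ≡ c ℤ.* (a ℤ.* x ℤ.+ p)
  regroup = ℤSolver.solve-∀

NonNeg : List ℤ → LinearForm → Set
NonNeg ρ f = 0ℤ ℤ.≤ dot f ρ

0≤sum : ∀ {i j} → 0ℤ ℤ.≤ i → 0ℤ ℤ.≤ j → 0ℤ ℤ.≤ i ℤ.+ j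
0≤sum = ℤ.+-mono-≤

coefficient : ℕ → LinearForm → ℤ
coefficient _       []       = 0ℤ
coefficient zero    (a ∷ _)  = a
coefficient (suc i) (_ ∷ as) = coefficient i as

-- Both multipliers are absolute values, so soundness needs no information about signs. Variable `i`
-- cancels when its coefficients in `p` and `n` have opposite signs.
combine : ℕ → LinearForm → LinearForm → LinearForm
combine i p n = addForm (scaleForm (+ ℤ.∣ coefficient i n ∣) p) (scaleForm (+ ℤ.∣ coefficient i p ∣) n)

0≤scale : ∀ k f ρ → NonNeg ρ f → NonNeg ρ (scaleForm (+ k) f)
0≤scale k f ρ h = subst (0ℤ ℤ.≤_) (sym (dot-scale (+ k) f ρ))
  (subst (ℤ._≤ + k ℤ.* dot f ρ) (ℤ.*-zeroʳ (+ k)) (ℤ.*-monoˡ-≤-nonNeg (+ k) h))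

combine-sound : ∀ i p n ρ → NonNeg ρ p → NonNeg ρ n → NonNeg ρ (combine i p n)
combine-sound i p n ρ hp hn = subst (0ℤ ℤ.≤_)
  (sym (dot-add (scaleForm (+ ℤ.∣ coefficient i n ∣) p) (scaleForm (+ ℤ.∣ coefficient i p ∣) n) ρ))
  (0≤sum (0≤scale ℤ.∣ coefficient i n ∣ p ρ hp) (0≤scale ℤ.∣ coefficient i p ∣ n ρ hn))

keep : ∀ {A : Set} → (A → Bool) → List A → List A
keep p []       = []
keep p (x ∷ xs) = if p x then x ∷ keep p xs else keep p xs

keep-sound : ∀ {A : Set} {P : A → Set} p {xs} → All P xs → All P (keep p xs)
keep-sound p []               = []
keep-sound p (_∷_ {x} px pxs) with p x
... | true  = px ∷ keep-sound p pxs
... | false = keep-sound p pxs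

isPositive isNegative isZero : ℤ → Bool
isPositive (+ suc _) = true
isPositive _         = false
isNegative -[1+ _ ]  = true
isNegative _         = false
isZero (+ zero)      = true
isZero _             = false

allZero : LinearForm → Bool
allZero []       = true
allZero (a ∷ as) = isZero a ∧ allZero as

-- The head of a form is its constant term.
trivial contradictory : LinearForm → Bool
trivial []              = true
trivial (a ∷ as)        = not (isNegative a) ∧ allZero as
contradictory []        = false
contradictory (a ∷ as)  = isNegative a ∧ allZero as

sameSlope : LinearForm → LinearForm → Bool
sameSlope []       bs       = allZero bs
sameSlope (a ∷ as) []       = allZero (a ∷ as)
sameSlope (a ∷ as) (b ∷ bs) = isZero (a ℤ.- b) ∧ sameSlope as bs

implies : LinearForm → LinearForm → Bool
implies (a ∷ as) (b ∷ bs) = not (isNegative (b ℤ.- a)) ∧ sameSlope as bs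
implies _        _        = false

someImplies : List LinearForm → LinearForm → Bool
someImplies []       f = false
someImplies (g ∷ gs) f = implies g f ∨ someImplies gs f

-- Each elimination step can square the number of inequalities. Removing those dominated by a
-- parallel one keeps the evaluation of `refute` feasible.
prune : List LinearForm → List LinearForm
prune []       = []
prune (f ∷ fs) with prune fs
... | gs = if trivial f ∨ someImplies gs f then gs else f ∷ keep (not ∘ implies f) gs

prune-sound : ∀ {P : LinearForm → Set} {fs} → All P fs → All P (prune fs)
prune-sound []                 = []
prune-sound (_∷_ {f} {fs} p ps) with prune fs | prune-sound ps
... | gs | qs with trivial f ∨ someImplies gs f
...   | true  = qs
...   | false = p ∷ keep-sound (not ∘ implies f) qs

combineAll : ℕ → List LinearForm → List LinearForm → List LinearForm
combineAll i []       ns = []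
combineAll i (p ∷ ps) ns = map (combine i p) ns ++ combineAll i ps ns

combineAll-sound : ∀ i ρ {ps ns} → All (NonNeg ρ) ps → All (NonNeg ρ) ns →
                   All (NonNeg ρ) (combineAll i ps ns)
combineAll-sound i ρ []       qns = []
combineAll-sound i ρ (_∷_ {p} qp qps) qns =
  All.++⁺ (All.map⁺ (All.map (λ {n} qn → combine-sound i p n ρ qp qn) qns))
          (combineAll-sound i ρ qps qns)

-- One Fourier–Motzkin step.
eliminate : ℕ → List LinearForm → List LinearForm
eliminate i fs = prune (keep (isZero ∘ coefficient i) fs ++
  combineAll i (keep (isPositive ∘ coefficient i) fs) (keep (isNegative ∘ coefficient i) fs))

eliminate-sound : ∀ i ρ {fs} → All (NonNeg ρ) fs → All (NonNeg ρ) (eliminate i fs)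
eliminate-sound i ρ hs = prune-sound (All.++⁺ (keep-sound _ hs)
  (combineAll-sound i ρ (keep-sound (isPositive ∘ coefficient i) hs) (keep-sound (isNegative ∘ coefficient i) hs)))

cost : ℕ → List LinearForm → ℕ
cost i fs = length (keep (isPositive ∘ coefficient i) fs) ℕ.* length (keep (isNegative ∘ coefficient i) fs)

dimension : List LinearForm → ℕ
dimension []       = 0
dimension (f ∷ fs) = length f ℕ.⊔ dimension fs

occurs : ℕ → List LinearForm → Bool
occurs i []       = false
occurs i (f ∷ fs) = not (isZero (coefficient i f)) ∨ occurs i fs

-- Index 0 holds the constant term, hence the default 1. Among the variables that occur, one
-- producing the fewest combinations is preferred.
cheapest : ℕ → List LinearForm → ℕ
cheapest zero          fs = 1
cheapest (suc zero)    fs = 1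
cheapest (suc (suc i)) fs with cheapest (suc i) fs
... | j = if occurs (suc (suc i)) fs
          then (if not (occurs j fs) ∨ (cost (suc (suc i)) fs ℕ.<ᵇ cost j fs) then suc (suc i) else j)
          else j

anyContradictory : List LinearForm → Bool
anyContradictory []       = false
anyContradictory (f ∷ fs) = contradictory f ∨ anyContradictory fs

refute : ℕ → List LinearForm → Bool
refute zero       fs = anyContradictory fs
refute (suc fuel) fs = anyContradictory fs ∨ refute fuel (eliminate (cheapest (dimension fs) fs) fs)

∨-split : ∀ a {b} → a ∨ b ≡ true → a ≡ true ⊎ b ≡ true
∨-split true  e = inj₁ refl
∨-split false e = inj₂ e

∧-split : ∀ a {b} → a ∧ b ≡ true → a ≡ true × b ≡ true
∧-split true e = refl , e

allZero-dot : ∀ as xs → allZero as ≡ true → dot as xs ≡ 0ℤ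
allZero-dot []            xs       e = refl
allZero-dot (a ∷ as)      []       e = refl
allZero-dot (+ zero ∷ as) (x ∷ xs) e =
  trans (ℤ.+-identityˡ (dot as xs)) (allZero-dot as xs e)

contradictory-sound : ∀ f ρ → contradictory f ≡ true → ¬ NonNeg (1ℤ ∷ ρ) f
contradictory-sound (-[1+ n ] ∷ as) ρ e h with subst (0ℤ ℤ.≤_) value h
  where
  value : dot (-[1+ n ] ∷ as) (1ℤ ∷ ρ) ≡ -[1+ n ]
  value = trans (cong (λ z → -[1+ n ] ℤ.* 1ℤ ℤ.+ z) (allZero-dot as ρ e))
         (trans (ℤ.+-identityʳ (-[1+ n ] ℤ.* 1ℤ)) (ℤ.*-identityʳ -[1+ n ]))
... | ()

refute-sound : ∀ fuel fs ρ → refute fuel fs ≡ true → ¬ All (NonNeg (1ℤ ∷ ρ)) fs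
refute-sound fuel fs ρ e hs = go fuel fs e hs
  where
  any : ∀ fs → anyContradictory fs ≡ true → ¬ All (NonNeg (1ℤ ∷ ρ)) fs
  any (f ∷ fs) e (h ∷ hs) with ∨-split (contradictory f) e
  ... | inj₁ e′ = contradictory-sound f ρ e′ h
  ... | inj₂ e′ = any fs e′ hs
  go : ∀ fuel fs → refute fuel fs ≡ true → ¬ All (NonNeg (1ℤ ∷ ρ)) fs
  go zero       fs e hs = any fs e hs
  go (suc fuel) fs e hs with ∨-split (anyContradictory fs) e
  ... | inj₁ e′ = any fs e′ hs
  ... | inj₂ e′ = go fuel _ e′ (eliminate-sound (cheapest (dimension fs) fs) (1ℤ ∷ ρ) hs)

-- Reflection of quantifier-free linear formulas

infix  8 #_
infixl 7 _:+_ _:-_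
infix  6 _:≤_ _:<_ _:≡_
infixr 5 _:∧_
infixr 4 _:∨_
infixr 3 _:⇒_

data Term : Set where
  #_        : ℕ → Term
  const     : ℤ → Term
  _:+_ _:-_ : Term → Term → Term

data Formula : Set where
  _:≤_ _:<_ _:≡_ : Term → Term → Formula
  _:∧_ _:∨_ _:⇒_ : Formula → Formula → Formula
  :⊥             : Formula

valueAt : List ℤ → ℕ → ℤ
valueAt []      _       = 0ℤ
valueAt (x ∷ _) zero    = x
valueAt (_ ∷ ρ) (suc i) = valueAt ρ i

⟦_⟧ₜ : Term → List ℤ → ℤ
⟦ # i ⟧ₜ     ρ = valueAt ρ i
⟦ const c ⟧ₜ ρ = c
⟦ s :+ t ⟧ₜ  ρ = ⟦ s ⟧ₜ ρ ℤ.+ ⟦ t ⟧ₜ ρ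
⟦ s :- t ⟧ₜ  ρ = ⟦ s ⟧ₜ ρ ℤ.- ⟦ t ⟧ₜ ρ

⟦_⟧ : Formula → List ℤ → Set
⟦ s :≤ t ⟧ ρ = ⟦ s ⟧ₜ ρ ℤ.≤ ⟦ t ⟧ₜ ρ
⟦ s :< t ⟧ ρ = ⟦ s ⟧ₜ ρ ℤ.< ⟦ t ⟧ₜ ρ
⟦ s :≡ t ⟧ ρ = ⟦ s ⟧ₜ ρ ≡ ⟦ t ⟧ₜ ρ
⟦ φ :∧ ψ ⟧ ρ = ⟦ φ ⟧ ρ × ⟦ ψ ⟧ ρ
⟦ φ :∨ ψ ⟧ ρ = ⟦ φ ⟧ ρ ⊎ ⟦ ψ ⟧ ρ
⟦ φ :⇒ ψ ⟧ ρ = ⟦ φ ⟧ ρ → ⟦ ψ ⟧ ρ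
⟦ :⊥ ⟧     ρ = ⊥

unitForm : ℕ → LinearForm
unitForm zero    = 1ℤ ∷ []
unitForm (suc i) = 0ℤ ∷ unitForm i

toForm : Term → LinearForm
toForm (# i)     = 0ℤ ∷ unitForm i
toForm (const c) = c ∷ []
toForm (s :+ t)  = addForm (toForm s) (toForm t)
toForm (s :- t)  = addForm (toForm s) (scaleForm -1ℤ (toForm t))

dot-unit : ∀ i ρ → dot (unitForm i) ρ ≡ valueAt ρ i
dot-unit zero    []      = refl
dot-unit (suc i) []      = refl
dot-unit zero    (x ∷ ρ) = trans (ℤ.+-identityʳ _) (ℤ.*-identityˡ x)
dot-unit (suc i) (x ∷ ρ) = trans (ℤ.+-identityˡ _) (dot-unit i ρ)

toForm-sound : ∀ t ρ → dot (toForm t) (1ℤ ∷ ρ) ≡ ⟦ t ⟧ₜ ρ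
toForm-sound (# i)     ρ = trans (ℤ.+-identityˡ _) (dot-unit i ρ)
toForm-sound (const c) ρ = trans (ℤ.+-identityʳ _) (ℤ.*-identityʳ c)
toForm-sound (s :+ t)  ρ = trans (dot-add (toForm s) (toForm t) (1ℤ ∷ ρ))
  (cong₂ ℤ._+_ (toForm-sound s ρ) (toForm-sound t ρ))
toForm-sound (s :- t)  ρ = trans (dot-add (toForm s) (scaleForm -1ℤ (toForm t)) (1ℤ ∷ ρ))
  (cong₂ ℤ._+_ (toForm-sound s ρ)
    (trans (dot-scale -1ℤ (toForm t) (1ℤ ∷ ρ))
      (trans (ℤ.-1*i≡-i _) (cong ℤ.-_ (toForm-sound t ρ)))))

DNF : Set
DNF = List (List LinearForm)

Holds : List ℤ → DNF → Set
Holds ρ = Any (All (NonNeg (1ℤ ∷ ρ)))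

conjunction : DNF → DNF → DNF
conjunction []       ds = []
conjunction (c ∷ cs) ds = map (c ++_) ds ++ conjunction cs ds

conjunction-sound : ∀ {ρ cs ds} → Holds ρ cs → Holds ρ ds → Holds ρ (conjunction cs ds)
conjunction-sound (here hc)  hd = Any.++⁺ˡ (Any.map⁺ (Any.map (All.++⁺ hc) hd))
conjunction-sound {ds = ds} (there {c} hc) hd = Any.++⁺ʳ (map (c ++_) ds) (conjunction-sound hc hd)

-- Over ℤ a strict inequality s < t is sharpened to 1 + s ≤ t. This is where integrality enters an
-- otherwise rational procedure.
leForm ltForm : Term → Term → LinearForm
leForm s t = toForm (t :- s)
ltForm s t = toForm (t :- (const 1ℤ :+ s))

whenTrue whenFalse : Formula → DNF
whenTrue (s :≤ t)  = (leForm s t ∷ []) ∷ []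
whenTrue (s :< t)  = (ltForm s t ∷ []) ∷ []
whenTrue (s :≡ t)  = (leForm s t ∷ leForm t s ∷ []) ∷ []
whenTrue (φ :∧ ψ)  = conjunction (whenTrue φ) (whenTrue ψ)
whenTrue (φ :∨ ψ)  = whenTrue φ ++ whenTrue ψ
whenTrue (φ :⇒ ψ)  = whenFalse φ ++ whenTrue ψ
whenTrue :⊥        = []
whenFalse (s :≤ t) = (ltForm t s ∷ []) ∷ []
whenFalse (s :< t) = (leForm t s ∷ []) ∷ []
whenFalse (s :≡ t) = (ltForm s t ∷ []) ∷ (ltForm t s ∷ []) ∷ []
whenFalse (φ :∧ ψ) = whenFalse φ ++ whenFalse ψ
whenFalse (φ :∨ ψ) = conjunction (whenFalse φ) (whenFalse ψ)
whenFalse (φ :⇒ ψ) = conjunction (whenTrue φ) (whenFalse ψ)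
whenFalse :⊥       = [] ∷ []

leForm-sound : ∀ s t ρ → ⟦ s ⟧ₜ ρ ℤ.≤ ⟦ t ⟧ₜ ρ → NonNeg (1ℤ ∷ ρ) (leForm s t)
leForm-sound s t ρ h = subst (0ℤ ℤ.≤_) (sym (toForm-sound (t :- s) ρ)) (ℤ.i≤j⇒0≤j-i h)

ltForm-sound : ∀ s t ρ → ⟦ s ⟧ₜ ρ ℤ.< ⟦ t ⟧ₜ ρ → NonNeg (1ℤ ∷ ρ) (ltForm s t)
ltForm-sound s t ρ h =
  subst (0ℤ ℤ.≤_) (sym (toForm-sound (t :- (const 1ℤ :+ s)) ρ)) (ℤ.i≤j⇒0≤j-i (ℤ.i<j⇒suc[i]≤j h))

-- Formulas are decidable at given values, so the classical reading of implication in `whenTrue` and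
-- `whenFalse` is sound, and a single induction covers both normal forms.
decideFormula : ∀ φ ρ → (⟦ φ ⟧ ρ × Holds ρ (whenTrue φ)) ⊎ (¬ ⟦ φ ⟧ ρ × Holds ρ (whenFalse φ))
decideFormula (s :≤ t) ρ with ⟦ s ⟧ₜ ρ ℤ.≤? ⟦ t ⟧ₜ ρ
... | yes h = inj₁ (h , here (leForm-sound s t ρ h ∷ []))
... | no h  = inj₂ (h , here (ltForm-sound t s ρ (ℤ.≰⇒> h) ∷ []))
decideFormula (s :< t) ρ with ⟦ s ⟧ₜ ρ ℤ.<? ⟦ t ⟧ₜ ρ
... | yes h = inj₁ (h , here (ltForm-sound s t ρ h ∷ []))
... | no h  = inj₂ (h , here (leForm-sound t s ρ (ℤ.≮⇒≥ h) ∷ []))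
decideFormula (s :≡ t) ρ with ℤ.<-cmp (⟦ s ⟧ₜ ρ) (⟦ t ⟧ₜ ρ)
... | tri< h ≢ _ = inj₂ (≢ , here (ltForm-sound s t ρ h ∷ []))
... | tri≈ _ h _ = inj₁ (h , here (leForm-sound s t ρ (ℤ.≤-reflexive h)
                                 ∷ leForm-sound t s ρ (ℤ.≤-reflexive (sym h)) ∷ []))
... | tri> _ ≢ h = inj₂ (≢ , there (here (ltForm-sound t s ρ h ∷ [])))
decideFormula (φ :∧ ψ) ρ with decideFormula φ ρ | decideFormula ψ ρ
... | inj₁ (h , p) | inj₁ (k , q) = inj₁ ((h , k) , conjunction-sound p q)
... | inj₁ _       | inj₂ (k , q) = inj₂ ((λ hk → k (proj₂ hk)) , Any.++⁺ʳ (whenFalse φ) q)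
... | inj₂ (h , p) | _            = inj₂ ((λ hk → h (proj₁ hk)) , Any.++⁺ˡ p)
decideFormula (φ :∨ ψ) ρ with decideFormula φ ρ | decideFormula ψ ρ
... | inj₁ (h , p) | _            = inj₁ (inj₁ h , Any.++⁺ˡ p)
... | inj₂ _       | inj₁ (k , q) = inj₁ (inj₂ k , Any.++⁺ʳ (whenTrue φ) q)
... | inj₂ (h , p) | inj₂ (k , q) = inj₂ ((λ { (inj₁ x) → h x ; (inj₂ y) → k y }) , conjunction-sound p q)
decideFormula (φ :⇒ ψ) ρ with decideFormula φ ρ | decideFormula ψ ρ
... | inj₂ (h , p) | _            = inj₁ ((λ x → ⊥-elim (h x)) , Any.++⁺ˡ p)
... | inj₁ _       | inj₁ (k , q) = inj₁ ((λ _ → k) , Any.++⁺ʳ (whenFalse φ) q)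
... | inj₁ (h , p) | inj₂ (k , q) = inj₂ ((λ f → k (f h)) , conjunction-sound p q)
decideFormula :⊥ ρ = inj₂ (id , here [])

refuteAll : DNF → Bool
refuteAll []       = true
refuteAll (c ∷ cs) = refute 20 (prune c) ∧ refuteAll cs

refuteAll-sound : ∀ cs ρ → refuteAll cs ≡ true → ¬ Holds ρ cs
refuteAll-sound (c ∷ cs) ρ e (here h)  =
  refute-sound 20 (prune c) ρ (proj₁ (∧-split (refute 20 (prune c)) e)) (prune-sound h)
refuteAll-sound (c ∷ cs) ρ e (there h) =
  refuteAll-sound cs ρ (proj₂ (∧-split (refute 20 (prune c)) e)) h

-- The negation of φ is put into disjunctive normal form and every disjunct is refuted. This
-- involves only the formula and never the values in ρ, so `refl` proves the equation even when ρ
-- contains variables.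
linear : ∀ φ → refuteAll (whenFalse φ) ≡ true → ∀ ρ → ⟦ φ ⟧ ρ
linear φ e ρ with decideFormula φ ρ
... | inj₁ (h , _) = h
... | inj₂ (_ , h) = ⊥-elim (refuteAll-sound (whenFalse φ) ρ e h)

-- Generating series

Seq : Set
Seq = ℕ → ℤ

shift : Seq → Seq
shift f zero    = 0ℤ
shift f (suc m) = f m

mulPoly : List ℤ → List ℤ → List ℤ
mulPoly []      q = []
mulPoly (c ∷ p) q = addForm (scaleForm c q) (0ℤ ∷ mulPoly p q)

1-x [1-x]³ : List ℤ
1-x    = 1ℤ ∷ -1ℤ ∷ []
[1-x]³ = mulPoly 1-x (mulPoly 1-x 1-x)

shift-cong : ∀ {f g} → f ≗ g → shift f ≗ shift g
shift-cong e zero    = refl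
shift-cong e (suc m) = e m

infixr 6 _▹_

opaque
  -- A polynomial in x, constant coefficient first, acting on sequences; x acts as the shift.
  _▹_ : List ℤ → Seq → Seq
  ([]      ▹ f) m = 0ℤ
  ((c ∷ p) ▹ f) m = c ℤ.* f m ℤ.+ shift (p ▹ f) m

  ▹-cong : ∀ p {f g} → f ≗ g → p ▹ f ≗ p ▹ g
  ▹-cong []      e m = refl
  ▹-cong (c ∷ p) e m = cong₂ ℤ._+_ (cong (c ℤ.*_) (e m)) (shift-cong (▹-cong p e) m)

  ▹-add : ∀ p q f m → (addForm p q ▹ f) m ≡ (p ▹ f) m ℤ.+ (q ▹ f) m
  ▹-add []      q       f m = sym (ℤ.+-identityˡ _)
  ▹-add (a ∷ p) []      f m = sym (ℤ.+-identityʳ _)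
  ▹-add (a ∷ p) (b ∷ q) f m =
    trans (cong (λ z → (a ℤ.+ b) ℤ.* f m ℤ.+ z) (shifted m))
          (regroup a b (f m) (shift (p ▹ f) m) (shift (q ▹ f) m))
    where
    shifted : ∀ m → shift (addForm p q ▹ f) m ≡ shift (p ▹ f) m ℤ.+ shift (q ▹ f) m
    shifted zero    = refl
    shifted (suc m) = ▹-add p q f m
    regroup : ∀ a b x y z → (a ℤ.+ b) ℤ.* x ℤ.+ (y ℤ.+ z) ≡ (a ℤ.* x ℤ.+ y) ℤ.+ (b ℤ.* x ℤ.+ z)
    regroup = ℤSolver.solve-∀

  ▹-scale : ∀ c p f m → (scaleForm c p ▹ f) m ≡ c ℤ.* (p ▹ f) m
  ▹-scale c []      f m = sym (ℤ.*-zeroʳ c)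
  ▹-scale c (a ∷ p) f m =
    trans (cong (λ z → c ℤ.* a ℤ.* f m ℤ.+ z) (shifted m)) (regroup c a (f m) (shift (p ▹ f) m))
    where
    shifted : ∀ m → shift (scaleForm c p ▹ f) m ≡ c ℤ.* shift (p ▹ f) m
    shifted zero    = sym (ℤ.*-zeroʳ c)
    shifted (suc m) = ▹-scale c p f m
    regroup : ∀ c a x y → c ℤ.* a ℤ.* x ℤ.+ c ℤ.* y ≡ c ℤ.* (a ℤ.* x ℤ.+ y)
    regroup = ℤSolver.solve-∀

  ▹-mul : ∀ p q f → mulPoly p q ▹ f ≗ p ▹ q ▹ f
  ▹-mul []      q f m = refl
  ▹-mul (c ∷ p) q f m =
    trans (▹-add (scaleForm c q) (0ℤ ∷ mulPoly p q) f m)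
          (cong₂ ℤ._+_ (▹-scale c q f m)
            (trans (ℤ.+-identityˡ _) (shift-cong (▹-mul p q f) m)))

  ▹-allZero : ∀ p f m → allZero p ≡ true → (p ▹ f) m ≡ 0ℤ
  ▹-allZero []           f m       e = refl
  ▹-allZero (+ zero ∷ p) f zero    e = refl
  ▹-allZero (+ zero ∷ p) f (suc m) e = trans (ℤ.+-identityˡ _) (▹-allZero p f m e)

  ▹-plus : ∀ p f g m → (p ▹ (λ n → f n ℤ.+ g n)) m ≡ (p ▹ f) m ℤ.+ (p ▹ g) m
  ▹-plus []      f g m = refl
  ▹-plus (c ∷ p) f g m =
    trans (cong (λ z → c ℤ.* (f m ℤ.+ g m) ℤ.+ z) (shifted m))
          (regroup c (f m) (g m) (shift (p ▹ f) m) (shift (p ▹ g) m))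
    where
    shifted : ∀ m → shift (p ▹ (λ n → f n ℤ.+ g n)) m ≡ shift (p ▹ f) m ℤ.+ shift (p ▹ g) m
    shifted zero    = refl
    shifted (suc m) = ▹-plus p f g m
    regroup : ∀ c x y z w → c ℤ.* (x ℤ.+ y) ℤ.+ (z ℤ.+ w) ≡ (c ℤ.* x ℤ.+ z) ℤ.+ (c ℤ.* y ℤ.+ w)
    regroup = ℤSolver.solve-∀

  ▹-zero : ∀ p m → (p ▹ (λ _ → 0ℤ)) m ≡ 0ℤ
  ▹-zero []      m       = refl
  ▹-zero (c ∷ p) zero    = trans (ℤ.+-identityʳ _) (ℤ.*-zeroʳ c)
  ▹-zero (c ∷ p) (suc m) = trans (cong₂ ℤ._+_ (ℤ.*-zeroʳ c) (▹-zero p m)) refl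

  ▹-multiple : ∀ p c f m → (p ▹ (λ n → c ℤ.* f n)) m ≡ c ℤ.* (p ▹ f) m
  ▹-multiple []      c f m = sym (ℤ.*-zeroʳ c)
  ▹-multiple (a ∷ p) c f m =
    trans (cong (λ z → a ℤ.* (c ℤ.* f m) ℤ.+ z) (shifted m)) (regroup a c (f m) (shift (p ▹ f) m))
    where
    shifted : ∀ m → shift (p ▹ (λ n → c ℤ.* f n)) m ≡ c ℤ.* shift (p ▹ f) m
    shifted zero    = sym (ℤ.*-zeroʳ c)
    shifted (suc m) = ▹-multiple p c f m
    regroup : ∀ a c x y → a ℤ.* (c ℤ.* x) ℤ.+ c ℤ.* y ≡ c ℤ.* (a ℤ.* x ℤ.+ y)
    regroup = ℤSolver.solve-∀

  ▹-shift : ∀ p f → p ▹ shift f ≗ shift (p ▹ f)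
  ▹-shift []      f zero          = refl
  ▹-shift []      f (suc m)       = refl
  ▹-shift (c ∷ p) f zero          = trans (ℤ.+-identityʳ _) (ℤ.*-zeroʳ c)
  ▹-shift (c ∷ p) f (suc m)       = cong (λ z → c ℤ.* f m ℤ.+ z) (▹-shift p f m)

  ▹-commute : ∀ p q f → p ▹ q ▹ f ≗ q ▹ p ▹ f
  ▹-commute []      q f m = sym (▹-zero q m)
  ▹-commute (c ∷ p) q f m = sym
    (trans (▹-plus q (λ n → c ℤ.* f n) (shift (p ▹ f)) m)
           (cong₂ ℤ._+_ (▹-multiple q c f m)
                        (trans (▹-shift q (p ▹ f) m) (shift-cong (λ n → sym (▹-commute p q f n)) m))))

  1-x-suc : ∀ f m → (1-x ▹ f) (suc m) ≡ f (suc m) ℤ.- f m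
  1-x-suc f zero    = regroup (f 1) (f 0)
    where
    regroup : ∀ x y → 1ℤ ℤ.* x ℤ.+ (-1ℤ ℤ.* y ℤ.+ 0ℤ) ≡ x ℤ.- y
    regroup = ℤSolver.solve-∀
  1-x-suc f (suc m) = regroup (f (suc (suc m))) (f (suc m))
    where
    regroup : ∀ x y → 1ℤ ℤ.* x ℤ.+ (-1ℤ ℤ.* y ℤ.+ 0ℤ) ≡ x ℤ.- y
    regroup = ℤSolver.solve-∀

  -- A sequence is recovered from its first value and its differences, so 1 - x is not a zero
  -- divisor.
  1-x-cancel : ∀ {f g} → 1-x ▹ f ≗ 1-x ▹ g → f ≗ g
  1-x-cancel {f} {g} e zero = trans (sym (simple (f 0))) (trans (e 0) (simple (g 0)))
    where
    simple : ∀ x → 1ℤ ℤ.* x ℤ.+ 0ℤ ≡ x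
    simple = ℤSolver.solve-∀
  1-x-cancel {f} {g} e (suc m) = begin
    f (suc m)                       ≡⟨ split (f (suc m)) (f m) ⟩
    (f (suc m) ℤ.- f m) ℤ.+ f m     ≡⟨ cong₂ ℤ._+_ step (1-x-cancel {f} {g} e m) ⟩
    (g (suc m) ℤ.- g m) ℤ.+ g m     ≡⟨ sym (split (g (suc m)) (g m)) ⟩
    g (suc m)                       ∎
    where
    open ≡-Reasoning
    split : ∀ x y → x ≡ (x ℤ.- y) ℤ.+ y
    split = ℤSolver.solve-∀
    step : f (suc m) ℤ.- f m ≡ g (suc m) ℤ.- g m
    step = trans (sym (1-x-suc f m)) (trans (e (suc m)) (1-x-suc g m))

[1-x]³-action : ∀ f → [1-x]³ ▹ f ≗ 1-x ▹ 1-x ▹ 1-x ▹ f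
[1-x]³-action f m = trans (▹-mul 1-x (mulPoly 1-x 1-x) f m) (▹-cong 1-x (▹-mul 1-x 1-x f) m)

[1-x]³-cancel : ∀ {f g} → [1-x]³ ▹ f ≗ [1-x]³ ▹ g → f ≗ g
[1-x]³-cancel {f} {g} e = 1-x-cancel (1-x-cancel (1-x-cancel
  (λ m → trans (sym ([1-x]³-action f m)) (trans (e m) ([1-x]³-action g m)))))

-- T f is the generating series Σ_k x^(k+1) f_k.
T : (ℕ → Seq) → Seq
T f zero    = 0ℤ
T f (suc m) = f 0 m ℤ.+ T (f ∘ suc) m

T-cong : ∀ {f g : ℕ → Seq} → (∀ k m → f k m ≡ g k m) → T f ≗ T g
T-cong e zero    = refl
T-cong e (suc m) = cong₂ ℤ._+_ (e 0 m) (T-cong (e ∘ suc) m)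

-- The factor x^(k+1) costs at least one power of x, so only indices below `m` matter. Recursion on
-- the number of cells rests on this.
T-cong< : ∀ {f g : ℕ → Seq} m → (∀ k n → n ℕ.< m → f k n ≡ g k n) → T f m ≡ T g m
T-cong< zero    e = refl
T-cong< (suc m) e = cong₂ ℤ._+_ (e 0 m ℕ.≤-refl)
  (T-cong< m (λ k n n<m → e (suc k) n (ℕ.m≤n⇒m≤1+n n<m)))

T-plus : ∀ f g m → T (λ k n → f k n ℤ.+ g k n) m ≡ T f m ℤ.+ T g m
T-plus f g zero    = refl
T-plus f g (suc m) =
  trans (cong (λ z → f 0 m ℤ.+ g 0 m ℤ.+ z) (T-plus (f ∘ suc) (g ∘ suc) m))
        (regroup (f 0 m) (g 0 m) (T (f ∘ suc) m) (T (g ∘ suc) m))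
  where
  regroup : ∀ x y z w → x ℤ.+ y ℤ.+ (z ℤ.+ w) ≡ (x ℤ.+ z) ℤ.+ (y ℤ.+ w)
  regroup = ℤSolver.solve-∀

T-multiple : ∀ c f m → T (λ k n → c ℤ.* f k n) m ≡ c ℤ.* T f m
T-multiple c f zero    = sym (ℤ.*-zeroʳ c)
T-multiple c f (suc m) = trans (cong (λ z → c ℤ.* f 0 m ℤ.+ z) (T-multiple c (f ∘ suc) m))
                               (sym (ℤ.*-distribˡ-+ c (f 0 m) (T (f ∘ suc) m)))

T-zero : ∀ m → T (λ _ _ → 0ℤ) m ≡ 0ℤ
T-zero zero    = refl
T-zero (suc m) = trans (ℤ.+-identityˡ _) (T-zero m)

sumOver : ∀ {A : Set} → List A → (A → ℤ) → ℤ
sumOver []       F = 0ℤ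
sumOver (x ∷ xs) F = F x ℤ.+ sumOver xs F

sumOver-cong : ∀ {A : Set} (xs : List A) {F G : A → ℤ} → F ≗ G → sumOver xs F ≡ sumOver xs G
sumOver-cong []       e = refl
sumOver-cong (x ∷ xs) e = cong₂ ℤ._+_ (e x) (sumOver-cong xs e)

sumOver-zero : ∀ {A : Set} (xs : List A) {F : A → ℤ} → (∀ x → F x ≡ 0ℤ) → sumOver xs F ≡ 0ℤ
sumOver-zero []       e = refl
sumOver-zero (x ∷ xs) e = cong₂ ℤ._+_ (e x) (sumOver-zero xs e)

sumOver-plus : ∀ {A : Set} (xs : List A) (F G : A → ℤ) →
               sumOver xs (λ x → F x ℤ.+ G x) ≡ sumOver xs F ℤ.+ sumOver xs G
sumOver-plus []       F G = refl
sumOver-plus (x ∷ xs) F G = trans (cong (λ z → F x ℤ.+ G x ℤ.+ z) (sumOver-plus xs F G))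
                                  (regroup (F x) (G x) (sumOver xs F) (sumOver xs G))
  where
  regroup : ∀ x y z w → x ℤ.+ y ℤ.+ (z ℤ.+ w) ≡ (x ℤ.+ z) ℤ.+ (y ℤ.+ w)
  regroup = ℤSolver.solve-∀

sumOver-multiple : ∀ {A : Set} c (xs : List A) (F : A → ℤ) →
                   sumOver xs (λ x → c ℤ.* F x) ≡ c ℤ.* sumOver xs F
sumOver-multiple c []       F = sym (ℤ.*-zeroʳ c)
sumOver-multiple c (x ∷ xs) F = trans (cong (λ z → c ℤ.* F x ℤ.+ z) (sumOver-multiple c xs F))
                                      (sym (ℤ.*-distribˡ-+ c (F x) (sumOver xs F)))

sumOver-swap : ∀ {A B : Set} (xs : List A) (ys : List B) (F : A → B → ℤ) →
               sumOver xs (λ x → sumOver ys (F x)) ≡ sumOver ys (λ y → sumOver xs (λ x → F x y))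
sumOver-swap []       ys F = sym (sumOver-zero ys (λ _ → refl))
sumOver-swap (x ∷ xs) ys F =
  trans (cong (λ z → sumOver ys (F x) ℤ.+ z) (sumOver-swap xs ys F))
        (sym (sumOver-plus ys (F x) (λ y → sumOver xs (λ x → F x y))))

T-sumOver : ∀ {A : Set} (xs : List A) (F : A → ℕ → Seq) m →
            T (λ k n → sumOver xs (λ x → F x k n)) m ≡ sumOver xs (λ x → T (F x) m)
T-sumOver []       F m = T-zero m
T-sumOver (x ∷ xs) F m =
  trans (T-plus (F x) (λ k n → sumOver xs (λ x → F x k n)) m)
        (cong (λ z → T (F x) m ℤ.+ z) (T-sumOver xs F m))

opaque
  unfolding _▹_

  ▹-sumOver : ∀ {A : Set} p (xs : List A) (F : A → Seq) m →
              (p ▹ (λ n → sumOver xs (λ x → F x n))) m ≡ sumOver xs (λ x → (p ▹ F x) m)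
  ▹-sumOver p []       F m = ▹-zero p m
  ▹-sumOver p (x ∷ xs) F m =
    trans (▹-plus p (F x) (λ n → sumOver xs (λ x → F x n)) m)
          (cong (λ z → (p ▹ F x) m ℤ.+ z) (▹-sumOver p xs F m))

sumPolys : ∀ {A : Set} → List A → (A → List ℤ) → List ℤ
sumPolys []       P = []
sumPolys (x ∷ xs) P = addForm (P x) (sumPolys xs P)

opaque
  unfolding _▹_

  sumPolys-▹ : ∀ {A : Set} (xs : List A) P f m →
               (sumPolys xs P ▹ f) m ≡ sumOver xs (λ x → (P x ▹ f) m)
  sumPolys-▹ []       P f m = refl
  sumPolys-▹ (x ∷ xs) P f m = trans (▹-add (P x) (sumPolys xs P) f m)
    (cong (λ z → (P x ▹ f) m ℤ.+ z) (sumPolys-▹ xs P f m))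

-- These are the coefficients of (1 - x) Σ φ(k) xᵏ, which is why the value at 0 is kept.
diff : (ℕ → ℤ) → ℕ → ℤ
diff φ zero    = φ zero
diff φ (suc k) = φ (suc k) ℤ.- φ k

opaque
  unfolding _▹_

  -- Here `T` is the Cauchy product of x Σ φ(k) xᵏ with the series of `v`, so the factor 1 - x can
  -- be moved onto φ.
  1-x-T : ∀ φ (v : Seq) → 1-x ▹ T (λ k n → φ k ℤ.* v n) ≗ T (λ k n → diff φ k ℤ.* v n)
  1-x-T φ v zero    = refl
  1-x-T φ v (suc m) = begin
    (1-x ▹ T (λ k n → φ k ℤ.* v n)) (suc m)
      ≡⟨ 1-x-suc (T (λ k n → φ k ℤ.* v n)) m ⟩
    φ 0 ℤ.* v m ℤ.+ T (λ k n → φ (suc k) ℤ.* v n) m ℤ.- T (λ k n → φ k ℤ.* v n) m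
      ≡⟨ regroup (φ 0 ℤ.* v m) (T (λ k n → φ (suc k) ℤ.* v n) m) (T (λ k n → φ k ℤ.* v n) m) ⟩
    φ 0 ℤ.* v m ℤ.+ (T (λ k n → φ (suc k) ℤ.* v n) m ℤ.+ -1ℤ ℤ.* T (λ k n → φ k ℤ.* v n) m)
      ≡⟨ cong (λ z → φ 0 ℤ.* v m ℤ.+ z) (sym combined) ⟩
    φ 0 ℤ.* v m ℤ.+ T (λ k n → (φ (suc k) ℤ.- φ k) ℤ.* v n) m ∎
    where
    open ≡-Reasoning
    regroup : ∀ x y z → x ℤ.+ y ℤ.- z ≡ x ℤ.+ (y ℤ.+ -1ℤ ℤ.* z)
    regroup = ℤSolver.solve-∀
    expand : ∀ x y w → (x ℤ.- y) ℤ.* w ≡ x ℤ.* w ℤ.+ -1ℤ ℤ.* (y ℤ.* w)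
    expand = ℤSolver.solve-∀
    combined : T (λ k n → (φ (suc k) ℤ.- φ k) ℤ.* v n) m ≡
               T (λ k n → φ (suc k) ℤ.* v n) m ℤ.+ -1ℤ ℤ.* T (λ k n → φ k ℤ.* v n) m
    combined = begin
      T (λ k n → (φ (suc k) ℤ.- φ k) ℤ.* v n) m
        ≡⟨ T-cong (λ k n → expand (φ (suc k)) (φ k) (v n)) m ⟩
      T (λ k n → φ (suc k) ℤ.* v n ℤ.+ -1ℤ ℤ.* (φ k ℤ.* v n)) m
        ≡⟨ T-plus (λ k n → φ (suc k) ℤ.* v n) (λ k n → -1ℤ ℤ.* (φ k ℤ.* v n)) m ⟩
      T (λ k n → φ (suc k) ℤ.* v n) m ℤ.+ T (λ k n → -1ℤ ℤ.* (φ k ℤ.* v n)) m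
        ≡⟨ cong (λ z → T (λ k n → φ (suc k) ℤ.* v n) m ℤ.+ z) (T-multiple -1ℤ (λ k n → φ k ℤ.* v n) m) ⟩
      T (λ k n → φ (suc k) ℤ.* v n) m ℤ.+ -1ℤ ℤ.* T (λ k n → φ k ℤ.* v n) m ∎

diff³ : (ℕ → ℤ) → ℕ → ℤ
diff³ φ = diff (diff (diff φ))

[1-x]³-T : ∀ φ (v : Seq) → [1-x]³ ▹ T (λ k n → φ k ℤ.* v n) ≗ T (λ k n → diff³ φ k ℤ.* v n)
[1-x]³-T φ v m =
  trans ([1-x]³-action (T (λ k n → φ k ℤ.* v n)) m)
 (trans (▹-cong 1-x {1-x ▹ 1-x ▹ T (λ k n → φ k ℤ.* v n)} (▹-cong 1-x (1-x-T φ v)) m)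
 (trans (▹-cong 1-x (1-x-T (diff φ) v) m) (1-x-T (diff (diff φ)) v m)))

firsts : ℕ → (ℕ → ℤ) → List ℤ
firsts zero    φ = []
firsts (suc l) φ = φ 0 ∷ firsts l (φ ∘ suc)

opaque
  unfolding _▹_

  T-finite : ∀ l φ (v : Seq) → (∀ k → φ (l ℕ.+ k) ≡ 0ℤ) → T (λ k n → φ k ℤ.* v n) ≗ (0ℤ ∷ firsts l φ) ▹ v
  T-finite l φ v z zero    = refl
  T-finite zero φ v z (suc m) =
    trans (T-cong {g = λ _ _ → 0ℤ} (λ k n → cong (ℤ._* v n) (z k)) (suc m)) (T-zero (suc m))
  T-finite (suc l) φ v z (suc m) =
    trans (cong (λ w → φ 0 ℤ.* v m ℤ.+ w) (trans (T-finite l (φ ∘ suc) v z m) (ℤ.+-identityˡ _)))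
          (sym (ℤ.+-identityˡ _))

-- The exceptional arguments below 4 leave room for the indicators of lengths 1 and 2 and for
-- subtractions truncated at most at 2.
record EventuallyQuadratic (φ : ℕ → ℤ) : Set where
  constructor quadratic
  field
    a b c : ℤ
    eventually : ∀ k → φ (4 ℕ.+ k) ≡ a ℤ.+ b ℤ.* + k ℤ.+ c ℤ.* (+ k ℤ.* + k)

-- The third difference at 8 + k involves φ only at arguments from 5 on, inside the quadratic range.
diff³-quadratic : ∀ {φ} → EventuallyQuadratic φ → ∀ k → diff³ φ (8 ℕ.+ k) ≡ 0ℤ
diff³-quadratic {φ} (quadratic a b c e) k
  rewrite e (4 ℕ.+ k) | e (3 ℕ.+ k) | e (2 ℕ.+ k) | e (1 ℕ.+ k) = vanish a b c (+ k)
  where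
  vanish : ∀ a b c x →
    let q = λ i → a ℤ.+ b ℤ.* (+ i ℤ.+ x) ℤ.+ c ℤ.* ((+ i ℤ.+ x) ℤ.* (+ i ℤ.+ x)) in
    ((q 4 ℤ.- q 3) ℤ.- (q 3 ℤ.- q 2)) ℤ.- ((q 3 ℤ.- q 2) ℤ.- (q 2 ℤ.- q 1)) ≡ 0ℤ
  vanish = ℤSolver.solve-∀

-- The numerator of Σ_k φ(k) x^(k+1) over (1 - x)³.
gf : (ℕ → ℤ) → List ℤ
gf φ = 0ℤ ∷ firsts 8 (diff³ φ)

gf-correct : ∀ {φ} → EventuallyQuadratic φ → ∀ (v : Seq) → [1-x]³ ▹ T (λ k n → φ k ℤ.* v n) ≗ gf φ ▹ v
gf-correct {φ} q v m =
  trans ([1-x]³-T φ v m) (T-finite 8 (diff³ φ) v (diff³-quadratic {φ} q) m)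

-- The linear system for the features

-- Weights of a run of k + 1 cells: 1, its length, and the indicators of lengths 1 and 2.
data Weight : Set where
  unit extent length₁ length₂ : Weight

weight : Weight → ℕ → ℤ
weight unit   k             = 1ℤ
weight extent   k             = + suc k
weight length₁  zero          = 1ℤ
weight length₁  (suc _)       = 0ℤ
weight length₂ (suc zero)    = 1ℤ
weight length₂ _             = 0ℤ

-- `empty` accounts for stopping after the current column; the other features describe a next column
-- with one component, or with two components and a given gap.
data Feature : Set where
  empty : Feature
  one   : Weight → Feature
  two   : Fin 3 → Weight → Weight → Feature

weights : List Weight
weights = unit ∷ extent ∷ length₁ ∷ length₂ ∷ []

-- `extent` does not occur: for a next column with two components the binding constraints concern
-- the top of the lower and the bottom of the upper one, whose distance is fixed by the gap. The
-- lengths matter only through the possibility of being trapped, and at most one component can be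
-- trapped at a time.
weightPairs : List (Weight × Weight)
weightPairs = (unit , unit) ∷ (length₁ , unit) ∷ (length₂ , unit) ∷ (unit , length₁) ∷ (unit , length₂) ∷ []

gaps : List (Fin 3)
gaps = 0F ∷ 1F ∷ 2F ∷ []

features : List Feature
features = empty ∷ map one weights ++ concatMap (λ h → map (λ (p , q) → two h p q) weightPairs) gaps

-- In a placement of a two-component column next to a two-component column,
-- a component of i + 1 cells can lie inside a gap of g + 1 cells in g ∸ i ways,
-- h ∸ b of which put the other component beyond the far run of b + 1 cells.
trapped : Fin 3 → ℕ → Fin 3 → ℕ → ℤ
trapped g b h i = + ((toℕ g ℕ.∸ i) ℕ.∸ (toℕ h ℕ.∸ b))

coefficient₁ : Feature → ℕ → ℤ
coefficient₁ empty             k = 1ℤ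
coefficient₁ (one unit)        k = + suc k
coefficient₁ (one extent)        k = 1ℤ
coefficient₁ (two h unit unit) k = + (k ℕ.∸ toℕ h)
coefficient₁ _                 k = 0ℤ

-- The coefficient of a feature for the column with runs of a + 1 and b + 1
-- cells is the sum of a part depending on a and a part depending on b.
lowerCoefficient upperCoefficient : Fin 3 → Feature → ℕ → ℤ
lowerCoefficient g empty               a = 1ℤ
lowerCoefficient g (one unit)          a = + (3 ℕ.+ toℕ g ℕ.+ a)
lowerCoefficient g (one extent)          a = 1ℤ
lowerCoefficient g (one length₁)         a = ℤ.- + toℕ g
lowerCoefficient g (one length₂)        a = ℤ.- + (toℕ g ℕ.∸ 1)
lowerCoefficient g (two h unit unit)   a = + (2 ℕ.+ toℕ g ℕ.+ a) ℤ.- + toℕ h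
lowerCoefficient g (two h unit length₁)  a = ℤ.- trapped g a h 0
lowerCoefficient g (two h unit length₂) a = ℤ.- trapped g a h 1
lowerCoefficient g _                   a = 0ℤ
upperCoefficient g (one unit)          b = + b
upperCoefficient g (two h unit unit)   b = + b
upperCoefficient g (two h length₁ unit)  b = ℤ.- trapped g b h 0
upperCoefficient g (two h length₂ unit) b = ℤ.- trapped g b h 1
upperCoefficient g _                   b = 0ℤ

record Affine (φ : ℕ → ℤ) : Set where
  constructor affine
  field
    a b : ℤ
    eventually : ∀ k → φ (4 ℕ.+ k) ≡ a ℤ.+ b ℤ.* + k

constant-affine : ∀ {φ} c → (∀ k → φ (4 ℕ.+ k) ≡ c) → Affine φ
constant-affine c e = affine c 0ℤ λ k → trans (e k) (sym (ℤ.+-identityʳ c))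

slope-affine : ∀ {φ} c → (∀ k → φ (4 ℕ.+ k) ≡ c ℤ.+ + k) → Affine φ
slope-affine c e = affine c 1ℤ λ k → trans (e k) (cong (λ z → c ℤ.+ z) (sym (ℤ.*-identityˡ (+ k))))

shifted-affine : ∀ c n {φ} → (∀ k → φ (4 ℕ.+ k) ≡ + (n ℕ.+ (4 ℕ.+ k)) ℤ.- c) → Affine φ
shifted-affine c n e = slope-affine (+ (n ℕ.+ 4) ℤ.- c) λ k →
  trans (e k) (trans (cong (λ z → + z ℤ.- c) (sym (ℕ.+-assoc n 4 k))) (regroup (+ (n ℕ.+ 4)) (+ k) c))
  where
  regroup : ∀ x y c → x ℤ.+ y ℤ.- c ≡ x ℤ.- c ℤ.+ y
  regroup = ℤSolver.solve-∀

coefficient₁-affine : ∀ f → Affine (coefficient₁ f)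
coefficient₁-affine empty               = constant-affine 1ℤ (λ _ → refl)
coefficient₁-affine (one unit)          = slope-affine (+ 5) (λ _ → refl)
coefficient₁-affine (one extent)          = constant-affine 1ℤ (λ _ → refl)
coefficient₁-affine (one length₁)         = constant-affine 0ℤ (λ _ → refl)
coefficient₁-affine (one length₂)        = constant-affine 0ℤ (λ _ → refl)
coefficient₁-affine (two 0F unit unit)  = slope-affine (+ 4) (λ _ → refl)
coefficient₁-affine (two 1F unit unit)  = slope-affine (+ 3) (λ _ → refl)
coefficient₁-affine (two 2F unit unit)  = slope-affine (+ 2) (λ _ → refl)
coefficient₁-affine (two h unit extent)   = constant-affine 0ℤ (λ _ → refl)
coefficient₁-affine (two h unit length₁)  = constant-affine 0ℤ (λ _ → refl)
coefficient₁-affine (two h unit length₂) = constant-affine 0ℤ (λ _ → refl)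
coefficient₁-affine (two h extent _)      = constant-affine 0ℤ (λ _ → refl)
coefficient₁-affine (two h length₁ _)     = constant-affine 0ℤ (λ _ → refl)
coefficient₁-affine (two h length₂ _)    = constant-affine 0ℤ (λ _ → refl)

trapped-eventually : ∀ g h i k → trapped g (4 ℕ.+ k) h i ≡ + (toℕ g ℕ.∸ i)
trapped-eventually g 0F i k = refl
trapped-eventually g 1F i k = refl
trapped-eventually g 2F i k = refl

trapped-affine : ∀ g h i → Affine (λ b → ℤ.- trapped g b h i)
trapped-affine g h i = constant-affine (ℤ.- + (toℕ g ℕ.∸ i)) (λ k → cong ℤ.-_ (trapped-eventually g h i k))

lowerCoefficient-affine : ∀ g f → Affine (lowerCoefficient g f)
lowerCoefficient-affine g empty               = constant-affine 1ℤ (λ _ → refl)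
lowerCoefficient-affine g (one unit)          =
  shifted-affine 0ℤ (3 ℕ.+ toℕ g) (λ k → sym (ℤ.+-identityʳ _))
lowerCoefficient-affine g (one extent)          = constant-affine 1ℤ (λ _ → refl)
lowerCoefficient-affine g (one length₁)         = constant-affine _ (λ _ → refl)
lowerCoefficient-affine g (one length₂)        = constant-affine _ (λ _ → refl)
lowerCoefficient-affine g (two h unit unit)   = shifted-affine (+ toℕ h) (2 ℕ.+ toℕ g) (λ k → refl)
lowerCoefficient-affine g (two h unit extent)   = constant-affine 0ℤ (λ _ → refl)
lowerCoefficient-affine g (two h unit length₁)  = trapped-affine g h 0
lowerCoefficient-affine g (two h unit length₂) = trapped-affine g h 1
lowerCoefficient-affine g (two h extent _)      = constant-affine 0ℤ (λ _ → refl)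
lowerCoefficient-affine g (two h length₁ _)     = constant-affine 0ℤ (λ _ → refl)
lowerCoefficient-affine g (two h length₂ _)    = constant-affine 0ℤ (λ _ → refl)

upperCoefficient-affine : ∀ g f → Affine (upperCoefficient g f)
upperCoefficient-affine g empty               = constant-affine 0ℤ (λ _ → refl)
upperCoefficient-affine g (one unit)          = slope-affine (+ 4) (λ _ → refl)
upperCoefficient-affine g (one extent)          = constant-affine 0ℤ (λ _ → refl)
upperCoefficient-affine g (one length₁)         = constant-affine 0ℤ (λ _ → refl)
upperCoefficient-affine g (one length₂)        = constant-affine 0ℤ (λ _ → refl)
upperCoefficient-affine g (two h unit unit)   = slope-affine (+ 4) (λ _ → refl)
upperCoefficient-affine g (two h length₁ unit)  = trapped-affine g h 0
upperCoefficient-affine g (two h length₂ unit) = trapped-affine g h 1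
upperCoefficient-affine g (two h extent unit)   = constant-affine 0ℤ (λ _ → refl)
upperCoefficient-affine g (two h unit extent)   = constant-affine 0ℤ (λ _ → refl)
upperCoefficient-affine g (two h unit length₁)  = constant-affine 0ℤ (λ _ → refl)
upperCoefficient-affine g (two h unit length₂) = constant-affine 0ℤ (λ _ → refl)
upperCoefficient-affine g (two h extent extent)   = constant-affine 0ℤ (λ _ → refl)
upperCoefficient-affine g (two h extent length₁)  = constant-affine 0ℤ (λ _ → refl)
upperCoefficient-affine g (two h extent length₂) = constant-affine 0ℤ (λ _ → refl)
upperCoefficient-affine g (two h length₁ extent)  = constant-affine 0ℤ (λ _ → refl)
upperCoefficient-affine g (two h length₁ length₁) = constant-affine 0ℤ (λ _ → refl)
upperCoefficient-affine g (two h length₁ length₂) = constant-affine 0ℤ (λ _ → refl)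
upperCoefficient-affine g (two h length₂ extent) = constant-affine 0ℤ (λ _ → refl)
upperCoefficient-affine g (two h length₂ length₁) = constant-affine 0ℤ (λ _ → refl)
upperCoefficient-affine g (two h length₂ length₂) = constant-affine 0ℤ (λ _ → refl)

weighted-quadratic : ∀ p {φ} → Affine φ → EventuallyQuadratic (λ k → weight p k ℤ.* φ k)
weighted-quadratic unit   (affine a b e) = quadratic a b 0ℤ λ k →
  trans (cong (λ z → 1ℤ ℤ.* z) (e k)) (expand a b (+ k))
  where
  expand : ∀ a b x → 1ℤ ℤ.* (a ℤ.+ b ℤ.* x) ≡ a ℤ.+ b ℤ.* x ℤ.+ 0ℤ ℤ.* (x ℤ.* x)
  expand = ℤSolver.solve-∀
weighted-quadratic extent   (affine a b e) = quadratic (+ 5 ℤ.* a) (a ℤ.+ + 5 ℤ.* b) b λ k →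
  trans (cong (λ z → (+ 5 ℤ.+ + k) ℤ.* z) (e k)) (expand a b (+ k))
  where
  expand : ∀ a b x → (+ 5 ℤ.+ x) ℤ.* (a ℤ.+ b ℤ.* x) ≡
                     + 5 ℤ.* a ℤ.+ (a ℤ.+ + 5 ℤ.* b) ℤ.* x ℤ.+ b ℤ.* (x ℤ.* x)
  expand = ℤSolver.solve-∀
weighted-quadratic length₁  _ = quadratic 0ℤ 0ℤ 0ℤ λ k → refl
weighted-quadratic length₂ _ = quadratic 0ℤ 0ℤ 0ℤ λ k → refl

weightPoly : Weight → List ℤ
weightPoly p = gf (λ k → weight p k ℤ.* 1ℤ)

-- The coefficient of `total f` in the equation for the first feature, once `pivot` has cleared the
-- denominators. The coefficient for two runs is a sum of a part in a and a part in b, so its double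
-- series is a sum of two products of single series.
row : Feature → Feature → List ℤ
row empty       f = []
row (one p)     f = gf (λ k → weight p k ℤ.* coefficient₁ f k)
row (two g p q) f =
  addForm (mulPoly (gf (λ a → weight p a ℤ.* lowerCoefficient g f a)) (weightPoly q))
          (mulPoly (weightPoly p) (gf (λ b → weight q b ℤ.* upperCoefficient g f b)))

-- A weight times an affine coefficient grows quadratically, so each run contributes a denominator
-- (1 - x)³. The series of `empty` is known, and its equation is the vacuous 0 = 0.
pivot : Feature → List ℤ
pivot empty       = []
pivot (one p)     = [1-x]³
pivot (two g p q) = mulPoly [1-x]³ [1-x]³

δ₀ : Seq
δ₀ zero    = 1ℤ
δ₀ (suc _) = 0ℤ

-- The double sum is an iterated Cauchy product; one factor (1 - x)³ clears the series of each run.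
product-gf : ∀ {φ ψ} → EventuallyQuadratic φ → EventuallyQuadratic ψ → ∀ (v : Seq) →
  mulPoly [1-x]³ [1-x]³ ▹ T (λ a → T (λ b n → φ a ℤ.* (ψ b ℤ.* v n))) ≗ mulPoly (gf φ) (gf ψ) ▹ v
product-gf {φ} {ψ} qφ qψ v n = begin
  (mulPoly [1-x]³ [1-x]³ ▹ T (λ a → T (λ b n → φ a ℤ.* (ψ b ℤ.* v n)))) n
    ≡⟨ ▹-mul [1-x]³ [1-x]³ (T (λ a → T (λ b n → φ a ℤ.* (ψ b ℤ.* v n)))) n ⟩
  ([1-x]³ ▹ [1-x]³ ▹ T (λ a → T (λ b n → φ a ℤ.* (ψ b ℤ.* v n)))) n
    ≡⟨ ▹-cong [1-x]³ (▹-cong [1-x]³ (T-cong (λ a → T-multiple (φ a) (λ b n → ψ b ℤ.* v n)))) n ⟩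
  ([1-x]³ ▹ [1-x]³ ▹ T (λ a n → φ a ℤ.* T (λ b n → ψ b ℤ.* v n) n)) n
    ≡⟨ ▹-cong [1-x]³ (gf-correct qφ (T (λ b n → ψ b ℤ.* v n))) n ⟩
  ([1-x]³ ▹ gf φ ▹ T (λ b n → ψ b ℤ.* v n)) n
    ≡⟨ ▹-commute [1-x]³ (gf φ) (T (λ b n → ψ b ℤ.* v n)) n ⟩
  (gf φ ▹ [1-x]³ ▹ T (λ b n → ψ b ℤ.* v n)) n
    ≡⟨ ▹-cong (gf φ) (gf-correct qψ v) n ⟩
  (gf φ ▹ gf ψ ▹ v) n
    ≡⟨ sym (▹-mul (gf φ) (gf ψ) v n) ⟩
  (mulPoly (gf φ) (gf ψ) ▹ v) n ∎
  where open ≡-Reasoning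

▹-plus′ : ∀ p {f g h} → (∀ n → f n ≡ g n ℤ.+ h n) → ∀ n → (p ▹ f) n ≡ (p ▹ g) n ℤ.+ (p ▹ h) n
▹-plus′ p {f} {g} {h} e n = trans (▹-cong p e n) (▹-plus p g h n)

expand-▹ : ∀ {A : Set} p (xs : List A) {g : Seq} (F : A → Seq) (q : A → List ℤ) (s : A → Seq) →
           (∀ n → g n ≡ sumOver xs (λ x → F x n)) →
           (∀ x n → (p ▹ F x) n ≡ (q x ▹ s x) n) →
           ∀ n → (p ▹ g) n ≡ sumOver xs (λ x → (q x ▹ s x) n)
expand-▹ p xs F q s e h n = trans (▹-cong p e n)
  (trans (▹-sumOver p xs F n) (sumOver-cong xs (λ x → h x n)))

module Renewal (u : ℕ → Seq) (t : Fin 3 → ℕ → ℕ → Seq) where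

  -- The total, over all possible next columns, of weight times number of
  -- continuations, by the number of cells from that column on.
  total : Feature → Seq
  total empty       = δ₀
  total (one p)     = T (λ k n → weight p k ℤ.* u k n)
  total (two g p q) = T (λ a → T (λ b n → weight p a ℤ.* weight q b ℤ.* t g a b n))

  module _
    (u-expansion : ∀ k n → u k n ≡ sumOver features (λ f → coefficient₁ f k ℤ.* total f n))
    (t-expansion : ∀ g a b n → t g a b n ≡
      sumOver features (λ f → (lowerCoefficient g f a ℤ.+ upperCoefficient g f b) ℤ.* total f n))
    where

    row-one : ∀ p n → (pivot (one p) ▹ total (one p)) n ≡
                      sumOver features (λ f → (row (one p) f ▹ total f) n)
    row-one p = expand-▹ [1-x]³ features part (row (one p)) total expanded
      (λ f → gf-correct (weighted-quadratic p (coefficient₁-affine f)) (total f))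
      where
      part : Feature → Seq
      part f = T (λ k n → weight p k ℤ.* coefficient₁ f k ℤ.* total f n)
      distribute : ∀ k n → weight p k ℤ.* u k n ≡
                   sumOver features (λ f → weight p k ℤ.* coefficient₁ f k ℤ.* total f n)
      distribute k n = trans (cong (λ z → weight p k ℤ.* z) (u-expansion k n))
        (trans (sym (sumOver-multiple (weight p k) features (λ f → coefficient₁ f k ℤ.* total f n)))
               (sumOver-cong features (λ f → sym (ℤ.*-assoc (weight p k) (coefficient₁ f k) (total f n)))))
      expanded : ∀ n → total (one p) n ≡ sumOver features (λ f → part f n)
      expanded n = trans (T-cong distribute n)
        (T-sumOver features (λ f k n → weight p k ℤ.* coefficient₁ f k ℤ.* total f n) n)

    row-two : ∀ g p q n → (pivot (two g p q) ▹ total (two g p q)) n ≡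
                          sumOver features (λ f → (row (two g p q) f ▹ total f) n)
    row-two g p q = expand-▹ (mulPoly [1-x]³ [1-x]³) features (λ f → T (λ a → T (part f a)))
                             (row (two g p q)) total expanded each
      where
      lower upper lower′ upper′ : Feature → ℕ → ℤ
      lower  f a = weight p a ℤ.* lowerCoefficient g f a
      lower′ f a = weight p a ℤ.* 1ℤ
      upper  f b = weight q b ℤ.* upperCoefficient g f b
      upper′ f b = weight q b ℤ.* 1ℤ
      part₁ part₂ part : Feature → ℕ → ℕ → Seq
      part₁ f a b n = lower f a ℤ.* (upper′ f b ℤ.* total f n)
      part₂ f a b n = lower′ f a ℤ.* (upper f b ℤ.* total f n)
      part f a b n  = part₁ f a b n ℤ.+ part₂ f a b n
      split : ∀ w z x y s → w ℤ.* z ℤ.* ((x ℤ.+ y) ℤ.* s) ≡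
              w ℤ.* x ℤ.* (z ℤ.* 1ℤ ℤ.* s) ℤ.+ w ℤ.* 1ℤ ℤ.* (z ℤ.* y ℤ.* s)
      split = ℤSolver.solve-∀
      distribute : ∀ a b n → weight p a ℤ.* weight q b ℤ.* t g a b n ≡ sumOver features (λ f → part f a b n)
      distribute a b n = trans (cong (λ z → weight p a ℤ.* weight q b ℤ.* z) (t-expansion g a b n))
        (trans (sym (sumOver-multiple (weight p a ℤ.* weight q b) features
                 (λ f → (lowerCoefficient g f a ℤ.+ upperCoefficient g f b) ℤ.* total f n)))
               (sumOver-cong features (λ f → split (weight p a) (weight q b)
                 (lowerCoefficient g f a) (upperCoefficient g f b) (total f n))))
      expanded : ∀ n → total (two g p q) n ≡ sumOver features (λ f → T (λ a → T (part f a)) n)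
      expanded n = trans
        (T-cong (λ a n → trans (T-cong (distribute a) n) (T-sumOver features (λ f → part f a) n)) n)
        (T-sumOver features (λ f a → T (part f a)) n)
      one-affine : Affine (λ _ → 1ℤ)
      one-affine = constant-affine 1ℤ (λ _ → refl)
      each : ∀ f n → (mulPoly [1-x]³ [1-x]³ ▹ T (λ a → T (part f a))) n ≡ (row (two g p q) f ▹ total f) n
      each f n = trans
        (▹-plus′ (mulPoly [1-x]³ [1-x]³) {T (λ a → T (part f a))}
                 {T (λ a → T (part₁ f a))} {T (λ a → T (part₂ f a))}
          (λ m → trans (T-cong (λ a → T-plus (part₁ f a) (part₂ f a)) m)
                       (T-plus (λ a → T (part₁ f a)) (λ a → T (part₂ f a)) m)) n)
        (trans (cong₂ ℤ._+_
                 (product-gf {lower f} {upper′ f} (weighted-quadratic p (lowerCoefficient-affine g f))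
                             (weighted-quadratic q one-affine) (total f) n)
                 (product-gf {lower′ f} {upper f} (weighted-quadratic p one-affine)
                             (weighted-quadratic q (upperCoefficient-affine g f)) (total f) n))
               (sym (▹-add (mulPoly (gf (lower f)) (gf (upper′ f))) (mulPoly (gf (lower′ f)) (gf (upper f)))
                           (total f) n)))

    row-correct : ∀ i n → (pivot i ▹ total i) n ≡ sumOver features (λ f → (row i f ▹ total f) n)
    row-correct empty       n = trans (▹-allZero [] δ₀ n refl)
      (sym (sumOver-zero features (λ f → ▹-allZero [] (total f) n refl)))
    row-correct (one p)     n = row-one p n
    row-correct (two g p q) n = row-two g p q n

-- Certified elimination of all features but one

denominator numerator : List ℤ
denominator =
  + 1 ∷ -[1+ 13 ] ∷ + 80 ∷ -[1+ 242 ] ∷ + 423 ∷ -[1+ 412 ] ∷ + 174 ∷ + 106 ∷ -[1+ 349 ] ∷ + 533 ∷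
  -[1+ 545 ] ∷ + 427 ∷ -[1+ 147 ] ∷ -[1+ 260 ] ∷ + 383 ∷ -[1+ 252 ] ∷ + 158 ∷ + 57 ∷ -[1+ 180 ] ∷
  + 10 ∷ + 115 ∷ -[1+ 48 ] ∷ -[1+ 95 ] ∷ + 93 ∷ + 49 ∷ -[1+ 53 ] ∷ -[1+ 11 ] ∷ + 12 ∷ + 1 ∷ []
numerator =
  + 0 ∷ + 1 ∷ -[1+ 10 ] ∷ + 49 ∷ -[1+ 113 ] ∷ + 146 ∷ -[1+ 93 ] ∷ + 5 ∷ + 71 ∷ -[1+ 142 ] ∷
  + 176 ∷ -[1+ 153 ] ∷ + 100 ∷ + 24 ∷ -[1+ 120 ] ∷ + 90 ∷ -[1+ 60 ] ∷ + 19 ∷ + 58 ∷ -[1+ 31 ] ∷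
  -[1+ 30 ] ∷ + 37 ∷ + 14 ∷ -[1+ 42 ] ∷ -[1+ 3 ] ∷ + 21 ∷ -[1+ 0 ] ∷ -[1+ 4 ] ∷ []

-- A row of the inverse of the matrix of the linear system for the totals of the
-- features, multiplied by (1 - x)⁶ times the denominator.
multiplier₁ : Weight → List ℤ
multiplier₁ unit =
  + 1 ∷ -[1+ 15 ] ∷ + 112 ∷ -[1+ 452 ] ∷ + 1174 ∷ -[1+ 2034 ] ∷ + 2367 ∷ -[1+ 1702 ] ∷ + 246 ∷
  + 1519 ∷ -[1+ 3092 ] ∷ + 3801 ∷ -[1+ 3156 ] ∷ + 1337 ∷ + 801 ∷ -[1+ 2054 ] ∷ + 1961 ∷
  -[1+ 1107 ] ∷ + 30 ∷ + 758 ∷ -[1+ 527 ] ∷ -[1+ 352 ] ∷ + 620 ∷ -[1+ 55 ] ∷ -[1+ 386 ] ∷ + 204 ∷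
  + 121 ∷ -[1+ 135 ] ∷ + 6 ∷ + 32 ∷ -[1+ 9 ] ∷ []
multiplier₁ extent =
  + 0 ∷ + 1 ∷ -[1+ 13 ] ∷ + 85 ∷ -[1+ 294 ] ∷ + 646 ∷ -[1+ 922 ] ∷ + 839 ∷ -[1+ 371 ] ∷
  -[1+ 246 ] ∷ + 813 ∷ -[1+ 1181 ] ∷ + 1233 ∷ -[1+ 913 ] ∷ + 261 ∷ + 425 ∷ -[1+ 717 ] ∷ + 593 ∷
  -[1+ 271 ] ∷ -[1+ 87 ] ∷ + 220 ∷ -[1+ 23 ] ∷ -[1+ 157 ] ∷ + 57 ∷ + 130 ∷ -[1+ 109 ] ∷
  -[1+ 32 ] ∷ + 65 ∷ -[1+ 8 ] ∷ -[1+ 13 ] ∷ + 5 ∷ []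
multiplier₁ length₁ =
  + 0 ∷ + 0 ∷ + 0 ∷ + 0 ∷ + 0 ∷ -[1+ 0 ] ∷ + 6 ∷ -[1+ 15 ] ∷ + 38 ∷ -[1+ 104 ] ∷ + 219 ∷
  -[1+ 270 ] ∷ + 156 ∷ + 71 ∷ -[1+ 260 ] ∷ + 298 ∷ -[1+ 188 ] ∷ + 59 ∷ + 43 ∷ -[1+ 133 ] ∷
  + 116 ∷ + 25 ∷ -[1+ 106 ] ∷ + 67 ∷ + 5 ∷ -[1+ 48 ] ∷ + 31 ∷ + 15 ∷ -[1+ 16 ] ∷ -[1+ 2 ] ∷ + 4 ∷ []
multiplier₁ length₂ =
  + 0 ∷ + 0 ∷ + 0 ∷ + 0 ∷ + 0 ∷ + 0 ∷ -[1+ 0 ] ∷ + 5 ∷ -[1+ 3 ] ∷ -[1+ 23 ] ∷ + 73 ∷ -[1+ 90 ] ∷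
  + 54 ∷ + 11 ∷ -[1+ 69 ] ∷ + 78 ∷ -[1+ 43 ] ∷ + 29 ∷ -[1+ 0 ] ∷ -[1+ 49 ] ∷ + 35 ∷ + 19 ∷
  -[1+ 40 ] ∷ + 39 ∷ + 2 ∷ -[1+ 38 ] ∷ + 11 ∷ + 14 ∷ -[1+ 1 ] ∷ -[1+ 2 ] ∷ []

multiplier₂ : Fin 3 → Weight → List ℤ
multiplier₂ 0F unit =
  + 0 ∷ + 0 ∷ + 1 ∷ -[1+ 8 ] ∷ + 33 ∷ -[1+ 62 ] ∷ + 68 ∷ -[1+ 37 ] ∷ -[1+ 29 ] ∷ + 131 ∷
  -[1+ 159 ] ∷ + 66 ∷ + 19 ∷ -[1+ 59 ] ∷ + 74 ∷ -[1+ 21 ] ∷ + 4 ∷ + 10 ∷ -[1+ 76 ] ∷ + 23 ∷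
  + 77 ∷ -[1+ 60 ] ∷ + 1 ∷ + 31 ∷ -[1+ 18 ] ∷ -[1+ 8 ] ∷ + 11 ∷ + 3 ∷ -[1+ 0 ] ∷ []
multiplier₂ 0F length₁ =
  + 0 ∷ + 0 ∷ + 0 ∷ + 0 ∷ + 0 ∷ -[1+ 0 ] ∷ + 3 ∷ -[1+ 3 ] ∷ + 16 ∷ -[1+ 41 ] ∷ + 41 ∷ -[1+ 5 ] ∷
  -[1+ 26 ] ∷ + 49 ∷ -[1+ 38 ] ∷ + 7 ∷ -[1+ 1 ] ∷ -[1+ 6 ] ∷ + 35 ∷ -[1+ 9 ] ∷ -[1+ 25 ] ∷ + 12 ∷
  -[1+ 2 ] ∷ -[1+ 3 ] ∷ + 14 ∷ + 2 ∷ -[1+ 8 ] ∷ -[1+ 3 ] ∷ []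
multiplier₂ 0F length₂ =
  + 0 ∷ + 0 ∷ + 0 ∷ + 0 ∷ + 0 ∷ + 0 ∷ -[1+ 0 ] ∷ + 2 ∷ + 5 ∷ -[1+ 15 ] ∷ + 12 ∷ -[1+ 1 ] ∷
  -[1+ 3 ] ∷ + 17 ∷ -[1+ 8 ] ∷ -[1+ 3 ] ∷ -[1+ 11 ] ∷ -[1+ 3 ] ∷ + 19 ∷ + 7 ∷ -[1+ 4 ] ∷ + 2 ∷
  -[1+ 12 ] ∷ -[1+ 10 ] ∷ + 10 ∷ + 11 ∷ + 3 ∷ []
multiplier₂ 1F unit =
  + 0 ∷ + 0 ∷ + 0 ∷ + 1 ∷ -[1+ 6 ] ∷ + 19 ∷ -[1+ 22 ] ∷ + 14 ∷ -[1+ 26 ] ∷ + 52 ∷ + 0 ∷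
  -[1+ 92 ] ∷ + 98 ∷ -[1+ 39 ] ∷ -[1+ 28 ] ∷ + 64 ∷ -[1+ 22 ] ∷ + 29 ∷ -[1+ 36 ] ∷ -[1+ 51 ] ∷
  + 67 ∷ + 6 ∷ -[1+ 36 ] ∷ + 4 ∷ + 19 ∷ + 6 ∷ -[1+ 6 ] ∷ -[1+ 3 ] ∷ []
multiplier₂ 1F length₁ =
  + 0 ∷ + 0 ∷ + 0 ∷ + 0 ∷ + 0 ∷ + 0 ∷ -[1+ 1 ] ∷ + 6 ∷ -[1+ 0 ] ∷ -[1+ 6 ] ∷ -[1+ 10 ] ∷ + 33 ∷
  -[1+ 15 ] ∷ -[1+ 13 ] ∷ + 29 ∷ -[1+ 25 ] ∷ + 3 ∷ -[1+ 3 ] ∷ + 14 ∷ + 16 ∷ -[1+ 28 ] ∷ + 0 ∷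
  + 12 ∷ + 2 ∷ + 3 ∷ -[1+ 3 ] ∷ -[1+ 3 ] ∷ []
multiplier₂ 1F length₂ =
  + 0 ∷ + 0 ∷ + 0 ∷ + 0 ∷ + 0 ∷ + 0 ∷ + 0 ∷ -[1+ 0 ] ∷ + 2 ∷ + 5 ∷ -[1+ 17 ] ∷ + 17 ∷ -[1+ 0 ] ∷
  -[1+ 14 ] ∷ + 22 ∷ -[1+ 3 ] ∷ -[1+ 2 ] ∷ -[1+ 16 ] ∷ -[1+ 0 ] ∷ + 15 ∷ -[1+ 6 ] ∷ + 9 ∷ + 12 ∷
  -[1+ 7 ] ∷ -[1+ 6 ] ∷ []
multiplier₂ 2F unit =
  + 0 ∷ + 0 ∷ + 0 ∷ + 0 ∷ + 1 ∷ -[1+ 3 ] ∷ + 0 ∷ + 28 ∷ -[1+ 64 ] ∷ + 58 ∷ -[1+ 1 ] ∷ -[1+ 32 ] ∷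
  + 11 ∷ + 9 ∷ + 35 ∷ -[1+ 81 ] ∷ + 35 ∷ + 39 ∷ -[1+ 29 ] ∷ -[1+ 6 ] ∷ -[1+ 7 ] ∷ + 17 ∷ + 19 ∷
  -[1+ 19 ] ∷ -[1+ 8 ] ∷ + 5 ∷ + 3 ∷ []
multiplier₂ 2F length₁ =
  + 0 ∷ + 0 ∷ + 0 ∷ + 0 ∷ + 0 ∷ + 0 ∷ + 0 ∷ -[1+ 1 ] ∷ + 6 ∷ -[1+ 0 ] ∷ -[1+ 8 ] ∷ -[1+ 6 ] ∷
  + 34 ∷ -[1+ 19 ] ∷ -[1+ 14 ] ∷ + 27 ∷ -[1+ 16 ] ∷ -[1+ 8 ] ∷ + 5 ∷ + 22 ∷ + 11 ∷ -[1+ 21 ] ∷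
  -[1+ 19 ] ∷ + 6 ∷ + 8 ∷ + 3 ∷ []
multiplier₂ 2F length₂ =
  + 0 ∷ + 0 ∷ + 0 ∷ + 0 ∷ + 0 ∷ + 0 ∷ + 0 ∷ + 0 ∷ -[1+ 0 ] ∷ + 2 ∷ + 5 ∷ -[1+ 17 ] ∷ + 16 ∷ + 0 ∷
  -[1+ 8 ] ∷ + 10 ∷ + 0 ∷ + 1 ∷ -[1+ 21 ] ∷ + 4 ∷ + 20 ∷ -[1+ 0 ] ∷ -[1+ 6 ] ∷ []
multiplier₂ _ _ = []

-- Reflection in a horizontal line exchanges the two runs, so `two h p unit` and `two h unit p`
-- share a multiplier.
multiplier : Feature → List ℤ
multiplier empty          = []
multiplier (one p)        = multiplier₁ p
multiplier (two h p unit) = multiplier₂ h p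
multiplier (two h unit q) = multiplier₂ h q
multiplier _              = []

-- What the combination of the equations has to leave: (1 - x)⁶ times `denominator` ·
-- `total (one unit)` - `numerator` · `δ₀`.
relationTarget : Feature → List ℤ
relationTarget empty      = scaleForm -1ℤ (mulPoly [1-x]³ (mulPoly [1-x]³ numerator))
relationTarget (one unit) = mulPoly [1-x]³ (mulPoly [1-x]³ denominator)
relationTarget _          = []

collected defect : Feature → List ℤ
collected f = sumPolys features (λ i → mulPoly (multiplier i) (row i f))
defect f    = addForm (mulPoly (multiplier f) (pivot f)) (scaleForm -1ℤ (addForm (collected f) (relationTarget f)))

everywhere : (Feature → Bool) → List Feature → Bool
everywhere p []       = true
everywhere p (f ∷ fs) = p f ∧ everywhere p fs

everywhere-sound : ∀ p fs → everywhere p fs ≡ true → All (λ f → p f ≡ true) fs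
everywhere-sound p []       e = []
everywhere-sound p (f ∷ fs) e =
  proj₁ (∧-split (p f) e) ∷ everywhere-sound p fs (proj₂ (∧-split (p f) e))

sumOver-congᴬ : ∀ {A : Set} {F G : A → ℤ} {xs} → All (λ x → F x ≡ G x) xs → sumOver xs F ≡ sumOver xs G
sumOver-congᴬ []       = refl
sumOver-congᴬ (e ∷ es) = cong₂ ℤ._+_ e (sumOver-congᴬ es)

-- This is the certificate. It compares, feature by feature, the coefficients on both sides of the
-- combined equation; as the lists are not normalised, vanishing means that all entries are 0.
noDefect : everywhere (allZero ∘ defect) features ≡ true
noDefect = refl

defect-sound : ∀ f (v : Seq) n → allZero (defect f) ≡ true →
  (mulPoly (multiplier f) (pivot f) ▹ v) n ≡ (collected f ▹ v) n ℤ.+ (relationTarget f ▹ v) n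
defect-sound f v n e = begin
  (lhs ▹ v) n
    ≡⟨ split ((lhs ▹ v) n) ((rhs ▹ v) n) ⟩
  ((lhs ▹ v) n ℤ.+ -1ℤ ℤ.* (rhs ▹ v) n) ℤ.+ (rhs ▹ v) n
    ≡⟨ cong (ℤ._+ (rhs ▹ v) n) (sym (trans (▹-add lhs (scaleForm -1ℤ rhs) v n)
         (cong (λ z → (lhs ▹ v) n ℤ.+ z) (▹-scale -1ℤ rhs v n)))) ⟩
  (defect f ▹ v) n ℤ.+ (rhs ▹ v) n
    ≡⟨ cong (ℤ._+ (rhs ▹ v) n) (▹-allZero (defect f) v n e) ⟩
  0ℤ ℤ.+ (rhs ▹ v) n
    ≡⟨ ℤ.+-identityˡ _ ⟩
  (rhs ▹ v) n
    ≡⟨ ▹-add (collected f) (relationTarget f) v n ⟩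
  (collected f ▹ v) n ℤ.+ (relationTarget f ▹ v) n ∎
  where
  open ≡-Reasoning
  lhs rhs : List ℤ
  lhs = mulPoly (multiplier f) (pivot f)
  rhs = addForm (collected f) (relationTarget f)
  split : ∀ x y → x ≡ (x ℤ.+ -1ℤ ℤ.* y) ℤ.+ y
  split = ℤSolver.solve-∀

isNull : List ℤ → Bool
isNull []      = true
isNull (_ ∷ _) = false

isNull-sound : ∀ p (v : Seq) n → isNull p ≡ true → (p ▹ v) n ≡ 0ℤ
isNull-sound [] v n e = ▹-allZero [] v n refl

module Recurrence (u : ℕ → Seq) (t : Fin 3 → ℕ → ℕ → Seq)
  (u-expansion : ∀ k n → u k n ≡ sumOver features (λ f → coefficient₁ f k ℤ.* Renewal.total u t f n))
  (t-expansion : ∀ g a b n → t g a b n ≡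
    sumOver features (λ f → (lowerCoefficient g f a ℤ.+ upperCoefficient g f b) ℤ.* Renewal.total u t f n))
  where

  open Renewal u t

  -- Each equation is multiplied by its multiplier and all are added. After interchanging the sums,
  -- the certificate splits the left side into the right side and the targets, and the right side
  -- cancels.
  targets-cancel : ∀ n → sumOver features (λ f → (relationTarget f ▹ total f) n) ≡ 0ℤ
  targets-cancel n = cancelˡ _ _ (begin
    sumOver features (λ f → (collected f ▹ total f) n) ℤ.+
    sumOver features (λ f → (relationTarget f ▹ total f) n)
      ≡⟨ sym (sumOver-plus features (λ f → (collected f ▹ total f) n) (λ f → (relationTarget f ▹ total f) n)) ⟩
    sumOver features (λ f → (collected f ▹ total f) n ℤ.+ (relationTarget f ▹ total f) n)
      ≡⟨ sym (sumOver-congᴬ (All.map (λ {f} e → defect-sound f (total f) n e)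
           (everywhere-sound (allZero ∘ defect) features noDefect))) ⟩
    sumOver features (λ f → (mulPoly (multiplier f) (pivot f) ▹ total f) n)
      ≡⟨ sumOver-cong features (λ f → row-multiple f) ⟩
    sumOver features (λ i → sumOver features (λ f → (mulPoly (multiplier i) (row i f) ▹ total f) n))
      ≡⟨ sumOver-swap features features (λ i f → (mulPoly (multiplier i) (row i f) ▹ total f) n) ⟩
    sumOver features (λ f → sumOver features (λ i → (mulPoly (multiplier i) (row i f) ▹ total f) n))
      ≡⟨ sumOver-cong features (λ f → sym (sumPolys-▹ features (λ i → mulPoly (multiplier i) (row i f)) (total f) n)) ⟩
    sumOver features (λ f → (collected f ▹ total f) n) ∎)
    where
    open ≡-Reasoning
    cancelˡ : ∀ x y → x ℤ.+ y ≡ x → y ≡ 0ℤ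
    cancelˡ x y e = trans (isolate x y) (trans (cong (ℤ._- x) e) (ℤ.+-inverseʳ x))
      where
      isolate : ∀ x y → y ≡ (x ℤ.+ y) ℤ.- x
      isolate = ℤSolver.solve-∀
    row-multiple : ∀ i → (mulPoly (multiplier i) (pivot i) ▹ total i) n ≡
                   sumOver features (λ f → (mulPoly (multiplier i) (row i f) ▹ total f) n)
    row-multiple i = trans (▹-mul (multiplier i) (pivot i) (total i) n)
      (trans (▹-cong (multiplier i) (row-correct u-expansion t-expansion i) n)
      (trans (▹-sumOver (multiplier i) features (λ f → row i f ▹ total f) n)
             (sumOver-cong features (λ f → sym (▹-mul (multiplier i) (row i f) (total f) n)))))

  rational : denominator ▹ total (one unit) ≗ numerator ▹ δ₀
  rational = [1-x]³-cancel ([1-x]³-cancel (λ n → begin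
    ([1-x]³ ▹ [1-x]³ ▹ denominator ▹ total (one unit)) n
      ≡⟨ sym (cube denominator (total (one unit)) n) ⟩
    (mulPoly [1-x]³ (mulPoly [1-x]³ denominator) ▹ total (one unit)) n
      ≡⟨ isolate _ _ _ (twoTerms n) ⟩
    (mulPoly [1-x]³ (mulPoly [1-x]³ numerator) ▹ δ₀) n
      ≡⟨ cube numerator δ₀ n ⟩
    ([1-x]³ ▹ [1-x]³ ▹ numerator ▹ δ₀) n ∎))
    where
    open ≡-Reasoning
    cube : ∀ p v → mulPoly [1-x]³ (mulPoly [1-x]³ p) ▹ v ≗ [1-x]³ ▹ [1-x]³ ▹ p ▹ v
    cube p v n = trans (▹-mul [1-x]³ (mulPoly [1-x]³ p) v n) (▹-cong [1-x]³ (▹-mul [1-x]³ p v) n)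
    isolate : ∀ x y r → -1ℤ ℤ.* y ℤ.+ (x ℤ.+ r) ≡ 0ℤ × r ≡ 0ℤ → x ≡ y
    isolate x y _ (e , refl) = trans (solve-x x y) (trans (cong (ℤ._+ y) e) (ℤ.+-identityˡ y))
      where
      solve-x : ∀ x y → x ≡ (-1ℤ ℤ.* y ℤ.+ (x ℤ.+ 0ℤ)) ℤ.+ y
      solve-x = ℤSolver.solve-∀
    -- `empty` and `one unit` head the list of features; the targets of all the others are the empty
    -- polynomial.
    others : List Feature
    others = List.drop 2 features
    twoTerms : ∀ n →
      -1ℤ ℤ.* (mulPoly [1-x]³ (mulPoly [1-x]³ numerator) ▹ δ₀) n ℤ.+
      ((mulPoly [1-x]³ (mulPoly [1-x]³ denominator) ▹ total (one unit)) n ℤ.+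
       sumOver others (λ f → (relationTarget f ▹ total f) n)) ≡ 0ℤ ×
      sumOver others (λ f → (relationTarget f ▹ total f) n) ≡ 0ℤ
    twoTerms n =
      trans (cong (ℤ._+ rest) (sym (▹-scale -1ℤ (mulPoly [1-x]³ (mulPoly [1-x]³ numerator)) δ₀ n)))
            (targets-cancel n) ,
      trans (sumOver-congᴬ (All.map (λ {f} e → isNull-sound (relationTarget f) (total f) n e)
              (everywhere-sound (isNull ∘ relationTarget) others refl)))
            (sumOver-zero others (λ _ → refl))
      where
      rest : ℤ
      rest = (mulPoly [1-x]³ (mulPoly [1-x]³ denominator) ▹ total (one unit)) n ℤ.+
             sumOver others (λ f → (relationTarget f ▹ total f) n)

-- Placing a column next to another one

-- single k is a run of k + 1 cells; double a g b consists of runs of a + 1 and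
-- b + 1 cells, the first one below a gap of g + 1 cells and the second one above it.
data Shape : Set where
  single : ℕ → Shape
  double : ℕ → Fin 3 → ℕ → Shape

-- A shape with the height of its lowest cell.
Column : Set
Column = ℤ × Shape

upperStart : ℤ → ℕ → Fin 3 → ℤ
upperStart y a g = y ℤ.+ + a ℤ.+ + toℕ g ℤ.+ + 2

runs : Column → List Run
runs (y , single k)     = (y , y ℤ.+ + k) ∷ []
runs (y , double a g b) = (y , y ℤ.+ + a) ∷ (upperStart y a g , upperStart y a g ℤ.+ + b) ∷ []

-- The cell (x + 1 , z) shares edges with (x , z) and (x , z + 1).
RunsTouch : Run → Run → Set
RunsTouch (b , t) (b′ , t′) = b ℤ.≤ ℤ.suc t′ × b′ ℤ.≤ t

Follows : Column → Column → Set
Follows C D = All (λ s → Any (λ r → RunsTouch r s) (runs C)) (runs D)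

follows? : ∀ C D → Dec (Follows C D)
follows? C D = All.all? (λ s → Any.any? (λ r →
  (proj₁ r ℤ.≤? ℤ.suc (proj₂ s)) ×-dec (proj₁ s ℤ.≤? proj₂ r)) (runs C)) (runs D)

range : ℤ → ℕ → List ℤ
range y zero    = []
range y (suc n) = y ∷ range (ℤ.suc y) n

lowerExtent span : Shape → ℕ
lowerExtent (single k)     = k
lowerExtent (double a g b) = a
span (single k)            = k
span (double a g b)        = 2 ℕ.+ (toℕ g ℕ.+ (a ℕ.+ b))

-- The positions p with y - 1 - `lowerExtent s′` ≤ p ≤ y + `span s`. Outside them the lowest
-- component of s′ lies wholly below or wholly above the column.
candidates : Column → Shape → List ℤ
candidates (y , s) s′ = range (y ℤ.- + suc (lowerExtent s′)) (2 ℕ.+ (lowerExtent s′ ℕ.+ span s))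

placements : Column → Shape → List ℤ
placements C s = List.filter (λ p → follows? C (p , s)) (candidates C s)

-- Counting the placements for the four combinations of shapes

Between : ℤ → ℤ → ℤ → Set
Between u v p = u ℤ.≤ p × p ℤ.≤ v

between? : ∀ u v → Decidable (Between u v)
between? u v p = (u ℤ.≤? p) ×-dec (p ℤ.≤? v)

count : ∀ {P : ℤ → Set} → Decidable P → List ℤ → ℕ
count P? xs = length (List.filter P? xs)

count-accept : ∀ {P : ℤ → Set} (P? : Decidable P) {x} xs → P x → count P? (x ∷ xs) ≡ suc (count P? xs)
count-accept P? xs p = cong length (List.filter-accept P? p)

count-reject : ∀ {P : ℤ → Set} (P? : Decidable P) {x} xs → ¬ P x → count P? (x ∷ xs) ≡ count P? xs
count-reject P? xs ¬p = cong length (List.filter-reject P? ¬p)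

0≤+ : ∀ n → 0ℤ ℤ.≤ + n
0≤+ n = ℤ.+≤+ z≤n

-- The alternatives are chosen so that they survive the step from `lo` to `lo` + 1: the second turns
-- into the third once `lo` has passed `u`, and the third runs down to the first.
count-interval : ∀ lo n u v w → v ℤ.< lo ℤ.+ + n →
  (+ w ≡ 0ℤ × (v ℤ.< lo ⊎ v ℤ.< u)) ⊎ (+ w ≡ ℤ.suc (v ℤ.- u) × lo ℤ.≤ u) ⊎
  (+ w ≡ ℤ.suc (v ℤ.- lo) × u ℤ.≤ lo) →
  count (between? u v) (range lo n) ≡ w
count-interval lo zero u v w bound spec =
  sym (ℤ.+-injective (linear
    (# 3 :< # 0 :+ const 0ℤ :⇒
     (# 2 :≡ const 0ℤ :∧ (# 3 :< # 0 :∨ # 3 :< # 1)) :∨ (# 2 :≡ const 1ℤ :+ (# 3 :- # 1) :∧ # 0 :≤ # 1) :∨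
     (# 2 :≡ const 1ℤ :+ (# 3 :- # 0) :∧ # 1 :≤ # 0) :⇒ const 0ℤ :≤ # 2 :⇒ # 2 :≡ const 0ℤ)
    refl (lo ∷ u ∷ + w ∷ v ∷ []) bound spec (0≤+ w)))
count-interval lo (suc n) u v w bound spec with between? u v lo
... | no outside = trans (count-reject (between? u v) (range (ℤ.suc lo) n) outside) $ count-interval (ℤ.suc lo) n u v w
        (subst (v ℤ.<_) (shift-bound lo (+ n)) bound)
        (linear
          (((# 1 :≤ # 0 :∧ # 0 :≤ # 3) :⇒ :⊥) :⇒
           (# 2 :≡ const 0ℤ :∧ (# 3 :< # 0 :∨ # 3 :< # 1)) :∨ (# 2 :≡ const 1ℤ :+ (# 3 :- # 1) :∧ # 0 :≤ # 1) :∨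
           (# 2 :≡ const 1ℤ :+ (# 3 :- # 0) :∧ # 1 :≤ # 0) :⇒
           const 0ℤ :≤ # 2 :⇒
           (# 2 :≡ const 0ℤ :∧ (# 3 :< const 1ℤ :+ # 0 :∨ # 3 :< # 1)) :∨
           (# 2 :≡ const 1ℤ :+ (# 3 :- # 1) :∧ const 1ℤ :+ # 0 :≤ # 1) :∨
           (# 2 :≡ const 1ℤ :+ (# 3 :- (const 1ℤ :+ # 0)) :∧ # 1 :≤ const 1ℤ :+ # 0))
          refl (lo ∷ u ∷ + w ∷ v ∷ []) outside spec (0≤+ w))
  where
  shift-bound : ∀ x y → x ℤ.+ (1ℤ ℤ.+ y) ≡ 1ℤ ℤ.+ x ℤ.+ y
  shift-bound = ℤSolver.solve-∀
count-interval lo (suc n) u v zero bound spec | yes inside = ⊥-elim (linear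
  (# 1 :≤ # 0 :∧ # 0 :≤ # 3 :⇒
   (# 2 :≡ const 0ℤ :∧ (# 3 :< # 0 :∨ # 3 :< # 1)) :∨ (# 2 :≡ const 1ℤ :+ (# 3 :- # 1) :∧ # 0 :≤ # 1) :∨
   (# 2 :≡ const 1ℤ :+ (# 3 :- # 0) :∧ # 1 :≤ # 0) :⇒ # 2 :≡ const 0ℤ :⇒ :⊥)
  refl (lo ∷ u ∷ 0ℤ ∷ v ∷ []) inside spec refl)
count-interval lo (suc n) u v (suc w) bound spec | yes inside =
  trans (count-accept (between? u v) (range (ℤ.suc lo) n) inside) $ cong suc
  (count-interval (ℤ.suc lo) n u v w
    (subst (v ℤ.<_) (shift-bound lo (+ n)) bound)
    (linear
      (# 1 :≤ # 0 :∧ # 0 :≤ # 3 :⇒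
       (const 1ℤ :+ # 2 :≡ const 0ℤ :∧ (# 3 :< # 0 :∨ # 3 :< # 1)) :∨
       (const 1ℤ :+ # 2 :≡ const 1ℤ :+ (# 3 :- # 1) :∧ # 0 :≤ # 1) :∨
       (const 1ℤ :+ # 2 :≡ const 1ℤ :+ (# 3 :- # 0) :∧ # 1 :≤ # 0) :⇒
       const 0ℤ :≤ # 2 :⇒
       (# 2 :≡ const 0ℤ :∧ (# 3 :< const 1ℤ :+ # 0 :∨ # 3 :< # 1)) :∨
       (# 2 :≡ const 1ℤ :+ (# 3 :- # 1) :∧ const 1ℤ :+ # 0 :≤ # 1) :∨
       (# 2 :≡ const 1ℤ :+ (# 3 :- (const 1ℤ :+ # 0)) :∧ # 1 :≤ const 1ℤ :+ # 0))
      refl (lo ∷ u ∷ + w ∷ v ∷ []) inside spec (0≤+ w)))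
  where
  shift-bound : ∀ x y → x ℤ.+ (1ℤ ℤ.+ y) ≡ 1ℤ ℤ.+ x ℤ.+ y
  shift-bound = ℤSolver.solve-∀

count-⇔ : ∀ {P Q : ℤ → Set} (P? : Decidable P) (Q? : Decidable Q) xs →
          (∀ p → P p → Q p) → (∀ p → Q p → P p) → count P? xs ≡ count Q? xs
count-⇔ P? Q? xs to from = cong length (List.filter-≐ P? Q? ((λ {p} → to p) , (λ {p} → from p)) xs)

count-⊎ : ∀ {P Q R : ℤ → Set} (P? : Decidable P) (Q? : Decidable Q) (R? : Decidable R) xs →
          (∀ p → R p → P p ⊎ Q p) → (∀ p → P p → R p) → (∀ p → Q p → R p) → (∀ p → P p → Q p → ⊥) →
          count R? xs ≡ count P? xs ℕ.+ count Q? xs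
count-⊎ P? Q? R? []       split left right disjoint = refl
count-⊎ P? Q? R? (x ∷ xs) split left right disjoint
  with P? x | Q? x | count-⊎ P? Q? R? xs split left right disjoint
... | yes p | yes q | ih = contradiction q (disjoint x p)
... | yes p | no ¬q | ih = trans (count-accept R? xs (left x p)) (cong suc ih)
... | no ¬p | yes q | ih = trans (count-accept R? xs (right x q)) (trans (cong suc ih) (sym (ℕ.+-suc _ _)))
... | no ¬p | no ¬q | ih = trans (count-reject R? xs (λ r → neither (split x r))) ih
  where
  neither : _ → ⊥
  neither (inj₁ p) = ¬p p
  neither (inj₂ q) = ¬q q

monus-spec : ∀ m n → (+ m ℤ.≤ + n × + (m ℕ.∸ n) ≡ 0ℤ) ⊎ (+ n ℤ.≤ + m × + (m ℕ.∸ n) ≡ + m ℤ.- + n)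
monus-spec m n with ℕ.≤-total m n
... | inj₁ m≤n = inj₁ (ℤ.+≤+ m≤n , cong +_ (ℕ.m≤n⇒m∸n≡0 m≤n))
... | inj₂ n≤m = inj₂ (ℤ.+≤+ n≤m , trans (sym (ℤ.⊖-≥ n≤m)) (sym (ℤ.m-n≡m⊖n m n)))

toℕ≤2 : ∀ (g : Fin 3) → + toℕ g ℤ.≤ + 2
toℕ≤2 0F = ℤ.+≤+ z≤n
toℕ≤2 1F = ℤ.+≤+ (s≤s z≤n)
toℕ≤2 2F = ℤ.+≤+ (s≤s (s≤s z≤n))

module _ {A : Set} {P : A → Set} where

  any-one : ∀ {r} → Any P (r ∷ []) → P r
  any-one (here p) = p

  any-two : ∀ {r s} → Any P (r ∷ s ∷ []) → P r ⊎ P s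
  any-two (here p)         = inj₁ p
  any-two (there (here p)) = inj₂ p

  two-any : ∀ {r s} → P r ⊎ P s → Any P (r ∷ s ∷ [])
  two-any (inj₁ p) = here p
  two-any (inj₂ p) = there (here p)

touchF : Term → Term → Term → Term → Formula
touchF b t b′ t′ = b :≤ const 1ℤ :+ t′ :∧ b′ :≤ t

betweenF : Term → Term → Term → Formula
betweenF u v p = u :≤ p :∧ p :≤ v

-- The hypotheses of `count-interval` as a formula, so that `linear` can supply them.
countF : Term → Term → Term → Term → Term → Formula
countF lo n u v w =
  v :< lo :+ n :∧
  ((w :≡ const 0ℤ :∧ (v :< lo :∨ v :< u)) :∨ (w :≡ const 1ℤ :+ (v :- u) :∧ lo :≤ u) :∨
   (w :≡ const 1ℤ :+ (v :- lo) :∧ u :≤ lo))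

monusF : Term → Term → Term → Formula
monusF m n e = (m :≤ n :∧ e :≡ const 0ℤ) :∨ (n :≤ m :∧ e :≡ m :- n)

module SingleSingle (y : ℤ) (k l : ℕ) where
  Y P K L U V lo n : Term
  Y  = # 0
  K  = # 1
  L  = # 2
  P  = # 3
  U  = Y :- (const 1ℤ :+ L)
  V  = Y :+ K
  lo = Y :- (const 1ℤ :+ L)
  n  = const (+ 2) :+ (L :+ K)

  touch : Formula
  touch = touchF Y (Y :+ K) P (P :+ L)

  -- The interval bounds do not mention the position p, so they may be evaluated with the dummy
  -- position y.
  env : ℤ → List ℤ
  env p = y ∷ + k ∷ + l ∷ p ∷ []

  placements-count : length (placements (y , single k) (single l)) ≡ 2 ℕ.+ (k ℕ.+ l)
  placements-count = trans
    (count-⇔ (λ p → follows? (y , single k) (p , single l)) (between? (⟦ U ⟧ₜ (env y)) (⟦ V ⟧ₜ (env y)))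
      (candidates (y , single k) (single l))
      (λ { p (t ∷ []) → linear (touch :⇒ betweenF U V P) refl (env p) (any-one t) })
      (λ p h → here (linear (betweenF U V P :⇒ touch) refl (env p) h) ∷ []))
    (let bound , spec = linear (const 0ℤ :≤ K :⇒ const 0ℤ :≤ L :⇒ countF lo n U V (const (+ 2) :+ (K :+ L)))
                          refl (env y) (0≤+ k) (0≤+ l)
     in count-interval (⟦ lo ⟧ₜ (env y)) (2 ℕ.+ (l ℕ.+ k)) (⟦ U ⟧ₜ (env y)) (⟦ V ⟧ₜ (env y)) (2 ℕ.+ (k ℕ.+ l)) bound spec)

module SingleDouble (y : ℤ) (k c : ℕ) (h : Fin 3) (d : ℕ) where
  Y P Q K C H D W U V lo n : Term
  Y  = # 0
  K  = # 1
  C  = # 2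
  H  = # 3
  D  = # 4
  W  = # 5
  P  = # 6
  Q  = P :+ C :+ H :+ const (+ 2)
  U  = Y :- (const 1ℤ :+ C)
  V  = Y :+ K :- C :- H :- const (+ 2)
  lo = Y :- (const 1ℤ :+ C)
  n  = const (+ 2) :+ (C :+ K)

  lower upper nonneg : Formula
  lower  = touchF Y (Y :+ K) P (P :+ C)
  upper  = touchF Y (Y :+ K) Q (Q :+ D)
  nonneg = const 0ℤ :≤ K :∧ const 0ℤ :≤ C :∧ const 0ℤ :≤ H :∧ const 0ℤ :≤ D

  env : ℤ → List ℤ
  env p = y ∷ + k ∷ + c ∷ + toℕ h ∷ + d ∷ + (k ℕ.∸ toℕ h) ∷ p ∷ []

  signs : ∀ p → ⟦ nonneg ⟧ (env p)
  signs p = 0≤+ k , 0≤+ c , 0≤+ (toℕ h) , 0≤+ d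

  -- The lower component must reach at least height y - 1, and the upper one must start no higher
  -- than the top of the run. Both then touch, which leaves k - h positions, if any.
  placements-count : length (placements (y , single k) (double c h d)) ≡ k ℕ.∸ toℕ h
  placements-count = trans
    (count-⇔ (λ p → follows? (y , single k) (p , double c h d)) (between? (⟦ U ⟧ₜ (env y)) (⟦ V ⟧ₜ (env y)))
      (candidates (y , single k) (double c h d))
      (λ { p (s ∷ t ∷ []) → linear (nonneg :⇒ lower :⇒ upper :⇒ betweenF U V P) refl
             (env p) (signs p) (any-one s) (any-one t) })
      (λ p h → let s , t = linear (nonneg :⇒ betweenF U V P :⇒ lower :∧ upper) refl (env p) (signs p) h
               in here s ∷ here t ∷ []))
    (let bound , spec = linear (nonneg :⇒ monusF K H W :⇒ countF lo n U V W) refl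
                          (env y) (signs y) (monus-spec k (toℕ h))
     in count-interval (⟦ lo ⟧ₜ (env y)) (2 ℕ.+ (c ℕ.+ k)) (⟦ U ⟧ₜ (env y)) (⟦ V ⟧ₜ (env y)) (k ℕ.∸ toℕ h) bound spec)

module DoubleSingle (y : ℤ) (a : ℕ) (g : Fin 3) (b k : ℕ) where
  Y A G B K W P U₀ U V U′ V′ lo n : Term
  Y  = # 0
  A  = # 1
  G  = # 2
  B  = # 3
  K  = # 4
  W  = # 5
  P  = # 6
  U₀ = Y :+ A :+ G :+ const (+ 2)
  U  = Y :- (const 1ℤ :+ K)
  V  = U₀ :+ B
  U′ = Y :+ A :+ const 1ℤ
  V′ = Y :+ A :+ G :- K
  lo = Y :- (const 1ℤ :+ K)
  n  = const (+ 2) :+ (K :+ (const (+ 2) :+ (G :+ (A :+ B))))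

  touch nonneg : Formula
  touch  = touchF Y (Y :+ A) P (P :+ K) :∨ touchF U₀ (U₀ :+ B) P (P :+ K)
  nonneg = const 0ℤ :≤ A :∧ const 0ℤ :≤ G :∧ const 0ℤ :≤ B :∧ const 0ℤ :≤ K

  env : ℤ → List ℤ
  env p = y ∷ + a ∷ + toℕ g ∷ + b ∷ + k ∷ + (toℕ g ℕ.∸ k) ∷ p ∷ []

  signs : ∀ p → ⟦ nonneg ⟧ (env p)
  signs p = 0≤+ a , 0≤+ (toℕ g) , 0≤+ b , 0≤+ k

  outer inner : ℕ
  outer = 4 ℕ.+ (a ℕ.+ (toℕ g ℕ.+ (b ℕ.+ k)))
  inner = toℕ g ℕ.∸ k

  outside? : Decidable (Between (⟦ U ⟧ₜ (env y)) (⟦ V ⟧ₜ (env y)))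
  outside? = between? (⟦ U ⟧ₜ (env y)) (⟦ V ⟧ₜ (env y))
  inside? : Decidable (Between (⟦ U′ ⟧ₜ (env y)) (⟦ V′ ⟧ₜ (env y)))
  inside? = between? (⟦ U′ ⟧ₜ (env y)) (⟦ V′ ⟧ₜ (env y))

  outer-count : count outside? (candidates (y , double a g b) (single k)) ≡ outer
  outer-count =
    let bound , spec = linear (nonneg :⇒ countF lo n U V (const (+ 4) :+ (A :+ (G :+ (B :+ K))))) refl (env y) (signs y)
    in count-interval (⟦ lo ⟧ₜ (env y)) (2 ℕ.+ (k ℕ.+ span (double a g b))) (⟦ U ⟧ₜ (env y)) (⟦ V ⟧ₜ (env y)) outer bound spec

  inner-count : count inside? (candidates (y , double a g b) (single k)) ≡ inner
  inner-count =
    let bound , spec = linear (nonneg :⇒ monusF G K W :⇒ countF lo n U′ V′ W) refl (env y) (signs y) (monus-spec (toℕ g) k)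
    in count-interval (⟦ lo ⟧ₜ (env y)) (2 ℕ.+ (k ℕ.+ span (double a g b))) (⟦ U′ ⟧ₜ (env y)) (⟦ V′ ⟧ₜ (env y)) inner bound spec

  -- Among the positions level with the column only those inside the gap touch nothing. The additive
  -- form avoids a truncated subtraction.
  placements-count : length (placements (y , double a g b) (single k)) ℕ.+ inner ≡ outer
  placements-count = trans (cong (length (placements (y , double a g b) (single k)) ℕ.+_) (sym inner-count))
    (trans (sym (count-⊎ (λ p → follows? (y , double a g b) (p , single k)) inside? outside?
        (candidates (y , double a g b) (single k))
        (λ p r → wrap (linear (nonneg :⇒ betweenF U V P :⇒ touch :∨ betweenF U′ V′ P) refl (env p) (signs p) r))
        (λ { p (t ∷ []) → linear (nonneg :⇒ touch :⇒ betweenF U V P) refl (env p) (signs p) (any-two t) })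
        (λ p → linear (nonneg :⇒ betweenF U′ V′ P :⇒ betweenF U V P) refl (env p) (signs p))
        (λ { p (t ∷ []) → linear (nonneg :⇒ touch :⇒ betweenF U′ V′ P :⇒ :⊥) refl (env p) (signs p) (any-two t) })))
      outer-count)
    where
    wrap : ∀ {p} {Q : Set} → ⟦ touch ⟧ (env p) ⊎ Q → Follows (y , double a g b) (p , single k) ⊎ Q
    wrap (inj₁ t) = inj₁ (two-any t ∷ [])
    wrap (inj₂ q) = inj₂ q

module DoubleDouble (y : ℤ) (a : ℕ) (g : Fin 3) (b c : ℕ) (h : Fin 3) (d : ℕ) where
  e e′ low high outer : ℕ
  e     = toℕ h ℕ.∸ b
  e′    = toℕ h ℕ.∸ a
  low   = (toℕ g ℕ.∸ c) ℕ.∸ e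
  high  = (toℕ g ℕ.∸ d) ℕ.∸ e′
  outer = (2 ℕ.+ (toℕ g ℕ.+ (a ℕ.+ b))) ℕ.∸ toℕ h

  Y A G B C H D E E′ P Q U₀ U V U₁ V₁ U₂ V₂ lo n W X : Term
  Y  = # 0
  A  = # 1
  G  = # 2
  B  = # 3
  C  = # 4
  H  = # 5
  D  = # 6
  E  = # 7
  E′ = # 8
  P  = # 9
  W  = # 10
  X  = # 11
  U₀ = Y :+ A :+ G :+ const (+ 2)
  Q  = P :+ C :+ H :+ const (+ 2)
  U  = Y :- (const 1ℤ :+ C)
  V  = U₀ :+ B :- C :- H :- const (+ 2)
  U₁ = Y :+ A :+ const 1ℤ
  V₁ = Y :+ A :+ G :- C :- E
  U₂ = Y :+ A :+ E′ :- C :- H :- const 1ℤ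
  V₂ = Y :+ A :+ G :- D :- C :- H :- const (+ 2)
  lo = Y :- (const 1ℤ :+ C)
  n  = const (+ 2) :+ (C :+ (const (+ 2) :+ (G :+ (A :+ B))))

  lower upper context bounds : Formula
  lower   = touchF Y (Y :+ A) P (P :+ C) :∨ touchF U₀ (U₀ :+ B) P (P :+ C)
  upper   = touchF Y (Y :+ A) Q (Q :+ D) :∨ touchF U₀ (U₀ :+ B) Q (Q :+ D)
  context = const 0ℤ :≤ A :∧ const 0ℤ :≤ G :∧ const 0ℤ :≤ B :∧ const 0ℤ :≤ C :∧ const 0ℤ :≤ H :∧ const 0ℤ :≤ D :∧
            G :≤ const (+ 2) :∧ H :≤ const (+ 2) :∧ monusF H B E :∧ monusF H A E′

  bounds  = const 0ℤ :≤ A :∧ const 0ℤ :≤ G :∧ const 0ℤ :≤ B :∧ const 0ℤ :≤ C :∧ const 0ℤ :≤ H :∧ const 0ℤ :≤ D :∧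
            const 0ℤ :≤ E :∧ const 0ℤ :≤ E′ :∧ H :≤ A :+ E′

  env : ℤ → List ℤ
  env p = y ∷ + a ∷ + toℕ g ∷ + b ∷ + c ∷ + toℕ h ∷ + d ∷ + e ∷ + e′ ∷ p ∷ []

  facts : ∀ p → ⟦ context ⟧ (env p)
  facts p = 0≤+ a , 0≤+ (toℕ g) , 0≤+ b , 0≤+ c , 0≤+ (toℕ h) , 0≤+ d , toℕ≤2 g , toℕ≤2 h ,
          monus-spec (toℕ h) b , monus-spec (toℕ h) a

  bounded : ∀ ρ → ⟦ bounds ⟧ (env y ++ ρ)
  bounded ρ = 0≤+ a , 0≤+ (toℕ g) , 0≤+ b , 0≤+ c , 0≤+ (toℕ h) , 0≤+ d , 0≤+ e , 0≤+ e′ , ℤ.+≤+ (ℕ.m≤n+m∸n (toℕ h) a)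

  outside? : Decidable (Between (⟦ U ⟧ₜ (env y)) (⟦ V ⟧ₜ (env y)))
  outside? = between? (⟦ U ⟧ₜ (env y)) (⟦ V ⟧ₜ (env y))
  low? : Decidable (Between (⟦ U₁ ⟧ₜ (env y)) (⟦ V₁ ⟧ₜ (env y)))
  low? = between? (⟦ U₁ ⟧ₜ (env y)) (⟦ V₁ ⟧ₜ (env y))
  high? : Decidable (Between (⟦ U₂ ⟧ₜ (env y)) (⟦ V₂ ⟧ₜ (env y)))
  high? = between? (⟦ U₂ ⟧ₜ (env y)) (⟦ V₂ ⟧ₜ (env y))

  positions : List ℤ
  positions = candidates (y , double a g b) (double c h d)

  outer-count : count outside? positions ≡ outer
  outer-count =
    let bound , spec = linear (bounds :⇒ monusF (const (+ 2) :+ (G :+ (A :+ B))) H W :⇒ countF lo n U V W) refl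
                         (env y ++ + outer ∷ []) (bounded (+ outer ∷ [])) (monus-spec (2 ℕ.+ (toℕ g ℕ.+ (a ℕ.+ b))) (toℕ h))
    in count-interval (⟦ lo ⟧ₜ (env y)) (2 ℕ.+ (c ℕ.+ span (double a g b))) (⟦ U ⟧ₜ (env y)) (⟦ V ⟧ₜ (env y)) outer bound spec

  low-count : count low? positions ≡ low
  low-count =
    let bound , spec = linear (bounds :⇒ monusF G C X :⇒ monusF X E W :⇒ countF lo n U₁ V₁ W) refl
                         (env y ++ + low ∷ + (toℕ g ℕ.∸ c) ∷ []) (bounded (+ low ∷ + (toℕ g ℕ.∸ c) ∷ []))
                         (monus-spec (toℕ g) c) (monus-spec (toℕ g ℕ.∸ c) e)
    in count-interval (⟦ lo ⟧ₜ (env y)) (2 ℕ.+ (c ℕ.+ span (double a g b))) (⟦ U₁ ⟧ₜ (env y)) (⟦ V₁ ⟧ₜ (env y)) low bound spec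

  high-count : count high? positions ≡ high
  high-count =
    let bound , spec = linear (bounds :⇒ monusF G D X :⇒ monusF X E′ W :⇒ countF lo n U₂ V₂ W) refl
                         (env y ++ + high ∷ + (toℕ g ℕ.∸ d) ∷ []) (bounded (+ high ∷ + (toℕ g ℕ.∸ d) ∷ []))
                         (monus-spec (toℕ g) d) (monus-spec (toℕ g ℕ.∸ d) e′)
    in count-interval (⟦ lo ⟧ₜ (env y)) (2 ℕ.+ (c ℕ.+ span (double a g b))) (⟦ U₂ ⟧ₜ (env y)) (⟦ V₂ ⟧ₜ (env y)) high bound spec

  trapped? : Decidable (λ p → Between (⟦ U₁ ⟧ₜ (env y)) (⟦ V₁ ⟧ₜ (env y)) p ⊎ Between (⟦ U₂ ⟧ₜ (env y)) (⟦ V₂ ⟧ₜ (env y)) p)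
  trapped? p = low? p ⊎-dec high? p

  -- In the `outer` interval the lower component is not wholly below the column and the upper one
  -- not wholly above it. A placement there fails exactly when one component is trapped in the gap.
  -- Both cannot be: two components and the hole between them are adjacent to at least four cells,
  -- while the gap has at most three.
  placements-count : length (placements (y , double a g b) (double c h d)) ℕ.+ (low ℕ.+ high) ≡ outer
  placements-count = trans (cong (length (placements (y , double a g b) (double c h d)) ℕ.+_) (sym trapped-count))
    (trans (sym (count-⊎ (λ p → follows? (y , double a g b) (p , double c h d)) trapped? outside? positions
        (λ p r → wrap (linear (context :⇒ betweenF U V P :⇒ (lower :∧ upper) :∨ (betweenF U₁ V₁ P :∨ betweenF U₂ V₂ P))
                        refl (env p) (facts p) r))
        (λ { p (s ∷ t ∷ []) → linear (context :⇒ lower :⇒ upper :⇒ betweenF U V P) refl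
                                (env p) (facts p) (any-two s) (any-two t) })
        (λ p → linear (context :⇒ betweenF U₁ V₁ P :∨ betweenF U₂ V₂ P :⇒ betweenF U V P) refl (env p) (facts p))
        (λ { p (s ∷ t ∷ []) → linear (context :⇒ lower :⇒ upper :⇒ betweenF U₁ V₁ P :∨ betweenF U₂ V₂ P :⇒ :⊥) refl
                                (env p) (facts p) (any-two s) (any-two t) })))
      outer-count)
    where
    wrap : ∀ {p} {R : Set} → ⟦ lower :∧ upper ⟧ (env p) ⊎ R → Follows (y , double a g b) (p , double c h d) ⊎ R
    wrap (inj₁ (s , t)) = inj₁ (two-any s ∷ two-any t ∷ [])
    wrap (inj₂ r)       = inj₂ r
    trapped-count : count trapped? positions ≡ low ℕ.+ high
    trapped-count = trans
      (count-⊎ low? high? trapped? positions (λ _ r → r) (λ _ → inj₁) (λ _ → inj₂)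
        (λ p → linear (context :⇒ betweenF U₁ V₁ P :⇒ betweenF U₂ V₂ P :⇒ :⊥) refl (env p) (facts p)))
      (cong₂ ℕ._+_ low-count high-count)

-- Counting lists of columns

sumOver-++ : ∀ {A : Set} (xs ys : List A) (F : A → ℤ) → sumOver (xs ++ ys) F ≡ sumOver xs F ℤ.+ sumOver ys F
sumOver-++ []       ys F = sym (ℤ.+-identityˡ _)
sumOver-++ (x ∷ xs) ys F = trans (cong (λ z → F x ℤ.+ z) (sumOver-++ xs ys F)) (sym (ℤ.+-assoc (F x) _ _))

sumOver-map : ∀ {A B : Set} (f : A → B) xs (F : B → ℤ) → sumOver (map f xs) F ≡ sumOver xs (F ∘ f)
sumOver-map f []       F = refl
sumOver-map f (x ∷ xs) F = cong (λ z → F (f x) ℤ.+ z) (sumOver-map f xs F)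

sumOver-concatMap : ∀ {A B : Set} (f : A → List B) xs (F : B → ℤ) →
                    sumOver (concatMap f xs) F ≡ sumOver xs (λ x → sumOver (f x) F)
sumOver-concatMap f []       F = refl
sumOver-concatMap f (x ∷ xs) F = trans (sumOver-++ (f x) (concatMap f xs) F)
  (cong (λ z → sumOver (f x) F ℤ.+ z) (sumOver-concatMap f xs F))

shapeCoefficient : Shape → Feature → ℤ
shapeCoefficient (single k)     f = coefficient₁ f k
shapeCoefficient (double a g b) f = lowerCoefficient g f a ℤ.+ upperCoefficient g f b

placementCount : Shape → Shape → ℤ
placementCount s (single k)     = sumOver weights (λ p → shapeCoefficient s (one p) ℤ.* weight p k)
placementCount s (double c h d) = sumOver weightPairs (λ (p , q) →
  shapeCoefficient s (two h p q) ℤ.* (weight p c ℤ.* weight q d))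

-- As g ≤ 2, nothing is left for l ≥ 2, so the truncated difference is a combination of the
-- indicators of lengths 1 and 2. This is what makes the features finite in number.
trapped-weights : ∀ (g : Fin 3) l e → + ((toℕ g ℕ.∸ l) ℕ.∸ e) ≡
  + (toℕ g ℕ.∸ e) ℤ.* weight length₁ l ℤ.+ + ((toℕ g ℕ.∸ 1) ℕ.∸ e) ℤ.* weight length₂ l
trapped-weights g zero e = pick (+ (toℕ g ℕ.∸ e)) (+ ((toℕ g ℕ.∸ 1) ℕ.∸ e))
  where
  pick : ∀ x y → x ≡ x ℤ.* 1ℤ ℤ.+ y ℤ.* 0ℤ
  pick = ℤSolver.solve-∀
trapped-weights g (suc zero) e = pick (+ (toℕ g ℕ.∸ e)) (+ ((toℕ g ℕ.∸ 1) ℕ.∸ e))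
  where
  pick : ∀ x y → y ≡ x ℤ.* 0ℤ ℤ.+ y ℤ.* 1ℤ
  pick = ℤSolver.solve-∀
trapped-weights g (suc (suc l)) e =
  trans (cong (λ z → + (z ℕ.∸ e)) (ℕ.m≤n⇒m∸n≡0 {toℕ g} (ℕ.≤-trans (ℤ.drop‿+≤+ (toℕ≤2 g)) (ℕ.m≤m+n 2 l))))
 (trans (cong +_ (ℕ.0∸n≡0 e)) (pick (+ (toℕ g ℕ.∸ e)) (+ ((toℕ g ℕ.∸ 1) ℕ.∸ e))))
  where
  pick : ∀ x y → 0ℤ ≡ x ℤ.* 0ℤ ℤ.+ y ℤ.* 0ℤ
  pick = ℤSolver.solve-∀

-- The right side does not involve y: placing is invariant under vertical translation, and so the
-- series can be indexed by shapes instead of columns.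
placements-correct : ∀ y s s′ → + length (placements (y , s) s′) ≡ placementCount s s′
placements-correct y (single k) (single l) =
  trans (cong +_ (SingleSingle.placements-count y k l)) (regroup (+ k) (+ l) (weight length₁ l) (weight length₂ l))
  where
  regroup : ∀ k l w w′ → + 2 ℤ.+ (k ℤ.+ l) ≡
            (1ℤ ℤ.+ k) ℤ.* 1ℤ ℤ.+ (1ℤ ℤ.* (1ℤ ℤ.+ l) ℤ.+ (0ℤ ℤ.* w ℤ.+ (0ℤ ℤ.* w′ ℤ.+ 0ℤ)))
  regroup = ℤSolver.solve-∀
placements-correct y (single k) (double c h d) =
  trans (cong +_ (SingleDouble.placements-count y k c h d))
        (regroup (+ (k ℕ.∸ toℕ h)) (weight length₁ c) (weight length₂ c) (weight length₁ d) (weight length₂ d))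
  where
  regroup : ∀ x w w′ z z′ → x ≡ x ℤ.* (1ℤ ℤ.* 1ℤ) ℤ.+ (0ℤ ℤ.* (w ℤ.* 1ℤ) ℤ.+ (0ℤ ℤ.* (w′ ℤ.* 1ℤ) ℤ.+
            (0ℤ ℤ.* (1ℤ ℤ.* z) ℤ.+ (0ℤ ℤ.* (1ℤ ℤ.* z′) ℤ.+ 0ℤ))))
  regroup = ℤSolver.solve-∀
placements-correct y (double a g b) (single l) =
  solve-count (+ length (placements (y , double a g b) (single l))) (+ (toℕ g ℕ.∸ l)) (+ toℕ g) (+ (toℕ g ℕ.∸ 1))
    (+ a) (+ b) (+ l) (weight length₁ l) (weight length₂ l)
    (cong +_ (DoubleSingle.placements-count y a g b l)) (trapped-weights g l 0)
  where
  regroup : ∀ n i → n ≡ (n ℤ.+ i) ℤ.- i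
  regroup = ℤSolver.solve-∀
  expand : ∀ g g₁ a b l w w′ → + 4 ℤ.+ (a ℤ.+ (g ℤ.+ (b ℤ.+ l))) ℤ.- (g ℤ.* w ℤ.+ g₁ ℤ.* w′) ≡
    (+ 3 ℤ.+ g ℤ.+ a ℤ.+ b) ℤ.* 1ℤ ℤ.+ ((1ℤ ℤ.+ 0ℤ) ℤ.* (1ℤ ℤ.+ l) ℤ.+
    ((ℤ.- g ℤ.+ 0ℤ) ℤ.* w ℤ.+ ((ℤ.- g₁ ℤ.+ 0ℤ) ℤ.* w′ ℤ.+ 0ℤ)))
  expand = ℤSolver.solve-∀
  solve-count : ∀ n i g g₁ a b l w w′ → n ℤ.+ i ≡ + 4 ℤ.+ (a ℤ.+ (g ℤ.+ (b ℤ.+ l))) →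
    i ≡ g ℤ.* w ℤ.+ g₁ ℤ.* w′ → n ≡
    (+ 3 ℤ.+ g ℤ.+ a ℤ.+ b) ℤ.* 1ℤ ℤ.+ ((1ℤ ℤ.+ 0ℤ) ℤ.* (1ℤ ℤ.+ l) ℤ.+
    ((ℤ.- g ℤ.+ 0ℤ) ℤ.* w ℤ.+ ((ℤ.- g₁ ℤ.+ 0ℤ) ℤ.* w′ ℤ.+ 0ℤ)))
  solve-count n i g g₁ a b l w w′ e e′ =
    trans (regroup n i) (trans (cong₂ ℤ._-_ e e′) (expand g g₁ a b l w w′))
placements-correct y (double a g b) (double c h d) =
  solve-count (+ length (placements (y , double a g b) (double c h d)))
    (+ DoubleDouble.low y a g b c h d) (+ DoubleDouble.high y a g b c h d)
    (+ DoubleDouble.outer y a g b c h d) (+ toℕ g) (+ toℕ h) (+ a) (+ b)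
    (trapped g b h 0) (trapped g b h 1) (trapped g a h 0) (trapped g a h 1)
    (weight length₁ c) (weight length₂ c) (weight length₁ d) (weight length₂ d)
    (cong +_ (DoubleDouble.placements-count y a g b c h d))
    (trapped-weights g c (toℕ h ℕ.∸ b)) (trapped-weights g d (toℕ h ℕ.∸ a)) outer-value
  where
  outer-value : + DoubleDouble.outer y a g b c h d ≡ + 2 ℤ.+ (+ toℕ g ℤ.+ (+ a ℤ.+ + b)) ℤ.- + toℕ h
  outer-value = trans (sym (ℤ.⊖-≥ h≤)) (sym (ℤ.m-n≡m⊖n (2 ℕ.+ (toℕ g ℕ.+ (a ℕ.+ b))) (toℕ h)))
    where
    h≤ : toℕ h ℕ.≤ 2 ℕ.+ (toℕ g ℕ.+ (a ℕ.+ b))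
    h≤ = ℕ.≤-trans (ℤ.drop‿+≤+ (toℕ≤2 h)) (ℕ.m≤m+n 2 _)
  regroup : ∀ n i j → n ≡ (n ℤ.+ (i ℤ.+ j)) ℤ.- (i ℤ.+ j)
  regroup = ℤSolver.solve-∀
  expand : ∀ g h a b t t₁ s s₁ w w′ z z′ →
    + 2 ℤ.+ (g ℤ.+ (a ℤ.+ b)) ℤ.- h ℤ.- (t ℤ.* w ℤ.+ t₁ ℤ.* w′ ℤ.+ (s ℤ.* z ℤ.+ s₁ ℤ.* z′)) ≡
    (+ 2 ℤ.+ g ℤ.+ a ℤ.- h ℤ.+ b) ℤ.* (1ℤ ℤ.* 1ℤ) ℤ.+ ((0ℤ ℤ.+ ℤ.- t) ℤ.* (w ℤ.* 1ℤ) ℤ.+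
    ((0ℤ ℤ.+ ℤ.- t₁) ℤ.* (w′ ℤ.* 1ℤ) ℤ.+ ((ℤ.- s ℤ.+ 0ℤ) ℤ.* (1ℤ ℤ.* z) ℤ.+
    ((ℤ.- s₁ ℤ.+ 0ℤ) ℤ.* (1ℤ ℤ.* z′) ℤ.+ 0ℤ))))
  expand = ℤSolver.solve-∀
  solve-count : ∀ n i j o g h a b t t₁ s s₁ w w′ z z′ → n ℤ.+ (i ℤ.+ j) ≡ o →
    i ≡ t ℤ.* w ℤ.+ t₁ ℤ.* w′ → j ≡ s ℤ.* z ℤ.+ s₁ ℤ.* z′ → o ≡ + 2 ℤ.+ (g ℤ.+ (a ℤ.+ b)) ℤ.- h → n ≡
    (+ 2 ℤ.+ g ℤ.+ a ℤ.- h ℤ.+ b) ℤ.* (1ℤ ℤ.* 1ℤ) ℤ.+ ((0ℤ ℤ.+ ℤ.- t) ℤ.* (w ℤ.* 1ℤ) ℤ.+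
    ((0ℤ ℤ.+ ℤ.- t₁) ℤ.* (w′ ℤ.* 1ℤ) ℤ.+ ((ℤ.- s ℤ.+ 0ℤ) ℤ.* (1ℤ ℤ.* z) ℤ.+
    ((ℤ.- s₁ ℤ.+ 0ℤ) ℤ.* (1ℤ ℤ.* z′) ℤ.+ 0ℤ))))
  solve-count n i j o g h a b t t₁ s s₁ w w′ z z′ e ei ej eo =
    trans (regroup n i j) (trans (cong₂ ℤ._-_ (trans e eo) (cong₂ ℤ._+_ ei ej))
                                 (expand g h a b t t₁ s s₁ w w′ z z′))

tabulateSizes : ∀ {A : Set} → (ℕ → ℕ → List A) → ℕ → List A
tabulateSizes f zero    = []
tabulateSizes f (suc m) = f 0 m ++ tabulateSizes (f ∘ suc) m

length-tabulateSizes : ∀ {A : Set} (f : ℕ → ℕ → List A) m →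
                       + length (tabulateSizes f m) ≡ T (λ k n → + length (f k n)) m
length-tabulateSizes f zero    = refl
length-tabulateSizes f (suc m) = trans (cong +_ (List.length-++ (f 0 m)))
  (cong (λ z → + length (f 0 m) ℤ.+ z) (length-tabulateSizes (f ∘ suc) m))

length-concatMap : ∀ {A B : Set} (f : A → List B) xs →
                   + length (concatMap f xs) ≡ sumOver xs (λ x → + length (f x))
length-concatMap f []       = refl
length-concatMap f (x ∷ xs) = trans (cong +_ (List.length-++ (f x)))
  (cong (λ z → + length (f x) ℤ.+ z) (length-concatMap f xs))

sumOver-constant : ∀ {A : Set} (xs : List A) c → sumOver xs (λ _ → c) ≡ + length xs ℤ.* c
sumOver-constant []       c = refl
sumOver-constant (x ∷ xs) c = trans (cong (λ z → c ℤ.+ z) (sumOver-constant xs c)) (regroup c (+ length xs))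
  where
  regroup : ∀ c n → c ℤ.+ n ℤ.* c ≡ (1ℤ ℤ.+ n) ℤ.* c
  regroup = ℤSolver.solve-∀

endings : ℕ → List (List Column)
endings zero    = [] ∷ []
endings (suc _) = []

extend : (Column → ℕ → List (List Column)) → Column → Shape → ℕ → List (List Column)
extend rec C s n = concatMap (λ p → map ((p , s) ∷_) (rec (p , s) n)) (placements C s)

doublesAt : (Column → ℕ → List (List Column)) → Column → Fin 3 → ℕ → ℕ → List (List Column)
doublesAt rec C h a = tabulateSizes (λ b → extend rec C (double a h b))

singles doubles : (Column → ℕ → List (List Column)) → Column → ℕ → List (List Column)
singles rec C   = tabulateSizes (λ k → extend rec C (single k))
doubles rec C m = concatMap (λ h → tabulateSizes (doublesAt rec C h) m) gaps

-- The continuations of a column by columns with m cells altogether, for m up to the fuel.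
paths : (fuel : ℕ) → Column → ℕ → List (List Column)
paths zero       C m = endings m
paths (suc fuel) C m = endings m ++ (singles (paths fuel) C m ++ doubles (paths fuel) C m)

pathCount : (fuel : ℕ) → Shape → Seq
pathCount zero       s m = δ₀ m
pathCount (suc fuel) s m = δ₀ m ℤ.+
  (T (λ k n → placementCount s (single k) ℤ.* pathCount fuel (single k) n) m ℤ.+
   sumOver gaps (λ h → T (λ a → T (λ b n →
     placementCount s (double a h b) ℤ.* pathCount fuel (double a h b) n)) m))

length-endings : ∀ m → + length (endings m) ≡ δ₀ m
length-endings zero    = refl
length-endings (suc m) = refl

length-paths : ∀ fuel y s m → + length (paths fuel (y , s) m) ≡ pathCount fuel s m
length-paths zero       y s m = length-endings m
length-paths (suc fuel) y s m = trans (cong +_ (List.length-++ (endings m)))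
  (cong₂ ℤ._+_ (length-endings m)
    (trans (cong +_ (List.length-++ (singles (paths fuel) (y , s) m)))
      (cong₂ ℤ._+_
        (trans (length-tabulateSizes (λ k → extend (paths fuel) (y , s) (single k)) m)
               (T-cong (λ k → length-extend (single k)) m))
        (trans (length-concatMap (λ h → tabulateSizes (doublesAt (paths fuel) (y , s) h) m) gaps)
               (sumOver-cong gaps (λ h →
                 trans (length-tabulateSizes (doublesAt (paths fuel) (y , s) h) m)
                       (T-cong (λ a n → trans
                         (length-tabulateSizes (λ b → extend (paths fuel) (y , s) (double a h b)) n)
                         (T-cong (λ b → length-extend (double a h b)) n)) m)))))))
  where
  length-extend : ∀ s′ n → + length (extend (paths fuel) (y , s) s′ n) ≡
                           placementCount s s′ ℤ.* pathCount fuel s′ n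
  length-extend s′ n = trans (length-concatMap (λ p → map ((p , s′) ∷_) (paths fuel (p , s′) n)) (placements (y , s) s′))
    (trans (sumOver-cong (placements (y , s) s′) (λ p →
             trans (cong +_ (List.length-map ((p , s′) ∷_) (paths fuel (p , s′) n))) (length-paths fuel p s′ n)))
    (trans (sumOver-constant (placements (y , s) s′) (pathCount fuel s′ n))
           (cong (ℤ._* pathCount fuel s′ n) (placements-correct y s s′))))

-- Every further column uses at least one cell, so fuel beyond the number of cells changes nothing.
pathCount-stable : ∀ e f s m → m ℕ.≤ e → m ℕ.≤ f → pathCount e s m ≡ pathCount f s m
pathCount-stable zero    zero    s m    _   _   = refl
pathCount-stable zero    (suc f) s zero _   _   = refl
pathCount-stable (suc e) zero    s zero _   _   = refl
pathCount-stable (suc e) (suc f) s m    m≤e m≤f = cong (λ z → δ₀ m ℤ.+ z) (cong₂ ℤ._+_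
  (T-cong< m (λ k n n<m → cong (λ z → placementCount s (single k) ℤ.* z) (smaller (single k) n<m)))
  (sumOver-cong gaps (λ h → T-cong< m (λ a n n<m → T-cong< n (λ b o o<n →
    cong (λ z → placementCount s (double a h b) ℤ.* z) (smaller (double a h b) (ℕ.<-trans o<n n<m)))))))
  where
  smaller : ∀ s′ {n} → n ℕ.< m → pathCount e s′ n ≡ pathCount f s′ n
  smaller s′ {n} n<m = pathCount-stable e f s′ n (ℕ.≤-pred (ℕ.≤-trans n<m m≤e)) (ℕ.≤-pred (ℕ.≤-trans n<m m≤f))

continuations : Shape → Seq
continuations s m = pathCount m s m

open Renewal (λ k → continuations (single k)) (λ g a b → continuations (double a g b)) using (total)

continuations-renewal : ∀ s m → continuations s m ≡ δ₀ m ℤ.+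
  (T (λ k n → placementCount s (single k) ℤ.* continuations (single k) n) m ℤ.+
   sumOver gaps (λ h → T (λ a → T (λ b n →
     placementCount s (double a h b) ℤ.* continuations (double a h b) n)) m))
continuations-renewal s m = trans (pathCount-stable m (suc m) s m ℕ.≤-refl (ℕ.n≤1+n m))
  (cong (λ z → δ₀ m ℤ.+ z) (cong₂ ℤ._+_
    (T-cong< m (λ k n n<m → cong (λ z → placementCount s (single k) ℤ.* z)
      (pathCount-stable m n (single k) n (ℕ.<⇒≤ n<m) ℕ.≤-refl)))
    (sumOver-cong gaps (λ h → T-cong< m (λ a n n<m → T-cong< n (λ b o o<n →
      cong (λ z → placementCount s (double a h b) ℤ.* z)
        (pathCount-stable m o (double a h b) o (ℕ.<⇒≤ (ℕ.<-trans o<n n<m)) ℕ.≤-refl)))))))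

-- The coefficients of s do not depend on the next column and can be pulled out of the sum over it;
-- what remains are the totals.
continuations-expansion : ∀ s m → continuations s m ≡ shapeCoefficient s empty ℤ.* δ₀ m ℤ.+
  (sumOver weights (λ p → shapeCoefficient s (one p) ℤ.* total (one p) m) ℤ.+
   sumOver gaps (λ h → sumOver weightPairs (λ (p , q) → shapeCoefficient s (two h p q) ℤ.* total (two h p q) m)))
continuations-expansion s m = trans (continuations-renewal s m) (cong₂ ℤ._+_
  (trans (sym (ℤ.*-identityˡ (δ₀ m))) (cong (ℤ._* δ₀ m) (sym (empty-shapeCoefficient s))))
  (cong₂ ℤ._+_ from-singles (sumOver-cong gaps from-doubles)))
  where
  empty-shapeCoefficient : ∀ s → shapeCoefficient s empty ≡ 1ℤ
  empty-shapeCoefficient (single k)     = refl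
  empty-shapeCoefficient (double a g b) = refl
  spread : ∀ {A : Set} (xs : List A) (w : A → ℤ) c → sumOver xs w ℤ.* c ≡ sumOver xs (λ x → w x ℤ.* c)
  spread xs w c = trans (ℤ.*-comm (sumOver xs w) c) (trans (sym (sumOver-multiple c xs w))
    (sumOver-cong xs (λ x → ℤ.*-comm c (w x))))
  from-singles : T (λ k n → placementCount s (single k) ℤ.* continuations (single k) n) m ≡
            sumOver weights (λ p → shapeCoefficient s (one p) ℤ.* total (one p) m)
  from-singles = trans (T-cong (λ k n → trans
      (spread weights (λ p → shapeCoefficient s (one p) ℤ.* weight p k) (continuations (single k) n))
      (sumOver-cong weights (λ p → ℤ.*-assoc (shapeCoefficient s (one p)) (weight p k) (continuations (single k) n)))) m)
    (trans (T-sumOver weights (λ p k n → shapeCoefficient s (one p) ℤ.* (weight p k ℤ.* continuations (single k) n)) m)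
           (sumOver-cong weights (λ p → T-multiple (shapeCoefficient s (one p))
             (λ k n → weight p k ℤ.* continuations (single k) n) m)))
  from-doubles : ∀ h → T (λ a → T (λ b n → placementCount s (double a h b) ℤ.* continuations (double a h b) n)) m ≡
            sumOver weightPairs (λ (p , q) → shapeCoefficient s (two h p q) ℤ.* total (two h p q) m)
  from-doubles h = trans (T-cong (λ a n → trans (T-cong (λ b n → trans
      (spread weightPairs (λ (p , q) → shapeCoefficient s (two h p q) ℤ.* (weight p a ℤ.* weight q b)) (continuations (double a h b) n))
      (sumOver-cong weightPairs (λ (p , q) → ℤ.*-assoc (shapeCoefficient s (two h p q)) (weight p a ℤ.* weight q b)
                                               (continuations (double a h b) n)))) n)
      (trans (T-sumOver weightPairs (λ (p , q) b n → shapeCoefficient s (two h p q) ℤ.*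
               (weight p a ℤ.* weight q b ℤ.* continuations (double a h b) n)) n)
             (sumOver-cong weightPairs (λ (p , q) → T-multiple (shapeCoefficient s (two h p q))
               (λ b n → weight p a ℤ.* weight q b ℤ.* continuations (double a h b) n) n)))) m)
    (trans (T-sumOver weightPairs (λ (p , q) a n → shapeCoefficient s (two h p q) ℤ.*
             T (λ b n → weight p a ℤ.* weight q b ℤ.* continuations (double a h b) n) n) m)
           (sumOver-cong weightPairs (λ (p , q) → T-multiple (shapeCoefficient s (two h p q))
             (λ a → T (λ b n → weight p a ℤ.* weight q b ℤ.* continuations (double a h b) n)) m)))

continuations-features : ∀ s m → continuations s m ≡ sumOver features (λ f → shapeCoefficient s f ℤ.* total f m)
continuations-features s m = trans (continuations-expansion s m)
  (cong (λ z → shapeCoefficient s empty ℤ.* δ₀ m ℤ.+ z) (sym (trans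
    (sumOver-++ (map one weights) (concatMap (λ h → map (λ (p , q) → two h p q) weightPairs) gaps) F)
    (cong₂ ℤ._+_ (sumOver-map one weights F)
      (trans (sumOver-concatMap (λ h → map (λ (p , q) → two h p q) weightPairs) gaps F)
             (sumOver-cong gaps (λ h → sumOver-map (λ (p , q) → two h p q) weightPairs F)))))))
  where
  F : Feature → ℤ
  F f = shapeCoefficient s f ℤ.* total f m

-- The first column is a single run by semi-directedness, and starting it at height 0 fixes the
-- vertical translation.
codes : ℕ → List (List Column)
codes n = tabulateSizes (λ k m → map ((0ℤ , single k) ∷_) (paths m (0ℤ , single k) m)) n

codeCount : ℕ → ℕ
codeCount n = length (codes n)

codeCount-rational : denominator ▹ (λ n → + codeCount n) ≗ numerator ▹ δ₀
codeCount-rational n = trans (▹-cong denominator as-total n)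
  (Recurrence.rational (λ k → continuations (single k)) (λ g a b → continuations (double a g b))
    (λ k → continuations-features (single k)) (λ g a b → continuations-features (double a g b)) n)
  where
  as-total : ∀ n → + codeCount n ≡ total (one unit) n
  as-total n = trans (length-tabulateSizes (λ k m → map ((0ℤ , single k) ∷_) (paths m (0ℤ , single k) m)) n)
    (T-cong (λ k m → trans (cong +_ (List.length-map ((0ℤ , single k) ∷_) (paths m (0ℤ , single k) m)))
      (trans (length-paths m 0ℤ (single k) m) (sym (ℤ.*-identityˡ (continuations (single k) m))))) n)

-- The enumeration yields every chain of columns exactly once

runCells : Shape → ℕ
runCells (single k)     = suc k
runCells (double a g b) = suc a ℕ.+ suc b

totalCells : List Column → ℕ
totalCells []             = 0
totalCells ((_ , s) ∷ Cs) = runCells s ℕ.+ totalCells Cs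

data Chain : Column → List Column → Set where
  []  : ∀ {C} → Chain C []
  _∷_ : ∀ {C D Ds} → Follows C D → Chain D Ds → Chain C (D ∷ Ds)

∈-range⁻ : ∀ y n {z} → z ∈ range y n → y ℤ.≤ z × z ℤ.< y ℤ.+ + n
∈-range⁻ y (suc n) (here refl) =
  linear (const 0ℤ :≤ # 1 :⇒ # 0 :≤ # 0 :∧ # 0 :< # 0 :+ (const 1ℤ :+ # 1)) refl (y ∷ + n ∷ []) (0≤+ n)
∈-range⁻ y (suc n) {z} (there i) =
  let l , u = ∈-range⁻ (ℤ.suc y) n i
  in linear (const 1ℤ :+ # 0 :≤ # 2 :⇒ # 2 :< const 1ℤ :+ # 0 :+ # 1 :⇒ # 0 :≤ # 2 :∧ # 2 :< # 0 :+ (const 1ℤ :+ # 1))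
       refl (y ∷ + n ∷ z ∷ []) l u

∈-range⁺ : ∀ y n {z} → y ℤ.≤ z → z ℤ.< y ℤ.+ + n → z ∈ range y n
∈-range⁺ y zero    {z} l u = ⊥-elim (linear (# 0 :≤ # 1 :⇒ # 1 :< # 0 :+ const 0ℤ :⇒ :⊥) refl (y ∷ z ∷ []) l u)
∈-range⁺ y (suc n) {z} l u with z ℤ.≟ y
... | yes refl = here refl
... | no z≢y   = there (∈-range⁺ (ℤ.suc y) n
  (linear (# 0 :≤ # 1 :⇒ (# 1 :≡ # 0 :⇒ :⊥) :⇒ const 1ℤ :+ # 0 :≤ # 1) refl (y ∷ z ∷ []) l z≢y)
  (linear (# 2 :< # 0 :+ (const 1ℤ :+ # 1) :⇒ # 2 :< const 1ℤ :+ # 0 :+ # 1) refl (y ∷ + n ∷ z ∷ []) u))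

range-unique : ∀ y n → Unique (range y n)
range-unique y zero    = []
range-unique y (suc n) = All.tabulate (λ {z} i y≡z → linear
  (const 1ℤ :+ # 0 :≤ # 1 :⇒ # 0 :≡ # 1 :⇒ :⊥) refl (y ∷ z ∷ []) (proj₁ (∈-range⁻ (ℤ.suc y) n i)) y≡z)
  ∷ range-unique (ℤ.suc y) n

placements-sound : ∀ C s {p} → p ∈ placements C s → Follows C (p , s)
placements-sound C s i = proj₂ (∈-filter⁻ (λ p → follows? C (p , s)) {xs = candidates C s} i)

near-candidate : ∀ y s s′ p → (∃[ r ] r ∈ runs (y , s) × RunsTouch r (p , p ℤ.+ + lowerExtent s′)) → p ∈ candidates (y , s) s′
near-candidate y s s′ p (r , r∈ , touch) =
  let l , u = bounds s r∈ touch
  in ∈-range⁺ (y ℤ.- + suc (lowerExtent s′)) (2 ℕ.+ (lowerExtent s′ ℕ.+ span s)) l u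
  where
  C : ℕ
  C = lowerExtent s′
  bounds : ∀ s {r} → r ∈ runs (y , s) → RunsTouch r (p , p ℤ.+ + C) →
           y ℤ.- + suc C ℤ.≤ p × p ℤ.< y ℤ.- + suc C ℤ.+ + (2 ℕ.+ (C ℕ.+ span s))
  bounds (single k) (here refl) (t , t′) = linear
    (# 0 :≤ const 1ℤ :+ (# 1 :+ # 2) :⇒ # 1 :≤ # 0 :+ # 3 :⇒
     # 0 :- (const 1ℤ :+ # 2) :≤ # 1 :∧ # 1 :< # 0 :- (const 1ℤ :+ # 2) :+ (const (+ 2) :+ (# 2 :+ # 3)))
    refl (y ∷ p ∷ + C ∷ + k ∷ []) t t′
  bounds (double a g b) (here refl) (t , t′) = linear
    (const 0ℤ :≤ # 4 :⇒ const 0ℤ :≤ # 5 :⇒ # 0 :≤ const 1ℤ :+ (# 1 :+ # 2) :⇒ # 1 :≤ # 0 :+ # 3 :⇒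
     # 0 :- (const 1ℤ :+ # 2) :≤ # 1 :∧
     # 1 :< # 0 :- (const 1ℤ :+ # 2) :+ (const (+ 2) :+ (# 2 :+ (const (+ 2) :+ (# 4 :+ (# 3 :+ # 5))))))
    refl (y ∷ p ∷ + C ∷ + a ∷ + toℕ g ∷ + b ∷ []) (0≤+ (toℕ g)) (0≤+ b) t t′
  bounds (double a g b) (there (here refl)) (t , t′) = linear
    (const 0ℤ :≤ # 3 :⇒ const 0ℤ :≤ # 4 :⇒ # 0 :+ # 3 :+ # 4 :+ const (+ 2) :≤ const 1ℤ :+ (# 1 :+ # 2) :⇒
     # 1 :≤ # 0 :+ # 3 :+ # 4 :+ const (+ 2) :+ # 5 :⇒
     # 0 :- (const 1ℤ :+ # 2) :≤ # 1 :∧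
     # 1 :< # 0 :- (const 1ℤ :+ # 2) :+ (const (+ 2) :+ (# 2 :+ (const (+ 2) :+ (# 4 :+ (# 3 :+ # 5))))))
    refl (y ∷ p ∷ + C ∷ + a ∷ + toℕ g ∷ + b ∷ []) (0≤+ a) (0≤+ (toℕ g)) t t′

placements-complete : ∀ C s {p} → Follows C (p , s) → p ∈ placements C s
placements-complete (y , s) s′ {p} h = ∈-filter⁺ (λ p → follows? (y , s) (p , s′)) (near-candidate y s s′ p (lowest s′ h)) h
  where
  lowest : ∀ s′ → Follows (y , s) (p , s′) → ∃[ r ] r ∈ runs (y , s) × RunsTouch r (p , p ℤ.+ + lowerExtent s′)
  lowest (single k)     (t ∷ _) = Any.lookup t , ∈-lookup (Any.index t) , Any.lookup-result t
  lowest (double a g b) (t ∷ _) = Any.lookup t , ∈-lookup (Any.index t) , Any.lookup-result t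

placements-unique : ∀ C s → Unique (placements C s)
placements-unique (y , s) s′ = Unique.filter⁺ (λ p → follows? (y , s) (p , s′))
  (range-unique (y ℤ.- + suc (lowerExtent s′)) (2 ℕ.+ (lowerExtent s′ ℕ.+ span s)))

module _ {A : Set} where

  ∈-tabulateSizes⁻ : ∀ (f : ℕ → ℕ → List A) m {x} → x ∈ tabulateSizes f m →
                     ∃[ k ] ∃[ n ] suc k ℕ.+ n ≡ m × x ∈ f k n
  ∈-tabulateSizes⁻ f (suc m) i with ∈-++⁻ (f 0 m) i
  ... | inj₁ j = 0 , m , refl , j
  ... | inj₂ j with ∈-tabulateSizes⁻ (f ∘ suc) m j
  ...   | k , n , e , h = suc k , n , cong suc e , h

  ∈-tabulateSizes⁺ : ∀ (f : ℕ → ℕ → List A) k n {x} → x ∈ f k n → x ∈ tabulateSizes f (suc k ℕ.+ n)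
  ∈-tabulateSizes⁺ f zero    n i = ∈-++⁺ˡ i
  ∈-tabulateSizes⁺ f (suc k) n i = ∈-++⁺ʳ (f 0 (suc k ℕ.+ n)) (∈-tabulateSizes⁺ (f ∘ suc) k n i)

  tabulateSizes-unique : ∀ (f : ℕ → ℕ → List A) m → (∀ k n → n ℕ.< m → Unique (f k n)) →
    (∀ {k n k′ n′ x} → x ∈ f k n → x ∈ f k′ n′ → k ≡ k′) → Unique (tabulateSizes f m)
  tabulateSizes-unique f zero    u d = []
  tabulateSizes-unique f (suc m) u d = Unique.++⁺ (u 0 m ℕ.≤-refl)
    (tabulateSizes-unique (f ∘ suc) m (λ k n n<m → u (suc k) n (ℕ.m≤n⇒m≤1+n n<m)) (λ i j → ℕ.suc-injective (d i j)))
    (λ (i , j) → let k , n , _ , h = ∈-tabulateSizes⁻ (f ∘ suc) m j in ℕ.0≢1+n (d i h))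

  concatMap-unique : ∀ {B : Set} (f : B → List A) {xs} → Unique xs → (∀ x → Unique (f x)) →
    (∀ {x y z} → z ∈ f x → z ∈ f y → x ≡ y) → Unique (concatMap f xs)
  concatMap-unique f []            u d = []
  concatMap-unique f (_∷_ {x} {xs} x∉ uxs) u d = Unique.++⁺ (u x) (concatMap-unique f uxs u d)
    (λ (i , j) → absurd i (∈-concatMap⁻ f {xs = xs} j))
    where
    absurd : ∀ {z} → z ∈ f x → Any (λ y → z ∈ f y) xs → ⊥
    absurd i a with find-pair a
      where
      find-pair : ∀ {z ys} → Any (λ y → z ∈ f y) ys → ∃[ y ] y ∈ ys × z ∈ f y
      find-pair (here h)  = _ , here refl , h
      find-pair (there a) = let y , y∈ , h = find-pair a in y , there y∈ , h
    ... | y , y∈ , h = All.lookup x∉ y∈ (d i h)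

∈-extend⁻ : ∀ rec C s n {Cs} → Cs ∈ extend rec C s n →
            ∃[ p ] ∃[ Ds ] Cs ≡ (p , s) ∷ Ds × p ∈ placements C s × Ds ∈ rec (p , s) n
∈-extend⁻ rec C s n i with find-pair (∈-concatMap⁻ (λ p → map ((p , s) ∷_) (rec (p , s) n)) {xs = placements C s} i)
  where
  find-pair : ∀ {Cs ps} → Any (λ p → Cs ∈ map ((p , s) ∷_) (rec (p , s) n)) ps →
              ∃[ p ] p ∈ ps × Cs ∈ map ((p , s) ∷_) (rec (p , s) n)
  find-pair (here h)  = _ , here refl , h
  find-pair (there a) = let p , p∈ , h = find-pair a in p , there p∈ , h
... | p , p∈ , h with ∈-map⁻ ((p , s) ∷_) h
...   | Ds , Ds∈ , e = p , Ds , e , p∈ , Ds∈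

∈-extend⁺ : ∀ rec C s n {p Ds} → p ∈ placements C s → Ds ∈ rec (p , s) n → (p , s) ∷ Ds ∈ extend rec C s n
∈-extend⁺ rec C s n {p} {Ds} p∈ Ds∈ = ∈-concatMap⁺ (λ q → map ((q , s) ∷_) (rec (q , s) n))
  (Any.map (λ { refl → ∈-map⁺ ((p , s) ∷_) Ds∈ }) p∈)

extend-unique : ∀ rec C s n → (∀ D → Unique (rec D n)) → Unique (extend rec C s n)
extend-unique rec C s n u = concatMap-unique (λ p → map ((p , s) ∷_) (rec (p , s) n)) (placements-unique C s)
  (λ p → Unique.map⁺ (λ e → proj₂ (List.∷-injective e)) (u (p , s)))
  (λ {p} {q} i j → let _ , _ , e = ∈-map⁻ ((p , s) ∷_) i
                       _ , _ , e′ = ∈-map⁻ ((q , s) ∷_) j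
                   in cong proj₁ (proj₁ (List.∷-injective (trans (sym e) e′))))

-- The head of a list records the shape it was extended by, which keeps the blocks of the
-- enumeration disjoint.
extend-shape : ∀ {rec rec′ C C′ s s′ n n′ Cs} → Cs ∈ extend rec C s n → Cs ∈ extend rec′ C′ s′ n′ → s ≡ s′
extend-shape {rec} {rec′} {C} {C′} {s} {s′} {n} {n′} i j =
  let _ , _ , e , _ = ∈-extend⁻ rec C s n i
      _ , _ , e′ , _ = ∈-extend⁻ rec′ C′ s′ n′ j
  in cong proj₂ (proj₁ (List.∷-injective (trans (sym e) e′)))

IsPath : Column → ℕ → List Column → Set
IsPath C m Cs = Chain C Cs × totalCells Cs ≡ m

paths-sound : ∀ fuel C m {Cs} → m ℕ.≤ fuel → Cs ∈ paths fuel C m → IsPath C m Cs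
paths-sound zero       C zero m≤ (here refl) = [] , refl
paths-sound (suc fuel) C m m≤ i with ∈-++⁻ (endings m) i
paths-sound (suc fuel) C zero m≤ i | inj₁ (here refl) = [] , refl
paths-sound (suc fuel) C m m≤ i | inj₂ j with ∈-++⁻ (singles (paths fuel) C m) j
... | inj₁ i₁ = let k , n , e , h = ∈-tabulateSizes⁻ (λ k → extend (paths fuel) C (single k)) m i₁
                    p , Ds , e′ , p∈ , Ds∈ = ∈-extend⁻ (paths fuel) C (single k) n h
                    n≤ = ℕ.≤-pred (ℕ.≤-trans (ℕ.≤-trans (s≤s (ℕ.m≤n+m n k)) (ℕ.≤-reflexive e)) m≤)
                    chain , total = paths-sound fuel (p , single k) n n≤ Ds∈
                in subst (IsPath C m) (sym e′)
                     (placements-sound C (single k) p∈ ∷ chain , trans (cong (suc k ℕ.+_) total) e)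
... | inj₂ i₂ = doubled (∈-concatMap⁻ (λ h → tabulateSizes (doublesAt (paths fuel) C h) m) {xs = gaps} i₂)
  where
  at : ∀ {Cs} h → Cs ∈ tabulateSizes (doublesAt (paths fuel) C h) m → IsPath C m Cs
  at h i =
    let a , n , e , j = ∈-tabulateSizes⁻ (doublesAt (paths fuel) C h) m i
        b , o , e′ , k = ∈-tabulateSizes⁻ (λ b → extend (paths fuel) C (double a h b)) n j
        p , Ds , e″ , p∈ , Ds∈ = ∈-extend⁻ (paths fuel) C (double a h b) o k
        o<n = ℕ.≤-trans (s≤s (ℕ.m≤n+m o b)) (ℕ.≤-reflexive e′)
        n<m = ℕ.≤-trans (s≤s (ℕ.m≤n+m n a)) (ℕ.≤-reflexive e)
        chain , total = paths-sound fuel (p , double a h b) o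
                          (ℕ.≤-pred (ℕ.≤-trans (ℕ.<-trans o<n n<m) m≤)) Ds∈
    in subst (IsPath C m) (sym e″) (placements-sound C (double a h b) p∈ ∷ chain ,
         trans (ℕ.+-assoc (suc a) (suc b) (totalCells Ds))
               (trans (cong (suc a ℕ.+_) (trans (cong (suc b ℕ.+_) total) e′)) e))
  doubled : ∀ {Cs hs} → Any (λ h → Cs ∈ tabulateSizes (doublesAt (paths fuel) C h) m) hs →
            IsPath C m Cs
  doubled (here {h} i) = at h i
  doubled (there i)    = doubled i

∈-gaps : ∀ h → h ∈ gaps
∈-gaps 0F = here refl
∈-gaps 1F = there (here refl)
∈-gaps 2F = there (there (here refl))

paths-complete : ∀ fuel C Cs → Chain C Cs → totalCells Cs ℕ.≤ fuel → Cs ∈ paths fuel C (totalCells Cs)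
paths-complete zero       C [] [] _ = here refl
paths-complete (suc fuel) C [] [] _ = here refl
paths-complete zero C ((p , single k) ∷ Cs)     _ ()
paths-complete zero C ((p , double a g b) ∷ Cs) _ ()
paths-complete (suc fuel) C ((p , single k) ∷ Cs) (h ∷ c) (s≤s ≤fuel) =
  ∈-++⁺ˡ (∈-tabulateSizes⁺ (λ k → extend (paths fuel) C (single k)) k (totalCells Cs)
    (∈-extend⁺ (paths fuel) C (single k) (totalCells Cs) (placements-complete C (single k) h)
      (paths-complete fuel (p , single k) Cs c (ℕ.≤-trans (ℕ.m≤n+m (totalCells Cs) k) ≤fuel))))
paths-complete (suc fuel) C ((p , double a g b) ∷ Cs) (h ∷ c) (s≤s ≤fuel) =
  ∈-++⁺ʳ (singles (paths fuel) C m) (∈-concatMap⁺ (λ h → tabulateSizes (doublesAt (paths fuel) C h) m)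
    (Any.map (λ { refl → member }) (∈-gaps g)))
  where
  n m : ℕ
  n = totalCells Cs
  m = suc a ℕ.+ suc b ℕ.+ n
  n≤fuel : n ℕ.≤ fuel
  n≤fuel = ℕ.≤-trans (ℕ.m≤n+m n (a ℕ.+ suc b)) ≤fuel
  member : (p , double a g b) ∷ Cs ∈ tabulateSizes (doublesAt (paths fuel) C g) m
  member = subst (λ k → (p , double a g b) ∷ Cs ∈ tabulateSizes (doublesAt (paths fuel) C g) k)
    (sym (ℕ.+-assoc (suc a) (suc b) n))
    (∈-tabulateSizes⁺ (doublesAt (paths fuel) C g) a (suc b ℕ.+ n)
      (∈-tabulateSizes⁺ (λ b → extend (paths fuel) C (double a g b)) b n
        (∈-extend⁺ (paths fuel) C (double a g b) n (placements-complete C (double a g b) h)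
          (paths-complete fuel (p , double a g b) Cs c n≤fuel))))

single-injective : ∀ {k l} → single k ≡ single l → k ≡ l
single-injective refl = refl

double-injective : ∀ {a g b c h d} → double a g b ≡ double c h d → a ≡ c × g ≡ h × b ≡ d
double-injective refl = refl , refl , refl

paths-unique : ∀ fuel C m → Unique (paths fuel C m)
paths-unique fuel C m = go fuel C m
  where
  endings-unique : ∀ m → Unique (endings m)
  endings-unique zero    = [] ∷ []
  endings-unique (suc m) = []

  gaps-unique : Unique gaps
  gaps-unique = ((λ ()) ∷ (λ ()) ∷ []) ∷ ((λ ()) ∷ []) ∷ [] ∷ []

  go : ∀ fuel C m → Unique (paths fuel C m)
  go zero       C m = endings-unique m
  go (suc fuel) C m = Unique.++⁺ (endings-unique m)
    (Unique.++⁺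
      (tabulateSizes-unique (λ k → extend (paths fuel) C (single k)) m
        (λ k n _ → extend-unique (paths fuel) C (single k) n (λ D → go fuel D n))
        (λ {k} {n} {k′} {n′} i j → single-injective (extend-shape {paths fuel} {paths fuel} {C} {C} {single k} {single k′} {n} {n′} i j)))
      (concatMap-unique (λ h → tabulateSizes (doublesAt (paths fuel) C h) m) gaps-unique
        (λ h → tabulateSizes-unique (doublesAt (paths fuel) C h) m
          (λ a n _ → tabulateSizes-unique (λ b → extend (paths fuel) C (double a h b)) n
            (λ b o _ → extend-unique (paths fuel) C (double a h b) o (λ D → go fuel D o))
            (λ {b} {o} {b′} {o′} i j → proj₂ (proj₂ (double-injective
              (extend-shape {paths fuel} {paths fuel} {C} {C} {double a h b} {double a h b′} {o} {o′} i j)))))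
          (λ {a} {n} {a′} {n′} i j → proj₁ (same-double h h {a} {a′} {n} {n′} i j)))
        (λ {h} {h′} i j →
          let a , n , _ , i′ = ∈-tabulateSizes⁻ (doublesAt (paths fuel) C h) m i
              a′ , n′ , _ , j′ = ∈-tabulateSizes⁻ (doublesAt (paths fuel) C h′) m j
          in proj₂ (same-double h h′ {a} {a′} {n} {n′} i′ j′)))
      (λ (i , j) → single≢double i (∈-concatMap⁻ (λ h → tabulateSizes (doublesAt (paths fuel) C h) m) {xs = gaps} j)))
    (λ (i , j) → ending-disjoint m i j)
    where
    same-double : ∀ h h′ {a a′ n n′ Cs} → Cs ∈ doublesAt (paths fuel) C h a n →
                  Cs ∈ doublesAt (paths fuel) C h′ a′ n′ → a ≡ a′ × h ≡ h′
    same-double h h′ {a} {a′} {n} {n′} i j =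
      let b , o , _ , i′ = ∈-tabulateSizes⁻ (λ b → extend (paths fuel) C (double a h b)) n i
          b′ , o′ , _ , j′ = ∈-tabulateSizes⁻ (λ b → extend (paths fuel) C (double a′ h′ b)) n′ j
          e , e′ , _ = double-injective (extend-shape {paths fuel} {paths fuel} {C} {C} {double a h b} {double a′ h′ b′} {o} {o′} i′ j′)
      in e , e′
    single≢double : ∀ {Cs hs} → Cs ∈ singles (paths fuel) C m →
      Any (λ h → Cs ∈ tabulateSizes (doublesAt (paths fuel) C h) m) hs → ⊥
    single≢double i (there j)    = single≢double i j
    single≢double i (here {h} j) =
      let k , n , _ , i′ = ∈-tabulateSizes⁻ (λ k → extend (paths fuel) C (single k)) m i
          a , o , _ , j′ = ∈-tabulateSizes⁻ (doublesAt (paths fuel) C h) m j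
          b , q , _ , j″ = ∈-tabulateSizes⁻ (λ b → extend (paths fuel) C (double a h b)) o j′
      in case-impossible (extend-shape {paths fuel} {paths fuel} {C} {C} {single k} {double a h b} {n} {q} i′ j″)
      where
      case-impossible : ∀ {k a g b} → single k ≡ double a g b → ⊥
      case-impossible ()
    ending-disjoint : ∀ m {Cs} → Cs ∈ endings m → Cs ∈ singles (paths fuel) C m ++ doubles (paths fuel) C m → ⊥
    ending-disjoint zero (here refl) j = nothing-left j
      where
      nothing-left : ∀ {Cs} → Cs ∈ doubles (paths fuel) C 0 → ⊥
      nothing-left ()

IsCode : ℕ → List Column → Set
IsCode n Cs = ∃[ k ] ∃[ Ds ] Cs ≡ (0ℤ , single k) ∷ Ds × Chain (0ℤ , single k) Ds × totalCells Cs ≡ n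

codes-sound : ∀ n {Cs} → Cs ∈ codes n → IsCode n Cs
codes-sound n i =
  let k , m , e , j = ∈-tabulateSizes⁻ (λ k m → map ((0ℤ , single k) ∷_) (paths m (0ℤ , single k) m)) n i
      Ds , Ds∈ , e′ = ∈-map⁻ ((0ℤ , single k) ∷_) j
      chain , total = paths-sound m (0ℤ , single k) m ℕ.≤-refl Ds∈
  in k , Ds , e′ , chain , trans (cong totalCells e′) (trans (cong (suc k ℕ.+_) total) e)

codes-complete : ∀ {n Cs} → IsCode n Cs → Cs ∈ codes n
codes-complete (k , Ds , refl , chain , refl) =
  ∈-tabulateSizes⁺ (λ k m → map ((0ℤ , single k) ∷_) (paths m (0ℤ , single k) m)) k (totalCells Ds)
    (∈-map⁺ ((0ℤ , single k) ∷_) (paths-complete (totalCells Ds) (0ℤ , single k) Ds chain ℕ.≤-refl))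

codes-unique : ∀ n → Unique (codes n)
codes-unique n = tabulateSizes-unique (λ k m → map ((0ℤ , single k) ∷_) (paths m (0ℤ , single k) m)) n
  (λ k m _ → Unique.map⁺ (λ e → proj₂ (List.∷-injective e)) (paths-unique m (0ℤ , single k) m))
  (λ {k} {m} {k′} {m′} i j →
    let _ , _ , e = ∈-map⁻ ((0ℤ , single k) ∷_) i
        _ , _ , e′ = ∈-map⁻ ((0ℤ , single k′) ∷_) j
    in single-injective (cong proj₂ (proj₁ (List.∷-injective (trans (sym e) e′)))))

-- From lists of columns to polyominoes

heights : Column → List ℤ
heights (y , single k)     = range y (suc k)
heights (y , double a g b) = range y (suc a) ++ range (upperStart y a g) (suc b)

InRun : ℤ → Run → Set
InRun z (b , t) = b ℤ.≤ z × z ℤ.≤ t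

InColumn : ℤ → Column → Set
InColumn z C = Any (InRun z) (runs C)

range-run : ∀ y n {z} → z ∈ range y (suc n) → InRun z (y , y ℤ.+ + n)
range-run y n {z} i = let l , u = ∈-range⁻ y (suc n) i in l ,
  linear (# 2 :< # 0 :+ (const 1ℤ :+ # 1) :⇒ # 2 :≤ # 0 :+ # 1) refl (y ∷ + n ∷ z ∷ []) u

run-range : ∀ y n {z} → InRun z (y , y ℤ.+ + n) → z ∈ range y (suc n)
run-range y n {z} (l , u) = ∈-range⁺ y (suc n) l
  (linear (# 2 :≤ # 0 :+ # 1 :⇒ # 2 :< # 0 :+ (const 1ℤ :+ # 1)) refl (y ∷ + n ∷ z ∷ []) u)

∈-heights⁻ : ∀ C {z} → z ∈ heights C → InColumn z C
∈-heights⁻ (y , single k)     i = here (range-run y k i)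
∈-heights⁻ (y , double a g b) i with ∈-++⁻ (range y (suc a)) i
... | inj₁ j = here (range-run y a j)
... | inj₂ j = there (here (range-run (upperStart y a g) b j))

∈-heights⁺ : ∀ C {z} → InColumn z C → z ∈ heights C
∈-heights⁺ (y , single k)     (here h)         = run-range y k h
∈-heights⁺ (y , double a g b) (here h)         = ∈-++⁺ˡ (run-range y a h)
∈-heights⁺ (y , double a g b) (there (here h)) = ∈-++⁺ʳ (range y (suc a)) (run-range (upperStart y a g) b h)

runs-disjoint : ∀ y a (g : Fin 3) b {z} → InRun z (y , y ℤ.+ + a) →
                InRun z (upperStart y a g , upperStart y a g ℤ.+ + b) → ⊥
runs-disjoint y a g b {z} (_ , u) (l , _) = linear
  (const 0ℤ :≤ # 2 :⇒ # 3 :≤ # 0 :+ # 1 :⇒ # 0 :+ # 1 :+ # 2 :+ const (+ 2) :≤ # 3 :⇒ :⊥)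
  refl (y ∷ + a ∷ + toℕ g ∷ z ∷ []) (0≤+ (toℕ g)) u l

heights-unique : ∀ C → Unique (heights C)
heights-unique (y , single k)     = range-unique y (suc k)
heights-unique (y , double a g b) = Unique.++⁺ (range-unique y (suc a)) (range-unique (upperStart y a g) (suc b))
  (λ (i , j) → runs-disjoint y a g b (range-run y a i) (range-run (upperStart y a g) b j))

length-range : ∀ y n → length (range y n) ≡ n
length-range y zero    = refl
length-range y (suc n) = cong suc (length-range (ℤ.suc y) n)

length-heights : ∀ y s → length (heights (y , s)) ≡ runCells s
length-heights y (single k)     = length-range y (suc k)
length-heights y (double a g b) = trans (List.length-++ (range y (suc a)))
  (cong₂ ℕ._+_ (length-range y (suc a)) (length-range (upperStart y a g) (suc b)))

place : ℤ → List Column → List Cell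
place x []       = []
place x (C ∷ Cs) = map (x ,_) (heights C) ++ place (ℤ.suc x) Cs

data At : ℤ → List Column → ℤ → Column → Set where
  here  : ∀ {x C Cs} → At x (C ∷ Cs) x C
  there : ∀ {x C Cs x′ D} → At (ℤ.suc x) Cs x′ D → At x (C ∷ Cs) x′ D

place⁻ : ∀ x Cs {x′ z} → (x′ , z) ∈ place x Cs → ∃[ D ] At x Cs x′ D × InColumn z D
place⁻ x (C ∷ Cs) i with ∈-++⁻ (map (x ,_) (heights C)) i
... | inj₁ j with ∈-map⁻ (x ,_) j
...   | _ , z∈ , refl = C , here , ∈-heights⁻ C z∈
place⁻ x (C ∷ Cs) i | inj₂ j with place⁻ (ℤ.suc x) Cs j
...   | D , at , z∈ = D , there at , z∈

place⁺ : ∀ {x Cs x′ D z} → At x Cs x′ D → InColumn z D → (x′ , z) ∈ place x Cs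
place⁺ {x} {C ∷ Cs} here       h = ∈-++⁺ˡ (∈-map⁺ (x ,_) (∈-heights⁺ C h))
place⁺ {x} {C ∷ Cs} (there at) h = ∈-++⁺ʳ (map (x ,_) (heights C)) (place⁺ at h)

At-≤ : ∀ {x Cs x′ D} → At x Cs x′ D → x ℤ.≤ x′
At-≤ here       = ℤ.≤-refl
At-≤ (there at) = ℤ.≤-trans (ℤ.i≤suc[i] _) (At-≤ at)

suc≰ : ∀ {x} → ¬ ℤ.suc x ℤ.≤ x
suc≰ {x} = linear (const 1ℤ :+ # 0 :≤ # 0 :⇒ :⊥) refl (x ∷ [])

At-functional : ∀ {x Cs x′ D E} → At x Cs x′ D → At x Cs x′ E → D ≡ E
At-functional here       here       = refl
At-functional here       (there at) = ⊥-elim (suc≰ (At-≤ at))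
At-functional (there at) here       = ⊥-elim (suc≰ (At-≤ at))
At-functional (there at) (there bt) = At-functional at bt

At-follows : ∀ {x C Ds x′ x″ D E} → Chain C Ds → At x (C ∷ Ds) x′ D → At x (C ∷ Ds) x″ E → x″ ≡ ℤ.suc x′ → Follows D E
At-follows {x} c (here) here e = ⊥-elim (linear (# 0 :≡ const 1ℤ :+ # 0 :⇒ :⊥) refl (x ∷ []) e)
At-follows (h ∷ c) here (there here) e = h
At-follows {x} (h ∷ c) here (there (there bt)) refl = ⊥-elim (suc≰ (At-≤ bt))
At-follows {x} {x′ = x′} c (there at) here e = ⊥-elim (linear
  (const 1ℤ :+ # 0 :≤ # 1 :⇒ # 0 :≡ const 1ℤ :+ # 1 :⇒ :⊥) refl (x ∷ x′ ∷ []) (At-≤ at) e)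
At-follows (h ∷ c) (there at) (there bt) e = At-follows c at bt e

At-next : ∀ {x Cs x′ D x″ E} → At x Cs x′ D → At x Cs x″ E → x′ ℤ.< x″ → ∃[ F ] At x Cs (ℤ.suc x′) F
At-next here       here                    x<x = ⊥-elim (ℤ.<-irrefl refl x<x)
At-next here       (there {Cs = F ∷ _} bt) _   = F , there here
At-next (there at) (there bt)              lt  = let F , ft = At-next at bt lt in F , there ft
At-next (there at) here                    lt  = ⊥-elim (ℤ.<-irrefl refl (ℤ.<-≤-trans lt (ℤ.≤-trans (ℤ.i≤suc[i] _) (At-≤ at))))

place-unique : ∀ x Cs → Unique (place x Cs)
place-unique x []       = []
place-unique x (C ∷ Cs) = Unique.++⁺ (Unique.map⁺ (cong proj₂) (heights-unique C)) (place-unique (ℤ.suc x) Cs) disjoint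
  where
  disjoint : ∀ {c} → c ∈ map (x ,_) (heights C) × c ∈ place (ℤ.suc x) Cs → ⊥
  disjoint (i , j) with ∈-map⁻ (x ,_) i
  ... | _ , _ , refl = suc≰ (At-≤ (proj₁ (proj₂ (place⁻ (ℤ.suc x) Cs j))))

length-place : ∀ x Cs → length (place x Cs) ≡ totalCells Cs
length-place x []             = refl
length-place x ((y , s) ∷ Cs) = trans (List.length-++ (map (x ,_) (heights (y , s))))
  (cong₂ ℕ._+_ (trans (List.length-map (x ,_) (heights (y , s))) (length-heights y s)) (length-place (ℤ.suc x) Cs))

lowest-in-column : ∀ y s → InColumn y (y , s)
lowest-in-column y (single k)     = here (linear (const 0ℤ :≤ # 1 :⇒ # 0 :≤ # 0 :∧ # 0 :≤ # 0 :+ # 1) refl (y ∷ + k ∷ []) (0≤+ k))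
lowest-in-column y (double a g b) = here (linear (const 0ℤ :≤ # 1 :⇒ # 0 :≤ # 0 :∧ # 0 :≤ # 0 :+ # 1) refl (y ∷ + a ∷ []) (0≤+ a))

run-inhabited : ∀ C {r} → r ∈ runs C → proj₁ r ℤ.≤ proj₂ r
run-inhabited (y , single k)     (here refl)         = ℤ.i≤i+j y (+ k)
run-inhabited (y , double a g b) (here refl)         = ℤ.i≤i+j y (+ a)
run-inhabited (y , double a g b) (there (here refl)) = ℤ.i≤i+j (upperStart y a g) (+ b)

run-in-column : ∀ {C r z} → r ∈ runs C → InRun z r → InColumn z C
run-in-column r∈ h = Any.map (λ { refl → h }) r∈

-- If the runs overlap in height, the higher of the two lower ends is a height common to both.
-- Otherwise s ends just below r, and the slanted edge (1 , -1) joins them.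
contact : ∀ x {r s} → proj₁ r ℤ.≤ proj₂ r → proj₁ s ℤ.≤ proj₂ s → RunsTouch r s →
          ∃[ y ] ∃[ z ] InRun y r × InRun z s × ShareEdge (x , y) (ℤ.suc x , z)
contact x {b , t} {b′ , t′} b≤t b′≤t′ (touch₁ , touch₂) with b ℤ.≤? b′
... | yes b≤b′ = b′ , b′ , (b≤b′ , touch₂) , (ℤ.≤-refl , b′≤t′) ,
                 (+ 1 , + 0) , there (there (here refl)) , cong₂ _,_ (ℤ.+-comm 1ℤ x) (sym (ℤ.+-identityʳ b′))
... | no b≰b′ with b ℤ.≤? t′
...   | yes b≤t′ = b , b , (ℤ.≤-refl , b≤t) , (ℤ.<⇒≤ (ℤ.≰⇒> b≰b′) , b≤t′) ,
                   (+ 1 , + 0) , there (there (here refl)) , cong₂ _,_ (ℤ.+-comm 1ℤ x) (sym (ℤ.+-identityʳ b))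
...   | no b≰t′  = b , t′ , (ℤ.≤-refl , b≤t) , (b′≤t′ , ℤ.≤-refl) ,
                   (+ 1 , ℤ.-1ℤ) , there (there (there (here refl))) , cong₂ _,_ (ℤ.+-comm 1ℤ x)
                   (linear (# 0 :≤ const 1ℤ :+ # 1 :⇒ (# 0 :≤ # 1 :⇒ :⊥) :⇒ # 1 :≡ # 0 :+ const ℤ.-1ℤ)
                     refl (b ∷ t′ ∷ []) touch₁ b≰t′)

ShareEdge-sym : ∀ {c d} → ShareEdge c d → ShareEdge d c
ShareEdge-sym {c} {d} (δ , δ∈ , e) = neg δ , opposite δ∈ , sym (trans (cong (_⊹ neg δ) e) (back c δ))
  where
  opposite : ∀ {δ} → δ ∈ edgeVectors → neg δ ∈ edgeVectors
  opposite (here refl)                                         = there (here refl)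
  opposite (there (here refl))                                 = here refl
  opposite (there (there (here refl)))                         = there (there (there (there (here refl))))
  opposite (there (there (there (here refl))))                 = there (there (there (there (there (here refl)))))
  opposite (there (there (there (there (here refl)))))         = there (there (here refl))
  opposite (there (there (there (there (there (here refl)))))) = there (there (there (here refl)))
  back : ∀ c δ → (c ⊹ δ) ⊹ neg δ ≡ c
  back (x , y) (u , v) = cong₂ _,_ (cancel x u) (cancel y v)
    where
    cancel : ∀ x u → x ℤ.+ u ℤ.+ ℤ.- u ≡ x
    cancel = ℤSolver.solve-∀

Star-reverse : ∀ {P c d} → c ∈ P → Star (Step P) c d → Star (Step P) d c
Star-reverse c∈ Star.ε              = Star.ε
Star-reverse c∈ ((e , d∈) ◅ w) = Star-reverse d∈ w ◅◅ ((ShareEdge-sym e , c∈) ◅ Star.ε)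

ℤ-difference : ∀ {b z} → b ℤ.≤ z → ∃[ n ] z ≡ b ℤ.+ + n
ℤ-difference {b} {z} b≤z = ℤ.∣ z ℤ.- b ∣ , trans (split z b)
  (cong (λ y → b ℤ.+ y) (sym (ℤ.0≤i⇒+∣i∣≡i (ℤ.i≤j⇒0≤j-i b≤z))))
  where
  split : ∀ z b → z ≡ b ℤ.+ (z ℤ.- b)
  split = ℤSolver.solve-∀

descend : ∀ {P} x b n → (∀ z → InRun z (b , b ℤ.+ + n) → (x , z) ∈ P) → Star (Step P) (x , b ℤ.+ + n) (x , b)
descend {P} x b zero    h = subst (λ z → Star (Step P) (x , z) (x , b)) (sym (ℤ.+-identityʳ b)) Star.ε
descend {P} x b (suc n) h = (((+ 0 , ℤ.-1ℤ) , there (here refl) , cong₂ _,_ (sym (ℤ.+-identityʳ x)) (below b (+ n))) ,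
    h (b ℤ.+ + n) (ℤ.i≤i+j b (+ n) , shorter)) ◅
  descend x b n (λ z (l , u) → h z (l , ℤ.≤-trans u shorter))
  where
  below : ∀ b n → b ℤ.+ n ≡ b ℤ.+ (1ℤ ℤ.+ n) ℤ.+ ℤ.-1ℤ
  below = ℤSolver.solve-∀
  shorter : b ℤ.+ + n ℤ.≤ b ℤ.+ + suc n
  shorter = ℤ.+-monoʳ-≤ b (ℤ.+≤+ (ℕ.n≤1+n n))

run-connected : ∀ {P} x r → (∀ z → InRun z r → (x , z) ∈ P) → ∀ {y z} → InRun y r → InRun z r → Star (Step P) (x , y) (x , z)
run-connected {P} x (b , t) h hy hz = to-bottom hy ◅◅ Star-reverse (h _ hz) (to-bottom hz)
  where
  to-bottom : ∀ {y} → InRun y (b , t) → Star (Step P) (x , y) (x , b)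
  to-bottom {y} (b≤y , y≤t) = let n , e = ℤ-difference b≤y in
    subst (λ y → Star (Step P) (x , y) (x , b)) (sym e)
      (descend x b n (λ z (l , u) → h z (l , ℤ.≤-trans u (ℤ.≤-trans (ℤ.≤-reflexive (sym e)) y≤t))))

InColumn-run : ∀ {z C} → InColumn z C → ∃[ r ] r ∈ runs C × InRun z r
InColumn-run h = Any.lookup h , ∈-lookup (Any.index h) , Any.lookup-result h

-- By `Follows`, every component of a column shares an edge with the column to its left, so each
-- cell can walk leftwards to `root`.
chain-connected : ∀ {P root} x C Ds → Chain C Ds →
  (∀ {x′ D z} → At x (C ∷ Ds) x′ D → InColumn z D → (x′ , z) ∈ P) →
  (∀ {z} → InColumn z C → Star (Step P) (x , z) root) →
  ∀ {x′ D z} → At x (C ∷ Ds) x′ D → InColumn z D → Star (Step P) (x′ , z) root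
chain-connected x C Ds c inside first here h = first h
chain-connected {P} {root} x C (D ∷ Ds) (follows ∷ c) inside first (there at) h =
  chain-connected (ℤ.suc x) D Ds c (inside ∘ there) second at h
  where
  second : ∀ {z} → InColumn z D → Star (Step P) (ℤ.suc x , z) root
  second {z} z∈D =
    let s , s∈ , z∈s = InColumn-run {C = D} z∈D
        touching-run = All.lookup follows s∈
        r = Any.lookup touching-run
        r∈ = ∈-lookup (Any.index touching-run)
        y , z′ , y∈r , z′∈s , edge = contact x (run-inhabited C r∈) (run-inhabited D s∈) (Any.lookup-result touching-run)
    in run-connected (ℤ.suc x) s (λ z h → inside (there here) (run-in-column {D} s∈ h)) z∈s z′∈s
       ◅◅ ((ShareEdge-sym edge , inside here (run-in-column {C} r∈ y∈r)) ◅ first (run-in-column {C} r∈ y∈r))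

module Decode (k : ℕ) (Ds : List Column) (chain : Chain (0ℤ , single k) Ds) where

  Cs : List Column
  Cs = (0ℤ , single k) ∷ Ds

  connected-place : Connected (place 0ℤ Cs)
  connected-place {c} {d} c∈ d∈ = to-origin c∈ ◅◅ Star-reverse d∈ (to-origin d∈)
    where
    to-origin : ∀ {c} → c ∈ place 0ℤ Cs → Star (Step (place 0ℤ Cs)) c (0ℤ , 0ℤ)
    to-origin {x , z} i = let D , at , z∈ = place⁻ 0ℤ Cs i in
      chain-connected 0ℤ (0ℤ , single k) Ds chain place⁺
        (λ { (here h) → run-connected 0ℤ (0ℤ , 0ℤ ℤ.+ + k) (λ z h → place⁺ {0ℤ} {Cs} here (here h)) h
                          (ℤ.≤-refl , ℤ.i≤i+j 0ℤ (+ k)) })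
        at z∈

  polyomino : Polyomino
  polyomino = record
    { cells     = place 0ℤ Cs
    ; unique    = place-unique 0ℤ Cs
    ; nonEmpty  = (0ℤ , 0ℤ) , place⁺ {0ℤ} {Cs} here (lowest-in-column 0ℤ (single k))
    ; connected = connected-place
    }

run-ends : ∀ {y n b t} → InRun b (y , y ℤ.+ + n) → InRun t (y , y ℤ.+ + n) →
           ¬ InRun (ℤ.pred b) (y , y ℤ.+ + n) → ¬ InRun (ℤ.suc t) (y , y ℤ.+ + n) → (b , t) ≡ (y , y ℤ.+ + n)
run-ends {y} {n} {b} {t} hb ht below above =
  let e , e′ = linear
        (# 0 :≤ # 2 :∧ # 2 :≤ # 0 :+ # 1 :⇒ # 0 :≤ # 3 :∧ # 3 :≤ # 0 :+ # 1 :⇒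
         (# 0 :≤ const -1ℤ :+ # 2 :∧ const -1ℤ :+ # 2 :≤ # 0 :+ # 1 :⇒ :⊥) :⇒
         (# 0 :≤ const 1ℤ :+ # 3 :∧ const 1ℤ :+ # 3 :≤ # 0 :+ # 1 :⇒ :⊥) :⇒
         # 2 :≡ # 0 :∧ # 3 :≡ # 0 :+ # 1)
        refl (y ∷ + n ∷ b ∷ t ∷ []) hb ht below above
  in cong₂ _,_ e e′

-- A filled interval cannot bridge the gap, so both ends lie in the same run; maximality then makes
-- them its ends.
maximal-run : ∀ C {b t} → b ℤ.≤ t → (∀ z → b ℤ.≤ z → z ℤ.≤ t → InColumn z C) →
              ¬ InColumn (ℤ.pred b) C → ¬ InColumn (ℤ.suc t) C → (b , t) ∈ runs C
maximal-run (y , single k) {b} {t} b≤t filled below above = here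
  (run-ends (any-one (filled b ℤ.≤-refl b≤t)) (any-one (filled t b≤t ℤ.≤-refl)) (below ∘ here) (above ∘ here))
maximal-run (y , double a g c) {b} {t} b≤t filled below above
  with any-two (filled b ℤ.≤-refl b≤t) | any-two (filled t b≤t ℤ.≤-refl)
... | inj₁ hb | inj₁ ht = here (run-ends hb ht (below ∘ here) (above ∘ here))
... | inj₂ hb | inj₂ ht = there (here (run-ends hb ht (λ h → below (there (here h))) (λ h → above (there (here h)))))
... | inj₂ hb | inj₁ ht = ⊥-elim (linear
  (const 0ℤ :≤ # 2 :⇒ # 0 :+ # 1 :+ # 2 :+ const (+ 2) :≤ # 3 :⇒ # 4 :≤ # 0 :+ # 1 :⇒ # 3 :≤ # 4 :⇒ :⊥)
  refl (y ∷ + a ∷ + toℕ g ∷ b ∷ t ∷ []) (0≤+ (toℕ g)) (proj₁ hb) (proj₂ ht) b≤t)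
-- The cell just above the lower run always belongs to the gap, which has at least one cell.
... | inj₁ hb | inj₂ ht = ⊥-elim (hole (any-two (filled (y ℤ.+ + a ℤ.+ 1ℤ)
    (linear (# 2 :≤ # 0 :+ # 1 :⇒ # 2 :≤ # 0 :+ # 1 :+ const 1ℤ) refl (y ∷ + a ∷ b ∷ []) (proj₂ hb))
    (linear (const 0ℤ :≤ # 2 :⇒ # 0 :+ # 1 :+ # 2 :+ const (+ 2) :≤ # 3 :⇒ # 0 :+ # 1 :+ const 1ℤ :≤ # 3)
      refl (y ∷ + a ∷ + toℕ g ∷ t ∷ []) (0≤+ (toℕ g)) (proj₁ ht)))))
  where
  hole : ¬ (InRun (y ℤ.+ + a ℤ.+ 1ℤ) (y , y ℤ.+ + a) ⊎ InRun (y ℤ.+ + a ℤ.+ 1ℤ) (upperStart y a g , upperStart y a g ℤ.+ + c))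
  hole (inj₁ (_ , h)) = linear (# 0 :+ # 1 :+ const 1ℤ :≤ # 0 :+ # 1 :⇒ :⊥) refl (y ∷ + a ∷ []) h
  hole (inj₂ (h , _)) = linear (const 0ℤ :≤ # 2 :⇒ # 0 :+ # 1 :+ # 2 :+ const (+ 2) :≤ # 0 :+ # 1 :+ const 1ℤ :⇒ :⊥)
    refl (y ∷ + a ∷ + toℕ g ∷ []) (0≤+ (toℕ g)) h

three-runs : ∀ C {r s u} → r ∈ runs C → s ∈ runs C → u ∈ runs C → r ≡ s ⊎ r ≡ u ⊎ s ≡ u
three-runs (y , single k)     (here p)         (here q)         _                = inj₁ (trans p (sym q))
three-runs (y , double a g b) (here p)         (here q)         _                = inj₁ (trans p (sym q))
three-runs (y , double a g b) (there (here p)) (there (here q)) _                = inj₁ (trans p (sym q))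
three-runs (y , double a g b) (here p)         (there (here q)) (here o)         = inj₂ (inj₁ (trans p (sym o)))
three-runs (y , double a g b) (here p)         (there (here q)) (there (here o)) = inj₂ (inj₂ (trans q (sym o)))
three-runs (y , double a g b) (there (here p)) (here q)         (here o)         = inj₂ (inj₂ (trans q (sym o)))
three-runs (y , double a g b) (there (here p)) (here q)         (there (here o)) = inj₂ (inj₁ (trans p (sym o)))

gap≤3 : ∀ C {b₁ t₁ b₂ t₂} → (b₁ , t₁) ∈ runs C → (b₂ , t₂) ∈ runs C → t₁ ℤ.< b₂ → gapSize t₁ b₂ ℤ.≤ + 3
gap≤3 (y , single k)     (here refl)         (here refl)         t₁<b₂ = ⊥-elim
  (linear (const 0ℤ :≤ # 1 :⇒ # 0 :+ # 1 :< # 0 :⇒ :⊥) refl (y ∷ + k ∷ []) (0≤+ k) t₁<b₂)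
gap≤3 (y , double a g b) (here refl)         (here refl)         t₁<b₂ = ⊥-elim
  (linear (const 0ℤ :≤ # 1 :⇒ # 0 :+ # 1 :< # 0 :⇒ :⊥) refl (y ∷ + a ∷ []) (0≤+ a) t₁<b₂)
gap≤3 (y , double a g b) (here refl)         (there (here refl)) t₁<b₂ = linear
  (# 2 :≤ const (+ 2) :⇒ const -1ℤ :+ (# 0 :+ # 1 :+ # 2 :+ const (+ 2) :- (# 0 :+ # 1)) :≤ const (+ 3))
  refl (y ∷ + a ∷ + toℕ g ∷ []) (toℕ≤2 g)
gap≤3 (y , double a g b) (there (here refl)) (here refl)         t₁<b₂ = ⊥-elim
  (linear (const 0ℤ :≤ # 1 :⇒ const 0ℤ :≤ # 2 :⇒ const 0ℤ :≤ # 3 :⇒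
           # 0 :+ # 1 :+ # 2 :+ const (+ 2) :+ # 3 :< # 0 :⇒ :⊥)
    refl (y ∷ + a ∷ + toℕ g ∷ + b ∷ []) (0≤+ a) (0≤+ (toℕ g)) (0≤+ b) t₁<b₂)
gap≤3 (y , double a g b) (there (here refl)) (there (here refl)) t₁<b₂ = ⊥-elim
  (linear (const 0ℤ :≤ # 1 :⇒ # 0 :+ # 1 :< # 0 :⇒ :⊥) refl (upperStart y a g ∷ + b ∷ []) (0≤+ b) t₁<b₂)

module DecodeCheesy (k : ℕ) (Ds : List Column) (chain : Chain (0ℤ , single k) Ds) where
  open Decode k Ds chain

  column-at : ∀ {x} → IsColumn polyomino x → ∃[ D ] At 0ℤ Cs x D
  column-at (y , i) = let D , at , _ = place⁻ 0ℤ Cs i in D , at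

  at-column : ∀ {x D} → At 0ℤ Cs x D → IsColumn polyomino x
  at-column {D = y , s} at = y , place⁺ at (lowest-in-column y s)

  in-column : ∀ {x D z} → At 0ℤ Cs x D → (x , z) ∈ₚ polyomino → InColumn z D
  in-column {z = z} at i = let E , bt , h = place⁻ 0ℤ Cs i in subst (InColumn z) (At-functional bt at) h

  component-run : ∀ {x D r} → At 0ℤ Cs x D → Component polyomino x r → r ∈ runs D
  component-run {D = D} at c = maximal-run D (Component.inhabited c)
    (λ z l u → in-column at (Component.filled c z l u))
    (λ h → Component.maximalBelow c (place⁺ at h)) (λ h → Component.maximalAbove c (place⁺ at h))

  first-is-0 : ∀ {x} → FirstColumn polyomino x → x ≡ 0ℤ
  first-is-0 {x} (col , least) = ℤ.≤-antisym (least 0ℤ (at-column {0ℤ} {0ℤ , single k} here)) (At-≤ (proj₂ (column-at col)))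

  adjacent-suc : ∀ {x x′} → AdjacentColumns polyomino x x′ → x′ ≡ ℤ.suc x
  adjacent-suc {x} {x′} (c , c′ , x<x′ , none) with ℤ.suc x ℤ.≟ x′
  ... | yes e = sym e
  ... | no ≢  = ⊥-elim (none (ℤ.suc x) (linear (# 0 :< const 1ℤ :+ # 0) refl (x ∷ [])) (ℤ.≤∧≢⇒< (ℤ.i<j⇒suc[i]≤j x<x′) ≢)
    (at-column (proj₂ (At-next (proj₂ (column-at c)) (proj₂ (column-at c′)) x<x′))))

  touches : ∀ x x′ → AdjacentColumns polyomino x x′ → ∀ r → Component polyomino x′ r → TouchesColumn polyomino x x′ r
  touches x x′ adj@(c , c′ , _) s comp =
    let D , at  = column-at c
        E , at′ = column-at c′
        x′≡     = adjacent-suc adj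
        s∈      = component-run at′ comp
        touch   = All.lookup (At-follows chain at at′ x′≡) s∈
        r∈      = ∈-lookup (Any.index touch)
        y , z , y∈r , (l , u) , edge = contact x (run-inhabited D r∈) (run-inhabited E s∈) (Any.lookup-result touch)
    in y , z , place⁺ at (run-in-column {D} r∈ y∈r) , l , u , subst (λ x′ → ShareEdge (x , y) (x′ , z)) (sym x′≡) edge

  cheesy : Cheesy 3 polyomino
  cheesy = record
    { semiDirected  = record { firstColumn = one-run ; touching = touches }
    ; twoComponents = λ x col r s u cr cs cu → let D , at = column-at col in
        three-runs D (component-run at cr) (component-run at cs) (component-run at cu)
    ; smallGaps     = λ x b₁ t₁ b₂ t₂ c₁ c₂ → let D , at = column-at (b₁ , Component.filled c₁ b₁ ℤ.≤-refl (Component.inhabited c₁)) in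
        gap≤3 D (component-run at c₁) (component-run at c₂)
    }
    where
    one-run : ∀ x → FirstColumn polyomino x → AtMostOneComponent polyomino x
    one-run x first r s cr cs with first-is-0 first
    ... | refl with component-run {D = 0ℤ , single k} here cr | component-run {D = 0ℤ , single k} here cs
    ...   | here p | here q = trans p (sym q)

decode : ∀ n {Cs} → IsCode n Cs → CheesyPolyomino 3 n
decode n (k , Ds , e , chain , total) =
  Decode.polyomino k Ds chain , DecodeCheesy.cheesy k Ds chain , trans (length-place 0ℤ ((0ℤ , single k) ∷ Ds)) (trans (cong totalCells (sym e)) total)

-- A set of cells determines its list of columns

run-maximal : ∀ C {b t} → (b , t) ∈ runs C → ¬ InColumn (ℤ.pred b) C × ¬ InColumn (ℤ.suc t) C
run-maximal (y , single k) (here refl) =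
  (λ { (here (h , _)) → linear (# 0 :≤ const -1ℤ :+ # 0 :⇒ :⊥) refl (y ∷ []) h }) ,
  (λ { (here (_ , h)) → linear (const 1ℤ :+ (# 0 :+ # 1) :≤ # 0 :+ # 1 :⇒ :⊥) refl (y ∷ + k ∷ []) h })
run-maximal (y , double a g b) (here refl) =
  (λ { (here (h , _))         → linear (# 0 :≤ const -1ℤ :+ # 0 :⇒ :⊥) refl (y ∷ []) h
     ; (there (here (h , _))) → linear
         (const 0ℤ :≤ # 1 :⇒ const 0ℤ :≤ # 2 :⇒ # 0 :+ # 1 :+ # 2 :+ const (+ 2) :≤ const -1ℤ :+ # 0 :⇒ :⊥)
         refl (y ∷ + a ∷ + toℕ g ∷ []) (0≤+ a) (0≤+ (toℕ g)) h }) ,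
  (λ { (here (_ , h))         → linear (const 1ℤ :+ (# 0 :+ # 1) :≤ # 0 :+ # 1 :⇒ :⊥) refl (y ∷ + a ∷ []) h
     ; (there (here (h , _))) → linear
         (const 0ℤ :≤ # 2 :⇒ # 0 :+ # 1 :+ # 2 :+ const (+ 2) :≤ const 1ℤ :+ (# 0 :+ # 1) :⇒ :⊥)
         refl (y ∷ + a ∷ + toℕ g ∷ []) (0≤+ (toℕ g)) h })
run-maximal (y , double a g b) (there (here refl)) =
  (λ { (here (_ , h))         → linear
         (const 0ℤ :≤ # 2 :⇒ const -1ℤ :+ (# 0 :+ # 1 :+ # 2 :+ const (+ 2)) :≤ # 0 :+ # 1 :⇒ :⊥)
         refl (y ∷ + a ∷ + toℕ g ∷ []) (0≤+ (toℕ g)) h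
     ; (there (here (h , _))) → linear (# 0 :≤ const -1ℤ :+ # 0 :⇒ :⊥) refl (upperStart y a g ∷ []) h }) ,
  (λ { (here (_ , h))         → linear
         (const 0ℤ :≤ # 2 :⇒ const 0ℤ :≤ # 3 :⇒
          const 1ℤ :+ (# 0 :+ # 1 :+ # 2 :+ const (+ 2) :+ # 3) :≤ # 0 :+ # 1 :⇒ :⊥)
         refl (y ∷ + a ∷ + toℕ g ∷ + b ∷ []) (0≤+ (toℕ g)) (0≤+ b) h
     ; (there (here (_ , h))) → linear (const 1ℤ :+ (# 0 :+ # 1) :≤ # 0 :+ # 1 :⇒ :⊥) refl (upperStart y a g ∷ + b ∷ []) h })

SameColumn : Column → Column → Set
SameColumn C D = (∀ {z} → InColumn z C → InColumn z D) × (∀ {z} → InColumn z D → InColumn z C)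

same-runs : ∀ {C D r} → SameColumn C D → r ∈ runs C → r ∈ runs D
same-runs {C} {D} {b , t} (to , from) r∈ = maximal-run D (run-inhabited C r∈)
  (λ z l u → to (run-in-column {C} r∈ (l , u)))
  (λ h → proj₁ (run-maximal C r∈) (from h)) (λ h → proj₂ (run-maximal C r∈) (from h))

+-cancel : ∀ y {k l} → y ℤ.+ + k ≡ y ℤ.+ + l → k ≡ l
+-cancel y {k} {l} e = ℤ.+-injective
  (linear (# 0 :+ # 1 :≡ # 0 :+ # 2 :⇒ # 1 :≡ # 2) refl (y ∷ + k ∷ + l ∷ []) e)

upperStart-injective : ∀ y a {g h : Fin 3} → upperStart y a g ≡ upperStart y a h → g ≡ h
upperStart-injective y a {g} {h} e = toℕ-injective (ℤ.+-injective
  (linear (# 0 :+ # 1 :+ const (+ 2) :≡ # 0 :+ # 2 :+ const (+ 2) :⇒ # 1 :≡ # 2) refl (y ℤ.+ + a ∷ + toℕ g ∷ + toℕ h ∷ []) e))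

upperStart-above : ∀ y a (g : Fin 3) → y ℤ.< upperStart y a g
upperStart-above y a g = linear (const 0ℤ :≤ # 1 :⇒ const 0ℤ :≤ # 2 :⇒ # 0 :< # 0 :+ # 1 :+ # 2 :+ const (+ 2))
  refl (y ∷ + a ∷ + toℕ g ∷ []) (0≤+ a) (0≤+ (toℕ g))

lower≢upper : ∀ {y a} {g : Fin 3} {b} → (y , y ℤ.+ + a) ≡ (upperStart y a g , upperStart y a g ℤ.+ + b) → ⊥
lower≢upper {y} {a} {g} e = ℤ.<-irrefl (cong proj₁ e) (upperStart-above y a g)

-- The runs are the maximal intervals of cells, so equal sets of cells have the same runs, and all
-- parameters of the shape can be read off from these.
column-determined : ∀ C D → SameColumn C D → C ≡ D
column-determined (y , single k) (y′ , single k′) same with same-runs {y , single k} {y′ , single k′} same (here refl)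
... | here e with cong proj₁ e
...   | refl = cong (λ k → y , single k) (+-cancel y (cong proj₂ e))
column-determined (y , single k) (y′ , double a g b) (to , from)
  with same-runs {y′ , double a g b} {y , single k} (from , to) (here refl)
     | same-runs {y′ , double a g b} {y , single k} (from , to) (there (here refl))
... | here e | here e′ = ⊥-elim (lower≢upper {y′} {a} {g} {b} (trans e (sym e′)))
column-determined (y , double a g b) (y′ , single k) same
  with same-runs {y , double a g b} {y′ , single k} same (here refl)
     | same-runs {y , double a g b} {y′ , single k} same (there (here refl))
... | here e | here e′ = ⊥-elim (lower≢upper {y} {a} {g} {b} (trans e (sym e′)))
column-determined C@(y , double a g b) D@(y′ , double a′ g′ b′) same@(to , from)
  with same-runs {C} {D} same (here refl) | same-runs {C} {D} same (there (here refl))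
... | here e | here e′ = ⊥-elim (lower≢upper {y} {a} {g} {b} (trans e (sym e′)))
... | there (here e) | there (here e′) = ⊥-elim (lower≢upper {y} {a} {g} {b} (trans e (sym e′)))
-- A crossed matching would place each lower run strictly below the other.
... | there (here e) | here e′ = ⊥-elim (ℤ.<-asym
  (subst (y ℤ.<_) (cong proj₁ e′) (upperStart-above y a g))
  (subst (y′ ℤ.<_) (sym (cong proj₁ e)) (upperStart-above y′ a′ g′)))
... | here e | there (here e′) with cong proj₁ e
...   | refl with +-cancel y (cong proj₂ e)
...     | refl with upperStart-injective y a (cong proj₁ e′)
...       | refl = cong (λ b → y , double a g b) (+-cancel (upperStart y a g) (cong proj₂ e′))

place-determined : ∀ x Cs Ds → (∀ {c} → c ∈ place x Cs → c ∈ place x Ds) → (∀ {c} → c ∈ place x Ds → c ∈ place x Cs) → Cs ≡ Ds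
place-determined x []             []             to from = refl
place-determined x []             ((y , s) ∷ Ds) to from with from (place⁺ {x} {(y , s) ∷ Ds} here (lowest-in-column y s))
... | ()
place-determined x ((y , s) ∷ Cs) []             to from with to (place⁺ {x} {(y , s) ∷ Cs} here (lowest-in-column y s))
... | ()
place-determined x (C ∷ Cs)       (D ∷ Ds)       to from =
  cong₂ _∷_ (column-determined C D (heads C D Cs Ds to , heads D C Ds Cs from))
    (place-determined (ℤ.suc x) Cs Ds (tails C D Cs Ds to) (tails D C Ds Cs from))
  where
  heads : ∀ C D Cs Ds → (∀ {c} → c ∈ place x (C ∷ Cs) → c ∈ place x (D ∷ Ds)) → ∀ {z} → InColumn z C → InColumn z D
  heads C D Cs Ds f {z} h = let E , at , i = place⁻ x (D ∷ Ds) (f (place⁺ {x} {C ∷ Cs} here h))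
    in subst (InColumn z) (At-functional at here) i
  tails : ∀ C D Cs Ds → (∀ {c} → c ∈ place x (C ∷ Cs) → c ∈ place x (D ∷ Ds)) →
          ∀ {c} → c ∈ place (ℤ.suc x) Cs → c ∈ place (ℤ.suc x) Ds
  tails C D Cs Ds f i with place⁻ (ℤ.suc x) Cs i
  ... | E , at , h with place⁻ x (D ∷ Ds) (f (place⁺ {x} {C ∷ Cs} (there at) h))
  ...   | _ , here , _      = ⊥-elim (suc≰ (At-≤ at))
  ...   | _ , there bt , h′ = place⁺ bt h′

-- Both first columns consist of the cells from (0 , 0) upwards, so the
-- translation is trivial.
translation-trivial : ∀ k Ds l Es v →
  (∀ c → c ∈ place 0ℤ ((0ℤ , single k) ∷ Ds) ⇔ c ⊹ v ∈ place 0ℤ ((0ℤ , single l) ∷ Es)) → v ≡ (0ℤ , 0ℤ)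
translation-trivial k Ds l Es (u , w) iff = cong₂ _,_ u≡0 (w≡0 u≡0)
  where
  origin : ∀ k Ds → (0ℤ , 0ℤ) ∈ place 0ℤ ((0ℤ , single k) ∷ Ds)
  origin k Ds = place⁺ {0ℤ} {(0ℤ , single k) ∷ Ds} here (lowest-in-column 0ℤ (single k))
  nonneg-x : ∀ k Ds {x z} → (x , z) ∈ place 0ℤ ((0ℤ , single k) ∷ Ds) → 0ℤ ℤ.≤ x
  nonneg-x k Ds i = At-≤ (proj₁ (proj₂ (place⁻ 0ℤ ((0ℤ , single k) ∷ Ds) i)))
  nonneg-z : ∀ k Ds {x z} → x ≡ 0ℤ → (x , z) ∈ place 0ℤ ((0ℤ , single k) ∷ Ds) → 0ℤ ℤ.≤ z
  nonneg-z k Ds {z = z} refl i with place⁻ 0ℤ ((0ℤ , single k) ∷ Ds) i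
  ... | E , at , h with subst (InColumn z) (At-functional at here) h
  ...   | here (0≤z , _) = 0≤z
  forth : (0ℤ ℤ.+ u , 0ℤ ℤ.+ w) ∈ place 0ℤ ((0ℤ , single l) ∷ Es)
  forth = Equivalence.to (iff (0ℤ , 0ℤ)) (origin k Ds)
  back : (ℤ.- u , ℤ.- w) ∈ place 0ℤ ((0ℤ , single k) ∷ Ds)
  back = Equivalence.from (iff (ℤ.- u , ℤ.- w))
    (subst (_∈ place 0ℤ ((0ℤ , single l) ∷ Es)) (sym (⊹-inverseˡ (u , w))) (origin l Es))
  zero-of : ∀ u → 0ℤ ℤ.≤ 0ℤ ℤ.+ u → 0ℤ ℤ.≤ ℤ.- u → u ≡ 0ℤ
  zero-of u h h′ = linear (const 0ℤ :≤ const 0ℤ :+ # 0 :⇒ const 0ℤ :≤ const 0ℤ :- # 0 :⇒ # 0 :≡ const 0ℤ)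
    refl (u ∷ []) h (subst (0ℤ ℤ.≤_) (sym (ℤ.+-identityˡ (ℤ.- u))) h′)
  u≡0 : u ≡ 0ℤ
  u≡0 = zero-of u (nonneg-x l Es forth) (nonneg-x k Ds back)
  w≡0 : u ≡ 0ℤ → w ≡ 0ℤ
  w≡0 u≡0 = zero-of w (nonneg-z l Es (trans (ℤ.+-identityˡ u) u≡0) forth) (nonneg-z k Ds (cong ℤ.-_ u≡0) back)

codes-determined : ∀ k Ds l Es v →
  (∀ c → c ∈ place 0ℤ ((0ℤ , single k) ∷ Ds) ⇔ c ⊹ v ∈ place 0ℤ ((0ℤ , single l) ∷ Es)) →
  (0ℤ , single k) ∷ Ds ≡ (0ℤ , single l) ∷ Es
codes-determined k Ds l Es v iff with translation-trivial k Ds l Es v iff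
... | refl = place-determined 0ℤ ((0ℤ , single k) ∷ Ds) ((0ℤ , single l) ∷ Es)
  (λ {c} i → subst (_∈ place 0ℤ ((0ℤ , single l) ∷ Es)) (⊹-identityʳ c) (Equivalence.to (iff c) i))
  (λ {c} i → Equivalence.from (iff c) (subst (_∈ place 0ℤ ((0ℤ , single l) ∷ Es)) (sym (⊹-identityʳ c)) i))

-- From polyominoes to lists of columns

-- A single search that serves four purposes: finding the first column, the next column, the lowest
-- cell of a column and its next component.
least : ∀ {Q : Cell → Set} (Q? : ∀ c → Dec (Q c)) (f : Cell → ℤ) cs →
  (∀ {c} → c ∈ cs → ¬ Q c) ⊎ (∃[ c ] c ∈ cs × Q c × (∀ {d} → d ∈ cs → Q d → f c ℤ.≤ f d))
least Q? f []       = inj₁ λ ()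
least Q? f (c ∷ cs) with Q? c | least Q? f cs
... | no ¬q | inj₁ none = inj₁ λ { (here refl) → ¬q ; (there i) → none i }
... | no ¬q | inj₂ (d , d∈ , qd , min) = inj₂ (d , there d∈ , qd ,
  λ { (here refl) q → contradiction q ¬q ; (there i) q → min i q })
... | yes q | inj₁ none = inj₂ (c , here refl , q , λ { (here refl) _ → ℤ.≤-refl ; (there i) q → contradiction q (none i) })
... | yes q | inj₂ (d , d∈ , qd , min) with ℤ.≤-total (f c) (f d)
...   | inj₁ c≤d = inj₂ (c , here refl , q , λ { (here refl) _ → ℤ.≤-refl ; (there i) q → ℤ.≤-trans c≤d (min i q) })
...   | inj₂ d≤c = inj₂ (d , there d∈ , qd , λ { (here refl) _ → d≤c ; (there i) q → min i q })

_∈?_ : ∀ (c : Cell) cs → Dec (c ∈ cs)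
_∈?_ = DecMembership._∈?_ (Product.≡-dec ℤ._≟_ ℤ._≟_)

bounded-above : ∀ (f : Cell → ℤ) cs x → ∃[ n ] (∀ {c} → c ∈ cs → f c ℤ.≤ x ℤ.+ + n)
bounded-above f []       x = 0 , λ ()
bounded-above f (c ∷ cs) x with bounded-above f cs x
... | n , bound = n ℕ.+ ℤ.∣ f c ℤ.- x ∣ , λ
  { (here refl) → linear (const 0ℤ :≤ # 1 :⇒ # 2 :- # 0 :≤ # 3 :⇒ # 2 :≤ # 0 :+ (# 1 :+ # 3))
      refl (x ∷ + n ∷ f c ∷ + ℤ.∣ f c ℤ.- x ∣ ∷ []) (0≤+ n) (i≤∣i∣ (f c ℤ.- x))
  ; (there {xs = _} i) → ℤ.≤-trans (bound i) (ℤ.+-monoʳ-≤ x (ℤ.+≤+ (ℕ.m≤m+n n ℤ.∣ f c ℤ.- x ∣))) }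
  where
  i≤∣i∣ : ∀ i → i ℤ.≤ + ℤ.∣ i ∣
  i≤∣i∣ (+ n)    = ℤ.≤-refl
  i≤∣i∣ -[1+ n ] = ℤ.-≤+

module Encode (P : Polyomino) (isCheesy : Cheesy 3 P) where
  open Cheesy isCheesy
  open RightwardSemiDirected semiDirected

  FilledRun : ℤ → ℤ → ℕ → Set
  FilledRun x z k = (∀ y → InRun y (z , z ℤ.+ + k) → (x , y) ∈ₚ P) × (x , ℤ.suc (z ℤ.+ + k)) ∉ₚ P

  run-from : ∀ n x z → (x , z) ∈ₚ P → (∀ {y} → (x , y) ∈ₚ P → y ℤ.≤ z ℤ.+ + n) → ∃[ k ] FilledRun x z k
  run-from n x z z∈ bound with (x , ℤ.suc z) ∈? cells P
  ... | no above∉ = 0 ,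
    (λ y (l , u) → subst (λ y → (x , y) ∈ₚ P)
      (linear (# 0 :≤ # 1 :⇒ # 1 :≤ # 0 :+ const 0ℤ :⇒ # 0 :≡ # 1) refl (z ∷ y ∷ []) l u) z∈) ,
    subst (λ y → (x , ℤ.suc y) ∉ₚ P) (sym (ℤ.+-identityʳ z)) above∉
  run-from zero    x z z∈ bound | yes above∈ = ⊥-elim
    (linear (const 1ℤ :+ # 0 :≤ # 0 :+ const 0ℤ :⇒ :⊥) refl (z ∷ []) (bound above∈))
  run-from (suc n) x z z∈ bound | yes above∈
    with run-from n x (ℤ.suc z) above∈ (λ {y} i →
           linear (# 2 :≤ # 0 :+ (const 1ℤ :+ # 1) :⇒ # 2 :≤ const 1ℤ :+ # 0 :+ # 1) refl (z ∷ + n ∷ y ∷ []) (bound i))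
  ... | k , filled , end = suc k , inside , subst (λ y → (x , ℤ.suc y) ∉ₚ P) (assoc z (+ k)) end
    where
    assoc : ∀ z k → 1ℤ ℤ.+ z ℤ.+ k ≡ z ℤ.+ (1ℤ ℤ.+ k)
    assoc = ℤSolver.solve-∀
    inside : ∀ y → InRun y (z , z ℤ.+ + suc k) → (x , y) ∈ₚ P
    inside y (l , u) with y ℤ.≟ z
    ... | yes refl = z∈
    ... | no y≢z   = filled y (linear
      (# 0 :≤ # 2 :⇒ # 2 :≤ # 0 :+ (const 1ℤ :+ # 1) :⇒ (# 2 :≡ # 0 :⇒ :⊥) :⇒
       const 1ℤ :+ # 0 :≤ # 2 :∧ # 2 :≤ const 1ℤ :+ # 0 :+ # 1) refl (z ∷ + k ∷ y ∷ []) l u y≢z)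

  filled-run : ∀ {x z} → (x , z) ∈ₚ P → ∃[ k ] FilledRun x z k
  filled-run {x} {z} z∈ = let n , bound = bounded-above proj₂ (cells P) z in run-from n x z z∈ bound

  component : ∀ {x z k} → FilledRun x z k → (x , ℤ.pred z) ∉ₚ P → Component P x (z , z ℤ.+ + k)
  component {z = z} {k} (filled , end) start = record
    { inhabited    = ℤ.i≤i+j z (+ k)
    ; filled       = λ y l u → filled y (l , u)
    ; maximalBelow = start
    ; maximalAbove = end
    }

  LeastAbove : ℤ → ℤ → ℤ → Set
  LeastAbove x t b = (x , b) ∈ₚ P × t ℤ.< b × (∀ {y} → (x , y) ∈ₚ P → t ℤ.< y → b ℤ.≤ y)

  next-above : ∀ x t → (∀ {y} → (x , y) ∈ₚ P → y ℤ.≤ t) ⊎ (∃[ b ] LeastAbove x t b)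
  next-above x t with least (λ c → (proj₁ c ℤ.≟ x) ×-dec (t ℤ.<? proj₂ c)) proj₂ (cells P)
  ... | inj₁ none = inj₁ (λ i → ℤ.≮⇒≥ (λ t<y → none i (refl , t<y)))
  ... | inj₂ ((_ , b) , b∈ , (refl , t<b) , min) = inj₂ (b , b∈ , t<b , λ i t<y → min i (refl , t<y))

  LeastAbove-start : ∀ {x t b} → (x , ℤ.suc t) ∉ₚ P → LeastAbove x t b → (x , ℤ.pred b) ∉ₚ P × ℤ.suc (ℤ.suc t) ℤ.≤ b
  LeastAbove-start {x} {t} {b} t⁺∉ (b∈ , t<b , min) = (λ i → linear
      (const 1ℤ :+ (const 1ℤ :+ # 0) :≤ # 1 :⇒ (# 0 :< const -1ℤ :+ # 1 :⇒ # 1 :≤ const -1ℤ :+ # 1) :⇒ :⊥)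
      refl (t ∷ b ∷ []) far (min i)) , far
    where
    far : ℤ.suc (ℤ.suc t) ℤ.≤ b
    far = linear (# 0 :< # 1 :⇒ (# 1 :≡ const 1ℤ :+ # 0 :⇒ :⊥) :⇒ const 1ℤ :+ (const 1ℤ :+ # 0) :≤ # 1)
      refl (t ∷ b ∷ []) t<b (λ { refl → t⁺∉ b∈ })

  HasColumn : ℤ → Column → Set
  HasColumn x C = (∀ {z} → (x , z) ∈ₚ P → InColumn z C) × (∀ {z} → InColumn z C → (x , z) ∈ₚ P)

  small-gap : ∀ {x y k b l} → Component P x (y , y ℤ.+ + k) → Component P x (b , b ℤ.+ + l) →
              ℤ.suc (ℤ.suc (y ℤ.+ + k)) ℤ.≤ b → ∃[ g ] b ≡ upperStart y k g
  small-gap {x} {y} {k} {b} {l} c₁ c₂ far with ℤ-difference far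
  -- The gap has n + 1 cells, so a gap of at most three cells gives n < 3.
  ... | n , e = Fin.fromℕ< n<3 , trans e (trans (regroup (y ℤ.+ + k) (+ n))
                  (cong (λ m → y ℤ.+ + k ℤ.+ + m ℤ.+ + 2) (sym (toℕ-fromℕ< n<3))))
    where
    regroup : ∀ t n → 1ℤ ℤ.+ (1ℤ ℤ.+ t) ℤ.+ n ≡ t ℤ.+ n ℤ.+ + 2
    regroup = ℤSolver.solve-∀
    small : gapSize (y ℤ.+ + k) b ℤ.≤ + 3
    small = smallGaps x y (y ℤ.+ + k) b (b ℤ.+ + l) c₁ c₂
      (linear (const 1ℤ :+ (const 1ℤ :+ # 0) :≤ # 1 :⇒ # 0 :< # 1) refl (y ℤ.+ + k ∷ b ∷ []) far)
    n<3 : n ℕ.< 3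
    n<3 = ℤ.drop‿+<+ (linear
      (# 1 :≡ const 1ℤ :+ (const 1ℤ :+ # 0) :+ # 2 :⇒ const -1ℤ :+ (# 1 :- # 0) :≤ const (+ 3) :⇒ # 2 :< const (+ 3))
      refl (y ℤ.+ + k ∷ b ∷ + n ∷ []) e small)

  module ColumnOf (x y : ℤ) (y∈ : (x , y) ∈ₚ P) (lowest : ∀ {z} → (x , z) ∈ₚ P → y ℤ.≤ z) where

    below∉ : (x , ℤ.pred y) ∉ₚ P
    below∉ i = linear (# 0 :≤ const -1ℤ :+ # 0 :⇒ :⊥) refl (y ∷ []) (lowest i)

    three-components-absurd : ∀ {k b l c m} → Component P x (y , y ℤ.+ + k) → Component P x (b , b ℤ.+ + l) →
      Component P x (c , c ℤ.+ + m) → y ℤ.+ + k ℤ.< b → b ℤ.+ + l ℤ.< c → ⊥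
    three-components-absurd {k} {b} {l} c₁ c₂ c₃ lt lt′ with twoComponents x (y , y∈) _ _ _ c₁ c₂ c₃
    ... | inj₁ e         = ℤ.<-irrefl (cong proj₁ e) (ℤ.≤-<-trans (ℤ.i≤i+j y (+ k)) lt)
    ... | inj₂ (inj₁ e)  = ℤ.<-irrefl (cong proj₁ e)
      (ℤ.≤-<-trans (ℤ.i≤i+j y (+ k)) (ℤ.<-trans lt (ℤ.≤-<-trans (ℤ.i≤i+j b (+ l)) lt′)))
    ... | inj₂ (inj₂ e)  = ℤ.<-irrefl (cong proj₁ e) (ℤ.≤-<-trans (ℤ.i≤i+j b (+ l)) lt′)

    column : ∃[ s ] HasColumn x (y , s)
    column with filled-run y∈
    ... | k , run@(filled , end) with next-above x (y ℤ.+ + k)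
    ...   | inj₁ none = single k , (λ i → here (lowest i , none i)) , λ { (here h) → filled _ h }
    ...   | inj₂ (b , above@(b∈ , t<b , min)) with LeastAbove-start end above | filled-run b∈
    ...     | start , far | l , run′@(filled′ , end′)
      with small-gap (component {k = k} run below∉) (component {k = l} run′ start) far | next-above x (b ℤ.+ + l)
    ...       | g , refl | inj₁ none = double k g l , inside , outside
      where
      inside : ∀ {z} → (x , z) ∈ₚ P → InColumn z (y , double k g l)
      inside {z} i with z ℤ.≤? y ℤ.+ + k
      ... | yes z≤t = here (lowest i , z≤t)
      ... | no z≰t  = there (here (min i (ℤ.≰⇒> z≰t) , none i))
      outside : ∀ {z} → InColumn z (y , double k g l) → (x , z) ∈ₚ P
      outside (here h)         = filled _ h
      outside (there (here h)) = filled′ _ h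
    ...       | g , refl | inj₂ (c , above′@(c∈ , u<c , _)) with LeastAbove-start end′ above′ | filled-run c∈
    ...         | start′ , _ | m , run″ = ⊥-elim (three-components-absurd {k} {b} {l} {c} {m}
                    (component run below∉) (component run′ start) (component run″ start′) t<b u<c)

  column-at : ∀ {x} → IsColumn P x → ∃[ C ] HasColumn x C
  column-at {x} (z , z∈) with least (λ c → proj₁ c ℤ.≟ x) proj₂ (cells P)
  ... | inj₁ none = contradiction refl (none z∈)
  ... | inj₂ ((_ , y) , y∈ , refl , min) =
    let s , has = ColumnOf.column x y y∈ (λ i → min i refl) in (y , s) , has

  run-component : ∀ {x} C {r} → HasColumn x C → r ∈ runs C → Component P x r
  run-component C {b , t} (to , from) r∈ = record
    { inhabited    = run-inhabited C r∈
    ; filled       = λ z l u → from (run-in-column {C} r∈ (l , u))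
    ; maximalBelow = λ i → proj₁ (run-maximal C r∈) (to i)
    ; maximalAbove = λ i → proj₂ (run-maximal C r∈) (to i)
    }

  edge-right : ∀ {x x′ y z} → x ℤ.< x′ → ShareEdge (x , y) (x′ , z) → x′ ≡ ℤ.suc x × (z ≡ y ⊎ z ≡ y ℤ.+ -1ℤ)
  edge-right {x} {y = y} lt (_ , here refl , refl) = ⊥-elim (linear (# 0 :< # 0 :+ const 0ℤ :⇒ :⊥) refl (x ∷ []) lt)
  edge-right {x} lt (_ , there (here refl) , refl) = ⊥-elim (linear (# 0 :< # 0 :+ const 0ℤ :⇒ :⊥) refl (x ∷ []) lt)
  edge-right {x} {y = y} lt (_ , there (there (here refl)) , refl) = ℤ.+-comm x 1ℤ , inj₁ (ℤ.+-identityʳ y)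
  edge-right {x} lt (_ , there (there (there (here refl))) , refl) = ℤ.+-comm x 1ℤ , inj₂ refl
  edge-right {x} lt (_ , there (there (there (there (here refl)))) , refl) =
    ⊥-elim (linear (# 0 :< # 0 :+ const -1ℤ :⇒ :⊥) refl (x ∷ []) lt)
  edge-right {x} lt (_ , there (there (there (there (there (here refl))))) , refl) =
    ⊥-elim (linear (# 0 :< # 0 :+ const -1ℤ :⇒ :⊥) refl (x ∷ []) lt)

  -- An edge between different columns changes the abscissa by exactly 1, so `touching` also shows
  -- that no abscissa is skipped between adjacent columns.
  adjacent-follows : ∀ {x x′ C D} → AdjacentColumns P x x′ → HasColumn x C → HasColumn x′ D → x′ ≡ ℤ.suc x × Follows C D
  adjacent-follows {x} {x′} {C} {D} adj@(_ , (z , z∈) , x<x′ , _) (to , _) hasD@(to′ , _) =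
    next (proj₁ (proj₂ (InColumn-run {C = D} (to′ z∈)))) , All.tabulate touch
    where
    next : ∀ {s} → s ∈ runs D → x′ ≡ ℤ.suc x
    next s∈ = let y , y′ , _ , _ , _ , edge = touching x x′ adj _ (run-component D hasD s∈)
              in proj₁ (edge-right {y = y} {z = y′} x<x′ edge)
    touch : ∀ {s} → s ∈ runs D → Any (λ r → RunsTouch r s) (runs C)
    touch {b′ , t′} s∈ =
      let y , y′ , y∈ , b′≤ , ≤t′ , edge = touching x x′ adj _ (run-component D hasD s∈)
          (b , t) , r∈ , b≤ , ≤t = InColumn-run {C = C} (to y∈)
      in Any.map (λ { refl → linear
           (# 4 :≡ # 5 :∨ # 4 :≡ # 5 :+ const -1ℤ :⇒ # 2 :≤ # 4 :⇒ # 4 :≤ # 3 :⇒ # 0 :≤ # 5 :⇒ # 5 :≤ # 1 :⇒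
            # 0 :≤ const 1ℤ :+ # 3 :∧ # 2 :≤ # 1)
           refl (b ∷ t ∷ b′ ∷ t′ ∷ y′ ∷ y ∷ []) (proj₂ (edge-right {y = y} {z = y′} x<x′ edge)) b′≤ ≤t′ b≤ ≤t }) r∈

  -- The number `n` bounds how far P extends to the right of x. Columns are taken from left to
  -- right, the next one being that of least abscissa beyond x.
  chain-from : ∀ n x C → HasColumn x C → (∀ {c} → c ∈ₚ P → proj₁ c ℤ.≤ x ℤ.+ + n) →
    ∃[ Ds ] Chain C Ds × (∀ {x′ z} → x ℤ.< x′ → (x′ , z) ∈ₚ P → (x′ , z) ∈ place (ℤ.suc x) Ds) ×
                         (∀ {c} → c ∈ place (ℤ.suc x) Ds → c ∈ₚ P)
  chain-from n x C has bound with least (λ c → x ℤ.<? proj₁ c) proj₁ (cells P)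
  ... | inj₁ none = [] , [] , (λ lt i → contradiction lt (none i)) , λ ()
  chain-from zero x C has bound | inj₂ ((x₁ , z) , z∈ , x<x₁ , _) = ⊥-elim
    (linear (# 0 :< # 1 :⇒ # 1 :≤ # 0 :+ const 0ℤ :⇒ :⊥) refl (x ∷ x₁ ∷ []) x<x₁ (bound z∈))
  chain-from (suc n) x C@(y , s) has@(to , from) bound | inj₂ ((x₁ , z) , z∈ , x<x₁ , min) with column-at (z , z∈)
  ... | D , hasD
    with adjacent-follows {x} {x₁} {C} {D} ((y , from (lowest-in-column y s)) , (z , z∈) , x<x₁ ,
           λ w x<w w<x₁ (v , v∈) → ℤ.<-irrefl refl (ℤ.<-≤-trans w<x₁ (min v∈ x<w))) has hasD
  ...   | refl , follows with chain-from n (ℤ.suc x) D hasD (λ {c} i →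
            linear (# 2 :≤ # 0 :+ (const 1ℤ :+ # 1) :⇒ # 2 :≤ const 1ℤ :+ # 0 :+ # 1) refl (x ∷ + n ∷ proj₁ c ∷ []) (bound i))
  ...     | Ds , chain , into , out = D ∷ Ds , follows ∷ chain , into′ , out′
    where
    into′ : ∀ {x′ w} → x ℤ.< x′ → (x′ , w) ∈ₚ P → (x′ , w) ∈ place (ℤ.suc x) (D ∷ Ds)
    into′ {x′} lt i with x′ ℤ.≟ ℤ.suc x
    ... | yes refl = place⁺ {ℤ.suc x} {D ∷ Ds} here (proj₁ hasD i)
    ... | no x′≢   = ∈-++⁺ʳ (map (ℤ.suc x ,_) (heights D)) (into (linear
      (# 0 :< # 1 :⇒ (# 1 :≡ const 1ℤ :+ # 0 :⇒ :⊥) :⇒ const 1ℤ :+ # 0 :< # 1) refl (x ∷ x′ ∷ []) lt x′≢) i)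
    out′ : ∀ {c} → c ∈ place (ℤ.suc x) (D ∷ Ds) → c ∈ₚ P
    out′ i with place⁻ (ℤ.suc x) (D ∷ Ds) i
    ... | _ , here , h     = proj₂ hasD h
    ... | _ , there at , h = out (place⁺ at h)

  record Decomposition : Set where
    field
      x y   : ℤ
      k     : ℕ
      Ds    : List Column
      chain : Chain (y , single k) Ds
      into  : ∀ {c} → c ∈ₚ P → c ∈ place x ((y , single k) ∷ Ds)
      out   : ∀ {c} → c ∈ place x ((y , single k) ∷ Ds) → c ∈ₚ P

  decomposition : Decomposition
  decomposition with least (λ c → yes tt) proj₁ (cells P)
  ... | inj₁ none = ⊥-elim (none (proj₂ (nonEmpty P)) tt)
  ... | inj₂ ((x , z) , z∈ , _ , min) with column-at (z , z∈)
  ...   | (y , double a g b) , has = ⊥-elim (lower≢upper {y} {a} {g} {b} (firstColumn x ((z , z∈) , λ x′ (_ , i) → min i tt) _ _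
            (run-component (y , double a g b) has (here refl)) (run-component (y , double a g b) has (there (here refl)))))
  ...   | (y , single k) , has with bounded-above proj₁ (cells P) x
  ...     | n , bound with chain-from n x (y , single k) has bound
  ...       | Ds , chain , into , out = record
    { x = x ; y = y ; k = k ; Ds = Ds ; chain = chain ; into = into′ ; out = out′ }
    where
    into′ : ∀ {c} → c ∈ₚ P → c ∈ place x ((y , single k) ∷ Ds)
    into′ {x′ , w} i with x′ ℤ.≟ x
    ... | yes refl = place⁺ {x} {(y , single k) ∷ Ds} here (proj₁ has i)
    ... | no x′≢x  = ∈-++⁺ʳ (map (x ,_) (heights (y , single k))) (into (ℤ.≤∧≢⇒< (min i tt) (x′≢x ∘ sym)) i)
    out′ : ∀ {c} → c ∈ place x ((y , single k) ∷ Ds) → c ∈ₚ P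
    out′ i with place⁻ x ((y , single k) ∷ Ds) i
    ... | _ , here , h     = proj₂ has h
    ... | _ , there at , h = out (place⁺ at h)

-- Translation into normal position

raise : ℤ → Column → Column
raise w (y , s) = (y ℤ.+ w , s)

raiseRun : ℤ → Run → Run
raiseRun w (b , t) = (b ℤ.+ w , t ℤ.+ w)

range-raise : ∀ y w n → range (y ℤ.+ w) n ≡ map (ℤ._+ w) (range y n)
range-raise y w zero    = refl
range-raise y w (suc n) = cong (y ℤ.+ w ∷_)
  (trans (cong (λ z → range z n) (sym (ℤ.+-assoc 1ℤ y w))) (range-raise (ℤ.suc y) w n))

upperStart-raise : ∀ y w a g → upperStart (y ℤ.+ w) a g ≡ upperStart y a g ℤ.+ w
upperStart-raise y w a g = regroup y w (+ a) (+ toℕ g)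
  where
  regroup : ∀ y w a g → y ℤ.+ w ℤ.+ a ℤ.+ g ℤ.+ + 2 ≡ y ℤ.+ a ℤ.+ g ℤ.+ + 2 ℤ.+ w
  regroup = ℤSolver.solve-∀

heights-raise : ∀ w C → heights (raise w C) ≡ map (ℤ._+ w) (heights C)
heights-raise w (y , single k)     = range-raise y w (suc k)
heights-raise w (y , double a g b) = trans
  (cong₂ _++_ (range-raise y w (suc a))
    (trans (cong (λ z → range z (suc b)) (upperStart-raise y w a g)) (range-raise (upperStart y a g) w (suc b))))
  (sym (List.map-++ (ℤ._+ w) (range y (suc a)) (range (upperStart y a g) (suc b))))

runs-raise : ∀ w C → runs (raise w C) ≡ map (raiseRun w) (runs C)
runs-raise w (y , single k)     = cong (λ t → (y ℤ.+ w , t) ∷ []) (swap y w (+ k))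
  where
  swap : ∀ y w k → y ℤ.+ w ℤ.+ k ≡ y ℤ.+ k ℤ.+ w
  swap = ℤSolver.solve-∀
runs-raise w (y , double a g b) = cong₂ (λ t r → (y ℤ.+ w , t) ∷ r ∷ []) (swap y w (+ a))
  (cong₂ _,_ (upperStart-raise y w a g)
    (trans (cong (ℤ._+ + b) (upperStart-raise y w a g)) (swap (upperStart y a g) w (+ b))))
  where
  swap : ∀ y w k → y ℤ.+ w ℤ.+ k ≡ y ℤ.+ k ℤ.+ w
  swap = ℤSolver.solve-∀

RunsTouch-raise : ∀ w {r s} → RunsTouch r s → RunsTouch (raiseRun w r) (raiseRun w s)
RunsTouch-raise w {b , t} {b′ , t′} (h , h′) =
  linear (# 0 :≤ const 1ℤ :+ # 3 :⇒ # 2 :≤ # 1 :⇒ # 0 :+ # 4 :≤ const 1ℤ :+ (# 3 :+ # 4) :∧ # 2 :+ # 4 :≤ # 1 :+ # 4)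
    refl (b ∷ t ∷ b′ ∷ t′ ∷ w ∷ []) h h′

Follows-raise : ∀ w {C D} → Follows C D → Follows (raise w C) (raise w D)
Follows-raise w {C} {D} h rewrite runs-raise w C | runs-raise w D =
  All.map⁺ (All.map (λ {s} a → Any.map⁺ (Any.map (λ {r} → RunsTouch-raise w {r} {s}) a)) h)

Chain-raise : ∀ w {C Ds} → Chain C Ds → Chain (raise w C) (map (raise w) Ds)
Chain-raise w []      = []
Chain-raise w (h ∷ c) = Follows-raise w h ∷ Chain-raise w c

totalCells-raise : ∀ w Cs → totalCells (map (raise w) Cs) ≡ totalCells Cs
totalCells-raise w []             = refl
totalCells-raise w ((y , s) ∷ Cs) = cong (runCells s ℕ.+_) (totalCells-raise w Cs)

place-translate : ∀ x u w Cs → place (x ℤ.+ u) (map (raise w) Cs) ≡ map (_⊹ (u , w)) (place x Cs)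
place-translate x u w []       = refl
place-translate x u w (C ∷ Cs) = trans (cong₂ _++_ column rest)
  (sym (List.map-++ (_⊹ (u , w)) (map (x ,_) (heights C)) (place (ℤ.suc x) Cs)))
  where
  column : map (x ℤ.+ u ,_) (heights (raise w C)) ≡ map (_⊹ (u , w)) (map (x ,_) (heights C))
  column = trans (cong (map (x ℤ.+ u ,_)) (heights-raise w C))
    (trans (sym (List.map-∘ (heights C))) (List.map-∘ (heights C)))
  rest : place (ℤ.suc (x ℤ.+ u)) (map (raise w) Cs) ≡ map (_⊹ (u , w)) (place (ℤ.suc x) Cs)
  rest = trans (cong (λ z → place z (map (raise w) Cs)) (sym (ℤ.+-assoc 1ℤ x u))) (place-translate (ℤ.suc x) u w Cs)

⊹-injective : ∀ v {c d} → c ⊹ v ≡ d ⊹ v → c ≡ d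
⊹-injective v {c} {d} e = trans (sym (undo c)) (trans (cong (_⊹ neg v) e) (undo d))
  where
  undo : ∀ c → (c ⊹ v) ⊹ neg v ≡ c
  undo (x , y) = cong₂ _,_ (cancel x (proj₁ v)) (cancel y (proj₂ v))
    where
    cancel : ∀ x u → x ℤ.+ u ℤ.+ ℤ.- u ≡ x
    cancel = ℤSolver.solve-∀

∈-translate⁻ : ∀ v {c cs} → c ⊹ v ∈ map (_⊹ v) cs → c ∈ cs
∈-translate⁻ v i = let d , d∈ , e = ∈-map⁻ (_⊹ v) i in subst (_∈ _) (sym (⊹-injective v e)) d∈

-- A pigeonhole argument. Applied in both directions, it identifies the size of a polyomino with the
-- number of cells of its columns.
unique-length-≤ : ∀ {A : Set} {xs ys : List A} → Unique xs → (∀ {x} → x ∈ xs → x ∈ ys) → length xs ℕ.≤ length ys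
unique-length-≤ {xs = []}     _         _ = z≤n
unique-length-≤ {xs = x ∷ xs} (x∉ ∷ uxs) f with ∈-∃++ (f (here refl))
... | as , bs , refl = ℕ.≤-trans (s≤s (unique-length-≤ uxs smaller))
  (ℕ.≤-reflexive (sym (trans (List.length-++ as) (trans (ℕ.+-suc (length as) (length bs)) (cong suc (sym (List.length-++ as)))))))
  where
  smaller : ∀ {y} → y ∈ xs → y ∈ as ++ bs
  smaller i with ∈-++⁻ as (f (there i))
  ... | inj₁ j           = ∈-++⁺ˡ j
  ... | inj₂ (here refl) = ⊥-elim (All.lookup x∉ i refl)
  ... | inj₂ (there j)   = ∈-++⁺ʳ as j

record Encoding (P : Polyomino) : Set where
  field
    code     : List Column
    isCode   : IsCode (size P) code
    offset   : Cell
    into     : ∀ c → c ∈ₚ P ⇔ c ⊹ offset ∈ place 0ℤ code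

encoding : ∀ P → Cheesy 3 P → Encoding P
encoding P isCheesy = record
  { code   = code
  ; isCode = k , map (raise (ℤ.- y)) Ds , cong (λ z → (z , single k) ∷ map (raise (ℤ.- y)) Ds) (ℤ.+-inverseʳ y) ,
             subst (λ z → Chain (z , single k) (map (raise (ℤ.- y)) Ds)) (ℤ.+-inverseʳ y) (Chain-raise (ℤ.- y) chain) ,
             trans (totalCells-raise (ℤ.- y) ((y , single k) ∷ Ds)) sizes
  ; offset = v
  ; into   = λ c → mk⇔
      (λ i → subst (c ⊹ v ∈_) (sym translated) (∈-map⁺ (_⊹ v) (into i)))
      (λ i → out (∈-translate⁻ v (subst (c ⊹ v ∈_) translated i)))
  }
  where
  open Encode.Decomposition (Encode.decomposition P isCheesy)
  v : Cell
  v = (ℤ.- x , ℤ.- y)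
  code : List Column
  code = map (raise (ℤ.- y)) ((y , single k) ∷ Ds)
  translated : place 0ℤ code ≡ map (_⊹ v) (place x ((y , single k) ∷ Ds))
  translated = trans (cong (λ z → place z code) (sym (ℤ.+-inverseʳ x))) (place-translate x (ℤ.- x) (ℤ.- y) ((y , single k) ∷ Ds))
  sizes : totalCells ((y , single k) ∷ Ds) ≡ size P
  sizes = trans (sym (length-place x ((y , single k) ∷ Ds)))
    (ℕ.≤-antisym (unique-length-≤ (place-unique x ((y , single k) ∷ Ds)) out) (unique-length-≤ (unique P) into))

-- The bijection between codes and polyominoes up to translation

cells-decode : ∀ n {Cs} (c : IsCode n Cs) → cells (proj₁ (decode n c)) ≡ place 0ℤ Cs
cells-decode n (k , Ds , e , _) = cong (place 0ℤ) (sym e)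

decode-injective : ∀ n {Cs Es} (c : IsCode n Cs) (e : IsCode n Es) → proj₁ (decode n c) ≋ proj₁ (decode n e) → Cs ≡ Es
decode-injective n (k , Ds , e , _) (l , Es , e′ , _) (v , iff) =
  trans e (trans (codes-determined k Ds l Es v iff) (sym e′))

unique-lookup : ∀ {A : Set} {xs : List A} → Unique xs → ∀ i j → lookup xs i ≡ lookup xs j → i ≡ j
unique-lookup (x∉ ∷ u) zero    zero    e = refl
unique-lookup (x∉ ∷ u) zero    (suc j) e = ⊥-elim (All.lookup x∉ (∈-lookup j) e)
unique-lookup (x∉ ∷ u) (suc i) zero    e = ⊥-elim (All.lookup x∉ (∈-lookup i) (sym e))
unique-lookup (x∉ ∷ u) (suc i) (suc j) e = cong suc (unique-lookup u i j e)

module Counting (n : ℕ) where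

  codeAt : (i : Fin (codeCount n)) → IsCode n (lookup (codes n) i)
  codeAt i = codes-sound n (∈-lookup i)

  to : Fin (codeCount n) → CheesyPolyomino 3 n
  to i = decode n (codeAt i)

  position : ∀ {Cs} → IsCode n Cs → Fin (codeCount n)
  position c = Any.index (codes-complete c)

  lookup-position : ∀ {Cs} (c : IsCode n Cs) → Cs ≡ lookup (codes n) (position c)
  lookup-position c = Any.lookup-index (codes-complete c)

  codeOf : (P : CheesyPolyomino 3 n) → ∃[ Cs ] IsCode n Cs × (∃[ v ] (∀ c → c ∈ₚ proj₁ P ⇔ c ⊹ v ∈ place 0ℤ Cs))
  codeOf (P , isCheesy , refl) = code , isCode , offset , into
    where open Encoding (encoding P isCheesy)

  from : CheesyPolyomino 3 n → Fin (codeCount n)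
  from P = position (proj₁ (proj₂ (codeOf P)))

  ≋-to-from : ∀ P → proj₁ P ≋ proj₁ (to (from P))
  ≋-to-from P = let Cs , isCode , v , iff = codeOf P in v , λ c →
    subst (λ cs → c ∈ₚ proj₁ P ⇔ c ⊹ v ∈ cs)
      (trans (cong (place 0ℤ) (lookup-position isCode)) (sym (cells-decode n (codeAt (from P))))) (iff c)

  to-injective : ∀ {i j} → proj₁ (to i) ≋ proj₁ (to j) → i ≡ j
  to-injective {i} {j} e = unique-lookup (codes-unique n) i j (decode-injective n (codeAt i) (codeAt j) e)

  ≋-sym : ∀ P Q → P ≋ Q → Q ≋ P
  ≋-sym P Q = IsEquivalence.sym ≋-isEquivalence {P} {Q}

  ≋-trans : ∀ P Q R → P ≋ Q → Q ≋ R → P ≋ R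
  ≋-trans P Q R = IsEquivalence.trans ≋-isEquivalence {P} {Q} {R}

  -- Distinct codes give inequivalent polyominoes; with `≋-to-from` this yields both inverse laws
  -- and the compatibility of `from` with ≋.
  from-unique : ∀ P i → proj₁ P ≋ proj₁ (to i) → from P ≡ i
  from-unique P i e = to-injective (≋-trans (proj₁ (to (from P))) (proj₁ P) (proj₁ (to i))
    (≋-sym (proj₁ P) (proj₁ (to (from P))) (≋-to-from P)) e)

  cardinality : HasCardinality (cheesySetoid 3 n) (codeCount n)
  cardinality = record
    { to        = to
    ; from      = from
    ; to-cong   = λ { {i} refl → IsEquivalence.refl ≋-isEquivalence {proj₁ (to i)} }
    ; from-cong = λ {P} {Q} e → from-unique P (from Q)
                    (≋-trans (proj₁ P) (proj₁ Q) (proj₁ (to (from Q))) e (≋-to-from Q))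
    ; inverse   = (λ {P} {i} i≡ → subst (λ j → proj₁ (to j) ≋ proj₁ P) (sym i≡)
                    (≋-sym (proj₁ P) (proj₁ (to (from P))) (≋-to-from P)))
                , (λ {i} {P} e → from-unique P i e)
    }

-- Ball arithmetic

ℚ-ring : AlmostCommutativeRing 0ℓ 0ℓ
ℚ-ring = fromCommutativeRing ℚ.+-*-commutativeRing isZero?
  where
  isZero? : ∀ x → Maybe (0ℚ ≡ x)
  isZero? x with 0ℚ ℚ.≟ x
  ... | yes e = just e
  ... | no _  = nothing

opaque
  ι : ℤ → ℚ
  ι i = i ℚ./ 1

  ι-def : ∀ i → ι i ≡ i ℚ./ 1
  ι-def i = refl

  ι-toℚᵘ : ∀ i → ℚ.toℚᵘ (ι i) ℚᵘ.≃ ℚᵘ.mkℚᵘ i 0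
  ι-toℚᵘ i = ℚ.toℚᵘ-fromℚᵘ (ℚᵘ.mkℚᵘ i 0)

  ι-0 : ι 0ℤ ≡ 0ℚ
  ι-0 = refl

  ι-1 : ι 1ℤ ≡ 1ℚ
  ι-1 = refl

  ½*[2*x] : ∀ x → ½ ℚ.* (ι (+ 2) ℚ.* x) ≡ x
  ½*[2*x] x = trans (sym (ℚ.*-assoc ½ (ι (+ 2)) x)) (ℚ.*-identityˡ x)

ι-+ : ∀ i j → ι (i ℤ.+ j) ≡ ι i ℚ.+ ι j
ι-+ i j = ℚ.toℚᵘ-injective (ℚᵘ.≃-trans (ι-toℚᵘ (i ℤ.+ j)) (ℚᵘ.≃-sym
  (ℚᵘ.≃-trans (ℚ.toℚᵘ-homo-+ (ι i) (ι j))
  (ℚᵘ.≃-trans (ℚᵘ.+-cong (ι-toℚᵘ i) (ι-toℚᵘ j)) (ℚᵘ.*≡* (regroup i j))))))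
  where
  regroup : ∀ i j → (i ℤ.* 1ℤ ℤ.+ j ℤ.* 1ℤ) ℤ.* 1ℤ ≡ (i ℤ.+ j) ℤ.* 1ℤ
  regroup = ℤSolver.solve-∀

ι-* : ∀ i j → ι (i ℤ.* j) ≡ ι i ℚ.* ι j
ι-* i j = ℚ.toℚᵘ-injective (ℚᵘ.≃-trans (ι-toℚᵘ (i ℤ.* j)) (ℚᵘ.≃-sym
  (ℚᵘ.≃-trans (ℚ.toℚᵘ-homo-* (ι i) (ι j)) (ℚᵘ.*-cong (ι-toℚᵘ i) (ι-toℚᵘ j)))))

ι-≤ : ∀ {i j} → i ℤ.≤ j → ι i ℚ.≤ ι j
ι-≤ {i} {j} i≤j = ℚ.toℚᵘ-cancel-≤ (ℚᵘ.≤-respˡ-≃ (ℚᵘ.≃-sym (ι-toℚᵘ i)) (ℚᵘ.≤-respʳ-≃ (ℚᵘ.≃-sym (ι-toℚᵘ j))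
  (ℚᵘ.*≤* (ℤ.*-monoʳ-≤-nonNeg 1ℤ i≤j))))

ι-< : ∀ {i j} → i ℤ.< j → ι i ℚ.< ι j
ι-< {i} {j} i<j = ℚ.toℚᵘ-cancel-< (ℚᵘ.<-respˡ-≃ (ℚᵘ.≃-sym (ι-toℚᵘ i)) (ℚᵘ.<-respʳ-≃ (ℚᵘ.≃-sym (ι-toℚᵘ j))
  (ℚᵘ.*<* (ℤ.*-monoʳ-<-pos 1ℤ i<j))))

0≤ι : ∀ {i} → 0ℤ ℤ.≤ i → 0ℚ ℚ.≤ ι i
0≤ι {i} h = subst (ℚ._≤ ι i) ι-0 (ι-≤ h)

1≤ι : ∀ {i} → 1ℤ ℤ.≤ i → 1ℚ ℚ.≤ ι i
1≤ι {i} h = subst (ℚ._≤ ι i) ι-1 (ι-≤ h)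

ι-positive : ∀ k → ℚ.Positive (ι (+ suc k))
ι-positive k = ℚ.positive (subst (ℚ._< ι (+ suc k)) ι-0 (ι-< {0ℤ} {+ suc k} (ℤ.+<+ (s≤s z≤n))))

ι-neg : ∀ i → ι (ℤ.- i) ≡ ℚ.- ι i
ι-neg i = trans (regroup (ι (ℤ.- i)) (ι i))
  (trans (cong (ℚ._- ι i) (trans (sym (ι-+ (ℤ.- i) i)) (trans (cong ι (ℤ.+-inverseˡ i)) ι-0))) (ℚ.+-identityˡ (ℚ.- ι i)))
  where
  regroup : ∀ x y → x ≡ (x ℚ.+ y) ℚ.- y
  regroup = RingSolver.solve-∀ ℚ-ring

ι-∣∣ : ∀ i → ℚ.∣ ι i ∣ ≡ ι (+ ℤ.∣ i ∣)
ι-∣∣ (+ n)      = ℚ.0≤p⇒∣p∣≡p (0≤ι {+ n} (ℤ.+≤+ z≤n))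
ι-∣∣ (-[1+ n ]) = trans (cong ℚ.∣_∣ (ι-neg (+ suc n)))
  (trans (ℚ.∣-p∣≡∣p∣ (ι (+ suc n))) (ℚ.0≤p⇒∣p∣≡p (0≤ι {+ suc n} (ℤ.+≤+ z≤n))))

*-nonNeg : ∀ {p q} → 0ℚ ℚ.≤ p → 0ℚ ℚ.≤ q → 0ℚ ℚ.≤ p ℚ.* q
*-nonNeg {p} {q} 0≤p 0≤q = subst (ℚ._≤ p ℚ.* q) (ℚ.*-zeroʳ p) (ℚ.*-monoˡ-≤-nonNeg p {{ℚ.nonNegative 0≤p}} 0≤q)

+-nonNeg : ∀ {p q} → 0ℚ ℚ.≤ p → 0ℚ ℚ.≤ q → 0ℚ ℚ.≤ p ℚ.+ q
+-nonNeg = ℚ.+-mono-≤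

p≤p+q : ∀ {p q} → 0ℚ ℚ.≤ q → p ℚ.≤ p ℚ.+ q
p≤p+q {p} {q} 0≤q = subst (ℚ._≤ p ℚ.+ q) (ℚ.+-identityʳ p) (ℚ.+-monoʳ-≤ p 0≤q)

q≤p+q : ∀ {p q} → 0ℚ ℚ.≤ p → q ℚ.≤ p ℚ.+ q
q≤p+q {p} {q} 0≤p = subst (ℚ._≤ p ℚ.+ q) (ℚ.+-identityˡ q) (ℚ.+-monoˡ-≤ q 0≤p)

*-mono-≤₂ : ∀ {p q r s} → 0ℚ ℚ.≤ p → 0ℚ ℚ.≤ r → p ℚ.≤ q → r ℚ.≤ s → p ℚ.* r ℚ.≤ q ℚ.* s
*-mono-≤₂ {p} {q} {r} {s} 0≤p 0≤r p≤q r≤s = *-mono-≤ {p} {q} {r} {s} 0≤p (ℚ.≤-trans 0≤r r≤s) p≤q r≤s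

-- (c , r) encloses the rationals at distance at most r from c.
Ball : Set
Ball = ℤ × ℤ

infix 4 _∈ᵇ_
infixl 6 _+ᵇ_
infixl 7 _*ᵇ_

record _∈ᵇ_ (q : ℚ) (A : Ball) : Set where
  constructor within
  field
    distance : ℚ.∣ q ℚ.- ι (proj₁ A) ∣ ℚ.≤ ι (proj₂ A)

exactly : ℤ → Ball
exactly c = c , 0ℤ

_+ᵇ_ _*ᵇ_ : Ball → Ball → Ball
(c , r) +ᵇ (d , s) = c ℤ.+ d , r ℤ.+ s
(c , r) *ᵇ (d , s) = c ℤ.* d , + ℤ.∣ c ∣ ℤ.* s ℤ.+ (r ℤ.* + ℤ.∣ d ∣ ℤ.+ r ℤ.* s)

exactly-sound : ∀ c → ι c ∈ᵇ exactly c
exactly-sound c = within $ ℚ.≤-reflexive (trans (cong ℚ.∣_∣ (ℚ.+-inverseʳ (ι c))) (sym ι-0))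

zeroᵇ : 0ℚ ∈ᵇ exactly 0ℤ
zeroᵇ = subst (_∈ᵇ exactly 0ℤ) ι-0 (exactly-sound 0ℤ)

oneᵇ : 1ℚ ∈ᵇ exactly 1ℤ
oneᵇ = subst (_∈ᵇ exactly 1ℤ) ι-1 (exactly-sound 1ℤ)

+ᵇ-sound : ∀ {p q} A B → p ∈ᵇ A → q ∈ᵇ B → p ℚ.+ q ∈ᵇ A +ᵇ B
+ᵇ-sound {p} {q} (c , r) (d , s) (within pc) (within qd) = within $ begin
  ℚ.∣ p ℚ.+ q ℚ.- ι (c ℤ.+ d) ∣                   ≡⟨ cong (λ z → ℚ.∣ p ℚ.+ q ℚ.- z ∣) (ι-+ c d) ⟩
  ℚ.∣ p ℚ.+ q ℚ.- (ι c ℚ.+ ι d) ∣                 ≡⟨ cong ℚ.∣_∣ (regroup p q (ι c) (ι d)) ⟩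
  ℚ.∣ (p ℚ.- ι c) ℚ.+ (q ℚ.- ι d) ∣               ≤⟨ ℚ.∣p+q∣≤∣p∣+∣q∣ (p ℚ.- ι c) (q ℚ.- ι d) ⟩
  ℚ.∣ p ℚ.- ι c ∣ ℚ.+ ℚ.∣ q ℚ.- ι d ∣             ≤⟨ ℚ.+-mono-≤ pc qd ⟩
  ι r ℚ.+ ι s                                     ≡⟨ sym (ι-+ r s) ⟩
  ι (r ℤ.+ s)                                     ∎
  where
  open ℚ.≤-Reasoning
  regroup : ∀ p q c d → p ℚ.+ q ℚ.- (c ℚ.+ d) ≡ (p ℚ.- c) ℚ.+ (q ℚ.- d)
  regroup = RingSolver.solve-∀ ℚ-ring

*ᵇ-sound : ∀ {p q} A B → p ∈ᵇ A → q ∈ᵇ B → p ℚ.* q ∈ᵇ A *ᵇ B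
*ᵇ-sound {p} {q} (c , r) (d , s) (within pc) (within qd) = within $ begin
  ℚ.∣ p ℚ.* q ℚ.- ι (c ℤ.* d) ∣
    ≡⟨ cong (λ z → ℚ.∣ p ℚ.* q ℚ.- z ∣) (ι-* c d) ⟩
  ℚ.∣ p ℚ.* q ℚ.- ι c ℚ.* ι d ∣
    ≡⟨ cong ℚ.∣_∣ (regroup p q (ι c) (ι d)) ⟩
  ℚ.∣ ι c ℚ.* v ℚ.+ (u ℚ.* ι d ℚ.+ u ℚ.* v) ∣
    ≤⟨ ℚ.∣p+q∣≤∣p∣+∣q∣ (ι c ℚ.* v) (u ℚ.* ι d ℚ.+ u ℚ.* v) ⟩
  ℚ.∣ ι c ℚ.* v ∣ ℚ.+ ℚ.∣ u ℚ.* ι d ℚ.+ u ℚ.* v ∣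
    ≤⟨ ℚ.+-monoʳ-≤ ℚ.∣ ι c ℚ.* v ∣ (ℚ.∣p+q∣≤∣p∣+∣q∣ (u ℚ.* ι d) (u ℚ.* v)) ⟩
  ℚ.∣ ι c ℚ.* v ∣ ℚ.+ (ℚ.∣ u ℚ.* ι d ∣ ℚ.+ ℚ.∣ u ℚ.* v ∣)
    ≡⟨ cong₂ ℚ._+_ (ℚ.∣p*q∣≡∣p∣*∣q∣ (ι c) v) (cong₂ ℚ._+_ (ℚ.∣p*q∣≡∣p∣*∣q∣ u (ι d)) (ℚ.∣p*q∣≡∣p∣*∣q∣ u v)) ⟩
  ℚ.∣ ι c ∣ ℚ.* ℚ.∣ v ∣ ℚ.+ (ℚ.∣ u ∣ ℚ.* ℚ.∣ ι d ∣ ℚ.+ ℚ.∣ u ∣ ℚ.* ℚ.∣ v ∣)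
    ≤⟨ ℚ.+-mono-≤ (*-mono-≤₂ (ℚ.0≤∣p∣ (ι c)) (ℚ.0≤∣p∣ v) (ℚ.≤-reflexive (ι-∣∣ c)) qd)
        (ℚ.+-mono-≤ (*-mono-≤₂ (ℚ.0≤∣p∣ u) (ℚ.0≤∣p∣ (ι d)) pc (ℚ.≤-reflexive (ι-∣∣ d)))
                    (*-mono-≤₂ (ℚ.0≤∣p∣ u) (ℚ.0≤∣p∣ v) pc qd)) ⟩
  ι (+ ℤ.∣ c ∣) ℚ.* ι s ℚ.+ (ι r ℚ.* ι (+ ℤ.∣ d ∣) ℚ.+ ι r ℚ.* ι s)
    ≡⟨ sym (trans (ι-+ (+ ℤ.∣ c ∣ ℤ.* s) (r ℤ.* + ℤ.∣ d ∣ ℤ.+ r ℤ.* s))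
         (cong₂ ℚ._+_ (ι-* (+ ℤ.∣ c ∣) s) (trans (ι-+ (r ℤ.* + ℤ.∣ d ∣) (r ℤ.* s))
           (cong₂ ℚ._+_ (ι-* r (+ ℤ.∣ d ∣)) (ι-* r s))))) ⟩
  ι (+ ℤ.∣ c ∣ ℤ.* s ℤ.+ (r ℤ.* + ℤ.∣ d ∣ ℤ.+ r ℤ.* s)) ∎
  where
  open ℚ.≤-Reasoning
  u v : ℚ
  u = p ℚ.- ι c
  v = q ℚ.- ι d
  regroup : ∀ p q c d → p ℚ.* q ℚ.- c ℚ.* d ≡ c ℚ.* (q ℚ.- d) ℚ.+ ((p ℚ.- c) ℚ.* d ℚ.+ (p ℚ.- c) ℚ.* (q ℚ.- d))
  regroup = RingSolver.solve-∀ ℚ-ring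

upperᵇ lowerᵇ magnitudeᵇ : Ball → ℤ
upperᵇ (c , r)     = c ℤ.+ r
lowerᵇ (c , r)     = c ℤ.- r
magnitudeᵇ (c , r) = + ℤ.∣ c ∣ ℤ.+ r

upperᵇ-sound : ∀ {q} A → q ∈ᵇ A → q ℚ.≤ ι (upperᵇ A)
upperᵇ-sound {q} (c , r) (within h) = begin
  q                              ≡⟨ regroup q (ι c) ⟩
  ι c ℚ.+ (q ℚ.- ι c)            ≤⟨ ℚ.+-monoʳ-≤ (ι c) (ℚ.≤-trans (p≤∣p∣ (q ℚ.- ι c)) h) ⟩
  ι c ℚ.+ ι r                    ≡⟨ sym (ι-+ c r) ⟩
  ι (c ℤ.+ r)                    ∎
  where
  open ℚ.≤-Reasoning
  regroup : ∀ q c → q ≡ c ℚ.+ (q ℚ.- c)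
  regroup = RingSolver.solve-∀ ℚ-ring

lowerᵇ-sound : ∀ {q} A → q ∈ᵇ A → ι (lowerᵇ A) ℚ.≤ q
lowerᵇ-sound {q} (c , r) (within h) = begin
  ι (c ℤ.- r)                    ≡⟨ trans (ι-+ c (ℤ.- r)) (cong (λ z → ι c ℚ.+ z) (ι-neg r)) ⟩
  ι c ℚ.- ι r                    ≤⟨ ℚ.+-monoʳ-≤ (ι c) (ℚ.neg-antimono-≤
                                      (ℚ.≤-trans (p≤∣p∣ (ι c ℚ.- q))
                                        (subst (ℚ._≤ ι r) (∣u-v∣≡∣v-u∣ q (ι c)) h))) ⟩
  ι c ℚ.- (ι c ℚ.- q)            ≡⟨ regroup q (ι c) ⟩
  q                              ∎
  where
  open ℚ.≤-Reasoning
  regroup : ∀ q c → c ℚ.- (c ℚ.- q) ≡ q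
  regroup = RingSolver.solve-∀ ℚ-ring

magnitudeᵇ-sound : ∀ {q} A → q ∈ᵇ A → ℚ.∣ q ∣ ℚ.≤ ι (magnitudeᵇ A)
magnitudeᵇ-sound {q} (c , r) (within h) = begin
  ℚ.∣ q ∣                          ≤⟨ ∣u∣≤∣u-v∣+∣v∣ q (ι c) ⟩
  ℚ.∣ q ℚ.- ι c ∣ ℚ.+ ℚ.∣ ι c ∣    ≤⟨ ℚ.+-mono-≤ h (ℚ.≤-reflexive (ι-∣∣ c)) ⟩
  ι r ℚ.+ ι (+ ℤ.∣ c ∣)            ≡⟨ ℚ.+-comm (ι r) (ι (+ ℤ.∣ c ∣)) ⟩
  ι (+ ℤ.∣ c ∣) ℚ.+ ι r            ≡⟨ sym (ι-+ (+ ℤ.∣ c ∣) r) ⟩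
  ι (+ ℤ.∣ c ∣ ℤ.+ r)              ∎
  where open ℚ.≤-Reasoning

power : ℚ → ℕ → ℚ
power x zero    = 1ℚ
power x (suc n) = x ℚ.* power x n

powerᵇ : Ball → ℕ → Ball
powerᵇ X zero    = exactly 1ℤ
powerᵇ X (suc n) = X *ᵇ powerᵇ X n

powerᵇ-sound : ∀ {x} X n → x ∈ᵇ X → power x n ∈ᵇ powerᵇ X n
powerᵇ-sound X zero    h = oneᵇ
powerᵇ-sound X (suc n) h = *ᵇ-sound X (powerᵇ X n) h (powerᵇ-sound X n h)

-- With coefficients in order of decreasing degree, apply cs f n is the value at
-- n of the polynomial cs evaluated at the forward shift operator and applied to f.
apply : List ℚ → (ℕ → ℚ) → ℕ → ℚ
apply []       f n = 0ℚ
apply (c ∷ cs) f n = c ℚ.* f (length cs ℕ.+ n) ℚ.+ apply cs f n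

applyᵇ : List Ball → (ℕ → Ball) → Ball
applyᵇ []       F = exactly 0ℤ
applyᵇ (C ∷ Cs) F = C *ᵇ F (length Cs) +ᵇ applyᵇ Cs F

-- Synthetic division of v ∷ rs by the linear polynomial with root x.
quotientOf : ℚ → ℚ → List ℚ → List ℚ
quotientOf x v []       = []
quotientOf x v (r ∷ rs) = v ∷ quotientOf x (x ℚ.* v ℚ.+ r) rs

remainderOf : ℚ → ℚ → List ℚ → ℚ
remainderOf x v []       = v
remainderOf x v (r ∷ rs) = remainderOf x (x ℚ.* v ℚ.+ r) rs

quotientᵇ : Ball → Ball → List ℤ → List Ball
quotientᵇ X V []       = []
quotientᵇ X V (r ∷ rs) = V ∷ quotientᵇ X (X *ᵇ V +ᵇ exactly r) rs

data Encloses : List Ball → List ℚ → Set where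
  []  : Encloses [] []
  _∷_ : ∀ {C c Cs cs} → c ∈ᵇ C → Encloses Cs cs → Encloses (C ∷ Cs) (c ∷ cs)

encloses-length : ∀ {Cs cs} → Encloses Cs cs → length Cs ≡ length cs
encloses-length []       = refl
encloses-length (_ ∷ es) = cong suc (encloses-length es)

quotientᵇ-sound : ∀ {x v} X V rs → x ∈ᵇ X → v ∈ᵇ V → Encloses (quotientᵇ X V rs) (quotientOf x v (map ι rs))
quotientᵇ-sound X V []       hx hv = []
quotientᵇ-sound X V (r ∷ rs) hx hv = hv ∷ quotientᵇ-sound X (X *ᵇ V +ᵇ exactly r) rs hx
  (+ᵇ-sound (X *ᵇ V) (exactly r) (*ᵇ-sound X V hx hv) (exactly-sound r))

applyᵇ-sound : ∀ {Cs cs} (f : ℕ → ℚ) F → Encloses Cs cs → (∀ n → n ℕ.< length Cs → f n ∈ᵇ F n) →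
               apply cs f 0 ∈ᵇ applyᵇ Cs F
applyᵇ-sound f F [] hf = zeroᵇ
applyᵇ-sound f F (_∷_ {C} {c} {Cs} {cs} h hs) hf = +ᵇ-sound (C *ᵇ F (length Cs)) (applyᵇ Cs F)
  (*ᵇ-sound C (F (length Cs)) h
    (subst (λ k → f k ∈ᵇ F (length Cs)) (trans (encloses-length hs) (sym (ℕ.+-identityʳ (length cs))))
      (hf (length Cs) ℕ.≤-refl)))
  (applyᵇ-sound f F hs (λ n n< → hf n (ℕ.m≤n⇒m≤1+n n<)))

absolute : List ℚ → List ℚ
absolute = map ℚ.∣_∣

absoluteBound : List Ball → (ℕ → Ball) → ℤ
absoluteBound []       F = 0ℤ
absoluteBound (C ∷ Cs) F = magnitudeᵇ C ℤ.* magnitudeᵇ (F (length Cs)) ℤ.+ absoluteBound Cs F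

absoluteBound-sound : ∀ {Cs cs} (f : ℕ → ℚ) F → Encloses Cs cs → (∀ n → f n ∈ᵇ F n) → (∀ n → 0ℚ ℚ.≤ f n) →
                      apply (absolute cs) f 0 ℚ.≤ ι (absoluteBound Cs F)
absoluteBound-sound f F [] hf 0≤f = ℚ.≤-reflexive (sym ι-0)
absoluteBound-sound f F (_∷_ {C} {c} {Cs} {cs} h hs) hf 0≤f = begin
  ℚ.∣ c ∣ ℚ.* f (length (absolute cs) ℕ.+ 0) ℚ.+ apply (absolute cs) f 0
    ≤⟨ ℚ.+-mono-≤ (*-mono-≤₂ (ℚ.0≤∣p∣ c) (0≤f _) (magnitudeᵇ-sound C h)
         (ℚ.≤-trans (p≤∣p∣ _) (magnitudeᵇ-sound (F (length Cs)) enclosed)))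
       (absoluteBound-sound f F hs hf 0≤f) ⟩
  ι (magnitudeᵇ C) ℚ.* ι (magnitudeᵇ (F (length Cs))) ℚ.+ ι (absoluteBound Cs F)
    ≡⟨ sym (trans (ι-+ (magnitudeᵇ C ℤ.* magnitudeᵇ (F (length Cs))) (absoluteBound Cs F))
         (cong (ℚ._+ ι (absoluteBound Cs F)) (ι-* (magnitudeᵇ C) (magnitudeᵇ (F (length Cs)))))) ⟩
  ι (magnitudeᵇ C ℤ.* magnitudeᵇ (F (length Cs)) ℤ.+ absoluteBound Cs F) ∎
  where
  open ℚ.≤-Reasoning
  same : length Cs ≡ length (absolute cs) ℕ.+ 0
  same = trans (encloses-length hs) (trans (sym (List.length-map ℚ.∣_∣ cs)) (sym (ℕ.+-identityʳ _)))
  enclosed : f (length (absolute cs) ℕ.+ 0) ∈ᵇ F (length Cs)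
  enclosed = subst (λ k → f k ∈ᵇ F (length Cs)) same (hf (length Cs))

-- Linear recurrences with an approximate dominant root

halves : ℕ → ℚ
halves = power ½

0≤½ : 0ℚ ℚ.≤ ½
0≤½ = ℚ.nonNegative⁻¹ ½

halves-nonNeg : ∀ n → 0ℚ ℚ.≤ halves n
halves-nonNeg zero    = ℚ.nonNegative⁻¹ 1ℚ
halves-nonNeg (suc n) = *-nonNeg 0≤½ (halves-nonNeg n)

halves-linear : ∀ n → halves n ℚ.* ι (+ suc n) ℚ.≤ 1ℚ
halves-linear zero    = ℚ.≤-reflexive (trans (ℚ.*-identityˡ (ι 1ℤ)) ι-1)
halves-linear (suc n) = begin
  ½ ℚ.* halves n ℚ.* ι (+ suc (suc n))
    ≡⟨ regroup ½ (halves n) (ι (+ suc (suc n))) ⟩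
  halves n ℚ.* (½ ℚ.* ι (+ suc (suc n)))
    ≤⟨ ℚ.*-monoˡ-≤-nonNeg (halves n) {{ℚ.nonNegative (halves-nonNeg n)}}
         (ℚ.≤-trans (ℚ.*-monoˡ-≤-nonNeg ½ (ι-≤ (ℤ.+≤+ twice)))
           (ℚ.≤-reflexive (trans (cong (λ z → ½ ℚ.* z) (ι-+ (+ suc n) (+ suc n))) (halve (ι (+ suc n)))))) ⟩
  halves n ℚ.* ι (+ suc n)
    ≤⟨ halves-linear n ⟩
  1ℚ ∎
  where
  open ℚ.≤-Reasoning
  regroup : ∀ h x y → h ℚ.* x ℚ.* y ≡ x ℚ.* (h ℚ.* y)
  regroup = RingSolver.solve-∀ ℚ-ring
  halve : ∀ x → ½ ℚ.* (x ℚ.+ x) ≡ x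
  halve = RingSolver.solve-∀ ℚ-ring
  twice : suc (suc n) ℕ.≤ suc n ℕ.+ suc n
  twice = s≤s (ℕ.m≤n+m (suc n) n)

1≤numerator : ∀ p → ℚ.Positive p → 1ℤ ℤ.≤ ℚ.numerator p
1≤numerator (ℚ.mkℚ (+ suc m) _ _) _ = ℤ.+≤+ (s≤s z≤n)

clear-denominator : ∀ p → p ℚ.* ι (+ suc (ℚ.denominator-1 p)) ≡ ι (ℚ.numerator p)
clear-denominator p@(ℚ.mkℚ n d-1 _) = ℚ.toℚᵘ-injective (ℚᵘ.≃-trans (ℚ.toℚᵘ-homo-* p (ι (+ suc d-1)))
  (ℚᵘ.≃-trans (ℚᵘ.*-cong (ℚᵘ.≃-refl {ℚ.toℚᵘ p}) (ι-toℚᵘ (+ suc d-1)))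
  (ℚᵘ.≃-trans (ℚᵘ.*≡* (ℤ.*-assoc n (+ suc d-1) 1ℤ))
              (ℚᵘ.≃-sym (ι-toℚᵘ n)))))

-- If q is the denominator of ε, then (n + 1) 2⁻ⁿ ≤ 1 ≤ ε q < ε (n + 1) for all n ≥ q.
halves-small : ∀ ε → 0ℚ ℚ.< ε → ∃[ N ] (∀ n → N ℕ.≤ n → halves n ℚ.< ε)
halves-small ε ε>0 = q , λ n q≤n → ℚ.*-cancelʳ-<-nonNeg (ι (+ suc n))
  {{ℚ.nonNegative (0≤ι (0≤+ (suc n)))}} (begin-strict
    halves n ℚ.* ι (+ suc n)  ≤⟨ halves-linear n ⟩
    1ℚ                        ≤⟨ 1≤ι (1≤numerator ε ε-pos) ⟩
    ι (ℚ.numerator ε)         ≡⟨ sym (clear-denominator ε) ⟩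
    ε ℚ.* ι (+ q)             <⟨ ℚ.*-monoʳ-<-pos ε {{ε-pos}} (ι-< (ℤ.+<+ (s≤s q≤n))) ⟩
    ε ℚ.* ι (+ suc n)         ∎)
  where
  open ℚ.≤-Reasoning
  q : ℕ
  q = suc (ℚ.denominator-1 ε)
  ε-pos : ℚ.Positive ε
  ε-pos = ℚ.positive ε>0

power-nonNeg : ∀ {x} → 0ℚ ℚ.≤ x → ∀ n → 0ℚ ℚ.≤ power x n
power-nonNeg 0≤x zero    = ℚ.nonNegative⁻¹ 1ℚ
power-nonNeg 0≤x (suc n) = *-nonNeg 0≤x (power-nonNeg 0≤x n)

1≤power : ∀ {x} → 1ℚ ℚ.≤ x → ∀ n → 1ℚ ℚ.≤ power x n
1≤power 1≤x zero    = ℚ.≤-refl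
1≤power 1≤x (suc n) = *-mono-≤₂ {1ℚ} (ℚ.nonNegative⁻¹ 1ℚ) (ℚ.nonNegative⁻¹ 1ℚ) 1≤x (1≤power 1≤x n)

power-+ : ∀ x m n → power x (m ℕ.+ n) ≡ power x n ℚ.* power x m
power-+ x zero    n = sym (ℚ.*-identityʳ (power x n))
power-+ x (suc m) n = trans (cong (λ z → x ℚ.* z) (power-+ x m n)) (regroup x (power x n) (power x m))
  where
  regroup : ∀ x p q → x ℚ.* (p ℚ.* q) ≡ p ℚ.* (x ℚ.* q)
  regroup = RingSolver.solve-∀ ℚ-ring

power-* : ∀ x y n → power (x ℚ.* y) n ≡ power x n ℚ.* power y n
power-* x y zero    = refl
power-* x y (suc n) = trans (cong (λ z → x ℚ.* y ℚ.* z) (power-* x y n)) (regroup x y (power x n) (power y n))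
  where
  regroup : ∀ x y p q → x ℚ.* y ℚ.* (p ℚ.* q) ≡ x ℚ.* p ℚ.* (y ℚ.* q)
  regroup = RingSolver.solve-∀ ℚ-ring

quotientOf-length : ∀ x v rs → length (quotientOf x v rs) ≡ length rs
quotientOf-length x v []       = refl
quotientOf-length x v (r ∷ rs) = cong suc (quotientOf-length x (x ℚ.* v ℚ.+ r) rs)

-- With P the polynomial `v ∷ rs`, Q its quotient, ρ its remainder and E the shift, this is P = (E -
-- x) Q + ρ applied to `f`.
apply-quotient : ∀ x v rs f n →
  apply (quotientOf x v rs) f (suc n) ℚ.+ remainderOf x v rs ℚ.* f n ≡
  x ℚ.* apply (quotientOf x v rs) f n ℚ.+ apply (v ∷ rs) f n
apply-quotient x v []       f n = regroup x (v ℚ.* f n)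
  where
  regroup : ∀ x y → 0ℚ ℚ.+ y ≡ x ℚ.* 0ℚ ℚ.+ (y ℚ.+ 0ℚ)
  regroup = RingSolver.solve-∀ ℚ-ring
apply-quotient x v (r ∷ rs) f n
  rewrite quotientOf-length x (x ℚ.* v ℚ.+ r) rs | ℕ.+-suc (length rs) n =
  trans (ℚ.+-assoc (v ℚ.* top) (apply rest f (suc n)) _)
 (trans (cong (λ z → v ℚ.* top ℚ.+ z) (apply-quotient x (x ℚ.* v ℚ.+ r) rs f n))
        (regroup x v r top (f (length rs ℕ.+ n)) (apply rest f n) (apply rs f n)))
  where
  top : ℚ
  top = f (suc (length rs ℕ.+ n))
  rest : List ℚ
  rest = quotientOf x (x ℚ.* v ℚ.+ r) rs
  regroup : ∀ x v r t g p q → v ℚ.* t ℚ.+ (x ℚ.* p ℚ.+ ((x ℚ.* v ℚ.+ r) ℚ.* g ℚ.+ q)) ≡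
            x ℚ.* (v ℚ.* g ℚ.+ p) ℚ.+ (v ℚ.* t ℚ.+ (r ℚ.* g ℚ.+ q))
  regroup = RingSolver.solve-∀ ℚ-ring

apply-minus : ∀ cs f k g n → apply cs (λ m → f m ℚ.- k ℚ.* g m) n ≡ apply cs f n ℚ.- k ℚ.* apply cs g n
apply-minus []       f k g n = regroup k
  where
  regroup : ∀ k → 0ℚ ≡ 0ℚ ℚ.- k ℚ.* 0ℚ
  regroup = RingSolver.solve-∀ ℚ-ring
apply-minus (c ∷ cs) f k g n = trans
  (cong (λ z → c ℚ.* (f (length cs ℕ.+ n) ℚ.- k ℚ.* g (length cs ℕ.+ n)) ℚ.+ z) (apply-minus cs f k g n))
  (regroup c k (f (length cs ℕ.+ n)) (g (length cs ℕ.+ n)) (apply cs f n) (apply cs g n))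
  where
  regroup : ∀ c k x y p q → c ℚ.* (x ℚ.- k ℚ.* y) ℚ.+ (p ℚ.- k ℚ.* q) ≡ (c ℚ.* x ℚ.+ p) ℚ.- k ℚ.* (c ℚ.* y ℚ.+ q)
  regroup = RingSolver.solve-∀ ℚ-ring

apply-power : ∀ cs x n → apply cs (power x) n ≡ power x n ℚ.* apply cs (power x) 0
apply-power []       x n = sym (ℚ.*-zeroʳ (power x n))
apply-power (c ∷ cs) x n rewrite ℕ.+-identityʳ (length cs) = trans
  (cong₂ (λ y z → c ℚ.* y ℚ.+ z) (power-+ x (length cs) n) (apply-power cs x n))
  (regroup c (power x n) (power x (length cs)) (apply cs (power x) 0))
  where
  regroup : ∀ c p q s → c ℚ.* (p ℚ.* q) ℚ.+ p ℚ.* s ≡ p ℚ.* (c ℚ.* q ℚ.+ s)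
  regroup = RingSolver.solve-∀ ℚ-ring

repeat : ℕ → ℚ → ℚ
repeat zero    q = 0ℚ
repeat (suc m) q = q ℚ.+ repeat m q

apply-bound : ∀ {K M p β} cs (f g : ℕ → ℚ) n → 0ℚ ℚ.≤ K → 0ℚ ℚ.≤ M → 0ℚ ℚ.≤ p →
  All (λ c → ℚ.∣ c ∣ ℚ.≤ K) cs → (∀ j → j ℕ.< length cs → ℚ.∣ f (j ℕ.+ n) ∣ ℚ.≤ β ℚ.* g (j ℕ.+ n) ℚ.+ M ℚ.* p) →
  ℚ.∣ apply cs f n ∣ ℚ.≤ β ℚ.* apply (absolute cs) g n ℚ.+ repeat (length cs) (K ℚ.* M) ℚ.* p
apply-bound {K} {M} {p} {β} [] f g n 0≤K 0≤M 0≤p [] h = ℚ.≤-reflexive (regroup β p)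
  where
  regroup : ∀ β p → 0ℚ ≡ β ℚ.* 0ℚ ℚ.+ 0ℚ ℚ.* p
  regroup = RingSolver.solve-∀ ℚ-ring
apply-bound {K} {M} {p} {β} (c ∷ cs) f g n 0≤K 0≤M 0≤p (c≤K ∷ cs≤K) h = begin
  ℚ.∣ c ℚ.* f i ℚ.+ apply cs f n ∣
    ≤⟨ ℚ.∣p+q∣≤∣p∣+∣q∣ (c ℚ.* f i) (apply cs f n) ⟩
  ℚ.∣ c ℚ.* f i ∣ ℚ.+ ℚ.∣ apply cs f n ∣
    ≤⟨ ℚ.+-mono-≤ head (apply-bound {K} {M} {p} {β} cs f g n 0≤K 0≤M 0≤p cs≤K (λ j j< → h j (ℕ.m≤n⇒m≤1+n j<))) ⟩
  (β ℚ.* (ℚ.∣ c ∣ ℚ.* g i) ℚ.+ K ℚ.* M ℚ.* p) ℚ.+ (β ℚ.* A ℚ.+ repeat (length cs) (K ℚ.* M) ℚ.* p)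
    ≡⟨ regroup β (ℚ.∣ c ∣ ℚ.* g i) (K ℚ.* M) p A (repeat (length cs) (K ℚ.* M)) ⟩
  β ℚ.* (ℚ.∣ c ∣ ℚ.* g i ℚ.+ A) ℚ.+ (K ℚ.* M ℚ.+ repeat (length cs) (K ℚ.* M)) ℚ.* p
    ≡⟨ cong (λ k → β ℚ.* (ℚ.∣ c ∣ ℚ.* g (k ℕ.+ n) ℚ.+ A) ℚ.+ (K ℚ.* M ℚ.+ repeat (length cs) (K ℚ.* M)) ℚ.* p)
         (sym (List.length-map ℚ.∣_∣ cs)) ⟩
  β ℚ.* apply (absolute (c ∷ cs)) g n ℚ.+ repeat (suc (length cs)) (K ℚ.* M) ℚ.* p ∎
  where
  open ℚ.≤-Reasoning
  i : ℕ
  i = length cs ℕ.+ n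
  A : ℚ
  A = apply (absolute cs) g n
  regroup : ∀ β x m p a r → (β ℚ.* x ℚ.+ m ℚ.* p) ℚ.+ (β ℚ.* a ℚ.+ r ℚ.* p) ≡ β ℚ.* (x ℚ.+ a) ℚ.+ (m ℚ.+ r) ℚ.* p
  regroup = RingSolver.solve-∀ ℚ-ring
  expand : ∀ c β g m p → c ℚ.* (β ℚ.* g ℚ.+ m ℚ.* p) ≡ β ℚ.* (c ℚ.* g) ℚ.+ c ℚ.* (m ℚ.* p)
  expand = RingSolver.solve-∀ ℚ-ring
  head : ℚ.∣ c ℚ.* f i ∣ ℚ.≤ β ℚ.* (ℚ.∣ c ∣ ℚ.* g i) ℚ.+ K ℚ.* M ℚ.* p
  head = begin
    ℚ.∣ c ℚ.* f i ∣                                        ≡⟨ ℚ.∣p*q∣≡∣p∣*∣q∣ c (f i) ⟩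
    ℚ.∣ c ∣ ℚ.* ℚ.∣ f i ∣
      ≤⟨ ℚ.*-monoˡ-≤-nonNeg ℚ.∣ c ∣ {{ℚ.nonNegative (ℚ.0≤∣p∣ c)}} (h (length cs) ℕ.≤-refl) ⟩
    ℚ.∣ c ∣ ℚ.* (β ℚ.* g i ℚ.+ M ℚ.* p)                    ≡⟨ expand ℚ.∣ c ∣ β (g i) M p ⟩
    β ℚ.* (ℚ.∣ c ∣ ℚ.* g i) ℚ.+ ℚ.∣ c ∣ ℚ.* (M ℚ.* p)
      ≤⟨ ℚ.+-monoʳ-≤ (β ℚ.* (ℚ.∣ c ∣ ℚ.* g i))
           (ℚ.*-monoʳ-≤-nonNeg (M ℚ.* p) {{ℚ.nonNegative (*-nonNeg 0≤M 0≤p)}} c≤K) ⟩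
    β ℚ.* (ℚ.∣ c ∣ ℚ.* g i) ℚ.+ K ℚ.* (M ℚ.* p)
      ≡⟨ cong (λ z → β ℚ.* (ℚ.∣ c ∣ ℚ.* g i) ℚ.+ z) (sym (ℚ.*-assoc K M p)) ⟩
    β ℚ.* (ℚ.∣ c ∣ ℚ.* g i) ℚ.+ K ℚ.* M ℚ.* p              ∎

horner-step-bound : ∀ {x v V u r} → 0ℚ ℚ.≤ V → ℚ.∣ x ∣ ℚ.≤ u → ℚ.∣ v ∣ ℚ.≤ V →
                    ℚ.∣ x ℚ.* v ℚ.+ r ∣ ℚ.≤ u ℚ.* V ℚ.+ ℚ.∣ r ∣
horner-step-bound {x} {v} {V} {u} {r} 0≤V x≤u v≤V = ℚ.≤-trans (ℚ.∣p+q∣≤∣p∣+∣q∣ (x ℚ.* v) r)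
  (ℚ.+-monoˡ-≤ ℚ.∣ r ∣ (ℚ.≤-trans (ℚ.≤-reflexive (ℚ.∣p*q∣≡∣p∣*∣q∣ x v))
    (*-mono-≤₂ (ℚ.0≤∣p∣ x) (ℚ.0≤∣p∣ v) x≤u v≤V)))

-- The bound K is the same for all x with |x| ≤ u, as the estimates below must not depend on the
-- approximation to the root.
quotientOf-bounded : ∀ u → 0ℚ ℚ.≤ u → ∀ V → 0ℚ ℚ.≤ V → ∀ rs → ∃[ K ] 0ℚ ℚ.≤ K ×
  (∀ x v → ℚ.∣ x ∣ ℚ.≤ u → ℚ.∣ v ∣ ℚ.≤ V → All (λ c → ℚ.∣ c ∣ ℚ.≤ K) (quotientOf x v rs))
quotientOf-bounded u 0≤u V 0≤V []       = 0ℚ , ℚ.≤-refl , λ _ _ _ _ → []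
quotientOf-bounded u 0≤u V 0≤V (r ∷ rs)
  with quotientOf-bounded u 0≤u (u ℚ.* V ℚ.+ ℚ.∣ r ∣) (+-nonNeg (*-nonNeg 0≤u 0≤V) (ℚ.0≤∣p∣ r)) rs
... | K , 0≤K , bound = V ℚ.+ K , +-nonNeg 0≤V 0≤K , λ x v x≤u v≤V →
  ℚ.≤-trans v≤V (p≤p+q 0≤K) ∷
  All.map (λ c≤K → ℚ.≤-trans c≤K (q≤p+q 0≤V)) (bound x (x ℚ.* v ℚ.+ r) x≤u (horner-step-bound {x} {v} 0≤V x≤u v≤V))

-- Each Horner step turns a Lipschitz constant D for the current value into u D + V. Together with a
-- sign change, this bounds the residue at the bisection points.
remainderOf-lipschitz : ∀ u → 0ℚ ℚ.≤ u → ∀ V → 0ℚ ℚ.≤ V → ∀ D → 0ℚ ℚ.≤ D → ∀ rs → ∃[ L ] 0ℚ ℚ.≤ L ×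
  (∀ x y v w → ℚ.∣ x ∣ ℚ.≤ u → ℚ.∣ y ∣ ℚ.≤ u → ℚ.∣ v ∣ ℚ.≤ V → ℚ.∣ w ∣ ℚ.≤ V →
   ℚ.∣ v ℚ.- w ∣ ℚ.≤ D ℚ.* ℚ.∣ x ℚ.- y ∣ →
   ℚ.∣ remainderOf x v rs ℚ.- remainderOf y w rs ∣ ℚ.≤ L ℚ.* ℚ.∣ x ℚ.- y ∣)
remainderOf-lipschitz u 0≤u V 0≤V D 0≤D []       = D , 0≤D , λ _ _ _ _ _ _ _ _ h → h
remainderOf-lipschitz u 0≤u V 0≤V D 0≤D (r ∷ rs)
  with remainderOf-lipschitz u 0≤u (u ℚ.* V ℚ.+ ℚ.∣ r ∣) (+-nonNeg (*-nonNeg 0≤u 0≤V) (ℚ.0≤∣p∣ r))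
         (u ℚ.* D ℚ.+ V) (+-nonNeg (*-nonNeg 0≤u 0≤D) 0≤V) rs
... | L , 0≤L , bound = L , 0≤L , λ x y v w x≤u y≤u v≤V w≤V h →
  bound x y (x ℚ.* v ℚ.+ r) (y ℚ.* w ℚ.+ r) x≤u y≤u
    (horner-step-bound {x} {v} 0≤V x≤u v≤V) (horner-step-bound {y} {w} 0≤V y≤u w≤V) (next x y v w x≤u w≤V h)
  where
  open ℚ.≤-Reasoning
  next : ∀ x y v w → ℚ.∣ x ∣ ℚ.≤ u → ℚ.∣ w ∣ ℚ.≤ V → ℚ.∣ v ℚ.- w ∣ ℚ.≤ D ℚ.* ℚ.∣ x ℚ.- y ∣ →
         ℚ.∣ (x ℚ.* v ℚ.+ r) ℚ.- (y ℚ.* w ℚ.+ r) ∣ ℚ.≤ (u ℚ.* D ℚ.+ V) ℚ.* ℚ.∣ x ℚ.- y ∣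
  next x y v w x≤u w≤V h = begin
    ℚ.∣ (x ℚ.* v ℚ.+ r) ℚ.- (y ℚ.* w ℚ.+ r) ∣
      ≡⟨ cong ℚ.∣_∣ (cancel (x ℚ.* v) (y ℚ.* w) r) ⟩
    ℚ.∣ x ℚ.* v ℚ.- y ℚ.* w ∣
      ≤⟨ *-diff x v y w ⟩
    ℚ.∣ x ∣ ℚ.* ℚ.∣ v ℚ.- w ∣ ℚ.+ ℚ.∣ x ℚ.- y ∣ ℚ.* ℚ.∣ w ∣
      ≤⟨ ℚ.+-mono-≤ (*-mono-≤₂ (ℚ.0≤∣p∣ x) (ℚ.0≤∣p∣ (v ℚ.- w)) x≤u h)
           (*-mono-≤₂ (ℚ.0≤∣p∣ (x ℚ.- y)) (ℚ.0≤∣p∣ w) ℚ.≤-refl w≤V) ⟩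
    u ℚ.* (D ℚ.* ℚ.∣ x ℚ.- y ∣) ℚ.+ ℚ.∣ x ℚ.- y ∣ ℚ.* V
      ≡⟨ regroup u D ℚ.∣ x ℚ.- y ∣ V ⟩
    (u ℚ.* D ℚ.+ V) ℚ.* ℚ.∣ x ℚ.- y ∣ ∎
    where
    cancel : ∀ p q r → (p ℚ.+ r) ℚ.- (q ℚ.+ r) ≡ p ℚ.- q
    cancel = RingSolver.solve-∀ ℚ-ring
    regroup : ∀ u d e v → u ℚ.* (d ℚ.* e) ℚ.+ e ℚ.* v ≡ (u ℚ.* d ℚ.+ v) ℚ.* e
    regroup = RingSolver.solve-∀ ℚ-ring

-- Let x be an approximate root, in [l , h], of the characteristic polynomial of
-- the recurrence, ρ x its residue, and Q the quotient of the polynomial by the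
-- linear factor of x.  Applied to Q, the sequence b is x-geometric up to a
-- multiple of ρ x, and so the deviation z x n = b n - κ xⁿ satisfies the
-- recurrence with characteristic polynomial Q up to a multiple of ρ x.  As the
-- coefficients of Q after the first one are small, every window of d terms of
-- z x n / xⁿ is at most half as large as the preceding one.
module Deviation (b : ℕ → ℚ) (r : ℚ) (rs : List ℚ) (l h : ℚ) (1≤l : 1ℚ ℚ.≤ l)
  (recurrence : ∀ n → apply (1ℚ ∷ r ∷ rs) b n ≡ 0ℚ) where

  d : ℕ
  d = length rs

  Q Q′ : ℚ → List ℚ
  Q′ x = quotientOf x (x ℚ.* 1ℚ ℚ.+ r) rs
  Q x  = 1ℚ ∷ Q′ x

  ρ : ℚ → ℚ
  ρ x = remainderOf x 1ℚ (r ∷ rs)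

  InRange : ℚ → Set
  InRange x = l ℚ.≤ x × x ℚ.≤ h

  1≤x : ∀ {x} → InRange x → 1ℚ ℚ.≤ x
  1≤x (l≤x , _) = ℚ.≤-trans 1≤l l≤x

  0≤x : ∀ {x} → InRange x → 0ℚ ℚ.≤ x
  0≤x x∈ = ℚ.≤-trans (ℚ.nonNegative⁻¹ 1ℚ) (1≤x x∈)

  ∣x∣≤h : ∀ {x} → InRange x → ℚ.∣ x ∣ ℚ.≤ h
  ∣x∣≤h x∈ = subst (ℚ._≤ h) (sym (ℚ.0≤p⇒∣p∣≡p (0≤x x∈))) (proj₂ x∈)

  -- This is Q(x). Since P(t) = (t - x) Q(t) + ρ with constant ρ, it is also the derivative of P at
  -- x.
  normalizer : ℚ → ℚ
  normalizer x = apply (Q x) (power x) 0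

  error : ℚ → ℕ → ℚ
  error x n = apply (Q x) b n ℚ.- apply (Q x) b 0 ℚ.* power x n

  -- At an exact root the error would vanish identically; the residue feeds in -ρ(x) b(n) at every
  -- step.
  error-suc : ∀ x n → error x (suc n) ≡ x ℚ.* error x n ℚ.+ ℚ.- (ρ x ℚ.* b n)
  error-suc x n = trans (regroup (apply (Q x) b (suc n)) (ρ x ℚ.* b n) (apply (Q x) b 0) x (power x n))
    (trans (cong (λ y → y ℚ.- ρ x ℚ.* b n ℚ.- apply (Q x) b 0 ℚ.* (x ℚ.* power x n))
             (trans (apply-quotient x 1ℚ (r ∷ rs) b n)
                    (cong (λ y → x ℚ.* apply (Q x) b n ℚ.+ y) (recurrence n))))
           (collect x (apply (Q x) b n) (ρ x ℚ.* b n) (apply (Q x) b 0) (power x n)))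
    where
    regroup : ∀ w e w₀ x p → w ℚ.- w₀ ℚ.* (x ℚ.* p) ≡ (w ℚ.+ e) ℚ.- e ℚ.- w₀ ℚ.* (x ℚ.* p)
    regroup = RingSolver.solve-∀ ℚ-ring
    collect : ∀ x w e w₀ p → (x ℚ.* w ℚ.+ 0ℚ) ℚ.- e ℚ.- w₀ ℚ.* (x ℚ.* p) ≡ x ℚ.* (w ℚ.- w₀ ℚ.* p) ℚ.+ ℚ.- e
    collect = RingSolver.solve-∀ ℚ-ring

  error-bound : 0ℚ ℚ.≤ h → ∀ n → ∃[ C ] 0ℚ ℚ.≤ C × (∀ x → InRange x → ℚ.∣ error x n ∣ ℚ.≤ C ℚ.* ℚ.∣ ρ x ∣)
  error-bound 0≤h zero = 0ℚ , ℚ.≤-refl , λ x _ → ℚ.≤-reflexive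
    (trans (cong ℚ.∣_∣ (vanish (apply (Q x) b 0))) (sym (ℚ.*-zeroˡ ℚ.∣ ρ x ∣)))
    where
    vanish : ∀ w → w ℚ.- w ℚ.* 1ℚ ≡ 0ℚ
    vanish = RingSolver.solve-∀ ℚ-ring
  error-bound 0≤h (suc n) with error-bound 0≤h n
  ... | C , 0≤C , bound = h ℚ.* C ℚ.+ ℚ.∣ b n ∣ , +-nonNeg (*-nonNeg 0≤h 0≤C) (ℚ.0≤∣p∣ (b n)) , λ x x∈ → begin
    ℚ.∣ error x (suc n) ∣
      ≡⟨ cong ℚ.∣_∣ (error-suc x n) ⟩
    ℚ.∣ x ℚ.* error x n ℚ.+ ℚ.- (ρ x ℚ.* b n) ∣
      ≤⟨ ℚ.∣p+q∣≤∣p∣+∣q∣ (x ℚ.* error x n) (ℚ.- (ρ x ℚ.* b n)) ⟩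
    ℚ.∣ x ℚ.* error x n ∣ ℚ.+ ℚ.∣ ℚ.- (ρ x ℚ.* b n) ∣
      ≡⟨ cong₂ ℚ._+_ (ℚ.∣p*q∣≡∣p∣*∣q∣ x (error x n))
           (trans (ℚ.∣-p∣≡∣p∣ (ρ x ℚ.* b n)) (ℚ.∣p*q∣≡∣p∣*∣q∣ (ρ x) (b n))) ⟩
    ℚ.∣ x ∣ ℚ.* ℚ.∣ error x n ∣ ℚ.+ ℚ.∣ ρ x ∣ ℚ.* ℚ.∣ b n ∣
      ≤⟨ ℚ.+-monoˡ-≤ (ℚ.∣ ρ x ∣ ℚ.* ℚ.∣ b n ∣)
           (*-mono-≤₂ (ℚ.0≤∣p∣ x) (ℚ.0≤∣p∣ (error x n)) (∣x∣≤h x∈) (bound x x∈)) ⟩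
    h ℚ.* (C ℚ.* ℚ.∣ ρ x ∣) ℚ.+ ℚ.∣ ρ x ∣ ℚ.* ℚ.∣ b n ∣
      ≡⟨ regroup h C ℚ.∣ ρ x ∣ ℚ.∣ b n ∣ ⟩
    (h ℚ.* C ℚ.+ ℚ.∣ b n ∣) ℚ.* ℚ.∣ ρ x ∣ ∎
    where
    open ℚ.≤-Reasoning
    regroup : ∀ h c p b → h ℚ.* (c ℚ.* p) ℚ.+ p ℚ.* b ≡ (h ℚ.* c ℚ.+ b) ℚ.* p
    regroup = RingSolver.solve-∀ ℚ-ring

  module _
    (l≤h : l ℚ.≤ h)
    (contracting : ∀ x → InRange x → apply (absolute (Q′ x)) (power x) 0 ℚ.≤ ½ ℚ.* power x d)
    (κ : ℚ → ℚ) (κ-normalized : ∀ x → InRange x → κ x ℚ.* normalizer x ≡ apply (Q x) b 0)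
    (∣κ∣≤1 : ∀ x → InRange x → ℚ.∣ κ x ∣ ℚ.≤ 1ℚ)
    where

    0≤h : 0ℚ ℚ.≤ h
    0≤h = ℚ.≤-trans (0≤x (ℚ.≤-refl , l≤h)) l≤h

    z : ℚ → ℕ → ℚ
    z x n = b n ℚ.- κ x ℚ.* power x n

    -- By the choice of κ, the term κ Q(x) xⁿ equals Q(E) b(0) · xⁿ, so Q(E) maps z to `error`; Q is
    -- monic, so the leading term can be isolated.
    z-recurrence : ∀ x n → InRange x → z x (d ℕ.+ n) ≡ error x n ℚ.- apply (Q′ x) (z x) n
    z-recurrence x n x∈ = trans (isolate (z x (length (Q′ x) ℕ.+ n)) (apply (Q′ x) (z x) n) d≡)
      (cong (ℚ._- apply (Q′ x) (z x) n) (trans (apply-minus (Q x) b (κ x) (power x) n)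
        (trans (cong (λ y → apply (Q x) b n ℚ.- κ x ℚ.* y) (apply-power (Q x) x n))
        (trans (regroup (apply (Q x) b n) (κ x) (power x n) (normalizer x))
               (cong (λ y → apply (Q x) b n ℚ.- y ℚ.* power x n) (κ-normalized x x∈))))))
      where
      d≡ : z x (d ℕ.+ n) ≡ z x (length (Q′ x) ℕ.+ n)
      d≡ = cong (λ k → z x (k ℕ.+ n)) (sym (quotientOf-length x (x ℚ.* 1ℚ ℚ.+ r) rs))
      isolate : ∀ {y} v a → y ≡ v → y ≡ (1ℚ ℚ.* v ℚ.+ a) ℚ.- a
      isolate v a refl = ring v a
        where
        ring : ∀ v a → v ≡ (1ℚ ℚ.* v ℚ.+ a) ℚ.- a
        ring = RingSolver.solve-∀ ℚ-ring
      regroup : ∀ w k p q → w ℚ.- k ℚ.* (p ℚ.* q) ≡ w ℚ.- k ℚ.* q ℚ.* p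
      regroup = RingSolver.solve-∀ ℚ-ring

    -- M may depend on n but not on x. For fixed n the second term thus tends to 0 as x approaches
    -- the root.
    Bounded : ℚ → ℕ → Set
    Bounded β n = ∃[ M ] 0ℚ ℚ.≤ M × (∀ x → InRange x → ℚ.∣ z x n ∣ ℚ.≤ β ℚ.* power x n ℚ.+ M ℚ.* ℚ.∣ ρ x ∣)

    window : ∀ β n e → (∀ j → j ℕ.< e → Bounded β (j ℕ.+ n)) → ∃[ M ] 0ℚ ℚ.≤ M ×
      (∀ x → InRange x → ∀ j → j ℕ.< e → ℚ.∣ z x (j ℕ.+ n) ∣ ℚ.≤ β ℚ.* power x (j ℕ.+ n) ℚ.+ M ℚ.* ℚ.∣ ρ x ∣)
    window β n zero    bounded = 0ℚ , ℚ.≤-refl , λ _ _ _ ()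
    window β n (suc e) bounded
      with window β n e (λ j j<e → bounded j (ℕ.m≤n⇒m≤1+n j<e)) | bounded e ℕ.≤-refl
    ... | M , 0≤M , old | M′ , 0≤M′ , new = M ℚ.+ M′ , +-nonNeg 0≤M 0≤M′ , all
      where
      weaken : ∀ {N N′} x j → N ℚ.≤ N′ → ℚ.∣ z x (j ℕ.+ n) ∣ ℚ.≤ β ℚ.* power x (j ℕ.+ n) ℚ.+ N ℚ.* ℚ.∣ ρ x ∣ →
               ℚ.∣ z x (j ℕ.+ n) ∣ ℚ.≤ β ℚ.* power x (j ℕ.+ n) ℚ.+ N′ ℚ.* ℚ.∣ ρ x ∣
      weaken x j N≤N′ b = ℚ.≤-trans b (ℚ.+-monoʳ-≤ (β ℚ.* power x (j ℕ.+ n))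
        (ℚ.*-monoʳ-≤-nonNeg ℚ.∣ ρ x ∣ {{ℚ.nonNegative (ℚ.0≤∣p∣ (ρ x))}} N≤N′))
      all : ∀ x → InRange x → ∀ j → j ℕ.< suc e →
            ℚ.∣ z x (j ℕ.+ n) ∣ ℚ.≤ β ℚ.* power x (j ℕ.+ n) ℚ.+ (M ℚ.+ M′) ℚ.* ℚ.∣ ρ x ∣
      all x x∈ j j<se with ℕ.m≤n⇒m<n∨m≡n (ℕ.≤-pred j<se)
      ... | inj₁ j<e  = weaken {M} x j (p≤p+q 0≤M′) (old x x∈ j j<e)
      ... | inj₂ refl = weaken {M′} x j (q≤p+q 0≤M) (new x x∈)

    -- Substitute the bounds for a window into `z-recurrence`: the coefficients of Q after the first
    -- one turn β into at most β / 2, and everything else is a constant multiple of |ρ(x)|.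
    halved : ∀ β n → 0ℚ ℚ.≤ β → (∀ j → j ℕ.< d → Bounded β (j ℕ.+ n)) → Bounded (½ ℚ.* β) (d ℕ.+ n)
    halved β n 0≤β bounded
      with window β n d bounded | error-bound 0≤h n
         | quotientOf-bounded h 0≤h (h ℚ.* 1ℚ ℚ.+ ℚ.∣ r ∣)
             (+-nonNeg (*-nonNeg 0≤h (ℚ.nonNegative⁻¹ 1ℚ)) (ℚ.0≤∣p∣ r)) rs
    ... | M , 0≤M , zs | C , 0≤C , err | K , 0≤K , coefficients =
      C ℚ.+ repeat d (K ℚ.* M) , +-nonNeg 0≤C (repeat-nonNeg d (*-nonNeg 0≤K 0≤M)) , λ x x∈ → begin
      ℚ.∣ z x (d ℕ.+ n) ∣
        ≡⟨ cong ℚ.∣_∣ (z-recurrence x n x∈) ⟩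
      ℚ.∣ error x n ℚ.- apply (Q′ x) (z x) n ∣
        ≤⟨ ℚ.∣p-q∣≤∣p∣+∣q∣ (error x n) (apply (Q′ x) (z x) n) ⟩
      ℚ.∣ error x n ∣ ℚ.+ ℚ.∣ apply (Q′ x) (z x) n ∣
        ≤⟨ ℚ.+-mono-≤ (err x x∈)
             (apply-bound {K} {M} {ℚ.∣ ρ x ∣} {β} (Q′ x) (z x) (power x) n 0≤K 0≤M (ℚ.0≤∣p∣ (ρ x))
               (coefficients x (x ℚ.* 1ℚ ℚ.+ r) (∣x∣≤h x∈) (horner-step-bound {x} {1ℚ} (ℚ.nonNegative⁻¹ 1ℚ) (∣x∣≤h x∈) ℚ.≤-refl))
               (λ j j< → zs x x∈ j (subst (j ℕ.<_) (quotientOf-length x (x ℚ.* 1ℚ ℚ.+ r) rs) j<))) ⟩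
      C ℚ.* ℚ.∣ ρ x ∣ ℚ.+ (β ℚ.* apply (absolute (Q′ x)) (power x) n ℚ.+
                           repeat (length (Q′ x)) (K ℚ.* M) ℚ.* ℚ.∣ ρ x ∣)
        ≡⟨ cong₂ (λ s k → C ℚ.* ℚ.∣ ρ x ∣ ℚ.+ (β ℚ.* s ℚ.+ repeat k (K ℚ.* M) ℚ.* ℚ.∣ ρ x ∣))
             (apply-power (absolute (Q′ x)) x n) (quotientOf-length x (x ℚ.* 1ℚ ℚ.+ r) rs) ⟩
      C ℚ.* ℚ.∣ ρ x ∣ ℚ.+ (β ℚ.* (power x n ℚ.* apply (absolute (Q′ x)) (power x) 0) ℚ.+
                           repeat d (K ℚ.* M) ℚ.* ℚ.∣ ρ x ∣)
        ≤⟨ ℚ.+-monoʳ-≤ (C ℚ.* ℚ.∣ ρ x ∣) (ℚ.+-monoˡ-≤ (repeat d (K ℚ.* M) ℚ.* ℚ.∣ ρ x ∣)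
             (ℚ.*-monoˡ-≤-nonNeg β {{ℚ.nonNegative 0≤β}}
               (ℚ.*-monoˡ-≤-nonNeg (power x n) {{ℚ.nonNegative (power-nonNeg (0≤x x∈) n)}} (contracting x x∈)))) ⟩
      C ℚ.* ℚ.∣ ρ x ∣ ℚ.+ (β ℚ.* (power x n ℚ.* (½ ℚ.* power x d)) ℚ.+ repeat d (K ℚ.* M) ℚ.* ℚ.∣ ρ x ∣)
        ≡⟨ regroup C ℚ.∣ ρ x ∣ β (power x n) ½ (power x d) (repeat d (K ℚ.* M)) ⟩
      ½ ℚ.* β ℚ.* (power x n ℚ.* power x d) ℚ.+ (C ℚ.+ repeat d (K ℚ.* M)) ℚ.* ℚ.∣ ρ x ∣
        ≡⟨ cong (λ y → ½ ℚ.* β ℚ.* y ℚ.+ (C ℚ.+ repeat d (K ℚ.* M)) ℚ.* ℚ.∣ ρ x ∣) (sym (power-+ x d n)) ⟩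
      ½ ℚ.* β ℚ.* power x (d ℕ.+ n) ℚ.+ (C ℚ.+ repeat d (K ℚ.* M)) ℚ.* ℚ.∣ ρ x ∣ ∎
      where
      open ℚ.≤-Reasoning
      repeat-nonNeg : ∀ m {q} → 0ℚ ℚ.≤ q → 0ℚ ℚ.≤ repeat m q
      repeat-nonNeg zero    0≤q = ℚ.≤-refl
      repeat-nonNeg (suc m) 0≤q = +-nonNeg 0≤q (repeat-nonNeg m 0≤q)
      regroup : ∀ c p β y t q m → c ℚ.* p ℚ.+ (β ℚ.* (y ℚ.* (t ℚ.* q)) ℚ.+ m ℚ.* p) ≡
                t ℚ.* β ℚ.* (y ℚ.* q) ℚ.+ (c ℚ.+ m) ℚ.* p
      regroup = RingSolver.solve-∀ ℚ-ring

    -- The initial 1 absorbs |κ| ≤ 1, so that the sum over the first window bounds z x n / xⁿ there,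
    -- as x ≥ 1.
    firstTerms : ℕ → ℚ
    firstTerms zero    = 1ℚ
    firstTerms (suc n) = firstTerms n ℚ.+ ℚ.∣ b n ∣

    1≤firstTerms : ∀ n → 1ℚ ℚ.≤ firstTerms n
    1≤firstTerms zero    = ℚ.≤-refl
    1≤firstTerms (suc n) = ℚ.≤-trans (1≤firstTerms n) (p≤p+q (ℚ.0≤∣p∣ (b n)))

    initial : ∀ e n → n ℕ.< e → ℚ.∣ b n ∣ ℚ.+ 1ℚ ℚ.≤ firstTerms e
    initial (suc e) n n<se with ℕ.m≤n⇒m<n∨m≡n (ℕ.≤-pred n<se)
    ... | inj₁ n<e  = ℚ.≤-trans (initial e n n<e) (p≤p+q (ℚ.0≤∣p∣ (b e)))
    ... | inj₂ refl = ℚ.≤-trans (ℚ.≤-reflexive (ℚ.+-comm ℚ.∣ b e ∣ 1ℚ)) (ℚ.+-monoˡ-≤ ℚ.∣ b e ∣ (1≤firstTerms e))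

    B : ℚ
    B = firstTerms d

    0≤B : 0ℚ ℚ.≤ B
    0≤B = ℚ.≤-trans (ℚ.nonNegative⁻¹ 1ℚ) (1≤firstTerms d)

    bounded-initially : ∀ n → n ℕ.< d → Bounded B n
    bounded-initially n n<d = 0ℚ , ℚ.≤-refl , λ x x∈ → begin
      ℚ.∣ b n ℚ.- κ x ℚ.* power x n ∣
        ≤⟨ ℚ.∣p-q∣≤∣p∣+∣q∣ (b n) (κ x ℚ.* power x n) ⟩
      ℚ.∣ b n ∣ ℚ.+ ℚ.∣ κ x ℚ.* power x n ∣
        ≡⟨ cong (λ y → ℚ.∣ b n ∣ ℚ.+ y) (trans (ℚ.∣p*q∣≡∣p∣*∣q∣ (κ x) (power x n))
             (cong (λ y → ℚ.∣ κ x ∣ ℚ.* y) (ℚ.0≤p⇒∣p∣≡p (power-nonNeg (0≤x x∈) n)))) ⟩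
      ℚ.∣ b n ∣ ℚ.+ ℚ.∣ κ x ∣ ℚ.* power x n
        ≤⟨ ℚ.+-mono-≤ (ℚ.≤-trans (ℚ.≤-reflexive (sym (ℚ.*-identityʳ ℚ.∣ b n ∣)))
               (ℚ.*-monoˡ-≤-nonNeg ℚ.∣ b n ∣ {{ℚ.nonNegative (ℚ.0≤∣p∣ (b n))}} (1≤power (1≤x x∈) n)))
             (ℚ.*-monoʳ-≤-nonNeg (power x n) {{ℚ.nonNegative (power-nonNeg (0≤x x∈) n)}} (∣κ∣≤1 x x∈)) ⟩
      ℚ.∣ b n ∣ ℚ.* power x n ℚ.+ 1ℚ ℚ.* power x n
        ≡⟨ sym (ℚ.*-distribʳ-+ (power x n) ℚ.∣ b n ∣ 1ℚ) ⟩
      (ℚ.∣ b n ∣ ℚ.+ 1ℚ) ℚ.* power x n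
        ≤⟨ ℚ.*-monoʳ-≤-nonNeg (power x n) {{ℚ.nonNegative (power-nonNeg (0≤x x∈) n)}} (initial d n n<d) ⟩
      B ℚ.* power x n
        ≡⟨ regroup (B ℚ.* power x n) ℚ.∣ ρ x ∣ ⟩
      B ℚ.* power x n ℚ.+ 0ℚ ℚ.* ℚ.∣ ρ x ∣ ∎
      where
      open ℚ.≤-Reasoning
      regroup : ∀ y p → y ≡ y ℚ.+ 0ℚ ℚ.* p
      regroup = RingSolver.solve-∀ ℚ-ring

    weaken-bound : ∀ {β γ} n → β ℚ.≤ γ → Bounded β n → Bounded γ n
    weaken-bound {β} {γ} n β≤γ (M , 0≤M , bound) = M , 0≤M , λ x x∈ → ℚ.≤-trans (bound x x∈)
      (ℚ.+-monoˡ-≤ (M ℚ.* ℚ.∣ ρ x ∣) (ℚ.*-monoʳ-≤-nonNeg (power x n)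
        {{ℚ.nonNegative (power-nonNeg (0≤x x∈) n)}} β≤γ))

    ½*-≤ : ∀ β → 0ℚ ℚ.≤ β → ½ ℚ.* β ℚ.≤ β
    ½*-≤ β 0≤β = subst (½ ℚ.* β ℚ.≤_) (half+half β) (p≤p+q (*-nonNeg 0≤½ 0≤β))

    0≤halves*B : ∀ k → 0ℚ ℚ.≤ halves k ℚ.* B
    0≤halves*B k = *-nonNeg (halves-nonNeg k) 0≤B

    -- Every window of d terms gains a factor ½: if d + m ≥ (k + 1) d, then all indices of the
    -- window starting at m are at least k d.
    decay-from : ∀ k m → (∀ k′ j → k′ ℕ.* d ℕ.≤ j ℕ.+ m → j ℕ.< d → Bounded (halves k′ ℚ.* B) (j ℕ.+ m)) →
                 k ℕ.* d ℕ.≤ d ℕ.+ m → Bounded (halves k ℚ.* B) (d ℕ.+ m)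
    decay-from zero    m earlier _ = weaken-bound (d ℕ.+ m) (½*-≤ (halves 0 ℚ.* B) (0≤halves*B 0))
      (halved (halves 0 ℚ.* B) m (0≤halves*B 0) (λ j j<d → earlier 0 j z≤n j<d))
    decay-from (suc k) m earlier kd≤ = subst (λ β → Bounded β (d ℕ.+ m)) (sym (ℚ.*-assoc ½ (halves k) B))
      (halved (halves k ℚ.* B) m (0≤halves*B k) (λ j j<d → earlier k j
        (ℕ.≤-trans (ℕ.+-cancelˡ-≤ d (k ℕ.* d) m kd≤) (ℕ.m≤n+m m j)) j<d))

    decay : ∀ fuel n k → n ℕ.< fuel → k ℕ.* d ℕ.≤ n → Bounded (halves k ℚ.* B) n
    decay (suc fuel) n k n<fuel kd≤n with ℕ.<-≤-connex n d
    decay (suc fuel) n zero    n<fuel kd≤n | inj₁ n<d =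
      subst (λ β → Bounded β n) (sym (ℚ.*-identityˡ B)) (bounded-initially n n<d)
    decay (suc fuel) n (suc k) n<fuel kd≤n | inj₁ n<d =
      contradiction (ℕ.≤-<-trans (ℕ.≤-trans (ℕ.m≤m+n d (k ℕ.* d)) kd≤n) n<d) (ℕ.<-irrefl refl)
    decay (suc fuel) n k       n<fuel kd≤n | inj₂ d≤n =
      subst (Bounded (halves k ℚ.* B)) n≡ (decay-from k m
        (λ k′ j k′d≤ j<d → decay fuel (j ℕ.+ m) k′
          (ℕ.<-≤-trans (ℕ.+-monoˡ-< m j<d) (ℕ.≤-trans (ℕ.≤-reflexive n≡) (ℕ.≤-pred n<fuel))) k′d≤)
        (subst (k ℕ.* d ℕ.≤_) (sym n≡) kd≤n))
      where
      m : ℕ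
      m = n ℕ.∸ d
      n≡ : d ℕ.+ m ≡ n
      n≡ = ℕ.m+[n∸m]≡n d≤n

    negligible : ∀ ε → 0ℚ ℚ.< ε → ∃[ N ] (∀ n → N ℕ.≤ n → Bounded ε n)
    negligible ε ε>0 with quotient B ε (ℚ.<-≤-trans (ℚ.positive⁻¹ 1ℚ) (1≤firstTerms d)) ε>0
    ... | δ , δ>0 , Bδ≡ε with halves-small δ δ>0
    ...   | k , small = k ℕ.* d , λ n kd≤n → weaken-bound n
      (ℚ.≤-trans (ℚ.*-monoʳ-≤-nonNeg B {{ℚ.nonNegative 0≤B}} (ℚ.<⇒≤ (small k ℕ.≤-refl)))
        (ℚ.≤-reflexive (trans (ℚ.*-comm δ B) Bδ≡ε)))
      (decay (suc n) n k ℕ.≤-refl kd≤n)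

remainderᶻ : ℤ → ℤ → List ℤ → ℤ
remainderᶻ x v []       = v
remainderᶻ x v (r ∷ rs) = remainderᶻ x (x ℤ.* v ℤ.+ r) rs

remainder-ι : ∀ x v rs → remainderOf (ι x) (ι v) (map ι rs) ≡ ι (remainderᶻ x v rs)
remainder-ι x v []       = refl
remainder-ι x v (r ∷ rs) = trans
  (cong (λ y → remainderOf (ι x) y (map ι rs)) (sym (trans (ι-+ (x ℤ.* v) r) (cong (ℚ._+ ι r) (ι-* x v)))))
  (remainder-ι x (x ℤ.* v ℤ.+ r) rs)

power-ι : ∀ x n → power (ι x) n ≡ ι (x ℤ.^ n)
power-ι x zero    = sym ι-1
power-ι x (suc n) = trans (cong (λ y → ι x ℚ.* y) (power-ι x n)) (sym (ι-* x (x ℤ.^ n)))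

power-mono : ∀ {x y} → 0ℚ ℚ.≤ x → x ℚ.≤ y → ∀ n → power x n ℚ.≤ power y n
power-mono 0≤x x≤y zero    = ℚ.≤-refl
power-mono 0≤x x≤y (suc n) = *-mono-≤₂ 0≤x (power-nonNeg 0≤x n) x≤y (power-mono 0≤x x≤y n)

-- Bisection for the dominant root

module Bisection (ρ : ℚ → ℚ) (l : ℚ) (ρ[l]≤0 : ρ l ℚ.≤ 0ℚ) (0≤ρ[l+1] : 0ℚ ℚ.≤ ρ (l ℚ.+ 1ℚ)) where

  record Bracket (i : ℕ) : Set where
    field
      left    : ℚ
      l≤left  : l ℚ.≤ left
      right≤  : left ℚ.+ halves i ℚ.≤ l ℚ.+ 1ℚ
      ρleft≤0 : ρ left ℚ.≤ 0ℚ
      0≤ρright : 0ℚ ℚ.≤ ρ (left ℚ.+ halves i)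

  open Bracket

  two-halves : ∀ x h → (x ℚ.+ ½ ℚ.* h) ℚ.+ ½ ℚ.* h ≡ x ℚ.+ h
  two-halves = RingSolver.solve-∀ ℚ-ring

  middle≤right : ∀ x i → x ℚ.+ halves (suc i) ℚ.≤ x ℚ.+ halves i
  middle≤right x i = subst (x ℚ.+ halves (suc i) ℚ.≤_) (two-halves x (halves i)) (p≤p+q (halves-nonNeg (suc i)))

  refine : ∀ {i} → Bracket i → Bracket (suc i)
  refine {i} K with ρ (left K ℚ.+ halves (suc i)) ℚ.≤? 0ℚ
  ... | yes ρm≤0 = record
    { left     = left K ℚ.+ halves (suc i)
    ; l≤left   = ℚ.≤-trans (l≤left K) (p≤p+q (halves-nonNeg (suc i)))
    ; right≤   = subst (ℚ._≤ l ℚ.+ 1ℚ) (sym (two-halves (left K) (halves i))) (right≤ K)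
    ; ρleft≤0  = ρm≤0
    ; 0≤ρright = subst (λ y → 0ℚ ℚ.≤ ρ y) (sym (two-halves (left K) (halves i))) (0≤ρright K)
    }
  ... | no ρm≰0 = record
    { left     = left K
    ; l≤left   = l≤left K
    ; right≤   = ℚ.≤-trans (middle≤right (left K) i) (right≤ K)
    ; ρleft≤0  = ρleft≤0 K
    ; 0≤ρright = ℚ.<⇒≤ (ℚ.≰⇒> ρm≰0)
    }

  left≤refined : ∀ {i} (K : Bracket i) → left K ℚ.≤ left (refine K)
  left≤refined {i} K with ρ (left K ℚ.+ halves (suc i)) ℚ.≤? 0ℚ
  ... | yes _ = p≤p+q (halves-nonNeg (suc i))
  ... | no _  = ℚ.≤-refl

  refined≤right : ∀ {i} (K : Bracket i) → left (refine K) ℚ.+ halves (suc i) ℚ.≤ left K ℚ.+ halves i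
  refined≤right {i} K with ρ (left K ℚ.+ halves (suc i)) ℚ.≤? 0ℚ
  ... | yes _ = ℚ.≤-reflexive (two-halves (left K) (halves i))
  ... | no _  = middle≤right (left K) i

  bracket : ∀ i → Bracket i
  bracket zero    = record { left = l ; l≤left = ℚ.≤-refl ; right≤ = ℚ.≤-refl ; ρleft≤0 = ρ[l]≤0 ; 0≤ρright = 0≤ρ[l+1] }
  bracket (suc i) = refine (bracket i)

  approximation : ℕ → ℚ
  approximation i = left (bracket i)

  increasing : ∀ N k → approximation N ℚ.≤ approximation (k ℕ.+ N)
  increasing N zero    = ℚ.≤-refl
  increasing N (suc k) = ℚ.≤-trans (increasing N k) (left≤refined (bracket (k ℕ.+ N)))

  nested : ∀ N k → approximation (k ℕ.+ N) ℚ.+ halves (k ℕ.+ N) ℚ.≤ approximation N ℚ.+ halves N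
  nested N zero    = ℚ.≤-refl
  nested N (suc k) = ℚ.≤-trans (refined≤right (bracket (k ℕ.+ N))) (nested N k)

  ≤left+half : ∀ N i → N ℕ.≤ i → approximation N ℚ.≤ approximation i × approximation i ℚ.≤ approximation N ℚ.+ halves N
  ≤left+half N i N≤i = subst (λ j → approximation N ℚ.≤ approximation j × approximation j ℚ.≤ approximation N ℚ.+ halves N)
    (ℕ.m∸n+n≡m N≤i)
    (increasing N (i ℕ.∸ N) , ℚ.≤-trans (p≤p+q (halves-nonNeg (i ℕ.∸ N ℕ.+ N))) (nested N (i ℕ.∸ N)))

  approximation-cauchy : IsCauchy approximation
  approximation-cauchy ε ε>0 with halves-small ε ε>0
  ... | N , small = N , λ i j N≤i N≤j → ℚ.≤-<-trans
    (∣∣-bound (difference i j N≤i N≤j) (subst (ℚ._≤ halves N) (swap (approximation i) (approximation j)) (difference j i N≤j N≤i)))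
    (small N ℕ.≤-refl)
    where
    swap : ∀ x y → y ℚ.- x ≡ ℚ.- (x ℚ.- y)
    swap = RingSolver.solve-∀ ℚ-ring
    cancel : ∀ x h → (x ℚ.+ h) ℚ.- x ≡ h
    cancel = RingSolver.solve-∀ ℚ-ring
    difference : ∀ i j → N ℕ.≤ i → N ℕ.≤ j → approximation i ℚ.- approximation j ℚ.≤ halves N
    difference i j N≤i N≤j = ℚ.≤-trans
      (ℚ.+-mono-≤ (proj₂ (≤left+half N i N≤i)) (ℚ.neg-antimono-≤ (proj₁ (≤left+half N j N≤j))))
      (ℚ.≤-reflexive (cancel (approximation N) (halves N)))

-- The constants as real numbers

quotientᴿ : ℝ → ℝ → List ℚ → List ℝ
quotientᴿ X V []       = []
quotientᴿ X V (r ∷ rs) = V ∷ quotientᴿ X (X * V + fromℚ r) rs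

applyᴿ : List ℝ → (ℕ → ℝ) → ℝ
applyᴿ []       F = 0ℝ
applyᴿ (C ∷ Cs) F = C * F (length Cs) + applyᴿ Cs F

seq-quotientᴿ : ∀ X V rs i → map (λ c → seq c i) (quotientᴿ X V rs) ≡ quotientOf (seq X i) (seq V i) rs
seq-quotientᴿ X V []       i = refl
seq-quotientᴿ X V (r ∷ rs) i = cong (seq V i ∷_) (seq-quotientᴿ X (X * V + fromℚ r) rs i)

seq-applyᴿ : ∀ Cs F (f : ℕ → ℚ) i → (∀ n → seq (F n) i ≡ f n) → seq (applyᴿ Cs F) i ≡ apply (map (λ c → seq c i) Cs) f 0
seq-applyᴿ []       F f i e = refl
seq-applyᴿ (C ∷ Cs) F f i e = cong₂ (λ y z → seq C i ℚ.* y ℚ.+ z)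
  (trans (e (length Cs)) (cong f (trans (sym (List.length-map (λ c → seq c i) Cs)) (sym (ℕ.+-identityʳ _)))))
  (seq-applyᴿ Cs F f i e)

seq-^ : ∀ X n i → seq (X ^ n) i ≡ power (seq X i) n
seq-^ X zero    i = refl
seq-^ X (suc n) i = cong (λ y → seq X i ℚ.* y) (seq-^ X n i)

fraction-* : ∀ p k → (p ℚ./ suc k) ℚ.* ι (+ suc k) ≡ ι p
fraction-* p k = ℚ.toℚᵘ-injective (ℚᵘ.≃-trans (ℚ.toℚᵘ-homo-* (p ℚ./ suc k) (ι (+ suc k)))
  (ℚᵘ.≃-trans (ℚᵘ.*-cong (ℚ.toℚᵘ-fromℚᵘ (ℚᵘ.mkℚᵘ p k)) (ι-toℚᵘ (+ suc k)))
  (ℚᵘ.≃-trans (ℚᵘ.*≡* (ℤ.*-assoc p (+ suc k) 1ℤ)) (ℚᵘ.≃-sym (ι-toℚᵘ p)))))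

≤-fraction : ∀ y p k → y ℚ.* ι (+ suc k) ℚ.≤ ι p → y ℚ.≤ p ℚ./ suc k
≤-fraction y p k h = ℚ.*-cancelʳ-≤-pos (ι (+ suc k)) {{ι-positive k}}
  (ℚ.≤-trans h (ℚ.≤-reflexive (sym (fraction-* p k))))

fraction-≤ : ∀ y p k → ι p ℚ.≤ y ℚ.* ι (+ suc k) → p ℚ./ suc k ℚ.≤ y
fraction-≤ y p k h = ℚ.*-cancelʳ-≤-pos (ι (+ suc k)) {{ι-positive k}}
  (ℚ.≤-trans (ℚ.≤-reflexive (fraction-* p k)) h)

fraction-≤ᴿ : ∀ X p k → (∀ i → ι p ℚ.≤ seq X i ℚ.* ι (+ suc k)) → fromℚ (p ℚ./ suc k) ≤ X
fraction-≤ᴿ X p k h ε ε>0 = 0 , λ i _ → ℚ.≤-trans (fraction-≤ (seq X i) p k (h i)) (p≤p+q (ℚ.<⇒≤ ε>0))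

-- Strict inequality of reals asks for a margin independent of i; the margin used is one eighth of 1
-- / (k + 1).
<-fractionᴿ : ∀ X p k → (∀ i → seq X i ℚ.* ι (+ suc k) ℚ.+ halves 3 ℚ.≤ ι p) → X < fromℚ (p ℚ./ suc k)
<-fractionᴿ X p k h = δ , *-pos halves>0 unit>0 , 0 , λ i _ → ≤-fraction (seq X i ℚ.+ δ) p k
  (ℚ.≤-trans (ℚ.≤-reflexive (trans (regroup (seq X i) (halves 3) (1ℤ ℚ./ suc k) (ι (+ suc k)))
    (trans (cong (λ y → seq X i ℚ.* ι (+ suc k) ℚ.+ halves 3 ℚ.* y) (trans (fraction-* 1ℤ k) ι-1))
           (cong (λ y → seq X i ℚ.* ι (+ suc k) ℚ.+ y) (ℚ.*-identityʳ (halves 3)))))) (h i))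
  where
  δ : ℚ
  δ = halves 3 ℚ.* (1ℤ ℚ./ suc k)
  halves>0 : 0ℚ ℚ.< halves 3
  halves>0 = ℚ.positive⁻¹ (halves 3)
  unit>0 : 0ℚ ℚ.< 1ℤ ℚ./ suc k
  unit>0 = ℚ.positive⁻¹ (1ℤ ℚ./ suc k) {{ℚ.normalize-pos 1 (suc k)}}
  regroup : ∀ x h u m → (x ℚ.+ h ℚ.* u) ℚ.* m ≡ x ℚ.* m ℚ.+ h ℚ.* (u ℚ.* m)
  regroup = RingSolver.solve-∀ ℚ-ring

opaque
  unfolding ι

  forty : ∀ δ → (δ ℚ.+ δ) ℚ.* ι (+ 10) ℚ.+ ι (+ 20) ℚ.* δ ≡ ι (+ 40) ℚ.* δ
  forty = RingSolver.solve-∀ ℚ-ring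

  halves₃-scaled : ∀ y m → y ℚ.* m ℚ.+ halves 3 ≡ halves 3 ℚ.* (y ℚ.* (ι (+ 8) ℚ.* m)) ℚ.+ halves 3
  halves₃-scaled = RingSolver.solve-∀ ℚ-ring

  halves₃-unscaled : ∀ p → halves 3 ℚ.* (ι (+ 8) ℚ.* p ℚ.+ ι -1ℤ) ℚ.+ halves 3 ≡ p
  halves₃-unscaled = RingSolver.solve-∀ ℚ-ring

-- As ρ changes sign between x and x + e, its value at x is at most its variation over this
-- interval.
sign-change-bound : ∀ (ρ : ℚ → ℚ) {L x e} → 0ℚ ℚ.≤ e → ρ x ℚ.≤ 0ℚ → 0ℚ ℚ.≤ ρ (x ℚ.+ e) →
                    ℚ.∣ ρ x ℚ.- ρ (x ℚ.+ e) ∣ ℚ.≤ L ℚ.* ℚ.∣ x ℚ.- (x ℚ.+ e) ∣ → ℚ.∣ ρ x ∣ ℚ.≤ L ℚ.* e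
sign-change-bound ρ {L} {x} {e} 0≤e ρx≤0 0≤ρy lipschitz = begin
  ℚ.∣ ρ x ∣
    ≤⟨ ∣∣-bound (ℚ.≤-trans ρx≤0 (ℚ.0≤∣p∣ (ρ x ℚ.- ρ y)))
         (ℚ.≤-trans (q≤p+q 0≤ρy) (ℚ.≤-trans (p≤∣p∣ (ρ y ℚ.- ρ x)) (ℚ.≤-reflexive (∣u-v∣≡∣v-u∣ (ρ y) (ρ x))))) ⟩
  ℚ.∣ ρ x ℚ.- ρ y ∣
    ≤⟨ lipschitz ⟩
  L ℚ.* ℚ.∣ x ℚ.- y ∣
    ≡⟨ cong (λ d → L ℚ.* d) (trans (∣u-v∣≡∣v-u∣ x y) (trans (cong ℚ.∣_∣ (cancel x e)) (ℚ.0≤p⇒∣p∣≡p 0≤e))) ⟩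
  L ℚ.* e ∎
  where
  open ℚ.≤-Reasoning
  y : ℚ
  y = x ℚ.+ e
  cancel : ∀ x e → (x ℚ.+ e) ℚ.- x ≡ e
  cancel = RingSolver.solve-∀ ℚ-ring

eighth : ∀ y m p → y ℚ.* ι (+ 8 ℤ.* m) ℚ.≤ ι (+ 8 ℤ.* p ℤ.- 1ℤ) → y ℚ.* ι m ℚ.+ halves 3 ℚ.≤ ι p
eighth y m p bound = ℚ.≤-trans (ℚ.≤-reflexive (halves₃-scaled y (ι m)))
  (ℚ.≤-trans (ℚ.+-monoˡ-≤ (halves 3) (ℚ.*-monoˡ-≤-nonNeg (halves 3)
    (subst₂ ℚ._≤_ (cong (λ w → y ℚ.* w) (ι-* (+ 8) m))
      (trans (ι-+ (+ 8 ℤ.* p) -1ℤ) (cong (ℚ._+ ι -1ℤ) (ι-* (+ 8) p))) bound)))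
    (ℚ.≤-reflexive (halves₃-unscaled (ι p))))

-- The characteristic polynomial of f n sⁿ is monic with later coefficients r ∷ rs
-- and has its dominant root, which is s times that of f, in [l , l + 1]; F lists
-- the first values of f.
module Asymptotics (f : ℕ → ℕ) (s′ l′ : ℕ) (r : ℤ) (rs : List ℤ) (F : ℕ → ℕ)
  (σ : ℚ) (σs≡1 : σ ℚ.* ι (+ suc s′) ≡ 1ℚ) (0≤σ : 0ℚ ℚ.≤ σ) where

  s l : ℤ
  s = + suc s′
  l = + suc l′

  b : ℕ → ℚ
  b n = ι (+ f n) ℚ.* power (ι s) n

  d : ℕ
  d = length rs

  X : Ball
  X = l , 1ℤ

  Q′ᵇ Qᵇ : List Ball
  Q′ᵇ = quotientᵇ X (X *ᵇ exactly 1ℤ +ᵇ exactly r) rs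
  Qᵇ  = exactly 1ℤ ∷ Q′ᵇ

  -- The table `F` stands in for `f`, so that evaluating the ball does not require evaluating `f`.
  numeratorᵇ denominatorᵇ : Ball
  numeratorᵇ   = applyᵇ Qᵇ (λ n → exactly (+ F n) *ᵇ powerᵇ (exactly s) n)
  denominatorᵇ = applyᵇ Qᵇ (powerᵇ X)

  module _
    (recurrence : ∀ n → apply (1ℚ ∷ ι r ∷ map ι rs) b n ≡ 0ℚ)
    (values : ∀ n → n ℕ.≤ d → f n ≡ F n)
    (contraction : + 2 ℤ.* absoluteBound Q′ᵇ (powerᵇ X) ℤ.≤ l ℤ.^ d)
    (left≤0 : remainderᶻ l 1ℤ (r ∷ rs) ℤ.≤ 0ℤ)
    (0≤right : 0ℤ ℤ.≤ remainderᶻ (l ℤ.+ 1ℤ) 1ℤ (r ∷ rs))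
    (1≤denominator : 1ℤ ℤ.≤ lowerᵇ denominatorᵇ)
    (κ-small : 1ℤ ℤ.* upperᵇ numeratorᵇ ℤ.≤ 1ℤ ℤ.* lowerᵇ denominatorᵇ)
    (κ-large : 1ℤ ℤ.* upperᵇ denominatorᵇ ℤ.≤ + 10 ℤ.* lowerᵇ numeratorᵇ)
    (s≤l : s ℤ.≤ l)
    where

    0≤1ᶻ : 0ℤ ℤ.≤ 1ℤ
    0≤1ᶻ = ℤ.+≤+ z≤n

    h : ℚ
    h = ι l ℚ.+ 1ℚ

    1≤ιl : 1ℚ ℚ.≤ ι l
    1≤ιl = 1≤ι {l} (ℤ.+≤+ (s≤s z≤n))

    l≤h : ι l ℚ.≤ h
    l≤h = p≤p+q (ℚ.nonNegative⁻¹ 1ℚ)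

    0≤h : 0ℚ ℚ.≤ h
    0≤h = ℚ.≤-trans (ℚ.≤-trans (ℚ.nonNegative⁻¹ 1ℚ) 1≤ιl) l≤h

    open Deviation b (ι r) (map ι rs) (ι l) h 1≤ιl recurrence hiding (d; 0≤h)

    ball : ∀ {x} → InRange x → x ∈ᵇ X
    ball {x} (l≤x , x≤h) = within (∣∣-bound
      (ℚ.≤-trans (ℚ.+-monoˡ-≤ (ℚ.- ι l) x≤h) (ℚ.≤-reflexive (trans (cancel (ι l)) (sym ι-1))))
      (ℚ.≤-trans (ℚ.≤-trans (ℚ.≤-reflexive (swap x (ι l)))
        (ℚ.≤-trans (ℚ.+-monoʳ-≤ (ι l) (ℚ.neg-antimono-≤ l≤x)) (ℚ.≤-reflexive (ℚ.+-inverseʳ (ι l)))))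
        (0≤ι 0≤1ᶻ)))
      where
      cancel : ∀ l → (l ℚ.+ 1ℚ) ℚ.- l ≡ 1ℚ
      cancel = RingSolver.solve-∀ ℚ-ring
      swap : ∀ x l → ℚ.- (x ℚ.- l) ≡ l ℚ.- x
      swap = RingSolver.solve-∀ ℚ-ring

    Q′-enclosed : ∀ {x} → InRange x → Encloses Q′ᵇ (Q′ x)
    Q′-enclosed x∈ = quotientᵇ-sound X (X *ᵇ exactly 1ℤ +ᵇ exactly r) rs (ball x∈)
      (+ᵇ-sound (X *ᵇ exactly 1ℤ) (exactly r) (*ᵇ-sound X (exactly 1ℤ) (ball x∈) oneᵇ) (exactly-sound r))

    Q-enclosed : ∀ {x} → InRange x → Encloses Qᵇ (Q x)
    Q-enclosed x∈ = oneᵇ ∷ Q′-enclosed x∈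

    d≡ : length (map ι rs) ≡ d
    d≡ = List.length-map ι rs

    contracting : ∀ x → InRange x → apply (absolute (Q′ x)) (power x) 0 ℚ.≤ ½ ℚ.* power x (length (map ι rs))
    contracting x x∈ = begin
      apply (absolute (Q′ x)) (power x) 0
        ≤⟨ absoluteBound-sound (power x) (powerᵇ X) (Q′-enclosed x∈) (λ n → powerᵇ-sound X n (ball x∈)) (power-nonNeg (0≤x x∈)) ⟩
      ι A
        ≡⟨ sym (trans (cong (λ y → ½ ℚ.* y) (ι-* (+ 2) A)) (½*[2*x] (ι A))) ⟩
      ½ ℚ.* ι (+ 2 ℤ.* A)
        ≤⟨ ℚ.*-monoˡ-≤-nonNeg ½ (ℚ.≤-trans (ι-≤ contraction) (ℚ.≤-reflexive (sym (power-ι l d)))) ⟩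
      ½ ℚ.* power (ι l) d
        ≤⟨ ℚ.*-monoˡ-≤-nonNeg ½ (power-mono (ℚ.≤-trans (ℚ.nonNegative⁻¹ 1ℚ) 1≤ιl) (proj₁ x∈) d) ⟩
      ½ ℚ.* power x d
        ≡⟨ cong (λ k → ½ ℚ.* power x k) (sym d≡) ⟩
      ½ ℚ.* power x (length (map ι rs)) ∎
      where
      open ℚ.≤-Reasoning
      A : ℤ
      A = absoluteBound Q′ᵇ (powerᵇ X)

    numeratorOf : ℚ → ℚ
    numeratorOf x = apply (Q x) b 0

    Qᵇ-length : length Q′ᵇ ≡ d
    Qᵇ-length = go (X *ᵇ exactly 1ℤ +ᵇ exactly r) rs
      where
      go : ∀ V rs → length (quotientᵇ X V rs) ≡ length rs
      go V []       = refl
      go V (t ∷ rs) = cong suc (go (X *ᵇ V +ᵇ exactly t) rs)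

    numerator-enclosed : ∀ {x} → InRange x → numeratorOf x ∈ᵇ numeratorᵇ
    numerator-enclosed x∈ = applyᵇ-sound b (λ n → exactly (+ F n) *ᵇ powerᵇ (exactly s) n) (Q-enclosed x∈)
      (λ n n< → *ᵇ-sound (exactly (+ F n)) (powerᵇ (exactly s) n)
        (subst (λ k → ι (+ k) ∈ᵇ exactly (+ F n)) (sym (values n (subst (n ℕ.≤_) Qᵇ-length (ℕ.≤-pred n<)))) (exactly-sound (+ F n)))
        (powerᵇ-sound (exactly s) n (exactly-sound s)))

    denominator-enclosed : ∀ {x} → InRange x → normalizer x ∈ᵇ denominatorᵇ
    denominator-enclosed {x} x∈ = applyᵇ-sound (power x) (powerᵇ X) (Q-enclosed x∈) (λ n _ → powerᵇ-sound X n (ball x∈))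

    1≤normalizer : ∀ {x} → InRange x → 1ℚ ℚ.≤ normalizer x
    1≤normalizer x∈ = ℚ.≤-trans (1≤ι 1≤denominator) (lowerᵇ-sound denominatorᵇ (denominator-enclosed x∈))

    1>0 : 0ℚ ℚ.< 1ℚ
    1>0 = ℚ.positive⁻¹ 1ℚ

    κ : ℚ → ℚ
    κ x = numeratorOf x ℚ.* recipAbove 1ℚ 1>0 (normalizer x)

    κ-normalized : ∀ x → InRange x → κ x ℚ.* normalizer x ≡ numeratorOf x
    κ-normalized x x∈ = trans (regroup (numeratorOf x) (recipAbove 1ℚ 1>0 (normalizer x)) (normalizer x))
      (trans (cong (λ y → numeratorOf x ℚ.* y) (recip-inverse 1ℚ 1>0 (normalizer x) (1≤normalizer x∈)))
             (ℚ.*-identityʳ (numeratorOf x)))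
      where
      regroup : ∀ w v n → w ℚ.* v ℚ.* n ≡ w ℚ.* (n ℚ.* v)
      regroup = RingSolver.solve-∀ ℚ-ring

    normalizer-positive : ∀ {x} → InRange x → ℚ.Positive (normalizer x)
    normalizer-positive x∈ = ℚ.positive (ℚ.<-≤-trans 1>0 (1≤normalizer x∈))

    κ-upper : ∀ m → 0ℤ ℤ.≤ m → ∀ q → 0ℤ ℤ.≤ q → q ℤ.* upperᵇ numeratorᵇ ℤ.≤ m ℤ.* lowerᵇ denominatorᵇ →
              ∀ x → InRange x → κ x ℚ.* ι q ℚ.≤ ι m
    κ-upper m 0≤m q 0≤q check x x∈ = ℚ.*-cancelʳ-≤-pos (normalizer x) {{normalizer-positive x∈}} (begin
      κ x ℚ.* ι q ℚ.* normalizer x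
        ≡⟨ regroup (κ x) (ι q) (normalizer x) ⟩
      ι q ℚ.* (κ x ℚ.* normalizer x)
        ≡⟨ cong (λ y → ι q ℚ.* y) (κ-normalized x x∈) ⟩
      ι q ℚ.* numeratorOf x
        ≤⟨ ℚ.*-monoˡ-≤-nonNeg (ι q) {{ℚ.nonNegative (0≤ι 0≤q)}} (upperᵇ-sound numeratorᵇ (numerator-enclosed x∈)) ⟩
      ι q ℚ.* ι (upperᵇ numeratorᵇ)
        ≡⟨ sym (ι-* q (upperᵇ numeratorᵇ)) ⟩
      ι (q ℤ.* upperᵇ numeratorᵇ)
        ≤⟨ ι-≤ check ⟩
      ι (m ℤ.* lowerᵇ denominatorᵇ)
        ≡⟨ ι-* m (lowerᵇ denominatorᵇ) ⟩
      ι m ℚ.* ι (lowerᵇ denominatorᵇ)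
        ≤⟨ ℚ.*-monoˡ-≤-nonNeg (ι m) {{ℚ.nonNegative (0≤ι 0≤m)}} (lowerᵇ-sound denominatorᵇ (denominator-enclosed x∈)) ⟩
      ι m ℚ.* normalizer x ∎)
      where
      open ℚ.≤-Reasoning
      regroup : ∀ k q n → k ℚ.* q ℚ.* n ≡ q ℚ.* (k ℚ.* n)
      regroup = RingSolver.solve-∀ ℚ-ring

    κ-lower : ∀ m → 0ℤ ℤ.≤ m → ∀ q → 0ℤ ℤ.≤ q → m ℤ.* upperᵇ denominatorᵇ ℤ.≤ q ℤ.* lowerᵇ numeratorᵇ →
              ∀ x → InRange x → ι m ℚ.≤ κ x ℚ.* ι q
    κ-lower m 0≤m q 0≤q check x x∈ = ℚ.*-cancelʳ-≤-pos (normalizer x) {{normalizer-positive x∈}} (begin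
      ι m ℚ.* normalizer x
        ≤⟨ ℚ.*-monoˡ-≤-nonNeg (ι m) {{ℚ.nonNegative (0≤ι 0≤m)}} (upperᵇ-sound denominatorᵇ (denominator-enclosed x∈)) ⟩
      ι m ℚ.* ι (upperᵇ denominatorᵇ)
        ≡⟨ sym (ι-* m (upperᵇ denominatorᵇ)) ⟩
      ι (m ℤ.* upperᵇ denominatorᵇ)
        ≤⟨ ι-≤ check ⟩
      ι (q ℤ.* lowerᵇ numeratorᵇ)
        ≡⟨ ι-* q (lowerᵇ numeratorᵇ) ⟩
      ι q ℚ.* ι (lowerᵇ numeratorᵇ)
        ≤⟨ ℚ.*-monoˡ-≤-nonNeg (ι q) {{ℚ.nonNegative (0≤ι 0≤q)}} (lowerᵇ-sound numeratorᵇ (numerator-enclosed x∈)) ⟩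
      ι q ℚ.* numeratorOf x
        ≡⟨ cong (λ y → ι q ℚ.* y) (sym (κ-normalized x x∈)) ⟩
      ι q ℚ.* (κ x ℚ.* normalizer x)
        ≡⟨ regroup (κ x) (ι q) (normalizer x) ⟩
      κ x ℚ.* ι q ℚ.* normalizer x ∎)
      where
      open ℚ.≤-Reasoning
      regroup : ∀ k q n → q ℚ.* (k ℚ.* n) ≡ k ℚ.* q ℚ.* n
      regroup = RingSolver.solve-∀ ℚ-ring

    1≤10κ : ∀ x → InRange x → 1ℚ ℚ.≤ κ x ℚ.* ι (+ 10)
    1≤10κ x x∈ = subst (ℚ._≤ κ x ℚ.* ι (+ 10)) ι-1 (κ-lower 1ℤ 0≤1ᶻ (+ 10) (0≤+ 10) κ-large x x∈)

    0≤κ : ∀ x → InRange x → 0ℚ ℚ.≤ κ x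
    0≤κ x x∈ = ℚ.*-cancelʳ-≤-pos (ι (+ 10)) {{ι-positive 9}}
      (ℚ.≤-trans (ℚ.≤-reflexive (ℚ.*-zeroˡ (ι (+ 10)))) (ℚ.≤-trans (ℚ.nonNegative⁻¹ 1ℚ) (1≤10κ x x∈)))

    ∣κ∣≤1 : ∀ x → InRange x → ℚ.∣ κ x ∣ ℚ.≤ 1ℚ
    ∣κ∣≤1 x x∈ = subst (ℚ._≤ 1ℚ) (sym (ℚ.0≤p⇒∣p∣≡p (0≤κ x x∈)))
      (ℚ.≤-trans (ℚ.≤-reflexive (sym (trans (cong (λ y → κ x ℚ.* y) ι-1) (ℚ.*-identityʳ (κ x))))) (subst (κ x ℚ.* ι 1ℤ ℚ.≤_) ι-1 (κ-upper 1ℤ 0≤1ᶻ 1ℤ 0≤1ᶻ κ-small x x∈)))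

    ρ-ι : ∀ x → ρ (ι x) ≡ ι (remainderᶻ x 1ℤ (r ∷ rs))
    ρ-ι x = trans (cong (λ v → remainderOf (ι x) v (ι r ∷ map ι rs)) (sym ι-1)) (remainder-ι x 1ℤ (r ∷ rs))

    ρ[l]≤0 : ρ (ι l) ℚ.≤ 0ℚ
    ρ[l]≤0 = subst₂ ℚ._≤_ (sym (ρ-ι l)) ι-0 (ι-≤ left≤0)

    0≤ρ[l+1] : 0ℚ ℚ.≤ ρ h
    0≤ρ[l+1] = subst (0ℚ ℚ.≤_) (trans (sym (ρ-ι (l ℤ.+ 1ℤ)))
      (cong ρ (trans (ι-+ l 1ℤ) (cong (λ y → ι l ℚ.+ y) ι-1)))) (0≤ι 0≤right)

    open Bisection ρ (ι l) ρ[l]≤0 0≤ρ[l+1]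
    open Bracket

    root : ℕ → ℚ
    root = approximation

    root∈ : ∀ i → InRange (root i)
    root∈ i = l≤left (bracket i) , ℚ.≤-trans (p≤p+q (halves-nonNeg i)) (right≤ (bracket i))

    right∈ : ∀ i → InRange (root i ℚ.+ halves i)
    right∈ i = ℚ.≤-trans (l≤left (bracket i)) (p≤p+q (halves-nonNeg i)) , right≤ (bracket i)

    ρ-lipschitz : ∃[ L ] 0ℚ ℚ.≤ L × (∀ x y → InRange x → InRange y → ℚ.∣ ρ x ℚ.- ρ y ∣ ℚ.≤ L ℚ.* ℚ.∣ x ℚ.- y ∣)
    ρ-lipschitz = let L , 0≤L , lipschitz = remainderOf-lipschitz h 0≤h 1ℚ (ℚ.nonNegative⁻¹ 1ℚ) 0ℚ ℚ.≤-refl (ι r ∷ map ι rs)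
      in L , 0≤L , λ x y x∈ y∈ → lipschitz x y 1ℚ 1ℚ (∣x∣≤h x∈) (∣x∣≤h y∈) ∣1∣≤1 ∣1∣≤1 (no-difference ℚ.∣ x ℚ.- y ∣)
      where
      ∣1∣≤1 : ℚ.∣ 1ℚ ∣ ℚ.≤ 1ℚ
      ∣1∣≤1 = ℚ.≤-reflexive (ℚ.0≤p⇒∣p∣≡p (ℚ.nonNegative⁻¹ 1ℚ))
      no-difference : ∀ e → ℚ.∣ 1ℚ ℚ.- 1ℚ ∣ ℚ.≤ 0ℚ ℚ.* e
      no-difference e = ℚ.≤-reflexive (trans (cong ℚ.∣_∣ (ℚ.+-inverseʳ 1ℚ)) (sym (ℚ.*-zeroˡ e)))

    residue-small : ∃[ L ] 0ℚ ℚ.≤ L × (∀ i → ℚ.∣ ρ (root i) ∣ ℚ.≤ L ℚ.* halves i)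
    residue-small = proj₁ ρ-lipschitz , proj₁ (proj₂ ρ-lipschitz) , λ i →
      sign-change-bound ρ {proj₁ ρ-lipschitz} {root i} {halves i} (halves-nonNeg i) (ρleft≤0 (bracket i)) (0≤ρright (bracket i))
        (proj₂ (proj₂ ρ-lipschitz) (root i) (root i ℚ.+ halves i) (root∈ i) (right∈ i))

    rootᴿ numeratorᴿ denominatorᴿ κᴿ Λᴿ : ℝ
    Qᴿ : List ℝ
    rootᴿ = mkℝ root approximation-cauchy
    Qᴿ = quotientᴿ rootᴿ 1ℝ (ι r ∷ map ι rs)
    numeratorᴿ = applyᴿ Qᴿ (λ n → fromℚ (b n))
    denominatorᴿ = applyᴿ Qᴿ (λ n → rootᴿ ^ n)

    seq-numeratorᴿ : ∀ i → seq numeratorᴿ i ≡ numeratorOf (root i)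
    seq-numeratorᴿ i = trans (seq-applyᴿ Qᴿ (λ n → fromℚ (b n)) b i (λ _ → refl))
      (cong (λ cs → apply cs b 0) (seq-quotientᴿ rootᴿ 1ℝ (ι r ∷ map ι rs) i))

    seq-denominatorᴿ : ∀ i → seq denominatorᴿ i ≡ normalizer (root i)
    seq-denominatorᴿ i = trans (seq-applyᴿ Qᴿ (λ n → rootᴿ ^ n) (power (root i)) i (λ n → seq-^ rootᴿ n i))
      (cong (λ cs → apply cs (power (root i)) 0) (seq-quotientᴿ rootᴿ 1ℝ (ι r ∷ map ι rs) i))

    denominator>0 : 0ℝ < denominatorᴿ
    -- The witness 1 is the cut-off of the reciprocal in κ, so that the terms of `κᴿ` are the values
    -- of κ at the bisection points.
    denominator>0 = 1ℚ , 1>0 , 0 , λ i _ → ℚ.≤-trans (ℚ.≤-reflexive (ℚ.+-identityˡ 1ℚ))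
      (ℚ.≤-trans (1≤normalizer (root∈ i)) (ℚ.≤-reflexive (sym (seq-denominatorᴿ i))))

    κᴿ = numeratorᴿ / denominatorᴿ [ denominator>0 ]

    seq-κᴿ : ∀ i → seq κᴿ i ≡ κ (root i)
    seq-κᴿ i = cong₂ (λ p q → p ℚ.* recipAbove 1ℚ 1>0 q) (seq-numeratorᴿ i) (seq-denominatorᴿ i)

    σ-nonNeg : ℚ.NonNegative σ
    σ-nonNeg = ℚ.nonNegative 0≤σ

    Λᴿ = rootᴿ * fromℚ σ

    approximant : ℚ → ℕ → ℚ
    approximant x n = κ x ℚ.* power (x ℚ.* σ) n

    seq-approximant : ∀ n i → seq (κᴿ * Λᴿ ^ n) i ≡ approximant (root i) n
    seq-approximant n i = cong₂ ℚ._*_ (seq-κᴿ i) (seq-^ Λᴿ n i)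

    1≤xσ : ∀ {x} → InRange x → 1ℚ ℚ.≤ x ℚ.* σ
    1≤xσ {x} (l≤x , _) = ℚ.≤-trans (ℚ.≤-reflexive (trans (sym σs≡1) (ℚ.*-comm σ (ι s))))
      (ℚ.*-monoʳ-≤-nonNeg σ {{σ-nonNeg}} (ℚ.≤-trans (ι-≤ s≤l) l≤x))

    1≤10approximant : ∀ {x} → InRange x → ∀ n → power (x ℚ.* σ) n ℚ.≤ approximant x n ℚ.* ι (+ 10)
    1≤10approximant {x} x∈ n = ℚ.≤-trans (ℚ.≤-reflexive (sym (ℚ.*-identityˡ (power (x ℚ.* σ) n))))
      (ℚ.≤-trans (ℚ.*-monoʳ-≤-nonNeg (power (x ℚ.* σ) n) {{ℚ.nonNegative (ℚ.≤-trans (ℚ.nonNegative⁻¹ 1ℚ) (1≤power (1≤xσ x∈) n))}}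
                   (1≤10κ x x∈))
                 (ℚ.≤-reflexive (regroup (κ x) (ι (+ 10)) (power (x ℚ.* σ) n))))
      where
      regroup : ∀ k t p → k ℚ.* t ℚ.* p ≡ k ℚ.* p ℚ.* t
      regroup = RingSolver.solve-∀ ℚ-ring

    tenth : ℚ
    tenth = 1ℤ ℚ./ 10

    tenth>0 : 0ℚ ℚ.< tenth
    tenth>0 = ℚ.positive⁻¹ tenth

    tenth≤approximant : ∀ {x} → InRange x → ∀ n → tenth ℚ.≤ approximant x n
    tenth≤approximant {x} x∈ n = fraction-≤ (approximant x n) 1ℤ 9
      (ℚ.≤-trans (ℚ.≤-reflexive ι-1) $ ℚ.≤-trans (1≤power (1≤xσ x∈) n) (1≤10approximant x∈ n))

    approximant>0 : ∀ n → 0ℝ < κᴿ * Λᴿ ^ n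
    approximant>0 n = tenth , tenth>0 , 0 , λ i _ → ℚ.≤-trans (ℚ.≤-reflexive (ℚ.+-identityˡ tenth))
      (ℚ.≤-trans (tenth≤approximant (root∈ i) n) (ℚ.≤-reflexive (sym (seq-approximant n i))))

    -- Both sides are divided by sⁿ; as sⁿ ≥ 1, the residue term may be kept undivided.
    unscale : ∀ {x} → InRange x → ∀ n ε e → 0ℚ ℚ.≤ e →
      ℚ.∣ b n ℚ.- κ x ℚ.* power x n ∣ ℚ.≤ ε ℚ.* power x n ℚ.+ e →
      ℚ.∣ ι (+ f n) ℚ.- approximant x n ∣ ℚ.≤ ε ℚ.* power (x ℚ.* σ) n ℚ.+ e
    unscale {x} x∈ n ε e 0≤e bound = ℚ.*-cancelʳ-≤-pos S {{ℚ.positive (ℚ.<-≤-trans 1>0 1≤S)}} (begin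
      ℚ.∣ ι (+ f n) ℚ.- approximant x n ∣ ℚ.* S
        ≡⟨ cong (λ y → ℚ.∣ ι (+ f n) ℚ.- approximant x n ∣ ℚ.* y) (sym (ℚ.0≤p⇒∣p∣≡p 0≤S)) ⟩
      ℚ.∣ ι (+ f n) ℚ.- approximant x n ∣ ℚ.* ℚ.∣ S ∣
        ≡⟨ sym (ℚ.∣p*q∣≡∣p∣*∣q∣ (ι (+ f n) ℚ.- approximant x n) S) ⟩
      ℚ.∣ (ι (+ f n) ℚ.- approximant x n) ℚ.* S ∣
        ≡⟨ cong ℚ.∣_∣ (trans (distribute (ι (+ f n)) (κ x) (power (x ℚ.* σ) n) S)
             (cong (λ y → b n ℚ.- κ x ℚ.* y) rescale)) ⟩
      ℚ.∣ b n ℚ.- κ x ℚ.* power x n ∣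
        ≤⟨ bound ⟩
      ε ℚ.* power x n ℚ.+ e
        ≤⟨ ℚ.+-monoʳ-≤ (ε ℚ.* power x n) (ℚ.≤-trans (ℚ.≤-reflexive (sym (ℚ.*-identityʳ e)))
             (ℚ.*-monoˡ-≤-nonNeg e {{ℚ.nonNegative 0≤e}} 1≤S)) ⟩
      ε ℚ.* power x n ℚ.+ e ℚ.* S
        ≡⟨ cong (λ y → ε ℚ.* y ℚ.+ e ℚ.* S) (sym rescale) ⟩
      ε ℚ.* (power (x ℚ.* σ) n ℚ.* S) ℚ.+ e ℚ.* S
        ≡⟨ collect ε (power (x ℚ.* σ) n) e S ⟩
      (ε ℚ.* power (x ℚ.* σ) n ℚ.+ e) ℚ.* S ∎)
      where
      open ℚ.≤-Reasoning
      S : ℚ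
      S = power (ι s) n
      1≤S : 1ℚ ℚ.≤ S
      1≤S = 1≤power (1≤ι {s} (ℤ.+≤+ (s≤s z≤n))) n
      0≤S : 0ℚ ℚ.≤ S
      0≤S = ℚ.≤-trans (ℚ.nonNegative⁻¹ 1ℚ) 1≤S
      rescale : power (x ℚ.* σ) n ℚ.* S ≡ power x n
      rescale = trans (sym (power-* (x ℚ.* σ) (ι s) n)) (cong (λ y → power y n)
        (trans (ℚ.*-assoc x σ (ι s)) (trans (cong (λ y → x ℚ.* y) σs≡1) (ℚ.*-identityʳ x))))
      distribute : ∀ f k p s → (f ℚ.- k ℚ.* p) ℚ.* s ≡ f ℚ.* s ℚ.- k ℚ.* (p ℚ.* s)
      distribute = RingSolver.solve-∀ ℚ-ring
      collect : ∀ ε p e s → ε ℚ.* (p ℚ.* s) ℚ.+ e ℚ.* s ≡ (ε ℚ.* p ℚ.+ e) ℚ.* s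
      collect = RingSolver.solve-∀ ℚ-ring

    -- As κ ≥ 1/10, both (xσ)ⁿ and 1 are at most ten times the approximant, which turns the absolute
    -- error into a relative one.
    ratio-bound : ∀ {x} → InRange x → ∀ n ε e → 0ℚ ℚ.≤ ε → 0ℚ ℚ.≤ e →
      ℚ.∣ ι (+ f n) ℚ.- approximant x n ∣ ℚ.≤ ε ℚ.* power (x ℚ.* σ) n ℚ.+ e →
      ℚ.∣ ι (+ f n) ℚ.* recipAbove tenth tenth>0 (approximant x n) ℚ.- 1ℚ ∣ ℚ.≤ (ε ℚ.+ e) ℚ.* ι (+ 10)
    ratio-bound {x} x∈ n ε e 0≤ε 0≤e bound = begin
      ℚ.∣ ι (+ f n) ℚ.* R ℚ.- 1ℚ ∣
        ≡⟨ cong ℚ.∣_∣ (trans (cong (λ y → ι (+ f n) ℚ.* R ℚ.- y) (sym gR≡1)) (factor (ι (+ f n)) g R)) ⟩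
      ℚ.∣ (ι (+ f n) ℚ.- g) ℚ.* R ∣
        ≡⟨ trans (ℚ.∣p*q∣≡∣p∣*∣q∣ (ι (+ f n) ℚ.- g) R) (cong (λ y → ℚ.∣ ι (+ f n) ℚ.- g ∣ ℚ.* y) (ℚ.0≤p⇒∣p∣≡p 0≤R)) ⟩
      ℚ.∣ ι (+ f n) ℚ.- g ∣ ℚ.* R
        ≤⟨ ℚ.*-monoʳ-≤-nonNeg R {{ℚ.nonNegative 0≤R}} bound ⟩
      (ε ℚ.* P ℚ.+ e) ℚ.* R
        ≤⟨ ℚ.*-monoʳ-≤-nonNeg R {{ℚ.nonNegative 0≤R}} (ℚ.+-mono-≤
             (ℚ.*-monoˡ-≤-nonNeg ε {{ℚ.nonNegative 0≤ε}} (1≤10approximant x∈ n))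
             (ℚ.≤-trans (ℚ.≤-reflexive (sym (ℚ.*-identityʳ e)))
               (ℚ.*-monoˡ-≤-nonNeg e {{ℚ.nonNegative 0≤e}}
                 (ℚ.≤-trans (1≤power (1≤xσ x∈) n) (1≤10approximant x∈ n))))) ⟩
      (ε ℚ.* (g ℚ.* ι (+ 10)) ℚ.+ e ℚ.* (g ℚ.* ι (+ 10))) ℚ.* R
        ≡⟨ collect ε e g (ι (+ 10)) R ⟩
      (ε ℚ.+ e) ℚ.* ι (+ 10) ℚ.* (g ℚ.* R)
        ≡⟨ trans (cong (λ y → (ε ℚ.+ e) ℚ.* ι (+ 10) ℚ.* y) gR≡1) (ℚ.*-identityʳ ((ε ℚ.+ e) ℚ.* ι (+ 10))) ⟩
      (ε ℚ.+ e) ℚ.* ι (+ 10) ∎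
      where
      open ℚ.≤-Reasoning
      g R P : ℚ
      g = approximant x n
      R = recipAbove tenth tenth>0 g
      P = power (x ℚ.* σ) n
      gR≡1 : g ℚ.* R ≡ 1ℚ
      gR≡1 = recip-inverse tenth tenth>0 g (tenth≤approximant x∈ n)
      0≤R : 0ℚ ℚ.≤ R
      0≤R = ℚ.<⇒≤ (ℚ.positive⁻¹ R {{ℚ.1/pos⇒pos (tenth ℚ.⊔ g) {{⊔-pos g tenth>0}}}})
      factor : ∀ f g r → f ℚ.* r ℚ.- g ℚ.* r ≡ (f ℚ.- g) ℚ.* r
      factor = RingSolver.solve-∀ ℚ-ring
      collect : ∀ ε e g t r → (ε ℚ.* (g ℚ.* t) ℚ.+ e ℚ.* (g ℚ.* t)) ℚ.* r ≡ (ε ℚ.+ e) ℚ.* t ℚ.* (g ℚ.* r)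
      collect = RingSolver.solve-∀ ℚ-ring

    asymptotic : (λ n → fromℕ (f n)) ∼ (λ n → κᴿ * Λᴿ ^ n)
    asymptotic = approximant>0 , λ ε (e , e>0 , K , e≤ε) →
      -- The ratio will differ from 1 by at most 10 (δ + δ), and the strict inequality takes a
      -- further margin 20 δ.
      let δ , δ>0 , 40δ≡e = quotient (ι (+ 40)) e (ℚ.positive⁻¹ (ι (+ 40)) {{ι-positive 39}}) e>0
          N , bounds = negligible l≤h contracting κ κ-normalized ∣κ∣≤1 δ δ>0
          L , 0≤L , residue≤ = residue-small
      in N , λ n N≤n →
      let M , 0≤M , bound = bounds n N≤n
          ML+1>0 = ℚ.+-mono-≤-< (*-nonNeg 0≤M 0≤L) 1>0
          -- M depends on n, so the precision of the root is chosen only after n; this makes M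
          -- |ρ(x)| at most δ.
          η , η>0 , cη≡δ = quotient (M ℚ.* L ℚ.+ 1ℚ) δ ML+1>0 δ>0
          I , small = halves-small η η>0
      in ι (+ 20) ℚ.* δ , *-pos (ℚ.positive⁻¹ (ι (+ 20)) {{ι-positive 19}}) δ>0 , K ℕ.⊔ I , λ i K⊔I≤i →
      let error≤δ = remaining M L η δ i 0≤M 0≤L (ℚ.<⇒≤ η>0) cη≡δ (residue≤ i) (ℚ.<⇒≤ (small i (ℕ.m⊔n≤o⇒n≤o K I K⊔I≤i)))
          0≤error = *-nonNeg 0≤M (ℚ.0≤∣p∣ (ρ (root i)))
      in ℚ.≤-trans
           (ℚ.+-monoˡ-≤ (ι (+ 20) ℚ.* δ) (ℚ.≤-trans
             (subst₂ (λ u y → ℚ.∣ u ℚ.* recipAbove tenth tenth>0 y ℚ.- 1ℚ ∣ ℚ.≤ (δ ℚ.+ M ℚ.* ℚ.∣ ρ (root i) ∣) ℚ.* ι (+ 10))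
               (ι-def (+ f n)) (sym (seq-approximant n i))
               (ratio-bound (root∈ i) n δ (M ℚ.* ℚ.∣ ρ (root i) ∣) (ℚ.<⇒≤ δ>0) 0≤error
                 (unscale (root∈ i) n δ (M ℚ.* ℚ.∣ ρ (root i) ∣) 0≤error (bound (root i) (root∈ i)))))
             (ℚ.*-monoʳ-≤-nonNeg (ι (+ 10)) {{ℚ.nonNegative (0≤ι (0≤+ 10))}} (ℚ.+-monoʳ-≤ δ error≤δ))))
           (ℚ.≤-trans (ℚ.≤-reflexive (trans (forty δ) 40δ≡e))
             (ℚ.≤-trans (ℚ.≤-reflexive (sym (ℚ.+-identityˡ e))) (e≤ε i (ℕ.m⊔n≤o⇒m≤o K I K⊔I≤i))))
      where
      remaining : ∀ M L η δ i → 0ℚ ℚ.≤ M → 0ℚ ℚ.≤ L → 0ℚ ℚ.≤ η → (M ℚ.* L ℚ.+ 1ℚ) ℚ.* η ≡ δ →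
                  ℚ.∣ ρ (root i) ∣ ℚ.≤ L ℚ.* halves i → halves i ℚ.≤ η → M ℚ.* ℚ.∣ ρ (root i) ∣ ℚ.≤ δ
      remaining M L η δ i 0≤M 0≤L 0≤η cη≡δ res≤ half≤ = ℚ.≤-trans
        (ℚ.*-monoˡ-≤-nonNeg M {{ℚ.nonNegative 0≤M}} (ℚ.≤-trans res≤ (ℚ.*-monoˡ-≤-nonNeg L {{ℚ.nonNegative 0≤L}} half≤)))
        (ℚ.≤-trans (p≤p+q 0≤η) (ℚ.≤-reflexive (trans (expand M L η) cη≡δ)))
        where
        expand : ∀ M L η → M ℚ.* (L ℚ.* η) ℚ.+ η ≡ (M ℚ.* L ℚ.+ 1ℚ) ℚ.* η
        expand = RingSolver.solve-∀ ℚ-ring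

    κᴿ-≥ : ∀ p k → + p ℤ.* upperᵇ denominatorᵇ ℤ.≤ + suc k ℤ.* lowerᵇ numeratorᵇ → fromℚ (+ p ℚ./ suc k) ≤ κᴿ
    κᴿ-≥ p k check = fraction-≤ᴿ κᴿ (+ p) k (λ i → subst (λ y → ι (+ p) ℚ.≤ y ℚ.* ι (+ suc k)) (sym (seq-κᴿ i))
      (κ-lower (+ p) (0≤+ p) (+ suc k) (0≤+ (suc k)) check (root i) (root∈ i)))

    κᴿ-< : ∀ p k → 0ℤ ℤ.≤ + 8 ℤ.* + p ℤ.- 1ℤ →
      + 8 ℤ.* + suc k ℤ.* upperᵇ numeratorᵇ ℤ.≤ (+ 8 ℤ.* + p ℤ.- 1ℤ) ℤ.* lowerᵇ denominatorᵇ →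
      κᴿ < fromℚ (+ p ℚ./ suc k)
    κᴿ-< p k 0≤ check = <-fractionᴿ κᴿ (+ p) k (λ i → subst (λ y → y ℚ.* ι (+ suc k) ℚ.+ halves 3 ℚ.≤ ι (+ p)) (sym (seq-κᴿ i))
      (eighth (κ (root i)) (+ suc k) (+ p) (κ-upper (+ 8 ℤ.* + p ℤ.- 1ℤ) 0≤ (+ 8 ℤ.* + suc k) (0≤+ _) check (root i) (root∈ i))))

    xσ-lower : ∀ p q → p ℤ.* s ℤ.≤ l ℤ.* + q → ∀ {x} → InRange x → ι p ℚ.≤ x ℚ.* σ ℚ.* ι (+ q)
    xσ-lower p q check {x} (l≤x , _) = begin
      ι p                           ≡⟨ sym (trans (cong (λ y → ι p ℚ.* y) (trans (ℚ.*-comm (ι s) σ) σs≡1)) (ℚ.*-identityʳ (ι p))) ⟩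
      ι p ℚ.* (ι s ℚ.* σ)           ≡⟨ trans (sym (ℚ.*-assoc (ι p) (ι s) σ)) (cong (ℚ._* σ) (sym (ι-* p s))) ⟩
      ι (p ℤ.* s) ℚ.* σ             ≤⟨ ℚ.*-monoʳ-≤-nonNeg σ {{σ-nonNeg}} (ι-≤ check) ⟩
      ι (l ℤ.* + q) ℚ.* σ           ≡⟨ cong (ℚ._* σ) (ι-* l (+ q)) ⟩
      ι l ℚ.* ι (+ q) ℚ.* σ         ≤⟨ ℚ.*-monoʳ-≤-nonNeg σ {{σ-nonNeg}}
                                         (ℚ.*-monoʳ-≤-nonNeg (ι (+ q)) {{ℚ.nonNegative (0≤ι (0≤+ q))}} l≤x) ⟩
      x ℚ.* ι (+ q) ℚ.* σ           ≡⟨ regroup x (ι (+ q)) σ ⟩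
      x ℚ.* σ ℚ.* ι (+ q)           ∎
      where
      open ℚ.≤-Reasoning
      regroup : ∀ x q σ → x ℚ.* q ℚ.* σ ≡ x ℚ.* σ ℚ.* q
      regroup = RingSolver.solve-∀ ℚ-ring

    xσ-upper : ∀ p q → (l ℤ.+ 1ℤ) ℤ.* + q ℤ.≤ p ℤ.* s → ∀ {x} → InRange x → x ℚ.* σ ℚ.* ι (+ q) ℚ.≤ ι p
    xσ-upper p q check {x} (_ , x≤h) = begin
      x ℚ.* σ ℚ.* ι (+ q)           ≡⟨ regroup x (ι (+ q)) σ ⟩
      x ℚ.* ι (+ q) ℚ.* σ           ≤⟨ ℚ.*-monoʳ-≤-nonNeg σ {{σ-nonNeg}}
                                         (ℚ.*-monoʳ-≤-nonNeg (ι (+ q)) {{ℚ.nonNegative (0≤ι (0≤+ q))}} x≤h) ⟩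
      h ℚ.* ι (+ q) ℚ.* σ           ≡⟨ cong (ℚ._* σ) (sym (trans (ι-* (l ℤ.+ 1ℤ) (+ q)) (cong (ℚ._* ι (+ q)) (trans (ι-+ l 1ℤ) (cong (λ y → ι l ℚ.+ y) ι-1))))) ⟩
      ι ((l ℤ.+ 1ℤ) ℤ.* + q) ℚ.* σ  ≤⟨ ℚ.*-monoʳ-≤-nonNeg σ {{σ-nonNeg}} (ι-≤ check) ⟩
      ι (p ℤ.* s) ℚ.* σ             ≡⟨ trans (cong (ℚ._* σ) (ι-* p s)) (ℚ.*-assoc (ι p) (ι s) σ) ⟩
      ι p ℚ.* (ι s ℚ.* σ)           ≡⟨ trans (cong (λ y → ι p ℚ.* y) (trans (ℚ.*-comm (ι s) σ) σs≡1)) (ℚ.*-identityʳ (ι p)) ⟩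
      ι p                           ∎
      where
      open ℚ.≤-Reasoning
      regroup : ∀ x q σ → x ℚ.* σ ℚ.* q ≡ x ℚ.* q ℚ.* σ
      regroup = RingSolver.solve-∀ ℚ-ring

    Λᴿ-≥ : ∀ p k → + p ℤ.* s ℤ.≤ l ℤ.* + suc k → fromℚ (+ p ℚ./ suc k) ≤ Λᴿ
    Λᴿ-≥ p k check = fraction-≤ᴿ Λᴿ (+ p) k (λ i → xσ-lower (+ p) (suc k) check (root∈ i))

    Λᴿ-< : ∀ p k → (l ℤ.+ 1ℤ) ℤ.* (+ 8 ℤ.* + suc k) ℤ.≤ (+ 8 ℤ.* + p ℤ.- 1ℤ) ℤ.* s → Λᴿ < fromℚ (+ p ℚ./ suc k)
    Λᴿ-< p k check = <-fractionᴿ Λᴿ (+ p) k (λ i → eighth (root i ℚ.* σ) (+ suc k) (+ p)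
      (xσ-upper (+ 8 ℤ.* + p ℤ.- 1ℤ) (8 ℕ.* suc k) check (root∈ i)))

-- The recurrence for level three

-- The polynomial part of x⁴⁷ divided by the quotient of the reversed denominator
-- by x - Λ, rounded to integer coefficients.  Multiplying by it makes all the
-- coefficients of the quotient after the first one small.
cofactor : List ℤ
cofactor =
  + 1 ∷ + 10 ∷ + 56 ∷ + 250 ∷ + 953 ∷ + 3289 ∷ + 10576 ∷ + 32374 ∷ + 95776 ∷ + 276846 ∷
  + 788099 ∷ + 2221847 ∷ + 6227264 ∷ + 17394420 ∷ + 48497479 ∷ + 135087107 ∷ + 376103755 ∷
  + 1046912475 ∷ + 2913901363 ∷ + 8110070820 ∷ + 22571968473 ∷ []

-- The characteristic polynomial has degree 48 after multiplication by the cofactor, so Q has degree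
-- 47 and Q(E) evaluated at 0 involves the terms with indices 0 to 47.
firstCounts : List ℕ
firstCounts =
  0 ∷ 1 ∷ 3 ∷ 11 ∷ 43 ∷ 174 ∷ 719 ∷ 3012 ∷ 12727 ∷ 54067 ∷ 230464 ∷ 984477 ∷ 4211222 ∷ 18030186 ∷
  77240657 ∷ 331022139 ∷ 1418978449 ∷ 6083655523 ∷ 26085488070 ∷ 111856930598 ∷ 479673839955 ∷
  2057034787922 ∷ 8821558738321 ∷ 37831562212480 ∷ 162243246729066 ∷ 695794823920526 ∷
  2983988837089336 ∷ 12797175508013568 ∷ 54882219035130584 ∷ 235369178569215227 ∷
  1009410400558456448 ∷ 4328985428880706140 ∷ 18565411511969625242 ∷ 79620170939372761904 ∷
  341461447035088181997 ∷ 1464401875865413575750 ∷ 6280278393313157481064 ∷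
  26933793563542894929643 ∷ 115509091106152076378802 ∷ 495375828006429190582757 ∷
  2124483973768185544863478 ∷ 9111127193504077620521001 ∷ 39074259929854796854172735 ∷
  167575071654853970814743624 ∷ 718667601874950859296011647 ∷ 3082099964786936612332037871 ∷
  13217988641299336935141232473 ∷ 56687072380341676957446332282 ∷ []

firstCount : ℕ → ℕ
firstCount = at firstCounts
  where
  at : List ℕ → ℕ → ℕ
  at []       _       = 0
  at (x ∷ _)  zero    = x
  at (_ ∷ xs) (suc n) = at xs n

firsts-≡ : ∀ n φ ψ → firsts n φ ≡ firsts n ψ → ∀ m → m ℕ.< n → φ m ≡ ψ m
firsts-≡ (suc n) φ ψ e zero    _         = proj₁ (List.∷-injective e)
firsts-≡ (suc n) φ ψ e (suc m) (s≤s m<n) = firsts-≡ n (φ ∘ suc) (ψ ∘ suc) (proj₂ (List.∷-injective e)) m m<n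

opaque
  unfolding _▹_

  ▹-local : ∀ p (f g : Seq) m → (∀ k → k ℕ.≤ m → f k ≡ g k) → (p ▹ f) m ≡ (p ▹ g) m
  ▹-local []      f g m       e = refl
  ▹-local (c ∷ p) f g zero    e = cong (λ y → c ℤ.* y ℤ.+ 0ℤ) (e 0 z≤n)
  ▹-local (c ∷ p) f g (suc m) e = cong₂ (λ y z → c ℤ.* y ℤ.+ z) (e (suc m) ℕ.≤-refl)
    (▹-local p f g m (λ k k≤m → e k (ℕ.m≤n⇒m≤1+n k≤m)))

  ▹-determined : ∀ p (f g : Seq) M → (∀ m → m ℕ.< M → ((1ℤ ∷ p) ▹ f) m ≡ ((1ℤ ∷ p) ▹ g) m) →
                 ∀ m → m ℕ.< M → f m ≡ g m
  ▹-determined p f g (suc M) e m m<M with ℕ.m≤n⇒m<n∨m≡n (ℕ.≤-pred m<M)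
  ... | inj₁ m<M′ = ▹-determined p f g M (λ k k<M → e k (ℕ.m≤n⇒m≤1+n k<M)) m m<M′
  ... | inj₂ refl = cancel (f m) (g m) (shift (p ▹ f) m) (shift (p ▹ g) m) (e m ℕ.≤-refl) (earlier m before)
    where
    before : ∀ k → k ℕ.< m → f k ≡ g k
    before = ▹-determined p f g m (λ k k<m → e k (ℕ.m≤n⇒m≤1+n k<m))
    earlier : ∀ m → (∀ k → k ℕ.< m → f k ≡ g k) → shift (p ▹ f) m ≡ shift (p ▹ g) m
    earlier zero    b = refl
    earlier (suc m) b = ▹-local p f g m (λ k k≤m → b k (s≤s k≤m))
    cancel : ∀ x y u v → 1ℤ ℤ.* x ℤ.+ u ≡ 1ℤ ℤ.* y ℤ.+ v → u ≡ v → x ≡ y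
    cancel x y u _ e refl = trans (isolate x u) (trans (cong (ℤ._- u) e) (sym (isolate y u)))
      where
      isolate : ∀ x u → x ≡ (1ℤ ℤ.* x ℤ.+ u) ℤ.- u
      isolate = ℤSolver.solve-∀

  ▹δ₀-vanishes : ∀ p m → length p ℕ.≤ m → (p ▹ δ₀) m ≡ 0ℤ
  ▹δ₀-vanishes []      m       _         = refl
  ▹δ₀-vanishes (c ∷ p) (suc m) (s≤s p≤m) = cong₂ ℤ._+_ (ℤ.*-zeroʳ c) (▹δ₀-vanishes p m p≤m)

  firstCounts-correct : firsts 48 (denominator ▹ (+_ ∘ firstCount)) ≡ firsts 48 (numerator ▹ δ₀)
  firstCounts-correct = refl

-- The constant term 1 of the denominator makes the series determined by its rational form, so the
-- table can be checked without enumerating any codes.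
codeCount-first : ∀ n → n ℕ.≤ 47 → codeCount n ≡ firstCount n
codeCount-first n n≤47 = ℤ.+-injective
  (▹-determined (List.drop 1 denominator) (+_ ∘ codeCount) (+_ ∘ firstCount) 48
    (λ m m<48 → trans (codeCount-rational m)
      (sym (firsts-≡ 48 (denominator ▹ (+_ ∘ firstCount)) (numerator ▹ δ₀) firstCounts-correct m m<48)))
    n (s≤s n≤47))

-- The entry at position j is multiplied by t sʲ. With leading coefficients first and t = 1, this
-- multiplies all roots by s, as the passage from ℓₙ to ℓₙ sⁿ requires.
scaleRoots : ℤ → ℤ → List ℤ → List ℤ
scaleRoots s t []       = []
scaleRoots s t (c ∷ cs) = c ℤ.* t ∷ scaleRoots s (s ℤ.* t) cs

length-scaleRoots : ∀ s t cs → length (map ι (scaleRoots s t cs)) ≡ length cs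
length-scaleRoots s t []       = refl
length-scaleRoots s t (c ∷ cs) = cong suc (length-scaleRoots s (s ℤ.* t) cs)

opaque
  unfolding _▹_

  -- The same list is a series denominator read from the constant term and its reversed polynomial
  -- read from the leading term. From index `length cs` on, all backward shifts stay within the
  -- sequence, so the two actions agree up to the scaling.
  apply-scaleRoots : ∀ (f : ℕ → ℕ) s t c cs n →
    apply (map ι (scaleRoots s t (c ∷ cs))) (λ m → ι (+ f m) ℚ.* power (ι s) m) n ≡
    ι t ℚ.* power (ι s) (length cs ℕ.+ n) ℚ.* ι (((c ∷ cs) ▹ (+_ ∘ f)) (length cs ℕ.+ n))
  apply-scaleRoots f s t c cs n = trans
    (cong₂ (λ k y → ι (c ℤ.* t) ℚ.* (ι (+ f (k ℕ.+ n)) ℚ.* power (ι s) (k ℕ.+ n)) ℚ.+ y)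
      (length-scaleRoots s (s ℤ.* t) cs) (rest cs))
    (trans (cong (λ y → y ℚ.* (ι (+ f N) ℚ.* power (ι s) N) ℚ.+ ι t ℚ.* power (ι s) N ℚ.* ι (shift (cs ▹ (+_ ∘ f)) N)) (ι-* c t))
    (trans (regroup (ι c) (ι t) (ι (+ f N)) (power (ι s) N) (ι (shift (cs ▹ (+_ ∘ f)) N)))
           (cong (λ y → ι t ℚ.* power (ι s) N ℚ.* y)
             (sym (trans (ι-+ (c ℤ.* + f N) (shift (cs ▹ (+_ ∘ f)) N))
               (cong (ℚ._+ ι (shift (cs ▹ (+_ ∘ f)) N)) (ι-* c (+ f N))))))))
    where
    N : ℕ
    N = length cs ℕ.+ n
    regroup : ∀ c t f p s → c ℚ.* t ℚ.* (f ℚ.* p) ℚ.+ t ℚ.* p ℚ.* s ≡ t ℚ.* p ℚ.* (c ℚ.* f ℚ.+ s)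
    regroup = RingSolver.solve-∀ ℚ-ring
    rest : ∀ cs → apply (map ι (scaleRoots s (s ℤ.* t) cs)) (λ m → ι (+ f m) ℚ.* power (ι s) m) n ≡
           ι t ℚ.* power (ι s) (length cs ℕ.+ n) ℚ.* ι (shift (cs ▹ (+_ ∘ f)) (length cs ℕ.+ n))
    rest []       = sym (trans (cong (λ y → ι t ℚ.* power (ι s) n ℚ.* y) (trans (cong ι (nil n)) ι-0))
                               (ℚ.*-zeroʳ (ι t ℚ.* power (ι s) n)))
      where
      nil : ∀ n → shift ([] ▹ (+_ ∘ f)) n ≡ 0ℤ
      nil zero    = refl
      nil (suc n) = refl
    rest (e ∷ es) = trans (apply-scaleRoots f s (s ℤ.* t) e es n)
      (cong (ℚ._* ι (((e ∷ es) ▹ (+_ ∘ f)) (length es ℕ.+ n)))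
        (trans (cong (ℚ._* power (ι s) (length es ℕ.+ n)) (ι-* s t))
               (swap (ι s) (ι t) (power (ι s) (length es ℕ.+ n)))))
      where
      swap : ∀ s t p → s ℚ.* t ℚ.* p ≡ t ℚ.* (s ℚ.* p)
      swap = RingSolver.solve-∀ ℚ-ring

characteristic : List ℤ
characteristic = mulPoly cofactor denominator

-- The product of the cofactor and the numerator has 48 coefficients, so the inhomogeneous side
-- vanishes from index 48 on.
characteristic-recurrence : ∀ m → 48 ℕ.≤ m → (characteristic ▹ (+_ ∘ codeCount)) m ≡ 0ℤ
characteristic-recurrence m 48≤m = trans (▹-mul cofactor denominator (+_ ∘ codeCount) m)
  (trans (▹-cong cofactor codeCount-rational m)
  (trans (sym (▹-mul cofactor numerator δ₀ m)) (▹δ₀-vanishes (mulPoly cofactor numerator) m 48≤m)))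

-- Both are predecessors: roots are scaled by 10⁹, which puts the dominant one between the integers
-- 4288630740 and 4288630741.
scale′ root′ : ℕ
scale′ = 999999999
root′  = 4288630739

scaledCharacteristic : List ℤ
scaledCharacteristic = scaleRoots (+ suc scale′) 1ℤ characteristic

secondCoefficient : ℤ
secondCoefficient = coefficient 1 scaledCharacteristic

laterCoefficients : List ℤ
laterCoefficients = List.drop 2 scaledCharacteristic

opaque
  σ : ℚ
  σ = 1ℤ ℚ./ suc scale′

  σ-inverse : σ ℚ.* ι (+ suc scale′) ≡ 1ℚ
  σ-inverse = trans (fraction-* 1ℤ scale′) ι-1

  0≤σ : 0ℚ ℚ.≤ σ
  0≤σ = ℚ.nonNegative⁻¹ σ {{ℚ.normalize-nonNeg 1 (suc scale′)}}

open Asymptotics codeCount scale′ root′ secondCoefficient laterCoefficients firstCount σ σ-inverse 0≤σ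
  using (b)

split-characteristic : scaledCharacteristic ≡ 1ℤ ∷ secondCoefficient ∷ laterCoefficients
split-characteristic = refl

scaled-recurrence : ∀ n → apply (1ℚ ∷ ι secondCoefficient ∷ map ι laterCoefficients) b n ≡ 0ℚ
scaled-recurrence n = trans
  (cong (λ y → apply (y ∷ ι secondCoefficient ∷ map ι laterCoefficients) b n) (sym ι-1))
  (trans (cong (λ cs → apply (map ι cs) b n) (sym split-characteristic))
  (trans (apply-scaleRoots codeCount (+ suc scale′) 1ℤ (coefficient 0 characteristic) (List.drop 1 characteristic) n)
  (trans (cong (λ y → ι 1ℤ ℚ.* power (ι (+ suc scale′)) (48 ℕ.+ n) ℚ.* ι y) (characteristic-recurrence (48 ℕ.+ n) (ℕ.m≤m+n 48 n)))
  (trans (cong (λ y → ι 1ℤ ℚ.* power (ι (+ suc scale′)) (48 ℕ.+ n) ℚ.* y) ι-0)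
         (ℚ.*-zeroʳ (ι 1ℤ ℚ.* power (ι (+ suc scale′)) (48 ℕ.+ n)))))))

module Numerics where
  open Asymptotics codeCount scale′ root′ secondCoefficient laterCoefficients firstCount σ σ-inverse 0≤σ

  -- The cofactor exists for this inequality. It covers the whole ball around the root, so every
  -- bisection point satisfies it at once.
  contraction : + 2 ℤ.* absoluteBound Q′ᵇ (powerᵇ X) ℤ.≤ l ℤ.^ d
  contraction = ℤ.≤ᵇ⇒≤ tt

  left≤0 : remainderᶻ l 1ℤ (secondCoefficient ∷ laterCoefficients) ℤ.≤ 0ℤ
  left≤0 = ℤ.≤ᵇ⇒≤ tt

  0≤right : 0ℤ ℤ.≤ remainderᶻ (l ℤ.+ 1ℤ) 1ℤ (secondCoefficient ∷ laterCoefficients)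
  0≤right = ℤ.≤ᵇ⇒≤ tt

  1≤denominator : 1ℤ ℤ.≤ lowerᵇ denominatorᵇ
  1≤denominator = ℤ.≤ᵇ⇒≤ tt

  κ-small : 1ℤ ℤ.* upperᵇ numeratorᵇ ℤ.≤ 1ℤ ℤ.* lowerᵇ denominatorᵇ
  κ-small = ℤ.≤ᵇ⇒≤ tt

  κ-large : 1ℤ ℤ.* upperᵇ denominatorᵇ ℤ.≤ + 10 ℤ.* lowerᵇ numeratorᵇ
  κ-large = ℤ.≤ᵇ⇒≤ tt

  s≤l : s ℤ.≤ l
  s≤l = ℤ.≤ᵇ⇒≤ tt

  κ-lower-check : + 108269 ℤ.* upperᵇ denominatorᵇ ℤ.≤ + 1000000 ℤ.* lowerᵇ numeratorᵇ
  κ-lower-check = ℤ.≤ᵇ⇒≤ tt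

  κ-upper-check : + 8 ℤ.* + 1000000 ℤ.* upperᵇ numeratorᵇ ℤ.≤ (+ 8 ℤ.* + 108270 ℤ.- 1ℤ) ℤ.* lowerᵇ denominatorᵇ
  κ-upper-check = ℤ.≤ᵇ⇒≤ tt

codeCount-asymptotic :
  ∃[ κ ] ∃[ Λ ]
    fromℚ (+ 108269 ℚ./ 1000000) ≤ κ × κ < fromℚ (+ 108270 ℚ./ 1000000) ×
    fromℚ (+ 4288630 ℚ./ 1000000) ≤ Λ × Λ < fromℚ (+ 4288631 ℚ./ 1000000) ×
    (λ n → fromℕ (codeCount n)) ∼ (λ n → κ * Λ ^ n)
codeCount-asymptotic =
  κᴿ scaled-recurrence codeCount-first contraction left≤0 0≤right 1≤denominator κ-small κ-large s≤l ,
  Λᴿ scaled-recurrence codeCount-first contraction left≤0 0≤right 1≤denominator κ-small κ-large s≤l ,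
  κᴿ-≥ scaled-recurrence codeCount-first contraction left≤0 0≤right 1≤denominator κ-small κ-large s≤l
    108269 999999 κ-lower-check ,
  κᴿ-< scaled-recurrence codeCount-first contraction left≤0 0≤right 1≤denominator κ-small κ-large s≤l
    108270 999999 (ℤ.≤ᵇ⇒≤ tt) κ-upper-check ,
  Λᴿ-≥ scaled-recurrence codeCount-first contraction left≤0 0≤right 1≤denominator κ-small κ-large s≤l
    4288630 999999 (ℤ.≤ᵇ⇒≤ tt) ,
  Λᴿ-< scaled-recurrence codeCount-first contraction left≤0 0≤right 1≤denominator κ-small κ-large s≤l
    4288631 999999 (ℤ.≤ᵇ⇒≤ tt) ,
  asymptotic scaled-recurrence codeCount-first contraction left≤0 0≤right 1≤denominator κ-small κ-large s≤l
  where
  open Numerics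
  open Asymptotics codeCount scale′ root′ secondCoefficient laterCoefficients firstCount σ σ-inverse 0≤σ

corollary4 : Σ[ ℓ ∈ (ℕ → ℕ) ]
    (∀ n → 1 ℕ.≤ n → HasCardinality (cheesySetoid 3 n) (ℓ n)) ×
    (∃[ κ ] ∃[ Λ ]
    fromℚ (+ 108269 ℚ./ 1000000) ≤ κ × κ < fromℚ (+ 108270 ℚ./ 1000000) ×
    fromℚ (+ 4288630 ℚ./ 1000000) ≤ Λ × Λ < fromℚ (+ 4288631 ℚ./ 1000000) ×
    (λ n → fromℕ (ℓ n)) ∼ (λ n → κ * Λ ^ n))
corollary4 = codeCount , (λ n _ → Counting.cardinality n) , codeCount-asymptotic
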